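{- Let $n$ be a positive integer with $n\equiv 3\pmod 4$. Then \[ \sum_{k=0}^{n-1}[6k+1]\frac{(q;q^2)_k^2(q^2;q^4)_k(q;q^4)_k^2}{(q^2;q^2)_k^2(q^4;q^4)_k^3}q^{2k} \equiv[3n]\frac{q^{2n}(2-q^n)}{(1+q^n)^2}\frac{(q^2;q^4)_{(3n-1)/4}^2}{(q^4;q^4)_{(3n-1)/4}^2}\pmod{[n]\Phi_n(q)^4}. \]
   Context: For a complex number $x$ and integer $n\ge 0$, $(x;q)_n=\prod_{j=0}^{n-1}(1-xq^j)$ (with $(x;q)_0=1$). $[r]=(1-q^r)/(1-q)$ denotes the $q$-integer, and $\Phi_n(q)$ is the $n$-th cyclotomic polynomial in $q$. A congruence $A(q)\equiv B(q)\pmod{P(q)}$ between rational functions in $q$ whose denominators are coprime to the polynomial $P(q)$ means that $A(q)-B(q)$ is a rational function whose numerator is divisible by $P(q)$ and whose denominator is coprime to $P(q)$. -}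

module Defs where

open import Data.Nat as ℕ using (ℕ; zero; suc; _∸_)
open import Data.Nat.Divisibility using (_∣?_)
open import Data.Integer as ℤ using (ℤ; +_; 0ℤ; 1ℤ)
open import Data.List using (List; []; _∷_; _++_; replicate; reverse; length; map)
open import Data.Bool using (if_then_else_)
open import Data.Product using (Σ; _×_; _,_)
open import Relation.Binary.PropositionalEquality using (_≡_)
open import Relation.Nullary using (¬_; yes; no; does)

-- coefficient list, lowest degree first
Poly : Set
Poly = List ℤ

coeff : Poly → ℕ → ℤ
coeff []      _       = 0ℤ
coeff (a ∷ p) zero    = a
coeff (a ∷ p) (suc i) = coeff p i

-- equality of polynomials (coefficientwise; trailing zeros irrelevant)
infix 4 _≈ₚ_
_≈ₚ_ : Poly → Poly → Set
p ≈ₚ r = ∀ i → coeff p i ≡ coeff r i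

infixl 6 _+ₚ_ _-ₚ_
infixl 7 _*ₚ_
infixr 8 _^ₚ_

_+ₚ_ : Poly → Poly → Poly
[]      +ₚ r       = r
(a ∷ p) +ₚ []      = a ∷ p
(a ∷ p) +ₚ (b ∷ r) = (a ℤ.+ b) ∷ (p +ₚ r)

scaleₚ : ℤ → Poly → Poly
scaleₚ c = map (c ℤ.*_)

-ₚ_ : Poly → Poly
-ₚ p = scaleₚ (ℤ.- 1ℤ) p

_-ₚ_ : Poly → Poly → Poly
p -ₚ r = p +ₚ (-ₚ r)

_*ₚ_ : Poly → Poly → Poly
[]      *ₚ r = []
(a ∷ p) *ₚ r = scaleₚ a r +ₚ (0ℤ ∷ (p *ₚ r))

constₚ : ℤ → Poly
constₚ c = c ∷ []

oneₚ : Poly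
oneₚ = constₚ 1ℤ

qPow : ℕ → Poly
qPow k = replicate k 0ℤ ++ (1ℤ ∷ [])

_^ₚ_ : Poly → ℕ → Poly
p ^ₚ zero  = oneₚ
p ^ₚ suc k = p *ₚ (p ^ₚ k)

prodRange : ℕ → (ℕ → Poly) → Poly
prodRange zero    f = oneₚ
prodRange (suc k) f = prodRange k f *ₚ f k

sumRange : ℕ → (ℕ → Poly) → Poly
sumRange zero    f = []
sumRange (suc k) f = sumRange k f +ₚ f k

poch : ℕ → ℕ → ℕ → Poly
poch a b k = prodRange k (λ j → oneₚ -ₚ qPow (a ℕ.+ b ℕ.* j))

qint : ℕ → Poly
qint r = sumRange r qPow

-- Cyclotomic polynomials, via  q^n - 1 = ∏_{d ∣ n} Φ_d(q)

dropZeros : List ℤ → List ℤ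
dropZeros []      = []
dropZeros (a ∷ p) with a ℤ.≟ 0ℤ
... | yes _ = dropZeros p
... | no  _ = a ∷ p

normalize : Poly → Poly
normalize p = reverse (dropZeros (reverse p))

lead : Poly → ℤ
lead p with reverse p
... | []    = 0ℤ
... | a ∷ _ = a

divMonicFuel : ℕ → Poly → Poly → Poly
divMonicFuel zero       f g = []
divMonicFuel (suc fuel) f g with length f ℕ.<? length g
... | yes _ = []
... | no  _ = t +ₚ divMonicFuel fuel (normalize (f -ₚ t *ₚ g)) g
  where t = scaleₚ (lead f) (qPow (length f ∸ length g))

divMonic : Poly → Poly → Poly
divMonic f g = normalize (divMonicFuel (length f) (normalize f) (normalize g))

-- product of the entries of a list (entry i has index d + i) whose index divides n
prodDivisors : ℕ → List Poly → ℕ → Poly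
prodDivisors n []       d = oneₚ
prodDivisors n (φ ∷ φs) d =
  if does (d ∣? n) then φ *ₚ prodDivisors n φs (suc d) else prodDivisors n φs (suc d)

cycList : ℕ → List Poly
cycList zero    = []
cycList (suc m) =
  cycList m ++ (divMonic (qPow (suc m) -ₚ oneₚ) (prodDivisors (suc m) (cycList m) 1) ∷ [])

nth : List Poly → ℕ → Poly
nth []       _       = []
nth (x ∷ xs) zero    = x
nth (x ∷ xs) (suc i) = nth xs i

-- Φ_n(q), the n-th cyclotomic polynomial (n ≥ 1; Φ_0 is a dummy value)
Φ : ℕ → Poly
Φ zero    = []
Φ (suc m) = nth (cycList (suc m)) m

infix 5 _//_
record Frac : Set where
  constructor _//_
  field
    num : Poly
    den : Poly

infixl 6 _+f_
_+f_ : Frac → Frac → Frac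
(a // b) +f (c // d) = (a *ₚ d +ₚ c *ₚ b) // (b *ₚ d)

sumFrac : ℕ → (ℕ → Frac) → Frac
sumFrac zero    f = [] // oneₚ
sumFrac (suc n) f = sumFrac n f +f f n

-- divisibility P ∣ N in ℚ[q] (denominators cleared by a nonzero integer c)
DividesQ : Poly → Poly → Set
DividesQ P N = Σ ℤ λ c → (¬ c ≡ 0ℤ) × (Σ Poly λ Q → scaleₚ c N ≈ₚ Q *ₚ P)

-- D and P coprime in ℚ[q]: u D + v P = c for a nonzero constant c
CoprimeQ : Poly → Poly → Set
CoprimeQ D P = Σ ℤ λ c → (¬ c ≡ 0ℤ) × (Σ Poly λ u → Σ Poly λ v → u *ₚ D +ₚ v *ₚ P ≈ₚ constₚ c)

-- A ≡ B (mod P):  A - B = N/D  with  P ∣ N  and  D coprime to P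
_≡_[modₚ_] : Frac → Frac → Poly → Set
(a // b) ≡ (c // d) [modₚ P ] =
  Σ Poly λ N → Σ Poly λ D →
    (¬ D ≈ₚ []) × DividesQ P N × CoprimeQ D P ×
    ((a *ₚ d -ₚ c *ₚ b) *ₚ D ≈ₚ N *ₚ (b *ₚ d))

{-# OPTIONS --safe #-}
module Submission where

-- Replace the squared factors (1 − z)² of the summands by (1 − z y)(1 − z/y) and
-- (1 − z x)(1 − z/x), in two independent parameters x and y, and let S(x, y) be
-- the resulting sum over k < n.  WZ pairs give a product formula for S(q^{3n}, y),
-- and show that S(1, q^n) = 0.  After clearing denominators S depends linearly on
-- x + 1/x and on y + 1/y, so S(1,1) is determined by S(q^{3n},1), S(1,q^n) and
-- S(q^{3n},q^n) up to (1 − q^{3n})²(1 − q^n)² Ψ.  Modulo Φ_n, where q^n = 1, the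
-- cofactor Ψ is read off the jet of S at x = y = 1 and vanishes by another instance
-- of the first summation.  This proves the congruence modulo Φ_n⁵.
--
-- For a divisor 1 < e < n of n the summands are, modulo Φ_e, periodic in k with
-- period e up to a factor without a pole, and the sum over one period vanishes by
-- the jet computation for e; the right-hand side is divisible by [3n].  Finally
-- [n] is the product of the pairwise coprime Φ_e with 1 < e ∣ n.

-- A dependence on x + 1/x does not distinguish x from 1/x, so each of the nodes x = q^{3n} and y =
-- q^n counts twice: two parameters already give a fourth power, and the fifth factor Φ_n comes from
-- the cofactor Ψ alone. The node x = q^{3n} is q^{4N+1} with N = (3n - 1)/4, where the sum stops at
-- k = N. The node y = q^n = q^{2m+1} stops it at k = m, and there the sum vanishes because m is
-- odd, which is n ≡ 3 modulo 4. The factor 2 - q^n of the right-hand side is an inverse of q^n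
-- modulo (1 - q^n)². None of the rings involved (polynomials over ℤ, their quotients, truncated
-- power series) is a field, so identities are multiplied by common denominators, and being nonzero
-- is replaced by not being a zero divisor. The WZ proofs cancel 1 - q^i for many i, which is
-- impossible modulo Φ_n when n divides i; the summations are therefore proved over ℤ[q], or jets
-- over it, and only the resulting equations are reduced.

open import Defs
open import Algebra.Bundles using (CommutativeRing)
open import Algebra.Structures using (IsCommutativeRing)
open import Data.Bool using (Bool; true; false; T; if_then_else_)
open import Data.Empty using (⊥-elim)
open import Data.Fin using (Fin; zero; suc)
open import Data.Integer as ℤ using (ℤ; +_; -[1+_]; 0ℤ; 1ℤ)
import Data.Integer.Properties as ℤ
open import Data.List using (List; []; _∷_; length; reverse; _++_; initLast; _∷ʳ′_)
open import Data.List.Properties using (length-++; reverse-++; unfold-reverse; reverse-involutive)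
open import Data.Maybe using (nothing)
open import Data.Nat as ℕ using (ℕ; zero; suc; z≤n; s≤s)
import Data.Nat.Properties as ℕ
open import Data.Nat.Divisibility using (_∣_; divides; _∣?_; ∣-refl; ∣-trans; ∣⇒≤; 0∣⇒≡0; ∣m+n∣m⇒∣n; m∣m*n; ∣n⇒∣m*n)
open import Data.Nat.GCD using (gcd; gcd[m,n]∣m; gcd[m,n]∣n; gcd-GCD; module Bézout)
open import Data.Product using (Σ; _×_; _,_; proj₁; proj₂)
open import Data.Sum using (_⊎_; inj₁; inj₂)
open import Data.Vec using (Vec; []; _∷_)
open import Level using (0ℓ)
open import Relation.Binary.PropositionalEquality as ≡ using (_≡_)
open import Relation.Binary.Definitions using (tri<; tri≈; tri>)
open import Relation.Nullary using (¬_; Dec; yes; no; does)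
open import Tactic.RingSolver.Core.AlmostCommutativeRing using (AlmostCommutativeRing; fromCommutativeRing)
open import Tactic.RingSolver.Core.Expression using (Expr; module Eval; Κ; Ι; _⊕_; _⊗_; _⊛_; ⊝_)
open import Tactic.RingSolver.Core.Polynomial.Parameters using (Homomorphism)
open import Data.Nat.Tactic.RingSolver using (solve-∀)
open import Data.Nat.DivMod using (_%_; _/_; m%n<n; m≡m%n+[m/n]*n; m*n/n≡m)

-- Ring solving, finite sums and products in commutative rings.

-- The library's ring solver over an arbitrary commutative ring can only cancel
-- terms if its coefficients have decidable zero, hence the coefficient ring ℤ.
module ℤ-Solver (R : CommutativeRing 0ℓ 0ℓ) where
  open CommutativeRing R hiding (zero)
  open import Algebra.Properties.Ring ring using (-‿distribˡ-*; -‿distribʳ-*; -‿involutive; -0#≈0#)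
  open import Algebra.Properties.AbelianGroup +-abelianGroup using (⁻¹-∙-comm)
  open import Algebra.Properties.Semiring.Mult.TCOptimised semiring using (×-homo-+; ×1-homo-*) renaming (_×_ to _·_)
  open import Relation.Binary.Reasoning.Setoid setoid

  fromℤ : ℤ → Carrier
  fromℤ (+ n)    = n · 1#
  fromℤ -[1+ n ] = - (suc n · 1#)

  private
    suc-1 : ∀ n → suc n · 1# ≈ 1# + n · 1#
    suc-1 n = ×-homo-+ 1# 1 n

    from-⊖ : ∀ m n → fromℤ (m ℤ.⊖ n) ≈ m · 1# - n · 1#
    from-⊖ m zero = begin
      m · 1#        ≈⟨ +-identityʳ _ ⟨
      m · 1# + 0#   ≈⟨ +-congˡ -0#≈0# ⟨
      m · 1# - 0#   ∎
    from-⊖ zero (suc n) = sym (+-identityˡ _)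
    from-⊖ (suc m) (suc n) = begin
      fromℤ (suc m ℤ.⊖ suc n)                ≡⟨ ≡.cong fromℤ (ℤ.[1+m]⊖[1+n]≡m⊖n m n) ⟩
      fromℤ (m ℤ.⊖ n)                        ≈⟨ from-⊖ m n ⟩
      m · 1# - n · 1#                        ≈⟨ +-congʳ (+-identityˡ _) ⟨
      0# + m · 1# - n · 1#                   ≈⟨ +-congʳ (+-congʳ (-‿inverseʳ 1#)) ⟨
      1# - 1# + m · 1# - n · 1#              ≈⟨ +-congʳ (trans (+-assoc _ _ _) (trans (+-congˡ (+-comm _ _)) (sym (+-assoc _ _ _)))) ⟩
      1# + m · 1# - 1# - n · 1#              ≈⟨ +-assoc _ _ _ ⟩
      1# + m · 1# + (- 1# - n · 1#)          ≈⟨ +-congˡ (⁻¹-∙-comm _ _) ⟩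
      1# + m · 1# - (1# + n · 1#)            ≈⟨ +-cong (suc-1 m) (-‿cong (suc-1 n)) ⟨
      suc m · 1# - suc n · 1#                ∎

    from-+ : ∀ i j → fromℤ (i ℤ.+ j) ≈ fromℤ i + fromℤ j
    from-+ (+ m)    (+ n)    = ×-homo-+ 1# m n
    from-+ (+ m)    -[1+ n ] = from-⊖ m (suc n)
    from-+ -[1+ m ] (+ n)    = trans (from-⊖ n (suc m)) (+-comm _ _)
    from-+ -[1+ m ] -[1+ n ] = begin
      - (suc (suc (m ℕ.+ n)) · 1#)           ≡⟨ ≡.cong (λ k → - (k · 1#)) (≡.cong suc (≡.sym (ℕ.+-suc m n))) ⟩
      - ((suc m ℕ.+ suc n) · 1#)             ≈⟨ -‿cong (×-homo-+ 1# (suc m) (suc n)) ⟩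
      - (suc m · 1# + suc n · 1#)            ≈⟨ ⁻¹-∙-comm _ _ ⟨
      - (suc m · 1#) - suc n · 1#            ∎

    from-neg : ∀ i → fromℤ (ℤ.- i) ≈ - fromℤ i
    from-neg (+ zero)  = sym -0#≈0#
    from-neg (+ suc n) = refl
    from-neg -[1+ n ]  = sym (-‿involutive _)

    from-neg* : ∀ m n → fromℤ (ℤ.- (+ (m ℕ.* n))) ≈ - (m · 1# * n · 1#)
    from-neg* m n = trans (from-neg (+ (m ℕ.* n))) (-‿cong (×1-homo-* m n))

    from-* : ∀ i j → fromℤ (i ℤ.* j) ≈ fromℤ i * fromℤ j
    from-* (+ m) (+ n) = begin
      fromℤ (+ m ℤ.* + n)     ≡⟨ ≡.cong fromℤ (ℤ.pos-* m n) ⟨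
      (m ℕ.* n) · 1#          ≈⟨ ×1-homo-* m n ⟩
      m · 1# * n · 1#         ∎
    from-* (+ m) -[1+ n ] = begin
      fromℤ (+ m ℤ.* -[1+ n ])      ≡⟨ ≡.cong fromℤ (ℤ.neg-distribʳ-* (+ m) (+ suc n)) ⟨
      fromℤ (ℤ.- (+ m ℤ.* + suc n)) ≡⟨ ≡.cong (λ z → fromℤ (ℤ.- z)) (ℤ.pos-* m (suc n)) ⟨
      fromℤ (ℤ.- (+ (m ℕ.* suc n))) ≈⟨ from-neg* m (suc n) ⟩
      - (m · 1# * suc n · 1#)       ≈⟨ -‿distribʳ-* _ _ ⟩
      m · 1# * - (suc n · 1#)       ∎
    from-* -[1+ m ] (+ n) = begin
      fromℤ (-[1+ m ] ℤ.* + n)      ≡⟨ ≡.cong fromℤ (ℤ.neg-distribˡ-* (+ suc m) (+ n)) ⟨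
      fromℤ (ℤ.- (+ suc m ℤ.* + n)) ≡⟨ ≡.cong (λ z → fromℤ (ℤ.- z)) (ℤ.pos-* (suc m) n) ⟨
      fromℤ (ℤ.- (+ (suc m ℕ.* n))) ≈⟨ from-neg* (suc m) n ⟩
      - (suc m · 1# * n · 1#)       ≈⟨ -‿distribˡ-* _ _ ⟩
      - (suc m · 1#) * n · 1#       ∎
    from-* -[1+ m ] -[1+ n ] = begin
      (suc m ℕ.* suc n) · 1#             ≈⟨ ×1-homo-* (suc m) (suc n) ⟩
      suc m · 1# * suc n · 1#            ≈⟨ -‿involutive _ ⟨
      - - (suc m · 1# * suc n · 1#)      ≈⟨ -‿cong (-‿distribˡ-* _ _) ⟩
      - (- (suc m · 1#) * suc n · 1#)    ≈⟨ -‿distribʳ-* _ _ ⟩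
      - (suc m · 1#) * - (suc n · 1#)    ∎

    isZero : ℤ → Bool
    isZero (+ zero) = true
    isZero _        = false

    isZero-sound : ∀ i → T (isZero i) → 0# ≈ fromℤ i
    isZero-sound (+ zero) _ = refl

    homo : Homomorphism _ _ _ _
    homo = record
      { from = record { rawRing = CommutativeRing.rawRing ℤ.+-*-commutativeRing ; isZero = isZero }
      ; to = fromCommutativeRing R (λ _ → nothing)
      ; morphism = record
        { ⟦_⟧ = fromℤ ; +-homo = from-+ ; *-homo = from-* ; -‿homo = from-neg
        ; 0-homo = refl ; 1-homo = refl }
      ; Zero-C⟶Zero-R = isZero-sound
      }
    to = Homomorphism.to homo

  open Eval (AlmostCommutativeRing.rawRing to) fromℤ public
  open import Tactic.RingSolver.Core.Polynomial.Base (Homomorphism.from homo) renaming (Poly to NormalForm)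
  open import Tactic.RingSolver.Core.Polynomial.Semantics homo renaming (⟦_⟧ to ⟦_⟧ₚ)
  open import Tactic.RingSolver.Core.Polynomial.Homomorphism homo
  open import Algebra.Properties.Semiring.Exp.TCOptimised semiring using (^-congˡ)

  private
    norm : ∀ {n} → Expr ℤ n → NormalForm n
    norm (Κ x)   = κ x
    norm (Ι x)   = ι x
    norm (x ⊕ y) = norm x ⊞ norm y
    norm (x ⊗ y) = norm x ⊠ norm y
    norm (⊝ x)   = ⊟ norm x
    norm (x ⊛ i) = norm x ⊡ i

  ⟦_⇓⟧ : ∀ {n} → Expr ℤ n → Vec Carrier n → Carrier
  ⟦ e ⇓⟧ = ⟦ norm e ⟧ₚ

  private
    correct : ∀ {n} (e : Expr ℤ n) ρ → ⟦ e ⇓⟧ ρ ≈ ⟦ e ⟧ ρ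
    correct (Κ x)   ρ = κ-hom x ρ
    correct (Ι x)   ρ = ι-hom x ρ
    correct (x ⊕ y) ρ = trans (⊞-hom (norm x) (norm y) ρ) (+-cong (correct x ρ) (correct y ρ))
    correct (x ⊗ y) ρ = trans (⊠-hom (norm x) (norm y) ρ) (*-cong (correct x ρ) (correct y ρ))
    correct (⊝ x)   ρ = trans (⊟-hom (norm x) ρ) (-‿cong (correct x ρ))
    correct (x ⊛ i) ρ = trans (⊡-hom (norm x) i ρ) (^-congˡ i (correct x ρ))

  -- Serves to eliminate a variable before solving: an identity that holds only under an equation
  -- for the first variable becomes, after substitution, a ring identity in the remaining ones.
  eval-cong : ∀ {n} (e : Expr ℤ (suc n)) {x y} → x ≈ y → ∀ ρ → ⟦ e ⟧ (x ∷ ρ) ≈ ⟦ e ⟧ (y ∷ ρ)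
  eval-cong (Κ x)       eq ρ = refl
  eval-cong (Ι zero)    eq ρ = eq
  eval-cong (Ι (suc i)) eq ρ = refl
  eval-cong (x ⊕ y) eq ρ = +-cong (eval-cong x eq ρ) (eval-cong y eq ρ)
  eval-cong (x ⊗ y) eq ρ = *-cong (eval-cong x eq ρ) (eval-cong y eq ρ)
  eval-cong (⊝ x)   eq ρ = -‿cong (eval-cong x eq ρ)
  eval-cong (x ⊛ i) eq ρ = ^-congˡ i (eval-cong x eq ρ)

  open import Relation.Binary.Reflection setoid Ι ⟦_⟧ ⟦_⇓⟧ correct public using (solve; _⊜_)

infixl 6 _⊖_
_⊖_ : ∀ {n} → Expr ℤ n → Expr ℤ n → Expr ℤ n
x ⊖ y = x ⊕ ⊝ y

𝟙 : ∀ {n} → Expr ℤ n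
𝟙 = Κ 1ℤ

-- Only the operations are parameters here, so that two rings which differ in
-- their equality alone share these functions definitionally.
module Iterated {A : Set} (_+_ _*_ : A → A → A) (0# 1# : A) where
  sum : ℕ → (ℕ → A) → A
  sum zero    f = 0#
  sum (suc n) f = sum n f + f n

  prod : ℕ → (ℕ → A) → A
  prod zero    f = 1#
  prod (suc n) f = prod n f * f n

  pow : A → ℕ → A
  pow q zero    = 1#
  pow q (suc n) = q * pow q n

module Ring (R : CommutativeRing 0ℓ 0ℓ) where
  open CommutativeRing R public hiding (zero)
  open ℤ-Solver R public using (solve; _⊜_; ⟦_⟧; eval-cong)
  open import Algebra.Solver.CommutativeMonoid *-commutativeMonoid public using () renaming (_⊕_ to infixl 7 _∙_; id to one; solve to *-solve; _⊜_ to infix 4 _≐_)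
  open import Algebra.Properties.Ring ring public using (-‿distribʳ-*)
  open Iterated _+_ _*_ 0# 1# public
  open import Relation.Binary.Reasoning.Setoid setoid

  -- Non-zero-divisors. They replace nonzero elements, because the identities are also needed in jet
  -- rings and in quotients of ℤ[q], where a nonzero element may fail to be cancellable.
  Regular : Carrier → Set
  Regular a = ∀ x → a * x ≈ 0# → x ≈ 0#

  reg-1 : Regular 1#
  reg-1 x p = trans (sym (*-identityˡ x)) p

  reg-* : ∀ {a b} → Regular a → Regular b → Regular (a * b)
  reg-* ra rb x p = rb x (ra _ (trans (sym (*-assoc _ _ _)) p))

  reg-cong : ∀ {a b} → a ≈ b → Regular a → Regular b
  reg-cong eq ra x p = ra x (trans (*-congʳ eq) p)

  reg-factor : ∀ {a b} → Regular (a * b) → Regular a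
  reg-factor {a} {b} rab x p = rab x (begin
    a * b * x    ≈⟨ solve 3 (λ a b x → a ⊗ b ⊗ x ⊜ b ⊗ (a ⊗ x)) refl a b x ⟩
    b * (a * x)  ≈⟨ *-congˡ p ⟩
    b * 0#       ≈⟨ zeroʳ b ⟩
    0#           ∎)

  x-y≈0⇒x≈y : ∀ {x y} → x - y ≈ 0# → x ≈ y
  x-y≈0⇒x≈y {x} {y} p = begin
    x            ≈⟨ solve 2 (λ x y → x ⊜ x ⊖ y ⊕ y) refl x y ⟩
    x - y + y    ≈⟨ +-congʳ p ⟩
    0# + y       ≈⟨ +-identityˡ y ⟩
    y            ∎

  x≈y⇒x-y≈0 : ∀ {x y} → x ≈ y → x - y ≈ 0#
  x≈y⇒x-y≈0 p = trans (+-congʳ p) (-‿inverseʳ _)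

  cancel : ∀ {a x y} → Regular a → a * x ≈ a * y → x ≈ y
  cancel {a} {x} {y} ra p = x-y≈0⇒x≈y (ra _ (begin
    a * (x - y)     ≈⟨ solve 3 (λ a x y → a ⊗ (x ⊖ y) ⊜ a ⊗ x ⊖ a ⊗ y) refl a x y ⟩
    a * x - a * y   ≈⟨ x≈y⇒x-y≈0 p ⟩
    0#              ∎))

  reg-neg : ∀ {a} → Regular a → Regular (- a)
  reg-neg {a} ra x p = ra x (begin
    a * x          ≈⟨ solve 2 (λ a x → a ⊗ x ⊜ ⊝ (⊝ a ⊗ x)) refl a x ⟩
    - (- a * x)    ≈⟨ -‿cong p ⟩
    - 0#           ≈⟨ solve 0 (⊝ Κ 0ℤ ⊜ Κ 0ℤ) refl ⟩
    0#             ∎)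

  prod-cong : ∀ n {f g} → (∀ i → i ℕ.< n → f i ≈ g i) → prod n f ≈ prod n g
  prod-cong zero    h = refl
  prod-cong (suc n) h = *-cong (prod-cong n (λ i i<n → h i (ℕ.m<n⇒m<1+n i<n))) (h n (ℕ.n<1+n n))

  prod-* : ∀ n f g → prod n (λ i → f i * g i) ≈ prod n f * prod n g
  prod-* zero    f g = sym (*-identityˡ _)
  prod-* (suc n) f g = trans (*-congʳ (prod-* n f g))
    (solve 4 (λ a b c d → a ⊗ b ⊗ (c ⊗ d) ⊜ a ⊗ c ⊗ (b ⊗ d)) refl _ _ _ _)

  prod-reg : ∀ n {f} → (∀ i → i ℕ.< n → Regular (f i)) → Regular (prod n f)
  prod-reg zero    h = reg-1
  prod-reg (suc n) h = reg-* (prod-reg n (λ i i<n → h i (ℕ.m<n⇒m<1+n i<n))) (h n (ℕ.n<1+n n))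

  prod-front : ∀ n f → prod (suc n) f ≈ f 0 * prod n (λ i → f (suc i))
  prod-front zero    f = *-comm _ _
  prod-front (suc n) f = trans (*-congʳ (prod-front n f)) (*-assoc _ _ _)

  prod-zero : ∀ {n f} i → i ℕ.< n → f i ≈ 0# → prod n f ≈ 0#
  prod-zero {suc n} {f} i i<n fi≈0 with ℕ.m≤n⇒m<n∨m≡n (ℕ.≤-pred i<n)
  ... | inj₁ i<n′   = trans (*-congʳ (prod-zero i i<n′ fi≈0)) (zeroˡ _)
  ... | inj₂ ≡.refl = trans (*-congˡ fi≈0) (zeroʳ _)

  prod-+ : ∀ m n f → prod (m ℕ.+ n) f ≈ prod m f * prod n (λ i → f (m ℕ.+ i))
  prod-+ m zero    f = trans (reflexive (≡.cong (λ k → prod k f) (ℕ.+-identityʳ m))) (sym (*-identityʳ _))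
  prod-+ m (suc n) f = begin
    prod (m ℕ.+ suc n) f                                           ≡⟨ ≡.cong (λ k → prod k f) (ℕ.+-suc m n) ⟩
    prod (m ℕ.+ n) f * f (m ℕ.+ n)                                 ≈⟨ *-congʳ (prod-+ m n f) ⟩
    prod m f * prod n (λ i → f (m ℕ.+ i)) * f (m ℕ.+ n)            ≈⟨ *-assoc _ _ _ ⟩
    prod m f * (prod n (λ i → f (m ℕ.+ i)) * f (m ℕ.+ n))          ∎

  sum-cong : ∀ n {f g} → (∀ i → i ℕ.< n → f i ≈ g i) → sum n f ≈ sum n g
  sum-cong zero    h = refl
  sum-cong (suc n) h = +-cong (sum-cong n (λ i i<n → h i (ℕ.m<n⇒m<1+n i<n))) (h n (ℕ.n<1+n n))

  sum-zero : ∀ n {f} → (∀ i → i ℕ.< n → f i ≈ 0#) → sum n f ≈ 0#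
  sum-zero zero    h = refl
  sum-zero (suc n) h = trans (+-cong (sum-zero n (λ i i<n → h i (ℕ.m<n⇒m<1+n i<n))) (h n (ℕ.n<1+n n))) (+-identityˡ _)

  sum-+ : ∀ n f g → sum n (λ i → f i + g i) ≈ sum n f + sum n g
  sum-+ zero    f g = sym (+-identityˡ _)
  sum-+ (suc n) f g = trans (+-congʳ (sum-+ n f g))
    (solve 4 (λ a b c d → a ⊕ b ⊕ (c ⊕ d) ⊜ a ⊕ c ⊕ (b ⊕ d)) refl _ _ _ _)

  sum-*ˡ : ∀ n c f → sum n (λ i → c * f i) ≈ c * sum n f
  sum-*ˡ zero    c f = sym (zeroʳ c)
  sum-*ˡ (suc n) c f = trans (+-congʳ (sum-*ˡ n c f)) (sym (distribˡ _ _ _))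

  sum-split : ∀ m n f → sum (m ℕ.+ n) f ≈ sum m f + sum n (λ i → f (m ℕ.+ i))
  sum-split m zero    f = trans (reflexive (≡.cong (λ k → sum k f) (ℕ.+-identityʳ m))) (sym (+-identityʳ _))
  sum-split m (suc n) f = begin
    sum (m ℕ.+ suc n) f                                            ≡⟨ ≡.cong (λ k → sum k f) (ℕ.+-suc m n) ⟩
    sum (m ℕ.+ n) f + f (m ℕ.+ n)                                  ≈⟨ +-congʳ (sum-split m n f) ⟩
    sum m f + sum n (λ i → f (m ℕ.+ i)) + f (m ℕ.+ n)              ≈⟨ +-assoc _ _ _ ⟩
    sum m f + (sum n (λ i → f (m ℕ.+ i)) + f (m ℕ.+ n))            ∎

  pow-+ : ∀ q m n → pow q (m ℕ.+ n) ≈ pow q m * pow q n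
  pow-+ q zero    n = sym (*-identityˡ _)
  pow-+ q (suc m) n = trans (*-congˡ (pow-+ q m n)) (sym (*-assoc _ _ _))

  pow-reg : ∀ {q} → Regular q → ∀ n → Regular (pow q n)
  pow-reg rq zero    = reg-1
  pow-reg rq (suc n) = reg-* rq (pow-reg rq n)

  Aperiodic : Carrier → Set
  Aperiodic q = ∀ i → 0 ℕ.< i → Regular (1# - pow q i)

module Coarser (R : CommutativeRing 0ℓ 0ℓ) where
  open CommutativeRing R

  Relation : Set₁
  Relation = Carrier → Carrier → Set

  IsRing Coarsens : Relation → Set
  IsRing _≈′_ = IsCommutativeRing _≈′_ _+_ _*_ -_ 0# 1#
  Coarsens _≈′_ = ∀ {x y} → x ≈ y → x ≈′ y

-- WZ pairs and hypergeometric terms without division.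

-- Summands f, f′ with ratios num / den, num′ / den′, of two sums which a WZ pair
-- relates; they are compared through f′ / f = (B′ Y) / (B X).
module WZ (R : CommutativeRing 0ℓ 0ℓ) where
  open Ring R
  open import Relation.Binary.Reasoning.Setoid setoid

  -- Induction on k. Going from k to k + 1 multiplies f and f′ by their ratios, and the hypothesis
  -- relating `num′ j * X (suc j)` to `num j * Y (suc j)` says that X and Y absorb the quotient of
  -- these ratios.
  compare-summands : ∀ {B B′ : Carrier} {f f′ num den num′ den′ X Y : ℕ → Carrier} {m : ℕ} →
    f 0 ≈ B → f′ 0 ≈ B′ → X 0 ≈ Y 0 →
    (∀ j → j ℕ.< m → f (suc j) * den j ≈ f j * num j) →
    (∀ j → j ℕ.< m → f′ (suc j) * den′ j ≈ f′ j * num′ j) →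
    (∀ j → j ℕ.< m → num′ j * X (suc j) * (Y j * den j) ≈ num j * Y (suc j) * (X j * den′ j)) →
    (∀ j → j ℕ.< m → Regular (den′ j * X j * (Y j * den j))) →
    ∀ k → k ℕ.≤ m → B * f′ k * X k ≈ B′ * f k * Y k
  compare-summands f-0 f′-0 X₀≈Y₀ f-suc f′-suc XY reg zero _ =
    trans (*-cong (trans (*-congˡ f′-0) (*-comm _ _)) X₀≈Y₀) (*-congʳ (*-congˡ (sym f-0)))
  compare-summands {B} {B′} {f} {f′} {num} {den} {num′} {den′} {X} {Y} f-0 f′-0 X₀≈Y₀ f-suc f′-suc XY reg (suc k) k<m = cancel (reg k k<m) (begin
    d′ * Xk * (Yk * d) * (B * f′ (suc k) * Xs)
      ≈⟨ *-solve 7 (λ d′ Xk Yk d B f Xs → d′ ∙ Xk ∙ (Yk ∙ d) ∙ (B ∙ f ∙ Xs) ≐ B ∙ (f ∙ d′) ∙ Xk ∙ (Xs ∙ (Yk ∙ d))) refl d′ Xk Yk d B (f′ (suc k)) Xs ⟩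
    B * (f′ (suc k) * d′) * Xk * (Xs * (Yk * d))
      ≈⟨ *-congʳ (*-congʳ (*-congˡ (f′-suc k k<m))) ⟩
    B * (f′ k * n′) * Xk * (Xs * (Yk * d))
      ≈⟨ *-solve 7 (λ B f n Xk Xs Yk d → B ∙ (f ∙ n) ∙ Xk ∙ (Xs ∙ (Yk ∙ d)) ≐ B ∙ f ∙ Xk ∙ (n ∙ Xs ∙ (Yk ∙ d))) refl B (f′ k) n′ Xk Xs Yk d ⟩
    B * f′ k * Xk * (n′ * Xs * (Yk * d))
      ≈⟨ *-cong (compare-summands {num = num} {den} {num′} {den′} f-0 f′-0 X₀≈Y₀ f-suc f′-suc XY reg k (ℕ.<⇒≤ k<m)) (XY k k<m) ⟩
    B′ * f k * Yk * (n * Ys * (Xk * d′))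
      ≈⟨ *-solve 7 (λ B f Yk n Ys Xk d′ → B ∙ f ∙ Yk ∙ (n ∙ Ys ∙ (Xk ∙ d′)) ≐ B ∙ (f ∙ n) ∙ (Yk ∙ Ys ∙ Xk ∙ d′)) refl B′ (f k) Yk n Ys Xk d′ ⟩
    B′ * (f k * n) * (Yk * Ys * Xk * d′)
      ≈⟨ *-congʳ (*-congˡ (f-suc k k<m)) ⟨
    B′ * (f (suc k) * d) * (Yk * Ys * Xk * d′)
      ≈⟨ *-solve 7 (λ B f d Yk Ys Xk d′ → B ∙ (f ∙ d) ∙ (Yk ∙ Ys ∙ Xk ∙ d′) ≐ d′ ∙ Xk ∙ (Yk ∙ d) ∙ (B ∙ f ∙ Ys)) refl B′ (f (suc k)) d Yk Ys Xk d′ ⟩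
    d′ * Xk * (Yk * d) * (B′ * f (suc k) * Ys) ∎)
    where
      n = num k
      n′ = num′ k
      d = den k
      d′ = den′ k
      Xk = X k
      Xs = X (suc k)
      Yk = Y k
      Ys = Y (suc k)

  -- The telescoping step of a WZ proof with denominators cleared: F and F′ are the certificate
  -- terms at two consecutive indices, and the last hypothesis is the WZ equation at a single index.
  -- The factor κ leaves room for a power of q, which one of the two applications needs.
  extend-sums : ∀ {A Zk Z X κ B B′ S S′ g f′ w f D n V F F′ Y} → A ≈ κ * X → g ≈ w * f → Regular (A * Z) →
      B * S′ * (D * Z) ≈ B′ * (n * S * (V * Z) - F) → B * f′ * X ≈ B′ * f * Y →
      κ * w * D * Zk * Z * (f * Y) ≈ A * Z * (n * g * (V * Zk) - F′) + A * Zk * F →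
      B * (S′ + w * f′) * (D * Zk) ≈ B′ * (n * (S + g) * (V * Zk) - F′)
  extend-sums {A} {Zk} {Z} {X} {κ} {B} {B′} {S} {S′} {g} {f′} {w} {f} {D} {n} {V} {F} {F′} {Y} A≈ g≈ reg IH CMP KEY = cancel reg (begin
      A * Z * (B * (S′ + w * f′) * (D * Zk))
        ≈⟨ solve 8 (λ A Z B S′ w f′ D Zk → A ⊗ Z ⊗ (B ⊗ (S′ ⊕ w ⊗ f′) ⊗ (D ⊗ Zk)) ⊜ A ⊗ Zk ⊗ (B ⊗ S′ ⊗ (D ⊗ Z)) ⊕ w ⊗ D ⊗ Zk ⊗ Z ⊗ (B ⊗ f′ ⊗ A)) refl A Z B S′ w f′ D Zk ⟩
      A * Zk * (B * S′ * (D * Z)) + w * D * Zk * Z * (B * f′ * A)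
        ≈⟨ +-cong (*-congˡ IH) (*-congˡ (trans (*-congˡ A≈) (*-solve 4 (λ B f κ X → B ∙ f ∙ (κ ∙ X) ≐ κ ∙ (B ∙ f ∙ X)) refl B f′ κ X))) ⟩
      A * Zk * (B′ * (n * S * (V * Z) - F)) + w * D * Zk * Z * (κ * (B * f′ * X))
        ≈⟨ +-congˡ (*-congˡ (*-congˡ CMP)) ⟩
      A * Zk * (B′ * (n * S * (V * Z) - F)) + w * D * Zk * Z * (κ * (B′ * f * Y))
        ≈⟨ +-congˡ (*-solve 8 (λ w D Zk Z κ B f Y → w ∙ D ∙ Zk ∙ Z ∙ (κ ∙ (B ∙ f ∙ Y)) ≐ B ∙ (κ ∙ w ∙ D ∙ Zk ∙ Z ∙ (f ∙ Y))) refl w D Zk Z κ B′ f Y) ⟩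
      A * Zk * (B′ * (n * S * (V * Z) - F)) + B′ * (κ * w * D * Zk * Z * (f * Y))
        ≈⟨ +-congˡ (*-congˡ KEY) ⟩
      A * Zk * (B′ * (n * S * (V * Z) - F)) + B′ * (A * Z * (n * g * (V * Zk) - F′) + A * Zk * F)
        ≈⟨ solve 10 (λ A Zk B n S V Z F g F′ → A ⊗ Zk ⊗ (B ⊗ (n ⊗ S ⊗ (V ⊗ Z) ⊖ F)) ⊕ B ⊗ (A ⊗ Z ⊗ (n ⊗ g ⊗ (V ⊗ Zk) ⊖ F′) ⊕ A ⊗ Zk ⊗ F)
             ⊜ A ⊗ Z ⊗ (B ⊗ (n ⊗ (S ⊕ g) ⊗ (V ⊗ Zk) ⊖ F′))) refl A Zk B′ n S V Z F g F′ ⟩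
      A * Z * (B′ * (n * (S + g) * (V * Zk) - F′)) ∎)


module Cleared (R : CommutativeRing 0ℓ 0ℓ) (num den : ℕ → CommutativeRing.Carrier R) where
  open Ring R
  open import Relation.Binary.Reasoning.Setoid setoid

  -- ∏_{i<k} num i / den i, times ∏_{i<m} den i
  cleared : ℕ → ℕ → Carrier
  cleared m k = prod k num * prod (m ℕ.∸ k) (λ i → den (k ℕ.+ i))

  cleared-0 : ∀ m → cleared m 0 ≈ prod m den
  cleared-0 m = *-identityˡ _

  cleared-suc : ∀ m j → j ℕ.< m → cleared m (suc j) * den j ≈ cleared m j * num j
  cleared-suc m j j<m = begin
    a * num j * b * den j
      ≈⟨ *-solve 4 (λ a n b d → a ∙ n ∙ b ∙ d ≐ a ∙ (d ∙ b) ∙ n) refl a (num j) b (den j) ⟩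
    a * (den j * b) * num j
      ≈⟨ *-congʳ (*-congˡ (*-cong (reflexive (≡.cong den (≡.sym (ℕ.+-identityʳ j))))
           (prod-cong (m ℕ.∸ suc j) (λ i _ → reflexive (≡.cong den (≡.sym (ℕ.+-suc j i))))))) ⟩
    a * (f 0 * prod (m ℕ.∸ suc j) (λ i → f (suc i))) * num j
      ≈⟨ *-congʳ (*-congˡ (prod-front (m ℕ.∸ suc j) f)) ⟨
    a * prod (suc (m ℕ.∸ suc j)) f * num j
      ≡⟨ ≡.cong (λ k → a * prod k f * num j) (≡.sym (ℕ.+-∸-assoc 1 j<m)) ⟩
    a * prod (m ℕ.∸ j) f * num j ∎
    where
      a = prod j num
      b = prod (m ℕ.∸ suc j) (λ i → den (suc j ℕ.+ i))
      f : ℕ → Carrier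
      f i = den (j ℕ.+ i)

module ClearedProperties (R : CommutativeRing 0ℓ 0ℓ) where
  open Ring R
  open Cleared R
  open import Relation.Binary.Reasoning.Setoid setoid

  cleared-cong : ∀ {num num′ den den′ : ℕ → Carrier} m k → k ℕ.≤ m → (∀ i → i ℕ.< m → num i ≈ num′ i) → (∀ i → i ℕ.< m → den i ≈ den′ i) →
    cleared num den m k ≈ cleared num′ den′ m k
  cleared-cong m k k≤m n≈ d≈ = *-cong (prod-cong k (λ i i<k → n≈ i (ℕ.<-≤-trans i<k k≤m)))
    (prod-cong (m ℕ.∸ k) (λ i i<m∸k → d≈ (k ℕ.+ i) (ℕ.<-≤-trans (ℕ.+-monoʳ-< k i<m∸k) (ℕ.≤-reflexive (ℕ.m+[n∸m]≡n k≤m)))))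

  cleared-* : ∀ (num den num′ den′ : ℕ → Carrier) m k →
    cleared (λ i → num i * num′ i) (λ i → den i * den′ i) m k ≈ cleared num den m k * cleared num′ den′ m k
  cleared-* num den num′ den′ m k = trans (*-cong (prod-* k num num′) (prod-* (m ℕ.∸ k) (λ i → den (k ℕ.+ i)) (λ i → den′ (k ℕ.+ i))))
    (*-solve 4 (λ a b c d → (a ∙ b) ∙ (c ∙ d) ≐ (a ∙ c) ∙ (b ∙ d)) refl _ _ _ _)

  cleared-same : ∀ (f : ℕ → Carrier) m k → k ℕ.≤ m → cleared f f m k ≈ prod m f
  cleared-same f m k k≤m = trans (sym (prod-+ k (m ℕ.∸ k) f)) (reflexive (≡.cong (λ i → prod i f) (ℕ.m+[n∸m]≡n k≤m)))

  -- Past an index with a vanishing numerator nothing is added to the sum.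
  cleared-extend : ∀ (w num den : ℕ → Carrier) m n → num m ≈ 0# → sum (suc m ℕ.+ n) (λ k → w k * cleared num den (m ℕ.+ n) k)
    ≈ sum (suc m) (λ k → w k * cleared num den m k) * prod n (λ i → den (m ℕ.+ i))
  cleared-extend w num den m n num≈0 = begin
    sum (suc m ℕ.+ n) f                                        ≈⟨ sum-split (suc m) n f ⟩
    sum (suc m) f + sum n (λ i → f (suc m ℕ.+ i))              ≈⟨ +-cong (sum-cong (suc m) below) (sum-zero n above) ⟩
    sum (suc m) (λ k → D * (w k * cleared num den m k)) + 0#   ≈⟨ +-identityʳ _ ⟩
    sum (suc m) (λ k → D * (w k * cleared num den m k))        ≈⟨ sum-*ˡ (suc m) D (λ k → w k * cleared num den m k) ⟩
    D * sum (suc m) (λ k → w k * cleared num den m k)          ≈⟨ *-comm _ _ ⟩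
    sum (suc m) (λ k → w k * cleared num den m k) * D          ∎
    where
      f : ℕ → Carrier
      f k = w k * cleared num den (m ℕ.+ n) k
      D = prod n (λ i → den (m ℕ.+ i))
      split : ∀ k → k ℕ.≤ m → m ℕ.+ n ℕ.∸ k ≡ (m ℕ.∸ k) ℕ.+ n
      split k k≤m = ℕ.+-∸-comm n k≤m
      below : ∀ k → k ℕ.< suc m → f k ≈ D * (w k * cleared num den m k)
      below k (s≤s k≤m) = begin
        w k * (prod k num * prod (m ℕ.+ n ℕ.∸ k) g)           ≡⟨ ≡.cong (λ i → w k * (prod k num * prod i g)) (split k k≤m) ⟩
        w k * (prod k num * prod ((m ℕ.∸ k) ℕ.+ n) g)         ≈⟨ *-congˡ (*-congˡ (prod-+ (m ℕ.∸ k) n g)) ⟩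
        w k * (prod k num * (prod (m ℕ.∸ k) g * prod n (λ i → g (m ℕ.∸ k ℕ.+ i))))
          ≈⟨ *-congˡ (*-congˡ (*-congˡ (prod-cong n (λ i _ → reflexive (≡.cong den (≡.trans (≡.sym (ℕ.+-assoc k (m ℕ.∸ k) i)) (≡.cong (ℕ._+ i) (ℕ.m+[n∸m]≡n k≤m)))))))) ⟩
        w k * (prod k num * (prod (m ℕ.∸ k) g * D))
          ≈⟨ *-solve 4 (λ w p g D → w ∙ (p ∙ (g ∙ D)) ≐ D ∙ (w ∙ (p ∙ g))) refl (w k) (prod k num) (prod (m ℕ.∸ k) g) D ⟩
        D * (w k * cleared num den m k) ∎
        where
          g : ℕ → Carrier
          g i = den (k ℕ.+ i)
      above : ∀ i → i ℕ.< n → f (suc m ℕ.+ i) ≈ 0#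
      above i _ = begin
        w k * (prod (suc m ℕ.+ i) num * E)                        ≈⟨ *-congˡ (*-congʳ (prod-+ (suc m) i num)) ⟩
        w k * (prod m num * num m * prod i (λ j → num (suc m ℕ.+ j)) * E)  ≈⟨ *-congˡ (*-congʳ (*-congʳ (*-congˡ num≈0))) ⟩
        w k * (prod m num * 0# * prod i (λ j → num (suc m ℕ.+ j)) * E)
          ≈⟨ solve 4 (λ w p r E → w ⊗ (p ⊗ Κ 0ℤ ⊗ r ⊗ E) ⊜ Κ 0ℤ) refl (w k) (prod m num) (prod i (λ j → num (suc m ℕ.+ j))) E ⟩
        0# ∎
        where
          k = suc m ℕ.+ i
          E = prod (m ℕ.+ n ℕ.∸ k) (λ j → den (k ℕ.+ j))

module Powers (R : CommutativeRing 0ℓ 0ℓ) (q : CommutativeRing.Carrier R) (q-reg : Ring.Regular R q) (1-q^-reg : Ring.Aperiodic R q) where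
  open Ring R
  open import Relation.Binary.Reasoning.Setoid setoid

  infix 4 _≈e_
  infixl 7 _⊡_
  -- Tags a monomial with its exponent. Exponents of products are then computed by `_⊡_`, and
  -- regularity of 1 - x or x - y becomes a statement about natural numbers.
  record _≈e_ (x : Carrier) (i : ℕ) : Set where
    constructor power
    field proof : x ≈ pow q i
  open _≈e_ public

  _⊡_ : ∀ {x y i j} → x ≈e i → y ≈e j → x * y ≈e i ℕ.+ j
  _⊡_ {i = i} {j} (power x≈) (power y≈) = power (trans (*-cong x≈ y≈) (sym (pow-+ q i j)))

  e≈ : ∀ j → pow q j ≈e j
  e≈ j = power refl

  q≈ : q ≈e 1
  q≈ = power (sym (*-identityʳ q))

  e-reg : ∀ {x j} → x ≈e j → Regular x
  e-reg {j = j} (power x≈) = reg-cong (sym x≈) (pow-reg q-reg j)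

  1-reg : ∀ {x i} → 0 ℕ.< i → x ≈e i → Regular (1# - x)
  1-reg {i = i} 0<i (power x≈) = reg-cong (+-congˡ (-‿cong (sym x≈))) (1-q^-reg i 0<i)

  <-reg : ∀ {x y i j} → i ℕ.< j → x ≈e i → y ≈e j → Regular (x - y)
  <-reg {x} {y} {i} {j} i<j x≈ y≈ = reg-cong (begin
      x * (1# - z)    ≈⟨ solve 2 (λ x z → x ⊗ (𝟙 ⊖ z) ⊜ x ⊖ x ⊗ z) refl x z ⟩
      x - x * z       ≈⟨ +-congˡ (-‿cong (trans (proof (x≈ ⊡ e≈ (j ℕ.∸ i))) (trans (reflexive (≡.cong (pow q) (ℕ.m+[n∸m]≡n (ℕ.<⇒≤ i<j)))) (sym (proof y≈))))) ⟩
      x - y           ∎)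
    (reg-* (e-reg x≈) (1-q^-reg (j ℕ.∸ i) (ℕ.m<n⇒0<n∸m i<j)))
    where z = pow q (j ℕ.∸ i)

  >-reg : ∀ {x y i j} → j ℕ.< i → x ≈e i → y ≈e j → Regular (x - y)
  >-reg j<i x≈ y≈ = reg-cong (solve 2 (λ x y → ⊝ (y ⊖ x) ⊜ x ⊖ y) refl _ _) (reg-neg (<-reg j<i y≈ x≈))

  ≢-reg : ∀ {x y i j} → ¬ i ≡ j → x ≈e i → y ≈e j → Regular (x - y)
  ≢-reg {i = i} {j} i≢j x≈ y≈ with ℕ.<-cmp i j
  ... | tri< i<j _ _ = <-reg i<j x≈ y≈
  ... | tri≈ _ i≡j _ = ⊥-elim (i≢j i≡j)
  ... | tri> _ _ j<i = >-reg j<i x≈ y≈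

-- The terminating quadratic summation.

record Ops (A : Set) : Set where
  infixl 6 _+_ _-_
  infixl 7 _*_
  field
    _+_ _*_ : A → A → A
    neg     : A → A
    1#      : A
  _-_ : A → A → A
  x - y = x + neg y

-- Lets one set of formulas be read both as ring elements and as expressions of the solver, so that
-- long polynomials are written once.
exprOps : ∀ n → Ops (Expr ℤ n)
exprOps n = record { _+_ = _⊕_ ; _*_ = _⊗_ ; neg = ⊝_ ; 1# = 𝟙 }

-- Polynomials in t = q^k, M = q^{4m} and L = q^{4(m-k)}.  The ratio of
-- consecutive summands is num / den, and Num / Den that of consecutive right-hand
-- sides; X / Y compares the summands for m and m + 1.
module Summand {A : Set} (O : Ops A) (q h U p : A) where
  open Ops O
  q2 = q * q
  q3 = q2 * q
  q4 = q2 * q2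
  q5 = q4 * q
  q6 = q4 * q2
  q8 = q4 * q4
  sq : A → A
  sq x = x * x

  -- With y + 1/y = U/h, `upper` is h (1 - q t² y)(1 - q t²/y), and `lower` has q⁴ t⁴ in place of q
  -- t². Together with α, β, γ, δ these are the term ratios of the Gasper-Rahman quadratic summation
  -- in base q² with a = q.
  w upper lower num₀ den₀ : A → A
  w t = 1# - q * (sq t * sq t * sq t)
  upper t = h * (1# + q2 * sq (sq t)) - q * sq t * U
  lower t = h * (1# + q8 * sq (sq (sq t))) - q4 * sq (sq t) * U
  num₀ t = (1# - q * sq t) * upper t * (p - q3 * sq (sq t))
  den₀ t = (1# - q4 * sq (sq t)) * lower t * (1# - sq t * p)

  -- `α M` vanishes at t = q^m and so ends the sum. Negative powers are avoided by scaling: `α` is 1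
  -- - t⁴/M times M, and `δ` is 1 - q² t²/(M p) times M p.
  α β γ δ : A → A → A
  α M t = M - sq (sq t)
  β M t = 1# - M * q * sq (sq t) * p
  γ M t = 1# - M * q3 * sq t
  δ M t = M * p - q2 * sq t

  num den X Y Z : A → A → A
  num M t = q2 * num₀ t * α M t * β M t
  den M t = den₀ t * γ M t * δ M t
  Z M t = γ M t * γ M (q * t)
  X M t = α (q4 * M) t * β M 1# * Z M t * (δ (q4 * M) 1# * δ (q4 * M) q)
  Y M t = α (q4 * M) 1# * β M t * Z M 1# * (δ (q4 * M) t * δ (q4 * M) (q * t))

  N₀ D₂ D₀ Num Den C₀ : A → A
  N₀ M = h * (1# + M * M * q2 * sq p) - M * q * U * p
  D₂ M = (1# - M * p) * (1# - M * q2 * p)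
  D₀ M = h * (1# + M * M * q8) - M * q4 * U
  Num M = Z M 1# * N₀ M
  Den M = D₂ M * D₀ M
  C₀ M = 1# - p * q5 * M * M

  -- The WZ certificate with its denominators cleared. It contains M/t², which is written t² L
  -- because L = M/t⁴.
  cert : A → A → A → A
  cert M L t = C₀ M * Z M 1# * (sq t * L) * num₀ t * β M t

module SummandIdentities (R : CommutativeRing 0ℓ 0ℓ) where
  open Ring R
  open WZ R
  open import Relation.Binary.Reasoning.Setoid setoid

  ringOps : Ops Carrier
  ringOps = record { _+_ = _+_ ; _*_ = _*_ ; neg = -_ ; 1# = 1# }

  -- The WZ equation at one index, without the factors common to its terms. It is a polynomial
  -- identity only after M is eliminated by M = t⁴ q⁴ ℓ; M is therefore made the first variable of
  -- `lhs` and `rhs`, where `eval-cong` can replace it.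
  core : ∀ q h U p t ℓ M → let open Summand ringOps q h U p ; L = q4 * ℓ ; t′ = q * t in
    M ≈ sq (sq t) * L →
    q2 * (w t′ * D₀ M * (α (q4 * M) 1# * β M t′ * (δ (q4 * M) t′ * δ (q4 * M) (q * t′)))
          - q4 * q6 * α M t * (w t′ * N₀ M * (β M 1# * Z M t′) - C₀ M * (sq t′ * ℓ) * num₀ t′ * β M t′))
    ≈ q4 * q6 * (γ M (q * t′) * C₀ M * (sq t * L) * den₀ t * δ M t)
  core q h U p t ℓ M M≈ = trans (eval-cong lhs M≈ (q ∷ h ∷ U ∷ p ∷ t ∷ ℓ ∷ [])) (trans
      (solve 6 (λ q h U p t ℓ → let open Summand (exprOps 6) q h U p ; L = q4 ⊗ ℓ ; M = sq (sq t) ⊗ L ; t′ = q ⊗ t in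
        q2 ⊗ (w t′ ⊗ D₀ M ⊗ (α (q4 ⊗ M) 𝟙 ⊗ β M t′ ⊗ (δ (q4 ⊗ M) t′ ⊗ δ (q4 ⊗ M) (q ⊗ t′)))
              ⊖ q4 ⊗ q6 ⊗ α M t ⊗ (w t′ ⊗ N₀ M ⊗ (β M 𝟙 ⊗ Z M t′) ⊖ C₀ M ⊗ (sq t′ ⊗ ℓ) ⊗ num₀ t′ ⊗ β M t′))
        ⊜ q4 ⊗ q6 ⊗ (γ M (q ⊗ t′) ⊗ C₀ M ⊗ (sq t ⊗ L) ⊗ den₀ t ⊗ δ M t)) refl q h U p t ℓ)
      (sym (eval-cong rhs M≈ (q ∷ h ∷ U ∷ p ∷ t ∷ ℓ ∷ []))))
    where
      module Vars where
        x : Fin 7 → Expr ℤ 7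
        x = Ι
        M′ q′ h′ U′ p′ t₀ ℓ′ t₁ : Expr ℤ 7
        M′ = x zero
        q′ = x (suc zero)
        h′ = x (suc (suc zero))
        U′ = x (suc (suc (suc zero)))
        p′ = x (suc (suc (suc (suc zero))))
        t₀ = x (suc (suc (suc (suc (suc zero)))))
        ℓ′ = x (suc (suc (suc (suc (suc (suc zero))))))
        t₁ = q′ ⊗ t₀
      open Vars
      module S = Summand (exprOps 7) q′ h′ U′ p′
      lhs rhs : Expr ℤ 7
      lhs = S.q2 ⊗ (S.w t₁ ⊗ S.D₀ M′ ⊗ (S.α (S.q4 ⊗ M′) 𝟙 ⊗ S.β M′ t₁ ⊗ (S.δ (S.q4 ⊗ M′) t₁ ⊗ S.δ (S.q4 ⊗ M′) (q′ ⊗ t₁)))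
              ⊖ S.q4 ⊗ S.q6 ⊗ S.α M′ t₀ ⊗ (S.w t₁ ⊗ S.N₀ M′ ⊗ (S.β M′ 𝟙 ⊗ S.Z M′ t₁) ⊖ S.C₀ M′ ⊗ (S.sq t₁ ⊗ ℓ′) ⊗ S.num₀ t₁ ⊗ S.β M′ t₁))
      rhs = S.q4 ⊗ S.q6 ⊗ (S.γ M′ (q′ ⊗ t₁) ⊗ S.C₀ M′ ⊗ (S.sq t₀ ⊗ (S.q4 ⊗ ℓ′)) ⊗ S.den₀ t₀ ⊗ S.δ M′ t₀)

  -- The case k = m, where M = t⁴ and L = 1. It matches the additional summand of the longer sum
  -- with the boundary term of the telescoping.
  last-term : ∀ q h U p t → let open Summand ringOps q h U p ; M = sq (sq t) in
    w (q * t) * D₀ M * q2 * β (q4 * M) t * α (q4 * M) 1# * δ (q4 * M) (q * t) ≈ C₀ M * (sq t * 1#) * den₀ t * γ (q4 * M) t * q6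
  last-term = solve 5 (λ q h U p t → let open Summand (exprOps 5) q h U p ; M = sq (sq t) in
    w (q ⊗ t) ⊗ D₀ M ⊗ q2 ⊗ β (q4 ⊗ M) t ⊗ α (q4 ⊗ M) 𝟙 ⊗ δ (q4 ⊗ M) (q ⊗ t) ⊜ C₀ M ⊗ (sq t ⊗ 𝟙) ⊗ den₀ t ⊗ γ (q4 ⊗ M) t ⊗ q6) refl

  base : ∀ q h U p M → let open Summand ringOps q h U p in
    w 1# * Den M ≈ w 1# * Num M - C₀ M * M * num₀ 1#
  base = solve 5 (λ q h U p M → let open Summand (exprOps 5) q h U p in
    w 𝟙 ⊗ Den M ⊜ w 𝟙 ⊗ Num M ⊖ C₀ M ⊗ M ⊗ num₀ 𝟙) refl

  module _ (q h U p : Carrier) where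
    open Summand ringOps q h U p

    -- Raising m by one multiplies M by q⁴, and in each of the four factors this amounts to a shift
    -- of k, up to a power of q. Hence the summands for m and m + 1 differ by a quotient of
    -- boundedly many factors, which is Y / X.
    α-shift : ∀ M t → α (q4 * M) (q * t) ≈ q4 * α M t
    α-shift = solve 3 (λ q M t → let module E = Summand (exprOps 3) q q q q in E.α (E.q4 ⊗ M) (q ⊗ t) ⊜ E.q4 ⊗ E.α M t) refl q

    β-shift : ∀ M t → β (q4 * M) t ≈ β M (q * t)
    β-shift = solve 4 (λ q p M t → let module E = Summand (exprOps 4) q q q p in E.β (E.q4 ⊗ M) t ⊜ E.β M (q ⊗ t)) refl q p

    γ-shift : ∀ M t → γ (q4 * M) t ≈ γ M (q * (q * t))
    γ-shift = solve 3 (λ q M t → let module E = Summand (exprOps 3) q q q q in E.γ (E.q4 ⊗ M) t ⊜ E.γ M (q ⊗ (q ⊗ t))) refl q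

    δ-shift : ∀ M t → δ (q4 * M) (q * (q * t)) ≈ q4 * δ M t
    δ-shift = solve 4 (λ q p M t → let module E = Summand (exprOps 4) q q q p in E.δ (E.q4 ⊗ M) (q ⊗ (q ⊗ t)) ⊜ E.q4 ⊗ E.δ M t) refl q p

    δδ : ∀ M → δ (q4 * M) 1# * δ (q4 * M) q ≈ q6 * D₂ M
    δδ = solve 3 (λ q p M → let module E = Summand (exprOps 3) q q q p in E.δ (E.q4 ⊗ M) 𝟙 ⊗ E.δ (E.q4 ⊗ M) q ⊜ E.q6 ⊗ E.D₂ M) refl q p

    XY-step : ∀ M t → num (q4 * M) t * X M (q * t) * (Y M t * den M t) ≈ num M t * Y M (q * t) * (X M t * den (q4 * M) t)
    XY-step M t = trans (*-cong (*-cong (*-congˡ (β-shift M t)) (*-congʳ (*-cong (*-congʳ (α-shift M t)) (*-congˡ (sym (γ-shift M t)))))) refl)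
      (trans (*-solve 18
        (λ q2 n₀ α′t β′ q4 αt β1 γq γ′ δδ α1 βt γ1 δ′t δ′q d₀ γt δt →
          q2 ∙ n₀ ∙ α′t ∙ β′ ∙ (q4 ∙ αt ∙ β1 ∙ (γq ∙ γ′) ∙ δδ) ∙ (α1 ∙ βt ∙ γ1 ∙ (δ′t ∙ δ′q) ∙ (d₀ ∙ γt ∙ δt))
          ≐ q2 ∙ n₀ ∙ αt ∙ βt ∙ (α1 ∙ β′ ∙ γ1 ∙ (δ′q ∙ (q4 ∙ δt))) ∙ (α′t ∙ β1 ∙ (γt ∙ γq) ∙ δδ ∙ (d₀ ∙ γ′ ∙ δ′t))) refl
          q2 (num₀ t) (α (q4 * M) t) (β M (q * t)) q4 (α M t) (β M 1#) (γ M (q * t)) (γ (q4 * M) t) (δ (q4 * M) 1# * δ (q4 * M) q)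
          (α (q4 * M) 1#) (β M t) (Z M 1#) (δ (q4 * M) t) (δ (q4 * M) (q * t)) (den₀ t) (γ M t) (δ M t))
        (*-congʳ (*-congˡ (*-congˡ (*-congˡ (sym (δ-shift M t)))))))

    X₀≈Y₀ : ∀ M → X M 1# ≈ Y M 1#
    X₀≈Y₀ M = *-congˡ (*-congˡ (reflexive′ ))
      where reflexive′ : δ (q4 * M) q ≈ δ (q4 * M) (q * 1#)
            reflexive′ = solve 3 (λ q p M → let module E = Summand (exprOps 3) q q q p in E.δ (E.q4 ⊗ M) q ⊜ E.δ (E.q4 ⊗ M) (q ⊗ 𝟙)) refl q p M

  -- One step m → m + 1; f and f′ are the summands for m and m + 1 multiplied by
  -- the common denominators B and B′.
  module WZStep (q h U p : Carrier) (m : ℕ) where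
    open Summand ringOps q h U p
    e : ℕ → Carrier
    e = pow q
    M : Carrier
    M = sq (sq (e m))

    module _
      (B B′ : Carrier) (f f′ : ℕ → Carrier)
      (f-0  : f 0 ≈ B) (f′-0 : f′ 0 ≈ B′)
      (f-suc  : ∀ j → j ℕ.< m → f (suc j) * den M (e j) ≈ f j * num M (e j))
      (f′-suc : ∀ j → j ℕ.< suc m → f′ (suc j) * den (q4 * M) (e j) ≈ f′ j * num (q4 * M) (e j))
      (q-reg : Regular q)
      (α-reg : ∀ j → j ℕ.< m → Regular (α M (e j)))
      (X-reg : ∀ j → j ℕ.≤ m → Regular (X M (e j)))
      (Y-reg : ∀ j → j ℕ.< m → Regular (Y M (e j)))
      (den-reg  : ∀ j → j ℕ.< m → Regular (den M (e j)))
      (den′-reg : ∀ j → j ℕ.< suc m → Regular (den (q4 * M) (e j)))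
      (Z-reg : ∀ j → Regular (Z M (e j)))
      (V-reg : Regular (β M 1#))
      where

      compare : ∀ k → k ℕ.≤ m → B * f′ k * X M (e k) ≈ B′ * f k * Y M (e k)
      compare = compare-summands {num = λ j → num M (e j)} {λ j → den M (e j)} {λ j → num (q4 * M) (e j)} {λ j → den (q4 * M) (e j)}
        f-0 f′-0 (X₀≈Y₀ q h U p M) f-suc (λ j j<m → f′-suc j (ℕ.m<n⇒m<1+n j<m)) (λ j _ → XY-step q h U p M (e j))
        (λ j j<m → reg-* (reg-* (den′-reg j (ℕ.m<n⇒m<1+n j<m)) (X-reg j (ℕ.<⇒≤ j<m))) (reg-* (Y-reg j j<m) (den-reg j j<m)))

      S S′ : ℕ → Carrier
      S  k = sum (suc k) (λ i → w (e i) * f i)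
      S′ k = sum (suc k) (λ i → w (e i) * f′ i)

      -- The hypothesis `KEY` of `extend-sums`. It is `core` multiplied by `G`; the ratio of
      -- `f (suc k)` to `f k` then turns the right-hand side of `core` into the certificate at k.
      key : ∀ k → k ℕ.< m → ∀ ℓ → M ≈ sq (sq (e k)) * (q4 * ℓ) → let t = e k ; t′ = q * t in
        q2 * w t′ * (β M 1# * Den M) * Z M t′ * Z M t * (f (suc k) * Y M t′)
        ≈ q2 * X M t′ * Z M t * (Num M * (w t′ * f (suc k)) * (β M 1# * Z M t′) - f (suc k) * cert M ℓ t′)
          + q2 * X M t′ * Z M t′ * (f k * cert M (q4 * ℓ) t)
      key k k<m ℓ M≈ = begin
        q2 * w t′ * (V * (D₂ M * D₀ M)) * Z′ * (γ₀ * γ₁) * (f₁ * Y M t′)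
          ≈⟨ *-solve 14 (λ q2 w V D₂ D₀ Z′ γ₀ γ₁ f₁ α₁ β c δ δ′ →
               q2 ∙ w ∙ (V ∙ (D₂ ∙ D₀)) ∙ Z′ ∙ (γ₀ ∙ γ₁) ∙ (f₁ ∙ (α₁ ∙ β ∙ c ∙ (δ ∙ δ′)))
               ≐ c ∙ V ∙ D₂ ∙ Z′ ∙ γ₀ ∙ γ₁ ∙ f₁ ∙ (q2 ∙ (w ∙ D₀ ∙ (α₁ ∙ β ∙ (δ ∙ δ′))))) refl
               q2 (w t′) V (D₂ M) (D₀ M) Z′ γ₀ γ₁ f₁ (α (q4 * M) 1#) (β M t′) c (δ (q4 * M) t′) (δ (q4 * M) (q * t′)) ⟩
        G * (q2 * a)
          ≈⟨ solve 4 (λ G q a b → G ⊗ (q ⊗ a) ⊜ G ⊗ (q ⊗ b) ⊕ G ⊗ (q ⊗ (a ⊖ b))) refl G q2 a b ⟩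
        G * (q2 * b) + G * (q2 * (a - b))
          ≈⟨ +-cong main (trans (*-congˡ (core q h U p t ℓ M M≈)) rest) ⟩
        q2 * X M t′ * (γ₀ * γ₁) * (Num M * (w t′ * f₁) * (V * Z′) - f₁ * cert M ℓ t′)
          + q2 * X M t′ * Z′ * (f k * cert M (q4 * ℓ) t) ∎
        where
          t = e k
          t′ = q * t
          V = β M 1#
          Z′ = Z M t′
          γ₀ = γ M t
          γ₁ = γ M t′
          γ₂ = γ M (q * t′)
          f₁ = f (suc k)
          c = Z M 1#
          G = c * V * D₂ M * Z′ * γ₀ * γ₁ * f₁
          a = w t′ * D₀ M * (α (q4 * M) 1# * β M t′ * (δ (q4 * M) t′ * δ (q4 * M) (q * t′)))
          E = C₀ M * (sq t′ * ℓ) * num₀ t′ * β M t′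
          b = q4 * q6 * α M t * (w t′ * N₀ M * (V * Z′) - E)
          X≈ : X M t′ ≈ q4 * α M t * V * Z′ * (q6 * D₂ M)
          X≈ = *-cong (*-congʳ (*-congʳ (α-shift q h U p M t))) (δδ q h U p M)
          main : G * (q2 * b) ≈ q2 * X M t′ * (γ₀ * γ₁) * (Num M * (w t′ * f₁) * (V * Z′) - f₁ * cert M ℓ t′)
          main = begin
            G * (q2 * b)
              ≈⟨ *-solve 12 (λ c V D Z′ γ₀ γ₁ f₁ q2 q4 q6 α x → c ∙ V ∙ D ∙ Z′ ∙ γ₀ ∙ γ₁ ∙ f₁ ∙ (q2 ∙ (q4 ∙ q6 ∙ α ∙ x)) ≐ q2 ∙ (q4 ∙ α ∙ V ∙ Z′ ∙ (q6 ∙ D)) ∙ (γ₀ ∙ γ₁) ∙ (c ∙ f₁ ∙ x)) refl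
                   c V (D₂ M) Z′ γ₀ γ₁ f₁ q2 q4 q6 (α M t) (w t′ * N₀ M * (V * Z′) - E) ⟩
            q2 * (q4 * α M t * V * Z′ * (q6 * D₂ M)) * (γ₀ * γ₁) * (c * f₁ * (w t′ * N₀ M * (V * Z′) - E))
              ≈⟨ *-cong (*-congʳ (*-congˡ (sym X≈))) (solve 9 (λ c f w N VZ C s n β → c ⊗ f ⊗ (w ⊗ N ⊗ VZ ⊖ C ⊗ s ⊗ n ⊗ β) ⊜ c ⊗ N ⊗ (w ⊗ f) ⊗ VZ ⊖ f ⊗ (C ⊗ c ⊗ s ⊗ n ⊗ β)) refl
                   c f₁ (w t′) (N₀ M) (V * Z′) (C₀ M) (sq t′ * ℓ) (num₀ t′) (β M t′)) ⟩
            q2 * X M t′ * (γ₀ * γ₁) * (Num M * (w t′ * f₁) * (V * Z′) - f₁ * cert M ℓ t′) ∎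
          rest : G * (q4 * q6 * (γ₂ * C₀ M * (sq t * (q4 * ℓ)) * den₀ t * δ M t)) ≈ q2 * X M t′ * Z′ * (f k * cert M (q4 * ℓ) t)
          rest = begin
            G * (q4 * q6 * (γ₂ * C₀ M * (sq t * (q4 * ℓ)) * den₀ t * δ M t))
              ≈⟨ *-solve 14 (λ c V D Z′ γ₀ γ₁ f₁ q4 q6 γ₂ C s d δ → c ∙ V ∙ D ∙ Z′ ∙ γ₀ ∙ γ₁ ∙ f₁ ∙ (q4 ∙ q6 ∙ (γ₂ ∙ C ∙ s ∙ d ∙ δ))
                   ≐ q4 ∙ V ∙ Z′ ∙ (q6 ∙ D) ∙ (γ₁ ∙ γ₂) ∙ (C ∙ c ∙ s) ∙ (f₁ ∙ (d ∙ γ₀ ∙ δ))) refl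
                   c V (D₂ M) Z′ γ₀ γ₁ f₁ q4 q6 γ₂ (C₀ M) (sq t * (q4 * ℓ)) (den₀ t) (δ M t) ⟩
            q4 * V * Z′ * (q6 * D₂ M) * Z′ * (C₀ M * c * (sq t * (q4 * ℓ))) * (f₁ * den M t)
              ≈⟨ *-congˡ (f-suc k k<m) ⟩
            q4 * V * Z′ * (q6 * D₂ M) * Z′ * (C₀ M * c * (sq t * (q4 * ℓ))) * (f k * num M t)
              ≈⟨ *-solve 11 (λ q4 V Z′ D cs f q2 n α β Z″ → q4 ∙ V ∙ Z′ ∙ D ∙ Z″ ∙ cs ∙ (f ∙ (q2 ∙ n ∙ α ∙ β)) ≐ q2 ∙ (q4 ∙ α ∙ V ∙ Z′ ∙ D) ∙ Z″ ∙ (f ∙ (cs ∙ n ∙ β))) refl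
                   q4 V Z′ (q6 * D₂ M) (C₀ M * c * (sq t * (q4 * ℓ))) (f k) q2 (num₀ t) (α M t) (β M t) Z′ ⟩
            q2 * (q4 * α M t * V * Z′ * (q6 * D₂ M)) * Z′ * (f k * cert M (q4 * ℓ) t)
              ≈⟨ *-congʳ (*-congʳ (*-congˡ X≈)) ⟨
            q2 * X M t′ * Z′ * (f k * cert M (q4 * ℓ) t) ∎

      -- Telescoping: after scaling, the partial sums for m and m + 1 differ only by the certificate
      -- at the last index. `ℓ` stands for M/t⁴ and is quantified because it picks up a factor q⁴ at
      -- each step down in k.
      partial-sums : ∀ k → k ℕ.≤ m → ∀ ℓ → M ≈ sq (sq (e k)) * ℓ →
        B * S′ k * (β M 1# * Den M * Z M (e k)) ≈ B′ * (Num M * S k * (β M 1# * Z M (e k)) - f k * cert M ℓ (e k))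
      partial-sums zero _ ℓ M≈ = begin
        B * (0# + w 1# * f′ 0) * (β M 1# * Den M * Z M 1#)
          ≈⟨ *-congʳ (*-congˡ (+-congˡ (*-congˡ f′-0))) ⟩
        B * (0# + w 1# * B′) * (β M 1# * Den M * Z M 1#)
          ≈⟨ solve 6 (λ B w B′ V D Z → B ⊗ (Κ 0ℤ ⊕ w ⊗ B′) ⊗ (V ⊗ D ⊗ Z) ⊜ B′ ⊗ B ⊗ (w ⊗ D) ⊗ (V ⊗ Z)) refl B (w 1#) B′ (β M 1#) (Den M) (Z M 1#) ⟩
        B′ * B * (w 1# * Den M) * (β M 1# * Z M 1#)
          ≈⟨ *-congʳ (*-congˡ (base q h U p M)) ⟩
        B′ * B * (w 1# * Num M - C₀ M * M * num₀ 1#) * (β M 1# * Z M 1#)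
          ≈⟨ *-congʳ (*-cong (*-congˡ (sym f-0)) (+-congˡ (-‿cong (*-congʳ (*-congˡ (trans M≈ (*-congʳ (*-cong (*-identityˡ _) (*-identityˡ _))))))))) ⟩
        B′ * f 0 * (w 1# * Num M - C₀ M * (sq 1# * ℓ) * num₀ 1#) * (β M 1# * Z M 1#)
          ≈⟨ solve 9 (λ B f w N C ℓ n V Z → B ⊗ f ⊗ (w ⊗ N ⊖ C ⊗ ℓ ⊗ n) ⊗ (V ⊗ Z) ⊜ B ⊗ (N ⊗ (Κ 0ℤ ⊕ w ⊗ f) ⊗ (V ⊗ Z) ⊖ f ⊗ (C ⊗ Z ⊗ ℓ ⊗ n ⊗ V))) refl
               B′ (f 0) (w 1#) (Num M) (C₀ M) (sq 1# * ℓ) (num₀ 1#) (β M 1#) (Z M 1#) ⟩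
        B′ * (Num M * (0# + w 1# * f 0) * (β M 1# * Z M 1#) - f 0 * cert M ℓ 1#) ∎
      partial-sums (suc k) k<m ℓ M≈ = extend-sums refl refl
        (reg-* (reg-* (reg-* q-reg q-reg) (X-reg (suc k) k<m)) (Z-reg k))
        (partial-sums k (ℕ.<⇒≤ k<m) (q4 * ℓ) M≈′) (compare (suc k) k<m) (key k k<m ℓ M≈′)
        where
          M≈′ : M ≈ sq (sq (e k)) * (q4 * ℓ)
          M≈′ = trans M≈ (solve 3 (λ q t ℓ → let s = λ x → x ⊗ x in s (s (q ⊗ t)) ⊗ ℓ ⊜ s (s t) ⊗ (s (s q) ⊗ ℓ)) refl q (e k) ℓ)

      -- The sum for m + 1 has one summand more than the sum for m. This summand cancels the
      -- certificate that `partial-sums` leaves at k = m.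
      top-summand : B * (w (e (suc m)) * f′ (suc m)) * (β M 1# * Den M * Z M (e m)) ≈ B′ * (f m * cert M 1# (e m))
      top-summand = cancel (reg-* (den′-reg m (ℕ.n<1+n m)) (X-reg m ℕ.≤-refl)) (begin
        d′ * x * (B * (w t′ * f′ (suc m)) * (V * Den M * z))
          ≈⟨ *-solve 8 (λ d′ x B w f V D z → d′ ∙ x ∙ (B ∙ (w ∙ f) ∙ (V ∙ D ∙ z)) ≐ w ∙ V ∙ D ∙ z ∙ x ∙ B ∙ (f ∙ d′)) refl d′ x B (w t′) (f′ (suc m)) V (Den M) z ⟩
        w t′ * V * Den M * z * x * B * (f′ (suc m) * d′)
          ≈⟨ *-congˡ (f′-suc m (ℕ.n<1+n m)) ⟩
        w t′ * V * Den M * z * x * B * (f′ m * num (q4 * M) t)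
          ≈⟨ *-solve 8 (λ w V D z x B f n → w ∙ V ∙ D ∙ z ∙ x ∙ B ∙ (f ∙ n) ≐ w ∙ V ∙ D ∙ z ∙ n ∙ (B ∙ f ∙ x)) refl (w t′) V (Den M) z x B (f′ m) (num (q4 * M) t) ⟩
        w t′ * V * Den M * z * num (q4 * M) t * (B * f′ m * x)
          ≈⟨ *-congˡ (compare m ℕ.≤-refl) ⟩
        w t′ * V * Den M * z * num (q4 * M) t * (B′ * f m * Y M t)
          ≈⟨ *-solve 16 (λ w V D₂ D₀ z q2 n α′ β′ B f α₁ β c δ δ′ →
               w ∙ V ∙ (D₂ ∙ D₀) ∙ z ∙ (q2 ∙ n ∙ α′ ∙ β′) ∙ (B ∙ f ∙ (α₁ ∙ β ∙ c ∙ (δ ∙ δ′)))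
               ≐ V ∙ D₂ ∙ z ∙ n ∙ α′ ∙ B ∙ f ∙ β ∙ c ∙ δ ∙ (w ∙ D₀ ∙ q2 ∙ β′ ∙ α₁ ∙ δ′)) refl
               (w t′) V (D₂ M) (D₀ M) z q2 (num₀ t) (α (q4 * M) t) (β (q4 * M) t) B′ (f m) (α (q4 * M) 1#) (β M t) (Z M 1#) (δ (q4 * M) t) (δ (q4 * M) t′) ⟩
        V * D₂ M * z * num₀ t * α (q4 * M) t * B′ * f m * β M t * Z M 1# * δ (q4 * M) t * (w t′ * D₀ M * q2 * β (q4 * M) t * α (q4 * M) 1# * δ (q4 * M) t′)
          ≈⟨ *-congˡ (last-term q h U p t) ⟩
        V * D₂ M * z * num₀ t * α (q4 * M) t * B′ * f m * β M t * Z M 1# * δ (q4 * M) t * (C₀ M * (sq t * 1#) * den₀ t * γ (q4 * M) t * q6)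
          ≈⟨ *-solve 15 (λ V D₂ z n α′ B f β c δ C s d γ′ q6 →
               V ∙ D₂ ∙ z ∙ n ∙ α′ ∙ B ∙ f ∙ β ∙ c ∙ δ ∙ (C ∙ s ∙ d ∙ γ′ ∙ q6)
               ≐ d ∙ γ′ ∙ δ ∙ (α′ ∙ V ∙ z ∙ (q6 ∙ D₂)) ∙ (B ∙ (f ∙ (C ∙ c ∙ s ∙ n ∙ β)))) refl
               V (D₂ M) z (num₀ t) (α (q4 * M) t) B′ (f m) (β M t) (Z M 1#) (δ (q4 * M) t) (C₀ M) (sq t * 1#) (den₀ t) (γ (q4 * M) t) q6 ⟩
        d′ * (α (q4 * M) t * V * z * (q6 * D₂ M)) * (B′ * (f m * cert M 1# t))
          ≈⟨ *-congʳ (*-congˡ (*-congˡ (δδ q h U p M))) ⟨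
        d′ * x * (B′ * (f m * cert M 1# t)) ∎)
        where
          t = e m
          t′ = q * t
          V = β M 1#
          z = Z M t
          d′ = den (q4 * M) t
          x = X M t

      step : B * sum (suc (suc m)) (λ i → w (e i) * f′ i) * Den M ≈ B′ * Num M * sum (suc m) (λ i → w (e i) * f i)
      step = cancel (reg-* V-reg (Z-reg m)) (begin
        V * z * (B * (S′ m + g) * Den M)
          ≈⟨ solve 6 (λ V z B S g D → V ⊗ z ⊗ (B ⊗ (S ⊕ g) ⊗ D) ⊜ B ⊗ S ⊗ (V ⊗ D ⊗ z) ⊕ B ⊗ g ⊗ (V ⊗ D ⊗ z)) refl V z B (S′ m) g (Den M) ⟩
        B * S′ m * (V * Den M * z) + B * g * (V * Den M * z)
          ≈⟨ +-cong (partial-sums m ℕ.≤-refl 1# (sym (*-identityʳ _))) top-summand ⟩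
        B′ * (Num M * S m * (V * z) - F) + B′ * F
          ≈⟨ solve 6 (λ B N S V z F → B ⊗ (N ⊗ S ⊗ (V ⊗ z) ⊖ F) ⊕ B ⊗ F ⊜ V ⊗ z ⊗ (B ⊗ N ⊗ S)) refl B′ (Num M) (S m) V z F ⟩
        V * z * (B′ * Num M * S m) ∎)
        where
          V = β M 1#
          z = Z M (e m)
          g = w (e (suc m)) * f′ (suc m)
          F = f m * cert M 1# (e m)

module QuadraticSummation (R : CommutativeRing 0ℓ 0ℓ) (q h U p : CommutativeRing.Carrier R) where
  open Ring R
  open SummandIdentities R
  open Summand ringOps q h U p
  open import Relation.Binary.Reasoning.Setoid setoid

  e : ℕ → Carrier
  e = pow q
  M : ℕ → Carrier
  M m = sq (sq (e m))

  denominators : ℕ → Carrier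
  denominators m = prod m (λ i → den (M m) (e i))

  -- The k-th summand without its factor w, times the common denominator.
  summand : ℕ → ℕ → Carrier
  summand m = Cleared.cleared R (λ i → num (M m) (e i)) (λ i → den (M m) (e i)) m

  summand-0 : ∀ m → summand m 0 ≈ denominators m
  summand-0 m = Cleared.cleared-0 R (λ i → num (M m) (e i)) (λ i → den (M m) (e i)) m

  summand-suc : ∀ m j → j ℕ.< m → summand m (suc j) * den (M m) (e j) ≈ summand m j * num (M m) (e j)
  summand-suc m = Cleared.cleared-suc R (λ i → num (M m) (e i)) (λ i → den (M m) (e i)) m

  M-suc : ∀ m → M (suc m) ≈ q4 * M m
  M-suc m = solve 2 (λ q t → let s = λ x → x ⊗ x in s (s (q ⊗ t)) ⊜ s (s q) ⊗ s (s t)) refl q (e m)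

  num-cong : ∀ {M M′} t → M ≈ M′ → num M t ≈ num M′ t
  num-cong t eq = *-cong (*-congˡ (+-congʳ eq)) (+-congˡ (-‿cong (*-congʳ (*-congʳ (*-congʳ eq)))))

  den-cong : ∀ {M M′} t → M ≈ M′ → den M t ≈ den M′ t
  den-cong t eq = *-cong (*-congˡ (+-congˡ (-‿cong (*-congʳ (*-congʳ eq))))) (+-congʳ (*-congʳ eq))

  module _
    (q-reg : Regular q)
    (1-q^-reg : ∀ i → 0 ℕ.< i → Regular (1# - e i))
    (1-q^p-reg : ∀ i → Regular (1# - e i * p))
    (lower-reg : ∀ j → Regular (lower (e j)))
    where

    open Powers R q q-reg 1-q^-reg

    private
      q3≈ : q3 ≈e 3
      q3≈ = q≈ ⊡ q≈ ⊡ q≈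
      q4≈ : q4 ≈e 4
      q4≈ = (q≈ ⊡ q≈) ⊡ (q≈ ⊡ q≈)
      sq≈ : ∀ j → sq (e j) ≈e j ℕ.+ j
      sq≈ j = e≈ j ⊡ e≈ j
      M≈ : ∀ j → M j ≈e (j ℕ.+ j) ℕ.+ (j ℕ.+ j)
      M≈ j = sq≈ j ⊡ sq≈ j

      1-p-reg : ∀ {x i} → x ≈e i → Regular (1# - x * p)
      1-p-reg {i = i} (power x≈) = reg-cong (+-congˡ (-‿cong (*-congʳ (sym x≈)))) (1-q^p-reg i)

      q6-reg : Regular q6
      q6-reg = let r = reg-* q-reg q-reg in reg-* (reg-* r r) r

    α-reg : ∀ m j → j ℕ.< m → Regular (α (M m) (e j))
    α-reg m j j<m = >-reg (ℕ.+-mono-< (ℕ.+-mono-< j<m j<m) (ℕ.+-mono-< j<m j<m)) (M≈ m) (M≈ j)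

    -- Splitting off q^{2j+2} leaves 1 - q^i p up to sign, with i = 4m - 2 - 2j; the hypothesis
    -- makes i a natural number.
    δ-reg : ∀ m j → suc j ℕ.≤ m ℕ.+ m → Regular (δ (M m) (e j))
    δ-reg m j j<2m = reg-cong (begin
        - (c * (1# - e i * p))         ≈⟨ solve 3 (λ c x p → ⊝ (c ⊗ (𝟙 ⊖ x ⊗ p)) ⊜ c ⊗ x ⊗ p ⊖ c) refl c (e i) p ⟩
        c * e i * p - c                ≈⟨ +-congʳ (*-congʳ (trans (proof (((q≈ ⊡ q≈) ⊡ sq≈ j) ⊡ e≈ i)) (trans (reflexive (≡.cong e eq)) (sym (proof (M≈ m)))))) ⟩
        M m * p - c ∎)
      (reg-neg (reg-* (e-reg (q≈ ⊡ q≈ ⊡ sq≈ j)) (1-q^p-reg i)))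
      where
        c = q2 * sq (e j)
        i = ((m ℕ.+ m) ℕ.+ (m ℕ.+ m)) ℕ.∸ (2 ℕ.+ (j ℕ.+ j))
        eq : (2 ℕ.+ (j ℕ.+ j)) ℕ.+ i ≡ (m ℕ.+ m) ℕ.+ (m ℕ.+ m)
        eq = ℕ.m+[n∸m]≡n (ℕ.≤-trans (ℕ.≤-reflexive (≡.cong suc (≡.sym (ℕ.+-suc j j)))) (ℕ.+-mono-≤ j<2m j<2m))

    β-reg : ∀ m j → Regular (β (M m) (e j))
    β-reg m j = 1-p-reg ((M≈ m ⊡ q≈) ⊡ M≈ j)

    γ-reg : ∀ m j → Regular (γ (M m) (e j))
    γ-reg m j = 1-reg (ℕ.<-≤-trans (s≤s z≤n) (ℕ.≤-trans (ℕ.m≤n+m 3 ((m ℕ.+ m) ℕ.+ (m ℕ.+ m))) (ℕ.m≤m+n _ (j ℕ.+ j)))) ((M≈ m ⊡ q3≈) ⊡ sq≈ j)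

    den-reg : ∀ m j → j ℕ.< m → Regular (den (M m) (e j))
    den-reg m j j<m = reg-* (reg-* (reg-* (reg-* (1-reg (s≤s z≤n) (q4≈ ⊡ M≈ j)) (lower-reg j)) (1-p-reg (sq≈ j))) (γ-reg m j))
      (δ-reg m j (ℕ.≤-trans j<m (ℕ.m≤m+n m m)))

    denominators-reg : ∀ m → Regular (denominators m)
    denominators-reg m = prod-reg m (den-reg m)

    private
      α′-reg : ∀ m j → j ℕ.≤ m → Regular (α (q4 * M m) (e j))
      α′-reg m j j≤m = reg-cong (+-congʳ (M-suc m)) (α-reg (suc m) j (s≤s j≤m))
      δ′-reg : ∀ m j → suc j ℕ.≤ suc m ℕ.+ suc m → Regular (δ (q4 * M m) (e j))
      δ′-reg m j le = reg-cong (+-congʳ (*-congʳ (M-suc m))) (δ-reg (suc m) j le)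
      Z-reg : ∀ m j → Regular (Z (M m) (e j))
      Z-reg m j = reg-* (γ-reg m j) (γ-reg m (suc j))
      X-reg : ∀ m j → j ℕ.≤ m → Regular (X (M m) (e j))
      X-reg m j j≤m = reg-* (reg-* (reg-* (α′-reg m j j≤m) (β-reg m 0)) (Z-reg m j))
        (reg-cong (sym (δδ q h U p (M m))) (reg-* q6-reg (reg-* (1-p-reg (M≈ m)) (1-p-reg (M≈ m ⊡ (q≈ ⊡ q≈))))))
      Y-reg : ∀ m j → j ℕ.< m → Regular (Y (M m) (e j))
      Y-reg m j j<m = reg-* (reg-* (reg-* (α′-reg m 0 z≤n) (β-reg m j)) (reg-* (γ-reg m 0) (γ-reg m 1)))
        (reg-* (δ′-reg m j (ℕ.≤-trans (ℕ.m≤n⇒m≤1+n j<m) (ℕ.m≤m+n _ _))) (δ′-reg m (suc j) (ℕ.≤-trans (s≤s j<m) (ℕ.m≤m+n _ _))))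

    -- Induction on m by the WZ step. For m = 0 only the summand k = 0 is present, which is 1 - q
    -- and explains the constant in front of the product.
    summation : ∀ m → sum (suc m) (λ i → w (e i) * summand m i) * prod m (λ i → Den (M i))
                      ≈ (1# - q) * denominators m * prod m (λ i → Num (M i))
    summation zero = solve 1 (λ q → (Κ 0ℤ ⊕ (𝟙 ⊖ q ⊗ (𝟙 ⊗ 𝟙 ⊗ (𝟙 ⊗ 𝟙) ⊗ (𝟙 ⊗ 𝟙))) ⊗ (𝟙 ⊗ 𝟙)) ⊗ 𝟙 ⊜ (𝟙 ⊖ q) ⊗ 𝟙 ⊗ 𝟙) refl q
    summation (suc m) = cancel (denominators-reg m) (begin
      B * (S′ * (P * D))    ≈⟨ *-solve 4 (λ B S P D → B ∙ (S ∙ (P ∙ D)) ≐ B ∙ S ∙ D ∙ P) refl B S′ P D ⟩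
      B * S′ * D * P        ≈⟨ *-congʳ step′ ⟩
      B′ * N * S * P        ≈⟨ *-assoc _ _ _ ⟩
      B′ * N * (S * P)      ≈⟨ *-congˡ (summation m) ⟩
      B′ * N * ((1# - q) * B * Q) ≈⟨ *-solve 5 (λ B′ N c B Q → B′ ∙ N ∙ (c ∙ B ∙ Q) ≐ B ∙ (c ∙ B′ ∙ (Q ∙ N))) refl B′ N (1# - q) B Q ⟩
      B * ((1# - q) * B′ * (Q * N)) ∎)
      where
        B = denominators m
        B′ = denominators (suc m)
        S = sum (suc m) (λ i → w (e i) * summand m i)
        S′ = sum (suc (suc m)) (λ i → w (e i) * summand (suc m) i)
        P = prod m (λ i → Den (M i))
        Q = prod m (λ i → Num (M i))
        D = Den (M m)
        N = Num (M m)
        step′ : B * S′ * D ≈ B′ * N * S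
        step′ = WZStep.step q h U p m B B′ (summand m) (summand (suc m)) (summand-0 m) (summand-0 (suc m)) (summand-suc m)
          (λ j j≤m → trans (*-congˡ (den-cong (e j) (sym (M-suc m)))) (trans (summand-suc (suc m) j j≤m) (*-congˡ (num-cong (e j) (M-suc m)))))
          q-reg (α-reg m) (X-reg m) (Y-reg m) (den-reg m)
          (λ j j≤m → reg-cong (den-cong (e j) (M-suc m)) (den-reg (suc m) j j≤m))
          (Z-reg m) (β-reg m 0)

-- The sum that vanishes at x = 1, y = q^{2m+1} for odd m.

-- The ratio num / den of consecutive summands as a function of Q = q^{2k}.
module VanishingSummand {A : Set} (O : Ops A) (q : A) where
  open Ops O
  q2 = q * q
  q3 = q2 * q
  q4 = q2 * q2
  sq : A → A
  sq x = x * x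

  w n₁ n₀ d₀ : A → A
  w Q = 1# - q * (Q * Q * Q)
  n₁ Q = (1# - q2 * sq Q) * sq (1# - q * sq Q)
  n₀ Q = q2 * n₁ Q
  d₀ Q = (1# - q4 * sq Q) * sq (1# - q2 * Q)

  -- `a` and `b` are the numerator factors in 1/y and y, the former multiplied by y; `d` and `c`
  -- play the same role in the denominator. For y = q^{2m+1} the factor `a` vanishes at Q = q^{2m},
  -- which ends the sum at k = m.
  a b c d ee : A → A → A
  a y Q = y - q * Q
  b y Q = 1# - q * Q * y
  c y Q = 1# - q4 * sq Q * y
  d y Q = y - q4 * sq Q
  ee y Q = y - sq Q

  num den X Y Z cc cert : A → A → A
  num y Q = n₀ Q * a y Q * b y Q
  den y Q = d₀ Q * c y Q * d y Q
  X y Q = a (q4 * y) Q * a (q2 * y) Q * c y Q * (y - 1#)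
  Y y Q = q2 * b y Q * b (q2 * y) Q * (1# - q4 * y) * ee y Q
  Z y Q = Q * a (q2 * y) Q * c y Q
  cc y Q = y * (1# - q4 * y) * (1# + q2 * y) * (q * Q - 1#)
  cert y Q = q * cc y Q * n₁ Q * b y Q

  Num Den : A → A
  Num y = sq (1# - q * y) * (1# - q4 * y)
  Den y = sq (1# - q3 * y) * (1# - y)

module VanishingSum (R : CommutativeRing 0ℓ 0ℓ) (q : CommutativeRing.Carrier R) where
  open Ring R
  open WZ R
  open SummandIdentities R using (ringOps)
  open import Relation.Binary.Reasoning.Setoid setoid
  private
    module E n = VanishingSummand (exprOps n)
  open VanishingSummand ringOps q

  private
    core : ∀ Q y → let Q′ = q2 * Q in
      q2 * Q′ * w Q′ * Den y * Q * Y y Q′ ≈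
      q4 * (y - 1#) * Q * a (q2 * y) Q * (Num y * w Q′ * Z y Q′ - cert y Q′) + q4 * (y - 1#) * Q′ * c y Q′ * (q * cc y Q) * d₀ Q * d y Q
    core = solve 3 (λ q Q y → let Q′ = E.q2 3 q ⊗ Q in let module S = E 3 in
      S.q2 q ⊗ Q′ ⊗ S.w q Q′ ⊗ S.Den q y ⊗ Q ⊗ S.Y q y Q′ ⊜
      S.q4 q ⊗ (y ⊖ 𝟙) ⊗ Q ⊗ S.a q (S.q2 q ⊗ y) Q ⊗ (S.Num q y ⊗ S.w q Q′ ⊗ S.Z q y Q′ ⊖ S.cert q y Q′) ⊕ S.q4 q ⊗ (y ⊖ 𝟙) ⊗ Q′ ⊗ S.c q y Q′ ⊗ (q ⊗ S.cc q y Q) ⊗ S.d₀ q Q ⊗ S.d q y Q) refl q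

    base : ∀ y → w 1# * Den y * Z y 1# ≈ Num y * w 1# * Z y 1# - cert y 1#
    base = solve 2 (λ q y → let module S = E 2 in S.w q 𝟙 ⊗ S.Den q y ⊗ S.Z q y 𝟙 ⊜ S.Num q y ⊗ S.w q 𝟙 ⊗ S.Z q y 𝟙 ⊖ S.cert q y 𝟙) refl q

    top-reduced : ∀ Q → let y = q * Q ; Q′ = q2 * Q ; Q″ = q2 * Q′ in
      sq (1# - q3 * y) * Q * q2 * q2 * b (q4 * y) Q * b (q2 * y) Q * ee y Q * (w Q′ * den (q4 * y) Q′ + w Q″ * num (q4 * y) Q′)
      ≈ q * (y * (1# + q2 * y) * (1# - q * Q)) * d₀ Q * c (q4 * y) Q * d (q4 * y) Q * den (q4 * y) Q′
    top-reduced = solve 2 (λ q Q → let module S = E 2 ; y = q ⊗ Q ; Q′ = S.q2 q ⊗ Q ; Q″ = S.q2 q ⊗ Q′ in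
      S.sq q (𝟙 ⊖ S.q3 q ⊗ y) ⊗ Q ⊗ S.q2 q ⊗ S.q2 q ⊗ S.b q (S.q4 q ⊗ y) Q ⊗ S.b q (S.q2 q ⊗ y) Q ⊗ S.ee q y Q ⊗ (S.w q Q′ ⊗ S.den q (S.q4 q ⊗ y) Q′ ⊕ S.w q Q″ ⊗ S.num q (S.q4 q ⊗ y) Q′)
      ⊜ q ⊗ (y ⊗ (𝟙 ⊕ S.q2 q ⊗ y) ⊗ (𝟙 ⊖ q ⊗ Q)) ⊗ S.d₀ q Q ⊗ S.c q (S.q4 q ⊗ y) Q ⊗ S.d q (S.q4 q ⊗ y) Q ⊗ S.den q (S.q4 q ⊗ y) Q′) refl q

    -- Here y = q Q, that is k = m. Passing from m to m + 2 adds two summands, and jointly they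
    -- cancel the last certificate. The common factors `G` are split off by hand so that the
    -- polynomial identity left for the solver stays small.
    top : ∀ Q → let y = q * Q ; Q′ = q2 * Q ; Q″ = q2 * Q′ in
      Den y * Z y Q * Y y Q * num (q4 * y) Q * (w Q′ * den (q4 * y) Q′ + w Q″ * num (q4 * y) Q′)
      ≈ cert y Q * den (q4 * y) Q * den (q4 * y) Q′ * X y Q
    top Q = begin
      Den y * Z y Q * Y y Q * num (q4 * y) Q * W
        ≈⟨ *-solve 15 (λ s y₁ Q a₂ C b b₂ c′ E n₁ a₄ b₄ W q2 q2′ →
             s ∙ y₁ ∙ (Q ∙ a₂ ∙ C) ∙ (q2 ∙ b ∙ b₂ ∙ c′ ∙ E) ∙ (q2′ ∙ n₁ ∙ a₄ ∙ b₄) ∙ W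
             ≐ (y₁ ∙ a₂ ∙ C ∙ b ∙ c′ ∙ n₁ ∙ a₄) ∙ (s ∙ Q ∙ q2 ∙ q2′ ∙ b₄ ∙ b₂ ∙ E ∙ W)) refl
             (sq (1# - q3 * y)) (1# - y) Q (a (q2 * y) Q) (c y Q) (b y Q) (b (q2 * y) Q) (1# - q4 * y) (ee y Q) (n₁ Q) (a (q4 * y) Q) (b (q4 * y) Q) W q2 q2 ⟩
      G * (sq (1# - q3 * y) * Q * q2 * q2 * b (q4 * y) Q * b (q2 * y) Q * ee y Q * W)
        ≈⟨ *-congˡ (top-reduced Q) ⟩
      G * (q * (y * (1# + q2 * y) * (1# - q * Q)) * d₀ Q * c (q4 * y) Q * d (q4 * y) Q * den (q4 * y) Q′)
        ≈⟨ *-solve 15 (λ y₁ a₂ C b c′ n₁ a₄ q y y₂ q₁ d₀ c₄ d₄ D →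
             (y₁ ∙ a₂ ∙ C ∙ b ∙ c′ ∙ n₁ ∙ a₄) ∙ (q ∙ (y ∙ y₂ ∙ q₁) ∙ d₀ ∙ c₄ ∙ d₄ ∙ D)
             ≐ (q₁ ∙ y₁) ∙ (q ∙ (y ∙ c′ ∙ y₂) ∙ n₁ ∙ b ∙ (d₀ ∙ c₄ ∙ d₄) ∙ D ∙ (a₄ ∙ a₂ ∙ C))) refl
             (1# - y) (a (q2 * y) Q) (c y Q) (b y Q) (1# - q4 * y) (n₁ Q) (a (q4 * y) Q) q y (1# + q2 * y) (1# - q * Q) (d₀ Q) (c (q4 * y) Q) (d (q4 * y) Q) (den (q4 * y) Q′) ⟩
      (1# - q * Q) * (1# - y) * H
        ≈⟨ *-congʳ (solve 2 (λ x y → (𝟙 ⊖ x) ⊗ (𝟙 ⊖ y) ⊜ (x ⊖ 𝟙) ⊗ (y ⊖ 𝟙)) refl (q * Q) y) ⟩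
      (q * Q - 1#) * (y - 1#) * H
        ≈⟨ *-solve 11 (λ q₁ y₁ q yc y₂ n₁ b d D a C →
             (q₁ ∙ y₁) ∙ (q ∙ (yc ∙ y₂) ∙ n₁ ∙ b ∙ d ∙ D ∙ (a ∙ C))
             ≐ (q ∙ (yc ∙ y₂ ∙ q₁) ∙ n₁ ∙ b) ∙ d ∙ D ∙ (a ∙ C ∙ y₁)) refl
             (q * Q - 1#) (y - 1#) q (y * (1# - q4 * y)) (1# + q2 * y) (n₁ Q) (b y Q) (den (q4 * y) Q) (den (q4 * y) Q′) (a (q4 * y) Q * a (q2 * y) Q) (c y Q) ⟩
      cert y Q * den (q4 * y) Q * den (q4 * y) Q′ * X y Q ∎
      where
        y = q * Q
        Q′ = q2 * Q
        Q″ = q2 * Q′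
        W = w Q′ * den (q4 * y) Q′ + w Q″ * num (q4 * y) Q′
        G = (1# - y) * a (q2 * y) Q * c y Q * b y Q * (1# - q4 * y) * n₁ Q * a (q4 * y) Q
        H = q * (y * (1# - q4 * y) * (1# + q2 * y)) * n₁ Q * b y Q * den (q4 * y) Q * den (q4 * y) Q′ * (a (q4 * y) Q * a (q2 * y) Q * c y Q)

    a-shift₂ : ∀ y Q → a (q2 * y) (q2 * Q) ≈ q2 * a y Q
    a-shift₂ = solve 3 (λ q y Q → let module S = E 3 in S.a q (S.q2 q ⊗ y) (S.q2 q ⊗ Q) ⊜ S.q2 q ⊗ S.a q y Q) refl q

    a-shift₄ : ∀ y Q → a (q4 * y) (q2 * Q) ≈ q2 * a (q2 * y) Q
    a-shift₄ = solve 3 (λ q y Q → let module S = E 3 in S.a q (S.q4 q ⊗ y) (S.q2 q ⊗ Q) ⊜ S.q2 q ⊗ S.a q (S.q2 q ⊗ y) Q) refl q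

    b-shift : ∀ y Q → b y (q2 * Q) ≈ b (q2 * y) Q
    b-shift = solve 3 (λ q y Q → let module S = E 3 in S.b q y (S.q2 q ⊗ Q) ⊜ S.b q (S.q2 q ⊗ y) Q) refl q

    b-shift₂ : ∀ y Q → b (q2 * y) (q2 * Q) ≈ b (q4 * y) Q
    b-shift₂ = solve 3 (λ q y Q → let module S = E 3 in S.b q (S.q2 q ⊗ y) (S.q2 q ⊗ Q) ⊜ S.b q (S.q4 q ⊗ y) Q) refl q

    c-shift : ∀ y Q → c y (q2 * Q) ≈ c (q4 * y) Q
    c-shift = solve 3 (λ q y Q → let module S = E 3 in S.c q y (S.q2 q ⊗ Q) ⊜ S.c q (S.q4 q ⊗ y) Q) refl q

    d-shift : ∀ y Q → d (q4 * y) Q ≈ q4 * ee y Q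
    d-shift = solve 3 (λ q y Q → let module S = E 3 in S.d q (S.q4 q ⊗ y) Q ⊜ S.q4 q ⊗ S.ee q y Q) refl q

    e-shift : ∀ y Q → ee y (q2 * Q) ≈ d y Q
    e-shift = solve 3 (λ q y Q → let module S = E 3 in S.ee q y (S.q2 q ⊗ Q) ⊜ S.d q y Q) refl q

    XY-step : ∀ y Q → num (q4 * y) Q * X y (q2 * Q) * (Y y Q * den y Q) ≈ num y Q * Y y (q2 * Q) * (X y Q * den (q4 * y) Q)
    XY-step y Q = begin
      num (q4 * y) Q * X y (q2 * Q) * (Y y Q * den y Q)
        ≈⟨ *-congʳ (*-congˡ (*-congʳ (*-cong (*-cong (a-shift₄ y Q) (a-shift₂ y Q)) (c-shift y Q)))) ⟩
      n₀ Q * a (q4 * y) Q * b (q4 * y) Q * (q2 * a (q2 * y) Q * (q2 * a y Q) * c (q4 * y) Q * (y - 1#)) * (Y y Q * den y Q)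
        ≈⟨ *-solve 17 (λ n₀ a₄ b₄ q2 a₂ q2′ a c₄ y₁ b b₂ q2″ c′ E d₀ c d →
             n₀ ∙ a₄ ∙ b₄ ∙ (q2 ∙ a₂ ∙ (q2′ ∙ a) ∙ c₄ ∙ y₁) ∙ (q2″ ∙ b ∙ b₂ ∙ c′ ∙ E ∙ (d₀ ∙ c ∙ d))
             ≐ n₀ ∙ a ∙ b ∙ (q2″ ∙ b₂ ∙ b₄ ∙ c′ ∙ d) ∙ (a₄ ∙ a₂ ∙ c ∙ y₁ ∙ (d₀ ∙ c₄ ∙ (q2 ∙ q2′ ∙ E)))) refl
             (n₀ Q) (a (q4 * y) Q) (b (q4 * y) Q) q2 (a (q2 * y) Q) q2 (a y Q) (c (q4 * y) Q) (y - 1#) (b y Q) (b (q2 * y) Q) q2 (1# - q4 * y) (ee y Q) (d₀ Q) (c y Q) (d y Q) ⟩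
      num y Q * (q2 * b (q2 * y) Q * b (q4 * y) Q * (1# - q4 * y) * d y Q) * (X y Q * (d₀ Q * c (q4 * y) Q * (q4 * ee y Q)))
        ≈⟨ *-cong (*-congˡ (*-cong (*-congʳ (*-cong (*-congˡ (b-shift y Q)) (b-shift₂ y Q))) (e-shift y Q))) (*-congˡ (*-congˡ (d-shift y Q))) ⟨
      num y Q * Y y (q2 * Q) * (X y Q * den (q4 * y) Q) ∎

    X₀≈Y₀ : ∀ y → X y 1# ≈ Y y 1#
    X₀≈Y₀ = solve 2 (λ q y → let module S = E 2 in S.X q y 𝟙 ⊜ S.Y q y 𝟙) refl q

    num-cong : ∀ {y y′} Q → y ≈ y′ → num y Q ≈ num y′ Q
    num-cong Q eq = *-cong (*-congˡ (+-congʳ eq)) (+-congˡ (-‿cong (*-congˡ eq)))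

    den-cong : ∀ {y y′} Q → y ≈ y′ → den y Q ≈ den y′ Q
    den-cong Q eq = *-cong (*-congˡ (+-congˡ (-‿cong (*-congˡ eq)))) (+-congʳ eq)

  Q : ℕ → Carrier
  Q = pow q2

  y : ℕ → Carrier
  y m = q * Q m

  y-suc² : ∀ m → y (suc (suc m)) ≈ q4 * y m
  y-suc² m = *-solve 2 (λ q t → q ∙ ((q ∙ q) ∙ ((q ∙ q) ∙ t)) ≐ (q ∙ q) ∙ (q ∙ q) ∙ (q ∙ t)) refl q (Q m)

  summand : ℕ → ℕ → Carrier
  summand m = Cleared.cleared R (λ i → num (y m) (Q i)) (λ i → den (y m) (Q i)) m

  module _ (q-reg : Regular q) (1-q^-reg : ∀ i → 0 ℕ.< i → Regular (1# - pow q i)) where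
    open Powers R q q-reg 1-q^-reg

    private
      q2≈ : q2 ≈e 2
      q2≈ = q≈ ⊡ q≈
      q4≈ : q4 ≈e 4
      q4≈ = q2≈ ⊡ q2≈
      Q≈ : ∀ k → Q k ≈e k ℕ.+ k
      Q≈ zero    = power refl
      Q≈ (suc k) = ≡.subst (λ n → Q (suc k) ≈e n) (≡.cong suc (≡.sym (ℕ.+-suc k k))) (q2≈ ⊡ Q≈ k)
      y≈ : ∀ m → y m ≈e suc (m ℕ.+ m)
      y≈ m = q≈ ⊡ Q≈ m
      -- y is an odd power of q while Q² is an even one, so `d` and `ee` never vanish, whatever the
      -- index.
      odd≢even : ∀ m k → ¬ suc (m ℕ.+ m) ≡ k ℕ.+ k
      odd≢even m k eq = ℕ.even≢odd k m (≡.sym (≡.trans (≡.cong suc (≡.cong (m ℕ.+_) (ℕ.+-identityʳ m))) (≡.trans eq (≡.cong (k ℕ.+_) (≡.sym (ℕ.+-identityʳ k))))))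

      c-reg : ∀ m k → Regular (c (y m) (Q k))
      c-reg m k = 1-reg (s≤s z≤n) (q4≈ ⊡ (Q≈ k ⊡ Q≈ k) ⊡ y≈ m)
      b-reg : ∀ m k → Regular (b (y m) (Q k))
      b-reg m k = 1-reg (s≤s z≤n) (q≈ ⊡ Q≈ k ⊡ y≈ m)
      d-reg : ∀ m k → Regular (d (y m) (Q k))
      d-reg m k = ≢-reg (λ eq → odd≢even m (2 ℕ.+ (k ℕ.+ k)) (≡.trans eq (≡.cong (2 ℕ.+_) (≡.sym lem))))
                         (y≈ m) (q4≈ ⊡ (Q≈ k ⊡ Q≈ k))
        where
          lem : (k ℕ.+ k) ℕ.+ (2 ℕ.+ (k ℕ.+ k)) ≡ 2 ℕ.+ ((k ℕ.+ k) ℕ.+ (k ℕ.+ k))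
          lem = ≡.trans (ℕ.+-suc (k ℕ.+ k) (suc (k ℕ.+ k))) (≡.cong suc (ℕ.+-suc (k ℕ.+ k) (k ℕ.+ k)))
      ee-reg : ∀ m k → Regular (ee (y m) (Q k))
      ee-reg m k = ≢-reg (odd≢even m (k ℕ.+ k)) (y≈ m) (Q≈ k ⊡ Q≈ k)
      a₂-reg : ∀ m k → k ℕ.≤ m → Regular (a (q2 * y m) (Q k))
      a₂-reg m k k≤m = >-reg (s≤s (ℕ.≤-trans (s≤s (ℕ.+-mono-≤ k≤m k≤m)) (ℕ.n≤1+n _))) (q2≈ ⊡ y≈ m) (q≈ ⊡ Q≈ k)
      a₄-reg : ∀ m k → k ℕ.≤ m → Regular (a (q4 * y m) (Q k))
      a₄-reg m k k≤m = >-reg (s≤s (ℕ.≤-trans (s≤s (ℕ.+-mono-≤ k≤m k≤m)) (ℕ.m≤n+m _ 3))) (q4≈ ⊡ y≈ m) (q≈ ⊡ Q≈ k)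

      den-reg : ∀ m k → Regular (den (y m) (Q k))
      den-reg m k = reg-* (reg-* (reg-* (1-reg (s≤s z≤n) (q4≈ ⊡ (Q≈ k ⊡ Q≈ k))) (reg-* r r)) (c-reg m k)) (d-reg m k)
        where r = 1-reg (s≤s z≤n) (q2≈ ⊡ Q≈ k)
      y-reg : ∀ m → Regular (1# - y m)
      y-reg m = 1-reg (s≤s z≤n) (y≈ m)
      den₄-reg : ∀ m k → Regular (den (q4 * y m) (Q k))
      den₄-reg m k = reg-cong (den-cong (Q k) (y-suc² m)) (den-reg (suc (suc m)) k)
      X-reg : ∀ m k → k ℕ.≤ m → Regular (X (y m) (Q k))
      X-reg m k k≤m = reg-* (reg-* (reg-* (a₄-reg m k k≤m) (a₂-reg m k k≤m)) (c-reg m k))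
        (reg-cong (solve 1 (λ y → ⊝ (𝟙 ⊖ y) ⊜ y ⊖ 𝟙) refl (y m)) (reg-neg (y-reg m)))
      Y-reg : ∀ m k → Regular (Y (y m) (Q k))
      Y-reg m k = reg-* (reg-* (reg-* (reg-* (e-reg q2≈) (b-reg m k)) (1-reg (s≤s z≤n) (q≈ ⊡ Q≈ k ⊡ (q2≈ ⊡ y≈ m)))) (1-reg (s≤s z≤n) (q4≈ ⊡ y≈ m))) (ee-reg m k)
      Z-reg : ∀ m k → k ℕ.≤ m → Regular (Z (y m) (Q k))
      Z-reg m k k≤m = reg-* (reg-* (e-reg (Q≈ k)) (a₂-reg m k k≤m)) (c-reg m k)
      Den-reg : ∀ m → Regular (Den (y m))
      Den-reg m = reg-* (reg-* r r) (y-reg m)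
        where r = 1-reg (s≤s z≤n) (q2≈ ⊡ q≈ ⊡ y≈ m)

    private
      module Step (m : ℕ) where
        m′ : ℕ
        m′ = suc (suc m)
        B B′ : Carrier
        f f′ : ℕ → Carrier
        B  = prod m (λ i → den (y m) (Q i))
        B′ = prod m′ (λ i → den (y m′) (Q i))
        f  = summand m
        f′ = summand m′

        f-suc : ∀ j → j ℕ.< m → f (suc j) * den (y m) (Q j) ≈ f j * num (y m) (Q j)
        f-suc = Cleared.cleared-suc R (λ i → num (y m) (Q i)) (λ i → den (y m) (Q i)) m

        f′-suc : ∀ j → j ℕ.< m′ → f′ (suc j) * den (q4 * y m) (Q j) ≈ f′ j * num (q4 * y m) (Q j)
        f′-suc j j<m′ = trans (*-congˡ (den-cong (Q j) (sym (y-suc² m))))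
          (trans (Cleared.cleared-suc R (λ i → num (y m′) (Q i)) (λ i → den (y m′) (Q i)) m′ j j<m′) (*-congˡ (num-cong (Q j) (y-suc² m))))

        compare : ∀ k → k ℕ.≤ m → B * f′ k * X (y m) (Q k) ≈ B′ * f k * Y (y m) (Q k)
        compare = compare-summands {num = λ j → num (y m) (Q j)} {λ j → den (y m) (Q j)} {λ j → num (q4 * y m) (Q j)} {λ j → den (q4 * y m) (Q j)}
          (*-identityˡ _) (*-identityˡ _) (X₀≈Y₀ (y m)) f-suc
          (λ j j<m → f′-suc j (ℕ.m<n⇒m<1+n (ℕ.m<n⇒m<1+n j<m))) (λ j _ → XY-step (y m) (Q j))
          (λ j j<m → reg-* (reg-* (den₄-reg m j) (X-reg m j (ℕ.<⇒≤ j<m))) (reg-* (Y-reg m j) (den-reg m j)))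

        S S′ : ℕ → Carrier
        S  k = sum (suc k) (λ i → w (Q i) * f i)
        S′ k = sum (suc k) (λ i → w (Q i) * f′ i)

        key : ∀ k → k ℕ.< m → let t = Q k ; t′ = q2 * t ; f₁ = f (suc k) in
          1# * w t′ * Den (y m) * Z (y m) t′ * Z (y m) t * (f₁ * Y (y m) t′)
          ≈ X (y m) t′ * Z (y m) t * (Num (y m) * (w t′ * f₁) * (1# * Z (y m) t′) - f₁ * cert (y m) t′)
            + X (y m) t′ * Z (y m) t′ * (f k * cert (y m) t)
        key k k<m = begin
          1# * w t′ * Den z * Z z t′ * (t * a₂ * c₀) * (f₁ * Y z t′)
            ≈⟨ *-congʳ (*-congʳ (*-cong (*-congʳ (*-identityˡ _)) Z≈)) ⟩
          w t′ * Den z * (t′ * (q2 * a₀) * c₁) * (t * a₂ * c₀) * (f₁ * Y z t′)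
            ≈⟨ *-solve 11 (λ w D t′ q2 a c₁ t a₂ c f Y → w ∙ D ∙ (t′ ∙ (q2 ∙ a) ∙ c₁) ∙ (t ∙ a₂ ∙ c) ∙ (f ∙ Y) ≐ (c ∙ a₂ ∙ c₁ ∙ a ∙ f) ∙ (q2 ∙ t′ ∙ w ∙ D ∙ t ∙ Y)) refl
                 (w t′) (Den z) t′ q2 a₀ c₁ t a₂ c₀ f₁ (Y z t′) ⟩
          G * (q2 * t′ * w t′ * Den z * t * Y z t′)
            ≈⟨ trans (*-congˡ (core t z)) (distribˡ _ _ _) ⟩
          G * (q4 * (z - 1#) * t * a₂ * N) + G * (q4 * (z - 1#) * t′ * c₁ * (q * cc z t) * d₀ t * d z t)
            ≈⟨ +-cong main rest ⟩
          X z t′ * (t * a₂ * c₀) * (Num z * (w t′ * f₁) * (1# * Z z t′) - f₁ * cert z t′) + X z t′ * Z z t′ * (f k * cert z t) ∎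
          where
            z = y m
            t = Q k
            t′ = q2 * t
            f₁ = f (suc k)
            a₂ = a (q2 * z) t
            a₀ = a z t
            c₀ = c z t
            c₁ = c z t′
            G = c₀ * a₂ * c₁ * a₀ * f₁
            N = Num z * w t′ * Z z t′ - cert z t′
            Z≈ : Z z t′ ≈ t′ * (q2 * a₀) * c₁
            Z≈ = *-congʳ (*-congˡ (a-shift₂ z t))
            X≈ : X z t′ ≈ q2 * a₂ * (q2 * a₀) * c₁ * (z - 1#)
            X≈ = *-congʳ (*-congʳ (*-cong (a-shift₄ z t) (a-shift₂ z t)))
            main : G * (q4 * (z - 1#) * t * a₂ * N) ≈ X z t′ * (t * a₂ * c₀) * (Num z * (w t′ * f₁) * (1# * Z z t′) - f₁ * cert z t′)
            main = begin
              G * (q4 * (z - 1#) * t * a₂ * N)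
                ≈⟨ *-solve 10 (λ c a₂ c₁ a f q2 q2′ z₁ t N → (c ∙ a₂ ∙ c₁ ∙ a ∙ f) ∙ ((q2 ∙ q2′) ∙ z₁ ∙ t ∙ a₂ ∙ N) ≐ q2 ∙ a₂ ∙ (q2′ ∙ a) ∙ c₁ ∙ z₁ ∙ (t ∙ a₂ ∙ c) ∙ (f ∙ N)) refl
                     c₀ a₂ c₁ a₀ f₁ q2 q2 (z - 1#) t N ⟩
              q2 * a₂ * (q2 * a₀) * c₁ * (z - 1#) * (t * a₂ * c₀) * (f₁ * N)
                ≈⟨ *-cong (*-congʳ (sym X≈)) (solve 5 (λ f n w Z C → f ⊗ (n ⊗ w ⊗ Z ⊖ C) ⊜ n ⊗ (w ⊗ f) ⊗ (𝟙 ⊗ Z) ⊖ f ⊗ C) refl f₁ (Num z) (w t′) (Z z t′) (cert z t′)) ⟩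
              X z t′ * (t * a₂ * c₀) * (Num z * (w t′ * f₁) * (1# * Z z t′) - f₁ * cert z t′) ∎
            rest : G * (q4 * (z - 1#) * t′ * c₁ * (q * cc z t) * d₀ t * d z t) ≈ X z t′ * Z z t′ * (f k * cert z t)
            rest = begin
              G * (q4 * (z - 1#) * t′ * c₁ * (q * cc z t) * d₀ t * d z t)
                ≈⟨ *-solve 12 (λ c a₂ c₁ a f q2 q2′ z₁ t′ C d₀ d → (c ∙ a₂ ∙ c₁ ∙ a ∙ f) ∙ ((q2 ∙ q2′) ∙ z₁ ∙ t′ ∙ c₁ ∙ C ∙ d₀ ∙ d) ≐ (a₂ ∙ c₁ ∙ a ∙ (q2 ∙ q2′) ∙ z₁ ∙ t′ ∙ c₁ ∙ C) ∙ (f ∙ (d₀ ∙ c ∙ d))) refl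
                     c₀ a₂ c₁ a₀ f₁ q2 q2 (z - 1#) t′ (q * cc z t) (d₀ t) (d z t) ⟩
              a₂ * c₁ * a₀ * (q2 * q2) * (z - 1#) * t′ * c₁ * (q * cc z t) * (f₁ * den z t)
                ≈⟨ *-congˡ (f-suc k k<m) ⟩
              a₂ * c₁ * a₀ * (q2 * q2) * (z - 1#) * t′ * c₁ * (q * cc z t) * (f k * num z t)
                ≈⟨ *-solve 12 (λ a₂ c₁ a q2 q2′ z₁ t′ C f q2″ n b → a₂ ∙ c₁ ∙ a ∙ (q2 ∙ q2′) ∙ z₁ ∙ t′ ∙ c₁ ∙ C ∙ (f ∙ (q2″ ∙ n ∙ a ∙ b)) ≐ q2 ∙ a₂ ∙ (q2′ ∙ a) ∙ c₁ ∙ z₁ ∙ (t′ ∙ (q2″ ∙ a) ∙ c₁) ∙ (f ∙ (C ∙ n ∙ b))) refl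
                     a₂ c₁ a₀ q2 q2 (z - 1#) t′ (q * cc z t) (f k) q2 (n₁ t) (b z t) ⟩
              q2 * a₂ * (q2 * a₀) * c₁ * (z - 1#) * (t′ * (q2 * a₀) * c₁) * (f k * cert z t)
                ≈⟨ *-congʳ (*-cong X≈ Z≈) ⟨
              X z t′ * Z z t′ * (f k * cert z t) ∎

        partial-sums : ∀ k → k ℕ.≤ m → B * S′ k * (Den (y m) * Z (y m) (Q k)) ≈ B′ * (Num (y m) * S k * (1# * Z (y m) (Q k)) - f k * cert (y m) (Q k))
        partial-sums zero _ = begin
          B * (0# + w 1# * f′ 0) * (Den (y m) * Z (y m) 1#)
            ≈⟨ *-congʳ (*-congˡ (+-congˡ (*-congˡ (*-identityˡ _)))) ⟩
          B * (0# + w 1# * B′) * (Den (y m) * Z (y m) 1#)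
            ≈⟨ solve 5 (λ B w B′ D Z → B ⊗ (Κ 0ℤ ⊕ w ⊗ B′) ⊗ (D ⊗ Z) ⊜ B′ ⊗ B ⊗ (w ⊗ D ⊗ Z)) refl B (w 1#) B′ (Den (y m)) (Z (y m) 1#) ⟩
          B′ * B * (w 1# * Den (y m) * Z (y m) 1#)
            ≈⟨ *-cong (*-congˡ (sym (*-identityˡ _))) (base (y m)) ⟩
          B′ * f 0 * (Num (y m) * w 1# * Z (y m) 1# - cert (y m) 1#)
            ≈⟨ solve 6 (λ B f N w Z C → B ⊗ f ⊗ (N ⊗ w ⊗ Z ⊖ C) ⊜ B ⊗ (N ⊗ (Κ 0ℤ ⊕ w ⊗ f) ⊗ (𝟙 ⊗ Z) ⊖ f ⊗ C)) refl B′ (f 0) (Num (y m)) (w 1#) (Z (y m) 1#) (cert (y m) 1#) ⟩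
          B′ * (Num (y m) * (0# + w 1# * f 0) * (1# * Z (y m) 1#) - f 0 * cert (y m) 1#) ∎
        partial-sums (suc k) k<m = extend-sums (sym (*-identityˡ _)) refl
          (reg-* (X-reg m (suc k) k<m) (Z-reg m k (ℕ.<⇒≤ k<m)))
          (partial-sums k (ℕ.<⇒≤ k<m)) (compare (suc k) k<m) (key k k<m)

        t = Q m
        t′ = q2 * t
        t″ = q2 * t′
        z = y m
        C₁ = cert z t
        g₁ = w t′ * f′ (suc m)
        g₂ = w t″ * f′ (suc (suc m))

        top-summands : B * (g₁ + g₂) * (Den z * Z z t) ≈ B′ * (f m * C₁)
        top-summands = cancel (reg-* (reg-* (den₄-reg m m) (den₄-reg m (suc m))) (X-reg m m ℕ.≤-refl)) (begin
          D₁ * D₂ * x * (B * (g₁ + g₂) * (Den z * Z z t))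
            ≈⟨ solve 10 (λ D₁ D₂ x B w₁ f₁ w₂ f₂ D Z → D₁ ⊗ D₂ ⊗ x ⊗ (B ⊗ (w₁ ⊗ f₁ ⊕ w₂ ⊗ f₂) ⊗ (D ⊗ Z)) ⊜ B ⊗ x ⊗ (D ⊗ Z) ⊗ (w₁ ⊗ (f₁ ⊗ D₁) ⊗ D₂ ⊕ w₂ ⊗ (f₂ ⊗ D₂) ⊗ D₁)) refl
                 D₁ D₂ x B (w t′) (f′ (suc m)) (w t″) (f′ (suc (suc m))) (Den z) (Z z t) ⟩
          B * x * (Den z * Z z t) * (w t′ * (f′ (suc m) * D₁) * D₂ + w t″ * (f′ (suc (suc m)) * D₂) * D₁)
            ≈⟨ *-congˡ (+-congˡ (*-congʳ (*-congˡ (f′-suc (suc m) (ℕ.n<1+n _))))) ⟩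
          B * x * (Den z * Z z t) * (w t′ * (f′ (suc m) * D₁) * D₂ + w t″ * (f′ (suc m) * N₂) * D₁)
            ≈⟨ *-congˡ (solve 6 (λ w₁ fD D₂ w₂ f N → w₁ ⊗ (fD ⊗ N) ⊗ D₂ ⊕ w₂ ⊗ (fD ⊗ f) ⊗ N ⊜ (fD ⊗ N) ⊗ (w₁ ⊗ D₂ ⊕ w₂ ⊗ f)) refl (w t′) (f′ (suc m)) D₂ (w t″) N₂ D₁) ⟩
          B * x * (Den z * Z z t) * (f′ (suc m) * D₁ * W)
            ≈⟨ *-congˡ (*-congʳ (f′-suc m (ℕ.m<n⇒m<1+n (ℕ.n<1+n m)))) ⟩
          B * x * (Den z * Z z t) * (f′ m * N₁ * W)
            ≈⟨ *-solve 7 (λ B x D Z f N W → B ∙ x ∙ (D ∙ Z) ∙ (f ∙ N ∙ W) ≐ (B ∙ f ∙ x) ∙ (D ∙ Z ∙ N ∙ W)) refl B x (Den z) (Z z t) (f′ m) N₁ W ⟩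
          B * f′ m * x * (Den z * Z z t * N₁ * W)
            ≈⟨ *-congʳ (compare m ℕ.≤-refl) ⟩
          B′ * f m * Y z t * (Den z * Z z t * N₁ * W)
            ≈⟨ *-solve 7 (λ B f Y D Z N W → B ∙ f ∙ Y ∙ (D ∙ Z ∙ N ∙ W) ≐ B ∙ f ∙ (D ∙ Z ∙ Y ∙ N ∙ W)) refl B′ (f m) (Y z t) (Den z) (Z z t) N₁ W ⟩
          B′ * f m * (Den z * Z z t * Y z t * N₁ * W)
            ≈⟨ *-congˡ (top t) ⟩
          B′ * f m * (C₁ * D₁ * D₂ * x)
            ≈⟨ *-solve 6 (λ B f C D₁ D₂ x → B ∙ f ∙ (C ∙ D₁ ∙ D₂ ∙ x) ≐ D₁ ∙ D₂ ∙ x ∙ (B ∙ (f ∙ C))) refl B′ (f m) C₁ D₁ D₂ x ⟩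
          D₁ * D₂ * x * (B′ * (f m * C₁)) ∎)
          where
            D₁ = den (q4 * z) t
            D₂ = den (q4 * z) t′
            N₁ = num (q4 * z) t
            N₂ = num (q4 * z) t′
            x = X z t
            W = w t′ * D₂ + w t″ * N₂

        step : S m ≈ 0# → S′ (suc (suc m)) ≈ 0#
        step S≈0 = reg-* (reg-* (prod-reg m (λ i _ → den-reg m i)) (Den-reg m)) (Z-reg m m ℕ.≤-refl) _ (begin
          B * Den z * Z z t * (S′ m + g₁ + g₂)
            ≈⟨ solve 6 (λ B D Z S g₁ g₂ → B ⊗ D ⊗ Z ⊗ (S ⊕ g₁ ⊕ g₂) ⊜ B ⊗ S ⊗ (D ⊗ Z) ⊕ B ⊗ (g₁ ⊕ g₂) ⊗ (D ⊗ Z)) refl B (Den z) (Z z t) (S′ m) g₁ g₂ ⟩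
          B * S′ m * (Den z * Z z t) + B * (g₁ + g₂) * (Den z * Z z t)
            ≈⟨ +-cong (partial-sums m ℕ.≤-refl) top-summands ⟩
          B′ * (Num z * S m * (1# * Z z t) - f m * C₁) + B′ * (f m * C₁)
            ≈⟨ +-congʳ (*-congˡ (+-congʳ (*-congʳ (*-congˡ S≈0)))) ⟩
          B′ * (Num z * 0# * (1# * Z z t) - f m * C₁) + B′ * (f m * C₁)
            ≈⟨ solve 4 (λ B N Z F → B ⊗ (N ⊗ Κ 0ℤ ⊗ (𝟙 ⊗ Z) ⊖ F) ⊕ B ⊗ F ⊜ Κ 0ℤ) refl B′ (Num z) (Z z t) (f m * C₁) ⟩
          0# ∎)

    -- The WZ step relates the sums for m and m + 2 by a homogeneous equation, so vanishing is
    -- inherited. For m = 1 the sum has two terms and vanishes by inspection, whence the restriction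
    -- to odd m.
    vanishing : ∀ l → let m = suc (l ℕ.+ l) in sum (suc m) (λ i → w (Q i) * summand m i) ≈ 0#
    vanishing zero = solve 1 (λ q → let module S = E 1 ; y = q ⊗ (S.q2 q ⊗ 𝟙) in
      Κ 0ℤ ⊕ S.w q 𝟙 ⊗ (𝟙 ⊗ (𝟙 ⊗ S.den q y 𝟙)) ⊕ S.w q (S.q2 q ⊗ 𝟙) ⊗ (𝟙 ⊗ S.num q y 𝟙 ⊗ 𝟙) ⊜ Κ 0ℤ) refl q
    vanishing (suc l) = ≡.subst (λ k → sum (suc (suc k)) (λ i → w (Q i) * summand (suc k) i) ≈ 0#)
      (≡.cong suc (≡.sym (ℕ.+-suc l l))) (Step.step (suc (l ℕ.+ l)) (vanishing l))

-- Truncated power series in the parameters.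

-- Without η, so that comparing jets does not unfold them to their coefficients.
record Jet (A : Set) : Set where
  no-eta-equality
  constructor jet
  field c₀ c₁ c₂ : A
open Jet public

-- R[s]/(s³)
module Jets (R : CommutativeRing 0ℓ 0ℓ) where
  private module R = Ring R
  open R using (solve; _⊜_) renaming (Carrier to A)

  infix 4 _≈ⱼ_
  record _≈ⱼ_ (x y : Jet A) : Set where
    constructor jet≈
    field
      e₀ : c₀ x R.≈ c₀ y
      e₁ : c₁ x R.≈ c₁ y
      e₂ : c₂ x R.≈ c₂ y
  open _≈ⱼ_ public

  _+ⱼ_ _*ⱼ_ : Jet A → Jet A → Jet A
  c₀ (x +ⱼ y) = c₀ x R.+ c₀ y
  c₁ (x +ⱼ y) = c₁ x R.+ c₁ y
  c₂ (x +ⱼ y) = c₂ x R.+ c₂ y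
  c₀ (x *ⱼ y) = c₀ x R.* c₀ y
  c₁ (x *ⱼ y) = c₀ x R.* c₁ y R.+ c₁ x R.* c₀ y
  c₂ (x *ⱼ y) = c₀ x R.* c₂ y R.+ c₁ x R.* c₁ y R.+ c₂ x R.* c₀ y

  -ⱼ_ : Jet A → Jet A
  c₀ (-ⱼ x) = R.- c₀ x
  c₁ (-ⱼ x) = R.- c₁ x
  c₂ (-ⱼ x) = R.- c₂ x

  const : A → Jet A
  c₀ (const a) = a
  c₁ (const a) = R.0#
  c₂ (const a) = R.0#

  jetRing : CommutativeRing 0ℓ 0ℓ
  jetRing = record
    { Carrier = Jet A ; _≈_ = _≈ⱼ_ ; _+_ = _+ⱼ_ ; _*_ = _*ⱼ_ ; -_ = -ⱼ_ ; 0# = const R.0# ; 1# = const R.1#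
    ; isCommutativeRing = record
      { isRing = record
        { +-isAbelianGroup = record
          { isGroup = record
            { isMonoid = record
              { isSemigroup = record
                { isMagma = record
                  { isEquivalence = record
                    { refl = jet≈ R.refl R.refl R.refl
                    ; sym = λ p → jet≈ (R.sym (e₀ p)) (R.sym (e₁ p)) (R.sym (e₂ p))
                    ; trans = λ p r → jet≈ (R.trans (e₀ p) (e₀ r)) (R.trans (e₁ p) (e₁ r)) (R.trans (e₂ p) (e₂ r)) }
                  ; ∙-cong = λ p r → jet≈ (R.+-cong (e₀ p) (e₀ r)) (R.+-cong (e₁ p) (e₁ r)) (R.+-cong (e₂ p) (e₂ r)) }
                ; assoc = λ _ _ _ → jet≈ (R.+-assoc _ _ _) (R.+-assoc _ _ _) (R.+-assoc _ _ _) }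
              ; identity = (λ _ → jet≈ (R.+-identityˡ _) (R.+-identityˡ _) (R.+-identityˡ _)) , (λ _ → jet≈ (R.+-identityʳ _) (R.+-identityʳ _) (R.+-identityʳ _)) }
            ; inverse = (λ _ → jet≈ (R.-‿inverseˡ _) (R.-‿inverseˡ _) (R.-‿inverseˡ _)) , (λ _ → jet≈ (R.-‿inverseʳ _) (R.-‿inverseʳ _) (R.-‿inverseʳ _))
            ; ⁻¹-cong = λ p → jet≈ (R.-‿cong (e₀ p)) (R.-‿cong (e₁ p)) (R.-‿cong (e₂ p)) }
          ; comm = λ _ _ → jet≈ (R.+-comm _ _) (R.+-comm _ _) (R.+-comm _ _) }
        ; *-cong = λ p r → jet≈ (R.*-cong (e₀ p) (e₀ r)) (R.+-cong (R.*-cong (e₀ p) (e₁ r)) (R.*-cong (e₁ p) (e₀ r)))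
            (R.+-cong (R.+-cong (R.*-cong (e₀ p) (e₂ r)) (R.*-cong (e₁ p) (e₁ r))) (R.*-cong (e₂ p) (e₀ r)))
        ; *-assoc = λ x y z → jet≈ (R.*-assoc _ _ _)
            (solve 6 (λ a b d e g h → (a ⊗ d) ⊗ h ⊕ (a ⊗ e ⊕ b ⊗ d) ⊗ g ⊜ a ⊗ (d ⊗ h ⊕ e ⊗ g) ⊕ b ⊗ (d ⊗ g)) R.refl (c₀ x) (c₁ x) (c₀ y) (c₁ y) (c₀ z) (c₁ z))
            (solve 9 (λ a b c d e f g h i → (a ⊗ d) ⊗ i ⊕ (a ⊗ e ⊕ b ⊗ d) ⊗ h ⊕ (a ⊗ f ⊕ b ⊗ e ⊕ c ⊗ d) ⊗ g
                ⊜ a ⊗ (d ⊗ i ⊕ e ⊗ h ⊕ f ⊗ g) ⊕ b ⊗ (d ⊗ h ⊕ e ⊗ g) ⊕ c ⊗ (d ⊗ g)) R.refl (c₀ x) (c₁ x) (c₂ x) (c₀ y) (c₁ y) (c₂ y) (c₀ z) (c₁ z) (c₂ z))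
        ; *-identity = (λ x → jet≈ (R.*-identityˡ _)
              (solve 2 (λ a b → 𝟙 ⊗ b ⊕ Κ 0ℤ ⊗ a ⊜ b) R.refl (c₀ x) (c₁ x))
              (solve 3 (λ a b c → 𝟙 ⊗ c ⊕ Κ 0ℤ ⊗ b ⊕ Κ 0ℤ ⊗ a ⊜ c) R.refl (c₀ x) (c₁ x) (c₂ x)))
          , (λ x → jet≈ (R.*-identityʳ _)
              (solve 2 (λ a b → a ⊗ Κ 0ℤ ⊕ b ⊗ 𝟙 ⊜ b) R.refl (c₀ x) (c₁ x))
              (solve 3 (λ a b c → a ⊗ Κ 0ℤ ⊕ b ⊗ Κ 0ℤ ⊕ c ⊗ 𝟙 ⊜ c) R.refl (c₀ x) (c₁ x) (c₂ x)))
        ; distrib = (λ x y z → jet≈ (R.distribˡ _ _ _)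
              (solve 6 (λ a b d e g h → a ⊗ (e ⊕ h) ⊕ b ⊗ (d ⊕ g) ⊜ a ⊗ e ⊕ b ⊗ d ⊕ (a ⊗ h ⊕ b ⊗ g)) R.refl (c₀ x) (c₁ x) (c₀ y) (c₁ y) (c₀ z) (c₁ z))
              (solve 9 (λ a b c d e f g h i → a ⊗ (f ⊕ i) ⊕ b ⊗ (e ⊕ h) ⊕ c ⊗ (d ⊕ g) ⊜ a ⊗ f ⊕ b ⊗ e ⊕ c ⊗ d ⊕ (a ⊗ i ⊕ b ⊗ h ⊕ c ⊗ g)) R.refl (c₀ x) (c₁ x) (c₂ x) (c₀ y) (c₁ y) (c₂ y) (c₀ z) (c₁ z) (c₂ z)))
          , (λ x y z → jet≈ (R.distribʳ _ _ _)
              (solve 6 (λ a b d e g h → (d ⊕ g) ⊗ b ⊕ (e ⊕ h) ⊗ a ⊜ d ⊗ b ⊕ e ⊗ a ⊕ (g ⊗ b ⊕ h ⊗ a)) R.refl (c₀ x) (c₁ x) (c₀ y) (c₁ y) (c₀ z) (c₁ z))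
              (solve 9 (λ a b c d e f g h i → (d ⊕ g) ⊗ c ⊕ (e ⊕ h) ⊗ b ⊕ (f ⊕ i) ⊗ a ⊜ d ⊗ c ⊕ e ⊗ b ⊕ f ⊗ a ⊕ (g ⊗ c ⊕ h ⊗ b ⊕ i ⊗ a)) R.refl (c₀ x) (c₁ x) (c₂ x) (c₀ y) (c₁ y) (c₂ y) (c₀ z) (c₁ z) (c₂ z)))
        }
      ; *-comm = λ x y → jet≈ (R.*-comm _ _)
          (solve 4 (λ a b d e → a ⊗ e ⊕ b ⊗ d ⊜ d ⊗ b ⊕ e ⊗ a) R.refl (c₀ x) (c₁ x) (c₀ y) (c₁ y))
          (solve 6 (λ a b c d e f → a ⊗ f ⊕ b ⊗ e ⊕ c ⊗ d ⊜ d ⊗ c ⊕ e ⊗ b ⊕ f ⊗ a) R.refl (c₀ x) (c₁ x) (c₂ x) (c₀ y) (c₁ y) (c₂ y))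
      }
    }

  private module J = Ring jetRing

  -- A triangular system: once the lower coefficients of x are known to vanish, the next coefficient
  -- of the product is c₀ of the factor times the next coefficient of x.
  jet-reg : ∀ {a} → R.Regular (c₀ a) → J.Regular a
  jet-reg {a} reg x p = jet≈ x₀≈0 x₁≈0 x₂≈0
    where
      x₀≈0 = reg (c₀ x) (e₀ p)
      x₁≈0 = reg (c₁ x) (R.trans (R.trans (R.sym (R.+-identityʳ _)) (R.+-congˡ (R.sym (R.trans (R.*-congˡ x₀≈0) (R.zeroʳ _))))) (e₁ p))
      x₂≈0 = reg (c₂ x) (R.trans (R.trans (solve 2 (λ a x → a ⊗ x ⊜ a ⊗ x ⊕ Κ 0ℤ ⊕ Κ 0ℤ) R.refl (c₀ a) (c₂ x))
        (R.+-cong (R.+-congˡ (R.sym (R.trans (R.*-congˡ x₁≈0) (R.zeroʳ _)))) (R.sym (R.trans (R.*-congˡ x₀≈0) (R.zeroʳ _))))) (e₂ p))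

  const-cong : ∀ {a b} → a R.≈ b → const a J.≈ const b
  const-cong eq = jet≈ eq R.refl R.refl

  const-* : ∀ a b → const (a R.* b) J.≈ const a J.* const b
  const-* a b = jet≈ R.refl (solve 2 (λ a b → Κ 0ℤ ⊜ a ⊗ Κ 0ℤ ⊕ Κ 0ℤ ⊗ b) R.refl a b) (solve 2 (λ a b → Κ 0ℤ ⊜ a ⊗ Κ 0ℤ ⊕ Κ 0ℤ ⊗ Κ 0ℤ ⊕ Κ 0ℤ ⊗ b) R.refl a b)

  const-+ : ∀ a b → const (a R.+ b) J.≈ const a J.+ const b
  const-+ a b = jet≈ R.refl (R.sym (R.+-identityˡ _)) (R.sym (R.+-identityˡ _))

  const-neg : ∀ a → const (R.- a) J.≈ J.- const a
  const-neg a = jet≈ R.refl (solve 0 (Κ 0ℤ ⊜ ⊝ Κ 0ℤ) R.refl) (solve 0 (Κ 0ℤ ⊜ ⊝ Κ 0ℤ) R.refl)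

-- The summands with independent parameters x and y.

-- The factors of the ratio of consecutive summands at t = q^k.  A parameter
-- y + y⁻¹ is represented homogeneously as U / h.
module Factors {A : Set} (O : Ops A) (q : A) where
  open Ops O
  q2 = q * q
  q4 = q2 * q2
  sq : A → A
  sq x = x * x

  quad : A → A → A → A
  quad h U z = h * (1# + z * z) - z * U

  w τn τd zyn zyd zxn zxd : A → A
  w t = 1# - q * (sq t * sq t * sq t)
  τn t = q2 * (1# - q2 * sq (sq t))
  τd t = 1# - q4 * sq (sq t)
  zyn t = q * sq t
  zyd t = q4 * sq (sq t)
  zxn t = q * sq (sq t)
  zxd t = q2 * sq t

  -- (h , U) are the parameters of the factors in y, (h′ , U′) of those in x.
  module _ (h U h′ U′ : A) where
    σn σd : A → A
    σn t = τn t * quad h U (zyn t) * quad h′ U′ (zxn t)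
    σd t = τd t * quad h U (zyd t) * quad h′ U′ (zxd t)

module FactorIdentities (R : CommutativeRing 0ℓ 0ℓ) where
  open Ring R
  open SummandIdentities R using (ringOps)
  open import Relation.Binary.Reasoning.Setoid setoid

  quad-factor : ∀ q {x x′} → x * x′ ≈ 1# → ∀ z → (1# - z * x) * (1# - z * x′) ≈ Factors.quad ringOps q 1# (x + x′) z
  quad-factor q {x} {x′} xx′ z = begin
    (1# - z * x) * (1# - z * x′)           ≈⟨ solve 3 (λ x x′ z → (𝟙 ⊖ z ⊗ x) ⊗ (𝟙 ⊖ z ⊗ x′) ⊜ 𝟙 ⊗ (𝟙 ⊕ z ⊗ z ⊗ (x ⊗ x′)) ⊖ z ⊗ (x ⊕ x′)) refl x x′ z ⟩
    1# * (1# + z * z * (x * x′)) - z * (x + x′) ≈⟨ +-congʳ (*-congˡ (+-congˡ (trans (*-congˡ xx′) (*-identityʳ _)))) ⟩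
    1# * (1# + z * z) - z * (x + x′)       ∎

  module _ (q h U x x′ M : Carrier) (xx′ : x * x′ ≈ 1#) (q2M : q * q * M ≈ 1#) where
    private
      module S = Summand ringOps q h U (q * q * x′)
      module F = Factors ringOps q
      κ : Carrier → Carrier
      κ t = (1# - q * (t * t)) * x′

      pull-x′ : ∀ z → x′ - z ≈ x′ * (1# - z * x)
      pull-x′ z = trans (+-congˡ (-‿cong (trans (sym (*-identityʳ z)) (*-congˡ (sym xx′)))))
        (solve 3 (λ x x′ z → x′ ⊖ z ⊗ (x ⊗ x′) ⊜ x′ ⊗ (𝟙 ⊖ z ⊗ x)) refl x x′ z)

    -- For p = q²/x and q² M = 1 the factors α and γ become 1 - q² t⁴ (over q²) and 1 - q t², so
    -- every dependence on m disappears. What remains is the two-parameter ratio, up to the factor κ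
    -- shared by numerator and denominator.
    num-reduced : ∀ t → S.num M t ≈ κ t * F.σn h U 1# (x + x′) t
    num-reduced t = begin
      S.num M t
        ≈⟨ solve 6 (λ q h U x′ M t → let module S′ = Summand (exprOps 6) q h U (q ⊗ q ⊗ x′) in let module F′ = Factors (exprOps 6) q ; z = F′.zxn t in
             S′.num M t ⊜ (𝟙 ⊖ q ⊗ (t ⊗ t)) ⊗ q ⊗ q ⊗ F′.quad h U (F′.zyn t) ⊗ ((q ⊗ q ⊗ M ⊖ q ⊗ q ⊗ F′.sq (F′.sq t)) ⊗ (x′ ⊖ z) ⊗ (𝟙 ⊖ (q ⊗ q ⊗ M) ⊗ z ⊗ x′))) refl q h U x′ M t ⟩
      (1# - q * (t * t)) * q * q * y * ((q * q * M - q * q * F.sq (F.sq t)) * (x′ - z) * (1# - (q * q * M) * z * x′))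
        ≈⟨ *-congˡ (*-cong (*-cong (+-congʳ q2M) (pull-x′ z)) (+-congˡ (-‿cong (*-congʳ (trans (*-congʳ q2M) (*-identityˡ z)))))) ⟩
      (1# - q * (t * t)) * q * q * y * ((1# - q * q * F.sq (F.sq t)) * (x′ * (1# - z * x)) * (1# - z * x′))
        ≈⟨ *-solve 8 (λ a q q′ y b x c d → a ∙ q ∙ q′ ∙ y ∙ (b ∙ (x ∙ c) ∙ d) ≐ a ∙ x ∙ ((q ∙ q′) ∙ b ∙ y ∙ (c ∙ d))) refl
             (1# - q * (t * t)) q q y (1# - q * q * F.sq (F.sq t)) x′ (1# - z * x) (1# - z * x′) ⟩
      κ t * (F.τn t * y * ((1# - z * x) * (1# - z * x′)))
        ≈⟨ *-congˡ (*-congˡ (quad-factor q xx′ z)) ⟩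
      κ t * F.σn h U 1# (x + x′) t ∎
      where
        z = F.zxn t
        y = F.quad h U (F.zyn t)

    den-reduced : ∀ t → S.den M t ≈ κ t * F.σd h U 1# (x + x′) t
    den-reduced t = begin
      S.den M t
        ≈⟨ solve 6 (λ q h U x′ M t → let module S′ = Summand (exprOps 6) q h U (q ⊗ q ⊗ x′) in let module F′ = Factors (exprOps 6) q ; z = F′.zxd t in
             S′.den M t ⊜ F′.τd t ⊗ F′.quad h U (F′.zyd t) ⊗ ((𝟙 ⊖ (q ⊗ q ⊗ M) ⊗ (q ⊗ (t ⊗ t))) ⊗ (𝟙 ⊖ z ⊗ x′) ⊗ ((q ⊗ q ⊗ M) ⊗ x′ ⊖ z))) refl q h U x′ M t ⟩
      F.τd t * y * ((1# - (q * q * M) * (q * (t * t))) * (1# - z * x′) * ((q * q * M) * x′ - z))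
        ≈⟨ *-congˡ (*-cong (*-congʳ (+-congˡ (-‿cong (trans (*-congʳ q2M) (*-identityˡ _))))) (trans (+-congʳ (trans (*-congʳ q2M) (*-identityˡ x′))) (pull-x′ z))) ⟩
      F.τd t * y * ((1# - q * (t * t)) * (1# - z * x′) * (x′ * (1# - z * x)))
        ≈⟨ *-solve 6 (λ a y b c x d → a ∙ y ∙ (b ∙ c ∙ (x ∙ d)) ≐ b ∙ x ∙ (a ∙ y ∙ (d ∙ c))) refl (F.τd t) y (1# - q * (t * t)) (1# - z * x′) x′ (1# - z * x) ⟩
      κ t * (F.τd t * y * ((1# - z * x) * (1# - z * x′)))
        ≈⟨ *-congˡ (*-congˡ (quad-factor q xx′ z)) ⟩
      κ t * F.σd h U 1# (x + x′) t ∎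
      where
        z = F.zxd t
        y = F.quad h U (F.zyd t)

-- Ring homomorphisms and double jets.

record RingHom (A B : CommutativeRing 0ℓ 0ℓ) : Set where
  private
    module A = CommutativeRing A
    module B = CommutativeRing B
  field
    ⟪_⟫    : A.Carrier → B.Carrier
    ⟪⟫-cong : ∀ {x y} → x A.≈ y → ⟪ x ⟫ B.≈ ⟪ y ⟫
    ⟪⟫-+    : ∀ x y → ⟪ x A.+ y ⟫ B.≈ ⟪ x ⟫ B.+ ⟪ y ⟫
    ⟪⟫-*    : ∀ x y → ⟪ x A.* y ⟫ B.≈ ⟪ x ⟫ B.* ⟪ y ⟫
    ⟪⟫-neg  : ∀ x → ⟪ A.- x ⟫ B.≈ B.- ⟪ x ⟫
    ⟪⟫-1    : ⟪ A.1# ⟫ B.≈ B.1#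

module Transport {A B : CommutativeRing 0ℓ 0ℓ} (h : RingHom A B) where
  private
    module A = Ring A
    module B = Ring B
  open RingHom h

  infix 4 _↦_
  infixl 6 _↦+_ _↦-_
  infixl 7 _↦*_
  record _↦_ (x : A.Carrier) (y : B.Carrier) : Set where
    constructor to
    field image : ⟪ x ⟫ B.≈ y
  open _↦_ public

  ↦1 : A.1# ↦ B.1#
  ↦1 = to ⟪⟫-1
  _↦+_ : ∀ {x y x′ y′} → x ↦ x′ → y ↦ y′ → x A.+ y ↦ x′ B.+ y′
  to p ↦+ to q = to (B.trans (⟪⟫-+ _ _) (B.+-cong p q))
  _↦*_ : ∀ {x y x′ y′} → x ↦ x′ → y ↦ y′ → x A.* y ↦ x′ B.* y′
  to p ↦* to q = to (B.trans (⟪⟫-* _ _) (B.*-cong p q))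
  _↦-_ : ∀ {x y x′ y′} → x ↦ x′ → y ↦ y′ → x A.- y ↦ x′ B.- y′
  p ↦- to q = p ↦+ to (B.trans (⟪⟫-neg _) (B.-‿cong q))

  ↦pow : ∀ {q q′} → q ↦ q′ → ∀ n → A.pow q n ↦ B.pow q′ n
  ↦pow p zero    = ↦1
  ↦pow p (suc n) = p ↦* ↦pow p n

  ↦prod : ∀ n {f g} → (∀ i → f i ↦ g i) → A.prod n f ↦ B.prod n g
  ↦prod zero    p = ↦1
  ↦prod (suc n) p = ↦prod n p ↦* p n

  ↦cleared : ∀ {f g f′ g′} m k → (∀ i → f i ↦ f′ i) → (∀ i → g i ↦ g′ i) → Cleared.cleared A f g m k ↦ Cleared.cleared B f′ g′ m k
  ↦cleared m k p r = ↦prod k p ↦* ↦prod (m ℕ.∸ k) (λ i → r (k ℕ.+ i))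

  ↦sum : ∀ n {f g} → (∀ i → f i ↦ g i) → A.sum n f ↦ B.sum n g
  -- That zero is preserved is derived from additivity and the group laws.
  ↦sum zero    p = to (B.trans (B.sym (B.+-identityʳ _)) (B.trans (B.+-congˡ (B.sym (B.-‿inverseʳ _)))
    (B.trans (B.sym (B.+-assoc _ _ _)) (B.trans (B.+-congʳ (B.trans (B.sym (⟪⟫-+ _ _)) (⟪⟫-cong (A.+-identityʳ _)))) (B.-‿inverseʳ _)))))
  ↦sum (suc n) p = ↦sum n p ↦+ p n

  module _ {q h U p q′ h′ U′ p′} (q↦ : q ↦ q′) (h↦ : h ↦ h′) (U↦ : U ↦ U′) (p↦ : p ↦ p′) where
    private
      module SA = Summand (SummandIdentities.ringOps A) q h U p
      module SB = Summand (SummandIdentities.ringOps B) q′ h′ U′ p′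
      module QA = QuadraticSummation A q h U p
      module QB = QuadraticSummation B q′ h′ U′ p′
      q2↦ : SA.q2 ↦ SB.q2
      q2↦ = q↦ ↦* q↦
      q3↦ : SA.q3 ↦ SB.q3
      q3↦ = q2↦ ↦* q↦
      q4↦ : SA.q4 ↦ SB.q4
      q4↦ = q2↦ ↦* q2↦
      q8↦ : SA.q8 ↦ SB.q8
      q8↦ = q4↦ ↦* q4↦
      sq↦ : ∀ {x x′} → x ↦ x′ → SA.sq x ↦ SB.sq x′
      sq↦ x = x ↦* x
      γ↦ : ∀ {M t M′ t′} → M ↦ M′ → t ↦ t′ → SA.γ M t ↦ SB.γ M′ t′
      γ↦ M t = ↦1 ↦- M ↦* q3↦ ↦* sq↦ t

    ↦num : ∀ {M t M′ t′} → M ↦ M′ → t ↦ t′ → SA.num M t ↦ SB.num M′ t′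
    ↦num M t = q2↦ ↦* ((↦1 ↦- q↦ ↦* sq↦ t) ↦* (h↦ ↦* (↦1 ↦+ q2↦ ↦* sq↦ (sq↦ t)) ↦- q↦ ↦* sq↦ t ↦* U↦) ↦* (p↦ ↦- q3↦ ↦* sq↦ (sq↦ t)))
      ↦* (M ↦- sq↦ (sq↦ t)) ↦* (↦1 ↦- M ↦* q↦ ↦* sq↦ (sq↦ t) ↦* p↦)

    ↦den : ∀ {M t M′ t′} → M ↦ M′ → t ↦ t′ → SA.den M t ↦ SB.den M′ t′
    ↦den M t = (↦1 ↦- q4↦ ↦* sq↦ (sq↦ t)) ↦* (h↦ ↦* (↦1 ↦+ q8↦ ↦* sq↦ (sq↦ (sq↦ t))) ↦- q4↦ ↦* sq↦ (sq↦ t) ↦* U↦) ↦* (↦1 ↦- sq↦ t ↦* p↦)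
      ↦* γ↦ M t ↦* (M ↦* p↦ ↦- q2↦ ↦* sq↦ t)

    ↦Num : ∀ {M M′} → M ↦ M′ → SA.Num M ↦ SB.Num M′
    ↦Num M = γ↦ M ↦1 ↦* γ↦ M (q↦ ↦* ↦1) ↦* (h↦ ↦* (↦1 ↦+ M ↦* M ↦* q2↦ ↦* sq↦ p↦) ↦- M ↦* q↦ ↦* U↦ ↦* p↦)

    ↦Den : ∀ {M M′} → M ↦ M′ → SA.Den M ↦ SB.Den M′
    ↦Den M = (↦1 ↦- M ↦* p↦) ↦* (↦1 ↦- M ↦* q2↦ ↦* p↦) ↦* (h↦ ↦* (↦1 ↦+ M ↦* M ↦* q8↦) ↦- M ↦* q4↦ ↦* U↦)

    ↦M : ∀ m → QA.M m ↦ QB.M m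
    ↦M m = sq↦ (sq↦ (↦pow q↦ m))

    -- Regularity is not preserved by homomorphisms, so in a quotient the proof of the summation
    -- cannot be repeated. Its conclusion, an equation, can be mapped.
    transport-summation : ∀ m →
      A.sum (suc m) (λ i → SA.w (QA.e i) A.* QA.summand m i) A.* A.prod m (λ i → SA.Den (QA.M i))
        A.≈ (A.1# A.- q) A.* QA.denominators m A.* A.prod m (λ i → SA.Num (QA.M i)) →
      B.sum (suc m) (λ i → SB.w (QB.e i) B.* QB.summand m i) B.* B.prod m (λ i → SB.Den (QB.M i))
        B.≈ (B.1# B.- q′) B.* QB.denominators m B.* B.prod m (λ i → SB.Num (QB.M i))
    transport-summation m eq = B.trans (B.sym (image (↦sum (suc m) (λ i → ↦w′ i ↦* summand↦ i) ↦* ↦prod m (λ i → ↦Den (↦M i)))))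
      (B.trans (⟪⟫-cong eq) (image ((↦1 ↦- q↦) ↦* ↦prod m (λ i → ↦den (↦M m) (↦pow q↦ i)) ↦* ↦prod m (λ i → ↦Num (↦M i)))))
      where
        ↦w′ : ∀ i → SA.w (QA.e i) ↦ SB.w (QB.e i)
        ↦w′ i = ↦1 ↦- q↦ ↦* (sq↦ (↦pow q↦ i) ↦* sq↦ (↦pow q↦ i) ↦* sq↦ (↦pow q↦ i))
        summand↦ : ∀ i → QA.summand m i ↦ QB.summand m i
        summand↦ k = ↦cleared m k (λ i → ↦num (↦M m) (↦pow q↦ i)) (λ i → ↦den (↦M m) (↦pow q↦ i))

  private
    module FA = Factors (SummandIdentities.ringOps A)
    module FB = Factors (SummandIdentities.ringOps B)

  ↦quad : ∀ {q q′ h h′ U U′ z z′} → h ↦ h′ → U ↦ U′ → z ↦ z′ → FA.quad q h U z ↦ FB.quad q′ h′ U′ z′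
  ↦quad h U z = h ↦* (↦1 ↦+ z ↦* z) ↦- z ↦* U

  module _ {q q′ t t′} (q↦ : q ↦ q′) (t↦ : t ↦ t′) where
    private
      q2↦ = q↦ ↦* q↦
      q4↦ = q2↦ ↦* q2↦
      s↦  = t↦ ↦* t↦
      s²↦ = s↦ ↦* s↦
    ↦w : FA.w q t ↦ FB.w q′ t′
    ↦w = ↦1 ↦- q↦ ↦* (s↦ ↦* s↦ ↦* s↦)
    ↦τn : FA.τn q t ↦ FB.τn q′ t′
    ↦τn = q2↦ ↦* (↦1 ↦- q2↦ ↦* s²↦)
    ↦τd : FA.τd q t ↦ FB.τd q′ t′
    ↦τd = ↦1 ↦- q4↦ ↦* s²↦
    ↦zyn : FA.zyn q t ↦ FB.zyn q′ t′
    ↦zyn = q↦ ↦* s↦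
    ↦zyd : FA.zyd q t ↦ FB.zyd q′ t′
    ↦zyd = q4↦ ↦* s²↦
    ↦zxn : FA.zxn q t ↦ FB.zxn q′ t′
    ↦zxn = q↦ ↦* s²↦
    ↦zxd : FA.zxd q t ↦ FB.zxd q′ t′
    ↦zxd = q2↦ ↦* s↦

-- R[s]/(s³)[t]/(t³), with x = 1 + s and y = 1 + t
module DoubleJets (R : CommutativeRing 0ℓ 0ℓ) where
  private
    module R = Ring R
    module J = Jets R
  J₁ : CommutativeRing 0ℓ 0ℓ
  J₁ = J.jetRing
  private
    module JJ = Jets J₁
    module S = Ring J₁
  J₂ : CommutativeRing 0ℓ 0ℓ
  J₂ = JJ.jetRing
  private module T = Ring J₂

  const-hom : ∀ (A : CommutativeRing 0ℓ 0ℓ) → RingHom A (Jets.jetRing A)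
  const-hom A = record { ⟪_⟫ = const ; ⟪⟫-cong = const-cong ; ⟪⟫-+ = const-+ ; ⟪⟫-* = const-* ; ⟪⟫-neg = const-neg ; ⟪⟫-1 = CommutativeRing.refl jetRing }
    where open Jets A

  ιY : RingHom J₁ J₂
  ιY = const-hom J₁

  -- Jets in x form the outer layer and jets in y the inner one. Hence the embedding of y is the
  -- inclusion of constants, while that of x applies this inclusion to each coefficient.
  X⟪_⟫ : S.Carrier → T.Carrier
  c₀ X⟪ a ⟫ = J.const (c₀ a)
  c₁ X⟪ a ⟫ = J.const (c₁ a)
  c₂ X⟪ a ⟫ = J.const (c₂ a)

  ιX : RingHom J₁ J₂
  ιX = record
    { ⟪_⟫ = X⟪_⟫
    ; ⟪⟫-cong = λ p → JJ.jet≈ (J.const-cong (J.e₀ p)) (J.const-cong (J.e₁ p)) (J.const-cong (J.e₂ p))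
    ; ⟪⟫-+ = λ a b → JJ.jet≈ (J.const-+ _ _) (J.const-+ _ _) (J.const-+ _ _)
    ; ⟪⟫-* = λ a b → JJ.jet≈ (J.const-* _ _)
        (S.trans (J.const-+ _ _) (S.+-cong (J.const-* _ _) (J.const-* _ _)))
        (S.trans (J.const-+ _ _) (S.+-cong (S.trans (J.const-+ _ _) (S.+-cong (J.const-* _ _) (J.const-* _ _))) (J.const-* _ _)))
    ; ⟪⟫-neg = λ a → JJ.jet≈ (J.const-neg _) (J.const-neg _) (J.const-neg _)
    ; ⟪⟫-1 = JJ.jet≈ S.refl S.refl S.refl }

  open RingHom ιY using () renaming (⟪_⟫ to Y⟪_⟫) public

  constant : RingHom R J₂
  constant = record
    { ⟪_⟫ = λ a → Y⟪ J.const a ⟫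
    ; ⟪⟫-cong = λ p → JJ.const-cong (J.const-cong p)
    ; ⟪⟫-+ = λ x y → T.trans (JJ.const-cong (J.const-+ x y)) (JJ.const-+ _ _)
    ; ⟪⟫-* = λ x y → T.trans (JJ.const-cong (J.const-* x y)) (JJ.const-* _ _)
    ; ⟪⟫-neg = λ x → T.trans (JJ.const-cong (J.const-neg x)) (JJ.const-neg _)
    ; ⟪⟫-1 = T.refl }
  open RingHom constant using () renaming (⟪_⟫ to C⟪_⟫) public

  regular : ∀ {z} → R.Regular (c₀ (c₀ z)) → T.Regular z
  regular reg = JJ.jet-reg (J.jet-reg reg)

  two : R.Carrier
  two = R.1# R.+ R.1#
  -- Modulo s³ the sum of 1 + s and its inverse is 2 + s². For a function of x + 1/x the coefficient
  -- of s therefore vanishes, and that of s² is the derivative in x + 1/x.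
  1+s [1+s]⁻¹ 2+s² : S.Carrier
  1+s     = jet R.1# R.1# R.0#
  [1+s]⁻¹ = jet R.1# (R.- R.1#) R.1#
  2+s²    = jet two R.0# R.1#
  x̂ x̂⁻¹ ŷ+ŷ⁻¹ : T.Carrier
  x̂   = X⟪ 1+s ⟫
  x̂⁻¹ = X⟪ [1+s]⁻¹ ⟫
  ŷ+ŷ⁻¹ = Y⟪ 2+s² ⟫

  private
    inverse-1+s : 1+s S.* [1+s]⁻¹ S.≈ S.1#
    inverse-1+s = J.jet≈
      (R.*-identityˡ _)
      (R.solve 0 (𝟙 ⊗ ⊝ 𝟙 ⊕ 𝟙 ⊗ 𝟙 ⊜ Κ 0ℤ) R.refl)
      (R.solve 0 (𝟙 ⊗ 𝟙 ⊕ 𝟙 ⊗ ⊝ 𝟙 ⊕ Κ 0ℤ ⊗ 𝟙 ⊜ Κ 0ℤ) R.refl)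
      where open R using (_⊜_)
    sum-1+s : 2+s² S.≈ 1+s S.+ [1+s]⁻¹
    sum-1+s = J.jet≈ R.refl (R.sym (R.-‿inverseʳ _)) (R.sym (R.+-identityˡ _))

  xx⁻¹≈1 : x̂ T.* x̂⁻¹ T.≈ T.1#
  xx⁻¹≈1 = T.trans (T.sym (RingHom.⟪⟫-* ιX 1+s [1+s]⁻¹)) (T.trans (RingHom.⟪⟫-cong ιX inverse-1+s) (RingHom.⟪⟫-1 ιX))

  private
    module F  = Factors (SummandIdentities.ringOps R)
    module F₁ = Factors (SummandIdentities.ringOps J₁)
    module F₂ = Factors (SummandIdentities.ringOps J₂)

  -- (1 − z(1 + s))(1 − z(1 + s)⁻¹)
  quadJet : R.Carrier → S.Carrier
  quadJet z = jet (F.quad R.1# R.1# two z) R.0# (R.- z)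

  private
    quad≈ : ∀ z → F₁.quad S.1# S.1# 2+s² (J.const z) S.≈ quadJet z
    quad≈ z = J.jet≈ R.refl
      (R.solve 1 (λ z → 𝟙 ⊗ (Κ 0ℤ ⊕ (z ⊗ Κ 0ℤ ⊕ Κ 0ℤ ⊗ z)) ⊕ Κ 0ℤ ⊗ (𝟙 ⊕ z ⊗ z) ⊖ (z ⊗ Κ 0ℤ ⊕ Κ 0ℤ ⊗ (𝟙 ⊕ 𝟙)) ⊜ Κ 0ℤ) R.refl z)
      (R.solve 1 (λ z → 𝟙 ⊗ (Κ 0ℤ ⊕ (z ⊗ Κ 0ℤ ⊕ Κ 0ℤ ⊗ Κ 0ℤ ⊕ Κ 0ℤ ⊗ z)) ⊕ Κ 0ℤ ⊗ (Κ 0ℤ ⊕ (z ⊗ Κ 0ℤ ⊕ Κ 0ℤ ⊗ z)) ⊕ Κ 0ℤ ⊗ (𝟙 ⊕ z ⊗ z)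
          ⊖ (z ⊗ 𝟙 ⊕ Κ 0ℤ ⊗ Κ 0ℤ ⊕ Κ 0ℤ ⊗ (𝟙 ⊕ 𝟙)) ⊜ ⊝ z) R.refl z)
      where open R using (_⊜_)

  quadY : ∀ {z ẑ q} → Transport._↦_ constant z ẑ → F₂.quad q T.1# ŷ+ŷ⁻¹ ẑ T.≈ Y⟪ quadJet z ⟫
  quadY {q = q} z↦ = T.trans (T.sym (_↦_.image (↦quad {q = S.1#} {q′ = q} ↦1 (to T.refl) (to (Transport.image z↦))))) (RingHom.⟪⟫-cong ιY (quad≈ _))
    where open Transport ιY

  quadX : ∀ {z ẑ q} → Transport._↦_ constant z ẑ → F₂.quad q T.1# (x̂ T.+ x̂⁻¹) ẑ T.≈ X⟪ quadJet z ⟫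
  quadX {z = z} {q = q} z↦ = T.trans (T.sym (_↦_.image (↦quad {q = S.1#} {q′ = q} ↦1 sum↦ z↦′))) (RingHom.⟪⟫-cong ιX (quad≈ _))
    where
      open Transport ιX
      sum↦ : 2+s² ↦ x̂ T.+ x̂⁻¹
      sum↦ = to (T.trans (RingHom.⟪⟫-cong ιX sum-1+s) (RingHom.⟪⟫-+ ιX 1+s [1+s]⁻¹))
      z↦′ : J.const z ↦ _
      z↦′ = to (T.trans (JJ.jet≈ S.refl (J.jet≈ R.refl R.refl R.refl) (J.jet≈ R.refl R.refl R.refl)) (Transport.image z↦))

  scalar : ∀ (A : CommutativeRing 0ℓ 0ℓ) → let open CommutativeRing A in ∀ a b →
      CommutativeRing._≈_ (Jets.jetRing A) (Jets._*ⱼ_ A (Jets.const A a) b) (jet (a * c₀ b) (a * c₁ b) (a * c₂ b))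
  scalar A a b = Jets.jet≈ A.refl
      (A.solve 3 (λ a b₀ b₁ → a ⊗ b₁ ⊕ Κ 0ℤ ⊗ b₀ ⊜ a ⊗ b₁) A.refl a (c₀ b) (c₁ b))
      (A.solve 4 (λ a b₀ b₁ b₂ → a ⊗ b₂ ⊕ Κ 0ℤ ⊗ b₁ ⊕ Κ 0ℤ ⊗ b₀ ⊜ a ⊗ b₂) A.refl a (c₀ b) (c₁ b) (c₂ b))
      where
        module A = Ring A
        open A using (_⊜_)

  XY-entries : ∀ x y → X⟪ x ⟫ T.* Y⟪ y ⟫ T.≈
    jet (jet (c₀ x R.* c₀ y) (c₀ x R.* c₁ y) (c₀ x R.* c₂ y))
        (jet (c₁ x R.* c₀ y) (c₁ x R.* c₁ y) (c₁ x R.* c₂ y))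
        (jet (c₂ x R.* c₀ y) (c₂ x R.* c₁ y) (c₂ x R.* c₂ y))
  XY-entries x y = T.trans (T.*-comm X⟪ x ⟫ Y⟪ y ⟫) (T.trans (scalar J₁ y X⟪ x ⟫)
    (JJ.jet≈ (S.trans (S.*-comm y _) (scalar R (c₀ x) y)) (S.trans (S.*-comm y _) (scalar R (c₁ x) y)) (S.trans (S.*-comm y _) (scalar R (c₂ x) y))))

-- Vanishing of the double jet modulo a cyclotomic polynomial.

-- A second, coarser ring structure K on the carrier of P; in the application it
-- is congruence modulo a cyclotomic polynomial.
module Coarsening (P : CommutativeRing 0ℓ 0ℓ) (_≈′_ : Coarser.Relation P) (isCommutativeRing′ : Coarser.IsRing P _≈′_) (coarsen : Coarser.Coarsens P _≈′_) where
  open CommutativeRing P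

  K : CommutativeRing 0ℓ 0ℓ
  K = record { isCommutativeRing = isCommutativeRing′ }

  private
    module P = Ring P
    module K = Ring K
    module DP = DoubleJets P
    module DK = DoubleJets K
    module TP = Ring DP.J₂
    module TK = Ring DK.J₂
    opsP = SummandIdentities.ringOps P
    opsK = SummandIdentities.ringOps K
    ops  = SummandIdentities.ringOps DK.J₂

  private
    jj : ∀ {x y} → c₀ (c₀ x) K.≈ c₀ (c₀ y) → c₁ (c₀ x) K.≈ c₁ (c₀ y) → c₂ (c₀ x) K.≈ c₂ (c₀ y)
      → c₀ (c₁ x) K.≈ c₀ (c₁ y) → c₁ (c₁ x) K.≈ c₁ (c₁ y) → c₂ (c₁ x) K.≈ c₂ (c₁ y)
      → c₀ (c₂ x) K.≈ c₀ (c₂ y) → c₁ (c₂ x) K.≈ c₁ (c₂ y) → c₂ (c₂ x) K.≈ c₂ (c₂ y) → x TK.≈ y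
    jj a b c d e f g h i = Jets.jet≈ (Jets.jet≈ a b c) (Jets.jet≈ d e f) (Jets.jet≈ g h i)

  coarsening : RingHom DP.J₂ DK.J₂
  coarsening = record
    { ⟪_⟫ = λ z → z
    ; ⟪⟫-cong = λ p → let open Jets DP.J₁ in let open Jets P using () renaming (e₀ to d₀; e₁ to d₁; e₂ to d₂) in
        jj (coarsen (d₀ (e₀ p))) (coarsen (d₁ (e₀ p))) (coarsen (d₂ (e₀ p)))
           (coarsen (d₀ (e₁ p))) (coarsen (d₁ (e₁ p))) (coarsen (d₂ (e₁ p)))
           (coarsen (d₀ (e₂ p))) (coarsen (d₁ (e₂ p))) (coarsen (d₂ (e₂ p)))
    ; ⟪⟫-+ = λ _ _ → jj K.refl K.refl K.refl K.refl K.refl K.refl K.refl K.refl K.refl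
    ; ⟪⟫-* = λ _ _ → jj K.refl K.refl K.refl K.refl K.refl K.refl K.refl K.refl K.refl
    ; ⟪⟫-neg = λ _ → jj K.refl K.refl K.refl K.refl K.refl K.refl K.refl K.refl K.refl
    ; ⟪⟫-1 = jj K.refl K.refl K.refl K.refl K.refl K.refl K.refl K.refl K.refl }

  module _ (q : Carrier) (m : ℕ) (0<m : 0 ℕ.< m)
    (q-reg : P.Regular q) (1-q^-reg : ∀ i → 0 ℕ.< i → P.Regular (1# - P.pow q i))
    (q^n≈1 : K.pow q (suc (m ℕ.+ m)) K.≈ 1#)
    (1-q^j-reg  : ∀ j → 0 ℕ.< j → j ℕ.≤ m ℕ.+ m → K.Regular (1# - P.pow q j))
    (1-q^2j-reg : ∀ j → 0 ℕ.< j → j ℕ.≤ m ℕ.+ m → K.Regular (1# - P.pow q (j ℕ.+ j)))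
    where

    private
      q̂P p̂P : TP.Carrier
      q̂P = DP.C⟪ q ⟫
      p̂P = q̂P TP.* q̂P TP.* DP.x̂⁻¹
      q̂ p̂ ĥ Û : TK.Carrier
      q̂ = DK.C⟪ q ⟫
      p̂ = q̂ TK.* q̂ TK.* DK.x̂⁻¹
      ĥ = TK.1#
      Û = DK.ŷ+ŷ⁻¹

      ε : TP.Carrier → Carrier
      ε z = c₀ (c₀ z)

      ε-powP : ∀ i → ε (TP.pow q̂P i) ≡ P.pow q i
      ε-powP zero    = ≡.refl
      ε-powP (suc i) = ≡.cong (q *_) (ε-powP i)
      ε-pow : ∀ i → ε (TK.pow q̂ i) ≡ P.pow q i
      ε-pow zero    = ≡.refl
      ε-pow (suc i) = ≡.cong (q *_) (ε-pow i)

      open Powers P q q-reg 1-q^-reg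

      lower-square : ∀ z → 1# * (1# + z * z) - z * DP.two ≈ (1# - z) * (1# - z)
      lower-square = solve 1 (λ z → 𝟙 ⊗ (𝟙 ⊕ z ⊗ z) ⊖ z ⊗ (𝟙 ⊕ 𝟙) ⊜ (𝟙 ⊖ z) ⊗ (𝟙 ⊖ z)) P.refl
        where open P using (solve; _⊜_)

      module QSP = QuadraticSummation DP.J₂ q̂P TP.1# DP.ŷ+ŷ⁻¹ p̂P
      module QS  = QuadraticSummation DK.J₂ q̂ ĥ Û p̂
      module S   = Summand ops q̂ ĥ Û p̂

      -- In K one has q^n = 1, so the regularity of all 1 - q^i that the summation requires is
      -- available only over P. It is proved in the double jets over P, with p = q²/x, and then
      -- transported.
      summation : TK.sum (suc m) (λ i → S.w (QS.e i) TK.* QS.summand m i) TK.* TK.prod m (λ i → S.Den (QS.M i))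
                  TK.≈ (TK.1# TK.- q̂) TK.* QS.denominators m TK.* TK.prod m (λ i → S.Num (QS.M i))
      summation = transport-summation {q = q̂P} {TP.1#} {DP.ŷ+ŷ⁻¹} {p̂P} {q̂} {ĥ} {Û} {p̂} q↦ ↦1 (to (jj K.refl K.refl K.refl K.refl K.refl K.refl K.refl K.refl K.refl))
          (q↦ ↦* q↦ ↦* to (jj K.refl K.refl K.refl K.refl K.refl K.refl K.refl K.refl K.refl)) m (QSP.summation (DP.regular q-reg) r₁ r₂ r₃ m)
        where
          open Transport coarsening
          q↦ : q̂P ↦ q̂
          q↦ = to (jj K.refl K.refl K.refl K.refl K.refl K.refl K.refl K.refl K.refl)
          r₁ : ∀ i → 0 ℕ.< i → TP.Regular (TP.1# TP.- TP.pow q̂P i)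
          r₁ i 0<i = DP.regular (P.reg-cong (P.reflexive (≡.cong (λ t → 1# - t) (≡.sym (ε-powP i)))) (1-q^-reg i 0<i))
          r₂ : ∀ i → TP.Regular (TP.1# TP.- TP.pow q̂P i TP.* p̂P)
          r₂ i = DP.regular (P.reg-cong (P.reflexive (≡.cong (λ t → 1# - t * (q * q * 1#)) (≡.sym (ε-powP i))))
            (1-reg (ℕ.<-≤-trans (s≤s z≤n) (ℕ.m≤n+m 2 i)) (e≈ i ⊡ (q≈ ⊡ q≈ ⊡ e≈ 0))))
          r₃ : ∀ j → TP.Regular (Summand.lower (SummandIdentities.ringOps DP.J₂) q̂P TP.1# DP.ŷ+ŷ⁻¹ p̂P (TP.pow q̂P j))
          r₃ j = DP.regular (P.reg-cong (P.trans (P.sym (lower-square z)) (P.trans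
              (P.solve 2 (λ q t → let s = λ x → x ⊗ x ; q4 = s (s q) ; z = q4 ⊗ s (s t) in 𝟙 ⊗ (𝟙 ⊕ z ⊗ z) ⊖ z ⊗ (𝟙 ⊕ 𝟙) P.⊜ 𝟙 ⊗ (𝟙 ⊕ q4 ⊗ q4 ⊗ s (s (s t))) ⊖ z ⊗ (𝟙 ⊕ 𝟙)) P.refl q t)
              (P.reflexive (≡.cong (λ t → Summand.lower opsP q 1# DP.two q t) (≡.sym (ε-powP j))))))
            (P.reg-* r r))
            where
              t = P.pow q j
              z = (q * q) * (q * q) * ((t * t) * (t * t))
              r = 1-reg (s≤s z≤n) ((q≈ ⊡ q≈) ⊡ (q≈ ⊡ q≈) ⊡ ((e≈ j ⊡ e≈ j) ⊡ (e≈ j ⊡ e≈ j)))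


      module F  = Factors opsP q
      module F₂ = Factors ops q̂

      module C = Transport DK.constant
      open C using (to; _↦*_; _↦-_; ↦1)
      e↦ : ∀ j → P.pow q j C.↦ TK.pow q̂ j
      e↦ j = C.↦pow (to TK.refl) j

      q^n≈1′ : q * (K.pow q m * K.pow q m) K.≈ 1#
      q^n≈1′ = K.trans (K.*-congˡ (K.sym (K.pow-+ q m m))) q^n≈1

      -- q̂² M = q^{2n} = 1
      q2M≈1 : q̂ TK.* q̂ TK.* QS.M m TK.≈ TK.1#
      q2M≈1 = TK.trans (TK.sym (C.image (to TK.refl ↦* to TK.refl ↦* ((e↦ m ↦* e↦ m) ↦* (e↦ m ↦* e↦ m)))))
        (RingHom.⟪⟫-cong DK.constant {y = 1#} (K.trans
          (K.*-solve 2 (λ q t → q K.∙ q K.∙ ((t K.∙ t) K.∙ (t K.∙ t)) K.≐ (q K.∙ (t K.∙ t)) K.∙ (q K.∙ (t K.∙ t))) K.refl q (K.pow q m))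
          (K.trans (K.*-cong q^n≈1′ q^n≈1′) (K.*-identityˡ 1#))))

      vanish : ∀ {x x̂} → x C.↦ x̂ → x K.≈ 1# → TK.1# TK.- x̂ TK.≈ TK.0#
      vanish x↦ eq = TK.x≈y⇒x-y≈0 (TK.sym (TK.trans (TK.sym (C.image x↦)) (RingHom.⟪⟫-cong DK.constant {y = 1#} eq)))

      M↦ : ∀ l → let t = P.pow q l in (t * t) * (t * t) C.↦ QS.M l
      M↦ l = (e↦ l ↦* e↦ l) ↦* (e↦ l ↦* e↦ l)

      1-reg′ : ∀ {x} j → 0 ℕ.< j → j ℕ.≤ m ℕ.+ m → x K.≈ P.pow q j → K.Regular (1# - x)
      1-reg′ j 0<j j≤2m eq = K.reg-cong (K.+-congˡ (K.-‿cong (K.sym eq))) (1-q^j-reg j 0<j j≤2m)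
      1-reg″ : ∀ {x} j → 0 ℕ.< j → j ℕ.≤ m ℕ.+ m → x K.≈ P.pow q (j ℕ.+ j) → K.Regular (1# - x)
      1-reg″ j 0<j j≤2m eq = K.reg-cong (K.+-congˡ (K.-‿cong (K.sym eq))) (1-q^2j-reg j 0<j j≤2m)

      -- n = 2m + 1 is either 4l + 3 or 4l + 5. Accordingly `γ` at M = q^{4l} and t = 1, or t = q,
      -- equals 1 - q^n, and this index l lies in the range of the product.
      Num-vanishes : TK.prod m (λ i → S.Num (QS.M i)) TK.≈ TK.0#
      Num-vanishes with parity m
        where
          parity : ∀ m → (Σ ℕ λ l → m ≡ l ℕ.+ l) ⊎ (Σ ℕ λ l → m ≡ suc (l ℕ.+ l))
          parity zero = inj₁ (0 , ≡.refl)
          parity (suc m) with parity m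
          ... | inj₁ (l , ≡.refl) = inj₂ (l , ≡.refl)
          ... | inj₂ (l , ≡.refl) = inj₁ (suc l , ≡.cong suc (≡.sym (ℕ.+-suc l l)))
      ... | inj₂ (l , ≡.refl) = TK.prod-zero l (s≤s (ℕ.m≤m+n l l)) (TK.trans (TK.*-congʳ (TK.trans (TK.*-congʳ γ≈0) (TK.zeroˡ _))) (TK.zeroˡ _))
        where
          γ≈0 : S.γ (QS.M l) TK.1# TK.≈ TK.0#
          γ≈0 = vanish (M↦ l ↦* (to TK.refl ↦* to TK.refl ↦* to TK.refl) ↦* (↦1 ↦* ↦1)) (K.trans
            (K.*-solve 2 (λ q t → ((t K.∙ t) K.∙ (t K.∙ t)) K.∙ (q K.∙ q K.∙ q) K.∙ (K.one K.∙ K.one) K.≐ q K.∙ ((q K.∙ (t K.∙ t)) K.∙ (q K.∙ (t K.∙ t)))) K.refl q (P.pow q l))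
            (K.trans (K.*-congˡ (K.*-cong (K.*-congˡ (K.sym (K.pow-+ q l l))) (K.*-congˡ (K.sym (K.pow-+ q l l))))) q^n≈1′))
      ... | inj₁ (suc l , ≡.refl) = TK.prod-zero l (s≤s (ℕ.m≤m+n l (suc l))) (TK.trans (TK.*-congʳ (TK.trans (TK.*-congˡ γ≈0) (TK.zeroʳ _))) (TK.zeroˡ _))
        where
          γ≈0 : S.γ (QS.M l) (q̂ TK.* TK.1#) TK.≈ TK.0#
          γ≈0 = vanish (M↦ l ↦* (to TK.refl ↦* to TK.refl ↦* to TK.refl) ↦* ((to TK.refl ↦* ↦1) ↦* (to TK.refl ↦* ↦1))) (K.trans
            (K.*-solve 2 (λ q t → ((t K.∙ t) K.∙ (t K.∙ t)) K.∙ (q K.∙ q K.∙ q) K.∙ ((q K.∙ K.one) K.∙ (q K.∙ K.one)) K.≐ q K.∙ (((q K.∙ t) K.∙ (q K.∙ t)) K.∙ ((q K.∙ t) K.∙ (q K.∙ t)))) K.refl q (P.pow q l))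
            (K.trans (K.*-congˡ (K.*-cong (K.sym (K.pow-+ q (suc l) (suc l))) (K.sym (K.pow-+ q (suc l) (suc l))))) q^n≈1′))
      ... | inj₁ (zero , ≡.refl) = ⊥-elim (ℕ.n≮0 0<m)

      κ : ℕ → TK.Carrier
      κ i = (TK.1# TK.- q̂ TK.* (QS.e i TK.* QS.e i)) TK.* DK.x̂⁻¹

      κ-reg : ∀ i → i ℕ.< m → TK.Regular (κ i)
      κ-reg i i<m = DK.regular (K.reg-* (1-reg′ (suc (i ℕ.+ i)) (s≤s z≤n) (ℕ.≤-trans (s≤s (ℕ.+-monoʳ-≤ i (ℕ.n≤1+n i))) (ℕ.+-mono-≤ i<m i<m))
        (K.*-congˡ (K.trans (K.reflexive (≡.cong (λ t → t * t) (ε-pow i))) (K.sym (K.pow-+ q i i))))) K.reg-1)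

      Den-reg : ∀ i → i ℕ.< m → TK.Regular (S.Den (QS.M i))
      Den-reg i i<m = DK.regular (≡.subst (λ t → K.Regular (Summand.Den opsK q 1# DK.two (q * q * 1#) ((t * t) * (t * t)))) (≡.sym (ε-pow i))
        (K.reg-* (K.reg-* r₁ r₂) (K.reg-cong (K.solve 2 (λ q M → let q4 = (q ⊗ q) ⊗ (q ⊗ q) ; z = M ⊗ q4 in (𝟙 ⊖ z) ⊗ (𝟙 ⊖ z) K.⊜ 𝟙 ⊗ (𝟙 ⊕ M ⊗ M ⊗ (q4 ⊗ q4)) ⊖ M ⊗ q4 ⊗ (𝟙 ⊕ 𝟙)) K.refl q M) (K.reg-* r₃ r₃))))
        where
          t = P.pow q i
          M = (t * t) * (t * t)
          j = suc (i ℕ.+ i)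
          ij : ∀ k → P.pow q (k ℕ.+ k) K.≈ P.pow q k * P.pow q k
          ij k = K.pow-+ q k k
          j≤ : suc j ℕ.≤ m ℕ.+ m
          j≤ = ℕ.≤-trans (ℕ.≤-reflexive (≡.cong suc (≡.sym (ℕ.+-suc i i)))) (ℕ.+-mono-≤ i<m i<m)
          r₁ : K.Regular (1# - M * (q * q * 1#))
          r₁ = 1-reg″ j (s≤s z≤n) (ℕ.≤-trans (ℕ.n≤1+n j) j≤) (K.trans
            (K.*-solve 2 (λ q t → ((t K.∙ t) K.∙ (t K.∙ t)) K.∙ (q K.∙ q K.∙ K.one) K.≐ (q K.∙ (t K.∙ t)) K.∙ (q K.∙ (t K.∙ t))) K.refl q t)
            (K.trans (K.*-cong (K.*-congˡ (K.sym (ij i))) (K.*-congˡ (K.sym (ij i)))) (K.sym (ij j))))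
          r₃ : K.Regular (1# - M * ((q * q) * (q * q)))
          r₃ = 1-reg″ (suc j) (s≤s z≤n) j≤ (K.trans
            (K.*-solve 2 (λ q t → ((t K.∙ t) K.∙ (t K.∙ t)) K.∙ ((q K.∙ q) K.∙ (q K.∙ q)) K.≐ (q K.∙ (q K.∙ (t K.∙ t))) K.∙ (q K.∙ (q K.∙ (t K.∙ t)))) K.refl q t)
            (K.trans (K.*-cong (K.*-congˡ (K.*-congˡ (K.sym (ij i)))) (K.*-congˡ (K.*-congˡ (K.sym (ij i))))) (K.sym (ij (suc j)))))
          r₂ : K.Regular (1# - M * (q * q) * (q * q * 1#))
          r₂ = K.reg-cong (K.+-congˡ (K.-‿cong (K.*-solve 2 (λ q M → M K.∙ ((q K.∙ q) K.∙ (q K.∙ q)) K.≐ M K.∙ (q K.∙ q) K.∙ (q K.∙ q K.∙ K.one)) K.refl q M))) r₃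

      σn̂ σd̂ : ℕ → TK.Carrier
      σn̂ i = F₂.σn ĥ Û TK.1# (DK.x̂ TK.+ DK.x̂⁻¹) (QS.e i)
      σd̂ i = F₂.σd ĥ Û TK.1# (DK.x̂ TK.+ DK.x̂⁻¹) (QS.e i)

      open import Relation.Binary.Reasoning.Setoid TK.setoid

      summand≈ : ∀ k → k ℕ.≤ m → QS.summand m k TK.≈ TK.prod m κ TK.* Cleared.cleared DK.J₂ σn̂ σd̂ m k
      summand≈ k k≤m = TK.trans (cleared-cong m k k≤m
          (λ i _ → num-reduced q̂ ĥ Û DK.x̂ DK.x̂⁻¹ (QS.M m) DK.xx⁻¹≈1 q2M≈1 (QS.e i))
          (λ i _ → den-reduced q̂ ĥ Û DK.x̂ DK.x̂⁻¹ (QS.M m) DK.xx⁻¹≈1 q2M≈1 (QS.e i)))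
        (TK.trans (cleared-* κ κ σn̂ σd̂ m k) (TK.*-congʳ (cleared-same κ m k k≤m)))
        where
          open ClearedProperties DK.J₂
          open FactorIdentities DK.J₂

      vanishing-m : TK.sum (suc m) (λ k → F₂.w (QS.e k) TK.* Cleared.cleared DK.J₂ σn̂ σd̂ m k) TK.≈ TK.0#
      vanishing-m = TK.reg-* (TK.prod-reg m κ-reg) (TK.prod-reg m Den-reg) _ (begin
        κs TK.* Ds TK.* Σ₀
          ≈⟨ TK.*-solve 3 (λ a b c → a TK.∙ b TK.∙ c TK.≐ a TK.∙ c TK.∙ b) TK.refl κs Ds Σ₀ ⟩
        κs TK.* Σ₀ TK.* Ds
          ≈⟨ TK.*-congʳ (TK.trans (TK.sym (TK.sum-*ˡ (suc m) κs _)) (TK.sum-cong (suc m) (λ k k≤m → TK.trans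
               (TK.*-solve 3 (λ a b c → a TK.∙ (b TK.∙ c) TK.≐ b TK.∙ (a TK.∙ c)) TK.refl κs (F₂.w (QS.e k)) (Cleared.cleared DK.J₂ σn̂ σd̂ m k))
               (TK.*-congˡ (TK.sym (summand≈ k (ℕ.≤-pred k≤m))))))) ⟩
        TK.sum (suc m) (λ i → S.w (QS.e i) TK.* QS.summand m i) TK.* Ds
          ≈⟨ summation ⟩
        (TK.1# TK.- q̂) TK.* QS.denominators m TK.* TK.prod m (λ i → S.Num (QS.M i))
          ≈⟨ TK.trans (TK.*-congˡ Num-vanishes) (TK.zeroʳ _) ⟩
        TK.0# ∎)
        where
          κs = TK.prod m κ
          Ds = TK.prod m (λ i → S.Den (QS.M i))
          Σ₀ = TK.sum (suc m) (λ k → F₂.w (QS.e k) TK.* Cleared.cleared DK.J₂ σn̂ σd̂ m k)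

      -- `κ` contains 1 - q^{2i+1}, which vanishes at i = m, so it can be cancelled only from the
      -- sum up to m. Once it is gone, the sum extends to 2m: the numerator at i = m contains 1 - q²
      -- q^{4m} = 1 - q^{2n}, and all later summands vanish.
      vanishing-2m : TK.sum (suc (m ℕ.+ m)) (λ k → F₂.w (QS.e k) TK.* Cleared.cleared DK.J₂ σn̂ σd̂ (m ℕ.+ m) k) TK.≈ TK.0#
      vanishing-2m = TK.trans (ClearedProperties.cleared-extend DK.J₂ (λ k → F₂.w (QS.e k)) σn̂ σd̂ m m σn≈0) (TK.trans (TK.*-congʳ vanishing-m) (TK.zeroˡ _))
        where
          σn≈0 : σn̂ m TK.≈ TK.0#
          σn≈0 = TK.trans (TK.*-congʳ (TK.trans (TK.*-congʳ (TK.trans (TK.*-congˡ (TK.x≈y⇒x-y≈0 (TK.sym q2M≈1))) (TK.zeroʳ _))) (TK.zeroˡ _))) (TK.zeroˡ _)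

    jetsX jetsY : ℕ → Jet Carrier
    jetsX = Cleared.cleared DK.J₁ (λ i → DK.quadJet (Factors.zxn opsP q (P.pow q i))) (λ i → DK.quadJet (Factors.zxd opsP q (P.pow q i))) (m ℕ.+ m)
    jetsY = Cleared.cleared DK.J₁ (λ i → DK.quadJet (Factors.zyn opsP q (P.pow q i))) (λ i → DK.quadJet (Factors.zyd opsP q (P.pow q i))) (m ℕ.+ m)
    weight : ℕ → Carrier
    weight k = Factors.w opsP q (P.pow q k) * Cleared.cleared K (λ i → Factors.τn opsP q (P.pow q i)) (λ i → Factors.τd opsP q (P.pow q i)) (m ℕ.+ m) k

    private
      term : ℕ → TK.Carrier
      term k = F₂.w (QS.e k) TK.* Cleared.cleared DK.J₂ σn̂ σd̂ (m ℕ.+ m) k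

      entries : ∀ k → k ℕ.≤ m ℕ.+ m → term k TK.≈ DK.C⟪ weight k ⟫ TK.* (DK.X⟪ jetsX k ⟫ TK.* DK.Y⟪ jetsY k ⟫)
      entries k k≤2m = begin
        F₂.w (QS.e k) TK.* Cleared.cleared DK.J₂ σn̂ σd̂ (m ℕ.+ m) k
          ≈⟨ TK.*-congˡ (TK.trans (cleared-* (λ i → tn i TK.* yn i) (λ i → td i TK.* yd i) xn xd (m ℕ.+ m) k) (TK.*-congʳ (cleared-* tn td yn yd (m ℕ.+ m) k))) ⟩
        F₂.w (QS.e k) TK.* (ct TK.* cy TK.* cx)
          ≈⟨ TK.*-congˡ (TK.*-cong (TK.*-congˡ cy≈) cx≈) ⟩
        F₂.w (QS.e k) TK.* (ct TK.* DK.Y⟪ jetsY k ⟫ TK.* DK.X⟪ jetsX k ⟫)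
          ≈⟨ TK.*-solve 4 (λ w t y x → w TK.∙ (t TK.∙ y TK.∙ x) TK.≐ (w TK.∙ t) TK.∙ (x TK.∙ y)) TK.refl (F₂.w (QS.e k)) ct DK.Y⟪ jetsY k ⟫ DK.X⟪ jetsX k ⟫ ⟩
        F₂.w (QS.e k) TK.* ct TK.* (DK.X⟪ jetsX k ⟫ TK.* DK.Y⟪ jetsY k ⟫)
          ≈⟨ TK.*-congʳ (C.image (C.↦w {q = q} (to TK.refl) (e↦ k) ↦* C.↦cleared (m ℕ.+ m) k (λ i → C.↦τn {q = q} (to TK.refl) (e↦ i)) (λ i → C.↦τd {q = q} (to TK.refl) (e↦ i)))) ⟨
        DK.C⟪ weight k ⟫ TK.* (DK.X⟪ jetsX k ⟫ TK.* DK.Y⟪ jetsY k ⟫) ∎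
        where
          open ClearedProperties DK.J₂
          tn td yn yd xn xd : ℕ → TK.Carrier
          tn i = F₂.τn (QS.e i)
          td i = F₂.τd (QS.e i)
          yn i = F₂.quad ĥ Û (F₂.zyn (QS.e i))
          yd i = F₂.quad ĥ Û (F₂.zyd (QS.e i))
          xn i = F₂.quad TK.1# (DK.x̂ TK.+ DK.x̂⁻¹) (F₂.zxn (QS.e i))
          xd i = F₂.quad TK.1# (DK.x̂ TK.+ DK.x̂⁻¹) (F₂.zxd (QS.e i))
          ct = Cleared.cleared DK.J₂ tn td (m ℕ.+ m) k
          cy = Cleared.cleared DK.J₂ yn yd (m ℕ.+ m) k
          cx = Cleared.cleared DK.J₂ xn xd (m ℕ.+ m) k
          module X = Transport DK.ιX
          module Y = Transport DK.ιY
          cy≈ : cy TK.≈ DK.Y⟪ jetsY k ⟫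
          cy≈ = TK.sym (Y.image (Y.↦cleared (m ℕ.+ m) k (λ i → Y.to (TK.sym (DK.quadY {q = q̂} (C.↦zyn {q = q} (to TK.refl) (e↦ i))))) (λ i → Y.to (TK.sym (DK.quadY {q = q̂} (C.↦zyd {q = q} (to TK.refl) (e↦ i)))))))
          cx≈ : cx TK.≈ DK.X⟪ jetsX k ⟫
          cx≈ = TK.sym (X.image (X.↦cleared (m ℕ.+ m) k (λ i → X.to (TK.sym (DK.quadX {q = q̂} (C.↦zxn {q = q} (to TK.refl) (e↦ i))))) (λ i → X.to (TK.sym (DK.quadX {q = q̂} (C.↦zxd {q = q} (to TK.refl) (e↦ i)))))))

      matrix : ℕ → TK.Carrier
      matrix k = jet (row (c₀ (jetsX k))) (row (c₁ (jetsX k))) (row (c₂ (jetsX k)))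
        where
          row : Carrier → Jet Carrier
          row x = jet (weight k * (x * c₀ (jetsY k))) (weight k * (x * c₁ (jetsY k))) (weight k * (x * c₂ (jetsY k)))

      matrix-sum : TK.sum (suc (m ℕ.+ m)) matrix TK.≈ TK.0#
      matrix-sum = TK.trans (TK.sum-cong (suc (m ℕ.+ m)) (λ k k≤2m → TK.sym (TK.trans (entries k (ℕ.≤-pred k≤2m))
        (TK.trans (TK.*-congˡ (DK.XY-entries (jetsX k) (jetsY k))) (TK.trans (DK.scalar DK.J₁ (Jets.const K (weight k)) _)
          (Jets.jet≈ (DK.scalar K (weight k) _) (DK.scalar K (weight k) _) (DK.scalar K (weight k) _))))))) vanishing-2m

      project : ∀ (π : TK.Carrier → Carrier) → π TK.0# ≡ 0# → (∀ x y → π (x TK.+ y) ≡ π x + π y) → ∀ n f → π (TK.sum n f) ≡ K.sum n (λ k → π (f k))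
      project π π0 π+ zero    f = π0
      project π π0 π+ (suc n) f = ≡.trans (π+ _ _) (≡.cong (_+ π (f n)) (project π π0 π+ n f))

    -- The entries of orders 0 and 2 in each parameter: the value at x = y = 1, the two first
    -- derivatives in x + 1/x and y + 1/y, and the mixed one. They are exactly what the cofactor of
    -- the interpolation consists of.
    sum₀₀ : K.sum (suc (m ℕ.+ m)) (λ k → weight k * (c₀ (jetsX k) * c₀ (jetsY k))) K.≈ 0#
    sum₀₀ = K.trans (K.reflexive (≡.sym (project (λ z → c₀ (c₀ z)) ≡.refl (λ _ _ → ≡.refl) (suc (m ℕ.+ m)) matrix))) (Jets.e₀ (Jets.e₀ matrix-sum))
    sum₀₂ : K.sum (suc (m ℕ.+ m)) (λ k → weight k * (c₀ (jetsX k) * c₂ (jetsY k))) K.≈ 0#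
    sum₀₂ = K.trans (K.reflexive (≡.sym (project (λ z → c₂ (c₀ z)) ≡.refl (λ _ _ → ≡.refl) (suc (m ℕ.+ m)) matrix))) (Jets.e₂ (Jets.e₀ matrix-sum))
    sum₂₀ : K.sum (suc (m ℕ.+ m)) (λ k → weight k * (c₂ (jetsX k) * c₀ (jetsY k))) K.≈ 0#
    sum₂₀ = K.trans (K.reflexive (≡.sym (project (λ z → c₀ (c₂ z)) ≡.refl (λ _ _ → ≡.refl) (suc (m ℕ.+ m)) matrix))) (Jets.e₀ (Jets.e₂ matrix-sum))
    sum₂₂ : K.sum (suc (m ℕ.+ m)) (λ k → weight k * (c₂ (jetsX k) * c₂ (jetsY k))) K.≈ 0#
    sum₂₂ = K.trans (K.reflexive (≡.sym (project (λ z → c₂ (c₂ z)) ≡.refl (λ _ _ → ≡.refl) (suc (m ℕ.+ m)) matrix))) (Jets.e₂ (Jets.e₂ matrix-sum))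

-- Values of the sum at the interpolation nodes.

module SpecialValues (P : CommutativeRing 0ℓ 0ℓ) (q : CommutativeRing.Carrier P) (q-reg : Ring.Regular P q) (1-q^-reg : Ring.Aperiodic P q) where
  open Ring P
  open SummandIdentities P using (ringOps)
  open Factors ringOps q
  open Cleared P
  open ClearedProperties P
  open Powers P q q-reg 1-q^-reg
  open import Relation.Binary.Reasoning.Setoid setoid

  private
    e : ℕ → Carrier
    e = pow q
    e4≈ : ∀ j → sq (sq (e j)) ≈e (j ℕ.+ j) ℕ.+ (j ℕ.+ j)
    e4≈ j = (e≈ j ⊡ e≈ j) ⊡ (e≈ j ⊡ e≈ j)

  -- The sum over k ≤ n times its common denominator; in the application this n is one less than the
  -- n of the theorem. The pair (h , U) encodes y + 1/y = U/h and (h′ , U′) encodes x + 1/x.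
  total : (h U h′ U′ : Carrier) → ℕ → Carrier
  total h U h′ U′ n = sum (suc n) (λ k → w (e k) * cleared (λ i → σn h U h′ U′ (e i)) (λ i → σd h U h′ U′ (e i)) n k)

  module _ (h U : Carrier) (N : ℕ) (lower-reg : ∀ j → Regular (quad h U (zyd (e j)))) where
    private
      module S = Summand ringOps q h U q
      module QS = QuadraticSummation P q h U q
      M H : Carrier
      M = QS.M N
      H = q * M
      U′ = 1# + H * H

      κ : ℕ → Carrier
      κ i = 1# - q * sq (e i)

      -- At p = q the last factor of `num₀` is q (1 - q² t⁴), and α, β combine to the quadratic with
      -- x = q M, represented by x + 1/x = (1 + H²)/H. The last factor of `den₀` is 1 - q t², which
      -- cancels against the numerator.
      num≈ : ∀ t → S.num M t ≈ (1# - q * sq t) * σn h U H U′ t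
      num≈ t = solve 5 (λ q h U M t → let module S′ = Summand (exprOps 5) q h U q in let module F′ = Factors (exprOps 5) q ; H = q ⊗ M in
        S′.num M t ⊜ (𝟙 ⊖ q ⊗ F′.sq t) ⊗ F′.σn h U H (𝟙 ⊕ H ⊗ H) t) refl q h U M t
      den≈ : ∀ t → S.den M t ≈ (1# - q * sq t) * σd h U H U′ t
      den≈ t = solve 5 (λ q h U M t → let module S′ = Summand (exprOps 5) q h U q in let module F′ = Factors (exprOps 5) q ; H = q ⊗ M in
        S′.den M t ⊜ (𝟙 ⊖ q ⊗ F′.sq t) ⊗ F′.σd h U H (𝟙 ⊕ H ⊗ H) t) refl q h U M t

      A B C : ℕ → Carrier
      A i = 1# - QS.M i * S.q3
      B i = 1# - QS.M i * S.q5
      C i = 1# - q * QS.M i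

      Num≈ : ∀ i → S.Num (QS.M i) ≈ A i * B i * quad h U (q2 * sq (sq (e i)))
      Num≈ i = solve 4 (λ q h U t → let module S′ = Summand (exprOps 4) q h U q in let module F′ = Factors (exprOps 4) q ; M = S′.sq (S′.sq t) in
        S′.Num M ⊜ (𝟙 ⊖ M ⊗ S′.q3) ⊗ (𝟙 ⊖ M ⊗ S′.q5) ⊗ F′.quad h U (F′.q2 ⊗ F′.sq (F′.sq t))) refl q h U (e i)
      Den≈ : ∀ i → S.Den (QS.M i) ≈ A i * C i * quad h U (zyd (e i))
      Den≈ i = solve 4 (λ q h U t → let module S′ = Summand (exprOps 4) q h U q in let module F′ = Factors (exprOps 4) q ; M = S′.sq (S′.sq t) in
        S′.Den M ⊜ (𝟙 ⊖ M ⊗ S′.q3) ⊗ (𝟙 ⊖ q ⊗ M) ⊗ F′.quad h U (F′.zyd t)) refl q h U (e i)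

      telescope : ∀ n → (1# - q) * prod n B ≈ prod n C * C n
      telescope n = begin
        (1# - q) * prod n B                     ≈⟨ *-cong (+-congˡ (-‿cong (solve 1 (λ q → q ⊜ q ⊗ (𝟙 ⊗ 𝟙 ⊗ (𝟙 ⊗ 𝟙))) refl q))) (prod-cong n (λ i _ → B≈C i)) ⟩
        C 0 * prod n (λ i → C (suc i))          ≈⟨ prod-front n C ⟨
        prod n C * C n                          ∎
        where
          B≈C : ∀ i → B i ≈ C (suc i)
          B≈C i = solve 2 (λ q t → let s = λ x → x ⊗ x in 𝟙 ⊖ s (s t) ⊗ (s q ⊗ s q ⊗ q) ⊜ 𝟙 ⊖ q ⊗ s (s (q ⊗ t))) refl q (e i)

      A-reg : ∀ i → Regular (A i)
      A-reg i = 1-reg (ℕ.<-≤-trans (s≤s z≤n) (ℕ.m≤n+m 3 _)) (e4≈ i ⊡ (q≈ ⊡ q≈ ⊡ q≈))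
      C-reg : ∀ i → Regular (C i)
      C-reg i = 1-reg (s≤s z≤n) (q≈ ⊡ e4≈ i)
      κ-reg : ∀ i → Regular (κ i)
      κ-reg i = 1-reg (s≤s z≤n) (q≈ ⊡ (e≈ i ⊡ e≈ i))

      lower≈ : ∀ t → quad h U (zyd t) ≈ S.lower t
      lower≈ t = solve 4 (λ q h U t → let module S′ = Summand (exprOps 4) q h U q in let module F′ = Factors (exprOps 4) q in F′.quad h U (F′.zyd t) ⊜ S′.lower t) refl q h U t

      cl : ℕ → ℕ → Carrier
      cl = cleared (λ i → σn h U H U′ (e i)) (λ i → σd h U H U′ (e i))

      summand≈ : ∀ k → k ℕ.≤ N → QS.summand N k ≈ prod N κ * cl N k
      summand≈ k k≤N = trans (cleared-cong N k k≤N (λ i _ → num≈ (e i)) (λ i _ → den≈ (e i)))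
        (trans (cleared-* κ κ (λ i → σn h U H U′ (e i)) (λ i → σd h U H U′ (e i)) N k) (*-congʳ (cleared-same κ N k k≤N)))

      Σ₀ Ds Os : Carrier
      Σ₀ = sum (suc N) (λ k → w (e k) * cl N k)
      Ds = prod N (λ i → quad h U (zyd (e i)))
      Os = prod N (λ i → quad h U (q2 * sq (sq (e i))))

      short : Σ₀ * Ds ≈ prod N (λ i → σd h U H U′ (e i)) * (1# - H) * Os
      short = cancel (reg-* (prod-reg N (λ i _ → κ-reg i)) (reg-* (prod-reg N (λ i _ → A-reg i)) (prod-reg N (λ i _ → C-reg i)))) (begin
        κs * (As * Cs) * (Σ₀ * Ds)
          ≈⟨ *-solve 5 (λ k a c s d → k ∙ (a ∙ c) ∙ (s ∙ d) ≐ (k ∙ s) ∙ (a ∙ c ∙ d)) refl κs As Cs Σ₀ Ds ⟩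
        κs * Σ₀ * (As * Cs * Ds)
          ≈⟨ *-cong (trans (sym (sum-*ˡ (suc N) κs _)) (sum-cong (suc N) (λ k k≤N → trans
               (*-solve 3 (λ a b c → a ∙ (b ∙ c) ≐ b ∙ (a ∙ c)) refl κs (w (e k)) (cl N k)) (*-congˡ (sym (summand≈ k (ℕ.≤-pred k≤N)))))))
               (sym (trans (prod-cong N (λ i _ → Den≈ i)) (trans (prod-* N (λ i → A i * C i) _) (*-congʳ (prod-* N A C))))) ⟩
        sum (suc N) (λ k → S.w (e k) * QS.summand N k) * prod N (λ i → S.Den (QS.M i))
          ≈⟨ QS.summation q-reg 1-q^-reg (λ i → 1-reg (ℕ.<-≤-trans (s≤s z≤n) (ℕ.m≤n+m 1 i)) (e≈ i ⊡ q≈)) (λ j → reg-cong (lower≈ (e j)) (lower-reg j)) N ⟩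
        (1# - q) * QS.denominators N * prod N (λ i → S.Num (QS.M i))
          ≈⟨ *-cong (*-congˡ (trans (prod-cong N (λ i _ → den≈ (e i))) (prod-* N κ _))) (trans (prod-cong N (λ i _ → Num≈ i)) (trans (prod-* N (λ i → A i * B i) _) (*-congʳ (prod-* N A B)))) ⟩
        (1# - q) * (κs * σs) * (As * Bs * Os)
          ≈⟨ *-solve 6 (λ c k s a b o → c ∙ (k ∙ s) ∙ (a ∙ b ∙ o) ≐ (c ∙ b) ∙ (k ∙ s ∙ a ∙ o)) refl (1# - q) κs σs As Bs Os ⟩
        (1# - q) * Bs * (κs * σs * As * Os)
          ≈⟨ *-congʳ (telescope N) ⟩
        Cs * C N * (κs * σs * As * Os)
          ≈⟨ *-solve 6 (λ c cN k s a o → c ∙ cN ∙ (k ∙ s ∙ a ∙ o) ≐ k ∙ (a ∙ c) ∙ (s ∙ cN ∙ o)) refl Cs (C N) κs σs As Os ⟩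
        κs * (As * Cs) * (σs * C N * Os) ∎)
        where
          κs = prod N κ
          As = prod N A
          Bs = prod N B
          Cs = prod N C
          σs = prod N (λ i → σd h U H U′ (e i))

      σn-N≈0 : σn h U H U′ (e N) ≈ 0#
      σn-N≈0 = solve 4 (λ q h U t → let module F′ = Factors (exprOps 4) q ; H = q ⊗ F′.sq (F′.sq t) in F′.σn h U H (𝟙 ⊕ H ⊗ H) t ⊜ Κ 0ℤ) refl q h U (e N)

    -- The value at x = q^{4N+1}. There `zxn` equals H at k = N, so the sum stops, and the r further
    -- indices only enlarge the common denominator.
    value-x : ∀ r → total h U (q * sq (sq (e N))) (1# + q * sq (sq (e N)) * (q * sq (sq (e N)))) (N ℕ.+ r) * prod N (λ i → quad h U (zyd (e i)))
      ≈ prod (N ℕ.+ r) (λ i → σd h U (q * sq (sq (e N))) (1# + q * sq (sq (e N)) * (q * sq (sq (e N)))) (e i)) * (1# - q * sq (sq (e N))) * prod N (λ i → quad h U (q2 * sq (sq (e i))))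
    value-x r = begin
      total h U H U′ (N ℕ.+ r) * Ds
        ≈⟨ *-congʳ (cleared-extend (λ k → w (e k)) (λ i → σn h U H U′ (e i)) (λ i → σd h U H U′ (e i)) N r σn-N≈0) ⟩
      Σ₀ * rest * Ds
        ≈⟨ *-solve 3 (λ a b c → a ∙ b ∙ c ≐ a ∙ c ∙ b) refl Σ₀ rest Ds ⟩
      Σ₀ * Ds * rest
        ≈⟨ *-congʳ short ⟩
      σs * (1# - H) * Os * rest
        ≈⟨ *-solve 4 (λ s c o r → s ∙ c ∙ o ∙ r ≐ (s ∙ r) ∙ c ∙ o) refl σs (1# - H) Os rest ⟩
      σs * rest * (1# - H) * Os
        ≈⟨ *-congʳ (*-congʳ (prod-+ N r (λ i → σd h U H U′ (e i)))) ⟨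
      prod (N ℕ.+ r) (λ i → σd h U H U′ (e i)) * (1# - H) * Os ∎
      where
        σs = prod N (λ i → σd h U H U′ (e i))
        rest = prod r (λ i → σd h U H U′ (e (N ℕ.+ i)))

  -- Here `zyn` equals y at k = m and the sum stops; what is left is the vanishing sum for the odd
  -- number m, with q^{2k} rewritten as the square of q^k.
  value-y : ∀ l r → let m = suc (l ℕ.+ l) ; y = q * sq (e m) in total y (1# + y * y) 1# (1# + 1#) (m ℕ.+ r) ≈ 0#
  value-y l r = trans (cleared-extend (λ k → w (e k)) n d m r n≈0) (trans (*-congʳ short) (zeroˡ _))
    where
      module V = VanishingSummand ringOps q
      module VS = VanishingSum P q
      m = suc (l ℕ.+ l)
      y = q * sq (e m)
      n d : ℕ → Carrier
      n i = σn y (1# + y * y) 1# (1# + 1#) (e i)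
      d i = σd y (1# + y * y) 1# (1# + 1#) (e i)
      Q≈ : ∀ k → VS.Q k ≈ sq (e k)
      Q≈ zero    = sym (*-identityˡ _)
      Q≈ (suc k) = trans (*-congˡ (Q≈ k)) (solve 2 (λ q t → q ⊗ q ⊗ (t ⊗ t) ⊜ q ⊗ t ⊗ (q ⊗ t)) refl q (e k))
      num≈ : ∀ i → V.num (VS.y m) (VS.Q i) ≈ n i
      num≈ i = trans (num-cong (*-congˡ (Q≈ m)) (Q≈ i)) (solve 3 (λ q y t → let module V′ = VanishingSummand (exprOps 3) q in let module F′ = Factors (exprOps 3) q in
        V′.num y (t ⊗ t) ⊜ F′.σn y (𝟙 ⊕ y ⊗ y) 𝟙 (𝟙 ⊕ 𝟙) t) refl q y (e i))
        where
          num-cong : ∀ {y y′ Q Q′} → y ≈ y′ → Q ≈ Q′ → V.num y Q ≈ V.num y′ Q′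
          num-cong p r = *-cong (*-cong (*-congˡ (*-cong (+-congˡ (-‿cong (*-congˡ (*-cong r r)))) (*-cong c c))) (+-cong p (-‿cong (*-congˡ r)))) (+-congˡ (-‿cong (*-cong (*-congˡ r) p)))
            where c = +-congˡ (-‿cong (*-congˡ (*-cong r r)))
      den≈ : ∀ i → V.den (VS.y m) (VS.Q i) ≈ d i
      den≈ i = trans (den-cong (*-congˡ (Q≈ m)) (Q≈ i)) (solve 3 (λ q y t → let module V′ = VanishingSummand (exprOps 3) q in let module F′ = Factors (exprOps 3) q in
        V′.den y (t ⊗ t) ⊜ F′.σd y (𝟙 ⊕ y ⊗ y) 𝟙 (𝟙 ⊕ 𝟙) t) refl q y (e i))
        where
          den-cong : ∀ {y y′ Q Q′} → y ≈ y′ → Q ≈ Q′ → V.den y Q ≈ V.den y′ Q′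
          den-cong p r = *-cong (*-cong (*-cong (+-congˡ (-‿cong (*-congˡ (*-cong r r)))) (*-cong c c)) (+-congˡ (-‿cong (*-cong (*-congˡ (*-cong r r)) p)))) (+-cong p (-‿cong (*-congˡ (*-cong r r))))
            where c = +-congˡ (-‿cong (*-congˡ r))
      n≈0 : n m ≈ 0#
      n≈0 = solve 2 (λ q t → let module F′ = Factors (exprOps 2) q ; y = q ⊗ F′.sq t in F′.σn y (𝟙 ⊕ y ⊗ y) 𝟙 (𝟙 ⊕ 𝟙) t ⊜ Κ 0ℤ) refl q (e m)
      short : sum (suc m) (λ k → w (e k) * cleared n d m k) ≈ 0#
      short = trans (sum-cong (suc m) (λ k k≤m → sym (*-cong (+-congˡ (-‿cong (*-congˡ (*-cong (*-cong (Q≈ k) (Q≈ k)) (Q≈ k)))))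
          (cleared-cong m k (ℕ.≤-pred k≤m) (λ i _ → num≈ i) (λ i _ → den≈ i)))))
        (VS.vanishing q-reg 1-q^-reg l)

-- Interpolation in x + 1/x and y + 1/y.

module Interpolation (P : CommutativeRing 0ℓ 0ℓ) (_≈′_ : Coarser.Relation P) (isCommutativeRing′ : Coarser.IsRing P _≈′_) (coarsen : Coarser.Coarsens P _≈′_) where
  open CommutativeRing P

  open Coarsening P _≈′_ isCommutativeRing′ coarsen
  private
    module P = Ring P
    module K = Ring K
    module DK = DoubleJets K
    module J = Ring DK.J₁
    opsP = SummandIdentities.ringOps P
  open P using (solve; _⊜_; pow)

  -- An element x, depending on h and ω, with x = hⁱ c₀ g + ω (c₂ g + …).
  record Expands (h ω : Carrier) (i : ℕ) (x : Carrier) (g : Jet Carrier) : Set where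
    constructor expands
    field
      ψ      : Carrier
      exact  : x P.≈ pow h i * c₀ g + ω * ψ
      second : ψ K.≈ c₂ g
      first  : c₁ g K.≈ 0#

  module _ {h ω : Carrier} (h≈1 : h K.≈ 1#) (ω≈0 : ω K.≈ 0#) where
    private
      pow≈1 : ∀ i → K.pow h i K.≈ 1#
      pow≈1 zero    = K.refl
      pow≈1 (suc i) = K.trans (K.*-cong h≈1 (pow≈1 i)) (K.*-identityˡ 1#)

    -- The coefficient c₂ of a product contains the product of the two coefficients c₁. It drops out
    -- because both are zero in K, and for this purpose `Expands` carries `first`.
    expands-* : ∀ {i j x y g g′} → Expands h ω i x g → Expands h ω j y g′ → Expands h ω (i ℕ.+ j) (x * y) (g J.* g′)
    expands-* {i} {j} {x} {y} {g} {g′} (expands ψ x≈ ψ≈ g₁≈0) (expands ψ′ y≈ ψ′≈ g′₁≈0) = expands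
      (pow h i * c₀ g * ψ′ + ψ * (pow h j * c₀ g′) + ω * ψ * ψ′)
      (P.trans (P.*-cong x≈ y≈) (P.trans
        (solve 7 (λ a c ω ψ b d ψ′ → (a ⊗ c ⊕ ω ⊗ ψ) ⊗ (b ⊗ d ⊕ ω ⊗ ψ′) ⊜ a ⊗ b ⊗ (c ⊗ d) ⊕ ω ⊗ (a ⊗ c ⊗ ψ′ ⊕ ψ ⊗ (b ⊗ d) ⊕ ω ⊗ ψ ⊗ ψ′)) P.refl
          (pow h i) (c₀ g) ω ψ (pow h j) (c₀ g′) ψ′)
        (P.+-congʳ (P.*-congʳ (P.sym (P.pow-+ h i j))))))
      (K.trans (K.+-cong (K.+-cong (K.*-cong (K.trans (K.*-congʳ (pow≈1 i)) (K.*-identityˡ _)) ψ′≈) (K.*-cong ψ≈ (K.trans (K.*-congʳ (pow≈1 j)) (K.*-identityˡ _))))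
          (K.trans (K.*-congʳ (K.trans (K.*-congʳ ω≈0) (K.zeroˡ ψ))) (K.zeroˡ ψ′)))
        (K.trans (K.solve 4 (λ a b c d → a ⊗ b ⊕ c ⊗ d ⊕ Κ 0ℤ K.⊜ a ⊗ b ⊕ Κ 0ℤ ⊗ Κ 0ℤ ⊕ c ⊗ d) K.refl (c₀ g) (c₂ g′) (c₂ g) (c₀ g′))
          (K.+-congʳ (K.+-congˡ (K.*-cong (K.sym g₁≈0) (K.sym g′₁≈0))))))
      (K.trans (K.+-cong (K.*-congˡ g′₁≈0) (K.*-congʳ g₁≈0)) (K.solve 2 (λ a b → a ⊗ Κ 0ℤ ⊕ Κ 0ℤ ⊗ b K.⊜ Κ 0ℤ) K.refl (c₀ g) (c₀ g′)))

    expands-prod : ∀ n {f g} → (∀ i → Expands h ω 1 (f i) (g i)) → Expands h ω n (P.prod n f) (J.prod n g)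
    expands-prod zero    ex = expands 0# (solve 1 (λ ω → 𝟙 ⊜ 𝟙 ⊗ 𝟙 ⊕ ω ⊗ Κ 0ℤ) P.refl ω) K.refl K.refl
    expands-prod (suc n) {f} {g} ex = ≡.subst (λ i → Expands h ω i (P.prod (suc n) f) (J.prod (suc n) g)) (ℕ.+-comm n 1) (expands-* (expands-prod n ex) (ex n))

    expands-cleared : ∀ {f f′ g g′} m k → k ℕ.≤ m → (∀ i → Expands h ω 1 (f i) (g i)) → (∀ i → Expands h ω 1 (f′ i) (g′ i)) →
      Expands h ω m (Cleared.cleared P f f′ m k) (Cleared.cleared DK.J₁ g g′ m k)
    expands-cleared {f} {f′} {g} {g′} m k k≤m ex ex′ = ≡.subst (λ i → Expands h ω i (Cleared.cleared P f f′ m k) (Cleared.cleared DK.J₁ g g′ m k)) (ℕ.m+[n∸m]≡n k≤m)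
      (expands-* (expands-prod k ex) (expands-prod (m ℕ.∸ k) (λ i → ex′ (k ℕ.+ i))))

  -- H (1 + z²) - z (1 + H²) = H (1 - z)² - z (1 - H)²: an exact expansion in (1 - H)², and its
  -- coefficients are those of `quadJet`.
  expands-quad : ∀ q H z → Expands H ((1# - H) * (1# - H)) 1 (Factors.quad opsP q H (1# + H * H) z) (DK.quadJet z)
  expands-quad q H z = expands (- z)
    (solve 2 (λ H z → H ⊗ (𝟙 ⊕ z ⊗ z) ⊖ z ⊗ (𝟙 ⊕ H ⊗ H) ⊜ H ⊗ 𝟙 ⊗ (𝟙 ⊗ (𝟙 ⊕ z ⊗ z) ⊖ z ⊗ (𝟙 ⊕ 𝟙)) ⊕ (𝟙 ⊖ H) ⊗ (𝟙 ⊖ H) ⊗ ⊝ z) P.refl H z)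
    K.refl K.refl

  c₀-prod : ∀ n f → c₀ (J.prod n f) ≡ P.prod n (λ i → c₀ (f i))
  c₀-prod zero    f = ≡.refl
  c₀-prod (suc n) f = ≡.cong (_* c₀ (f n)) (c₀-prod n f)

  c₀-cleared : ∀ f g m k → c₀ (Cleared.cleared DK.J₁ f g m k) ≡ Cleared.cleared P (λ i → c₀ (f i)) (λ i → c₀ (g i)) m k
  c₀-cleared f g m k = ≡.cong₂ _*_ (c₀-prod k f) (c₀-prod (m ℕ.∸ k) (λ i → g (k ℕ.+ i)))

  -- With a = c₀ g at the base point and a′ elsewhere, D a - D₀ a′ is a multiple of ω.
  module _ {h ω : Carrier} {m : ℕ} {D a : Carrier} {gD g : Jet Carrier} (eD : Expands h ω m D gD) (ea : Expands h ω m a g) where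
    private
      module D = Expands eD
      module A = Expands ea
    slope : Carrier
    slope = D.ψ * c₀ g - c₀ gD * A.ψ

    slope-exact : D * c₀ g P.≈ c₀ gD * a + ω * slope
    slope-exact = P.trans (P.*-congʳ D.exact) (P.trans
      (solve 6 (λ hm d ω ψ b ψ′ → (hm ⊗ d ⊕ ω ⊗ ψ) ⊗ b ⊜ d ⊗ (hm ⊗ b ⊕ ω ⊗ ψ′) ⊕ ω ⊗ (ψ ⊗ b ⊖ d ⊗ ψ′)) P.refl (pow h m) (c₀ gD) ω D.ψ (c₀ g) A.ψ)
      (P.+-congʳ (P.*-congˡ (P.sym A.exact))))

    slope≈ : slope K.≈ c₂ gD * c₀ g - c₀ gD * c₂ g
    slope≈ = K.+-cong (K.*-congʳ D.second) (K.-‿cong (K.*-congˡ A.second))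

  module _ (q : Carrier) (m : ℕ) (0<m : 0 ℕ.< m)
    (q-reg : P.Regular q) (1-q^-reg : ∀ i → 0 ℕ.< i → P.Regular (1# - P.pow q i))
    (q^n≈1 : K.pow q (suc (m ℕ.+ m)) K.≈ 1#)
    (1-q^j-reg  : ∀ j → 0 ℕ.< j → j ℕ.≤ m ℕ.+ m → K.Regular (1# - P.pow q j))
    (1-q^2j-reg : ∀ j → 0 ℕ.< j → j ℕ.≤ m ℕ.+ m → K.Regular (1# - P.pow q (j ℕ.+ j)))
    (H Y : Carrier) (H≈1 : H K.≈ 1#) (Y≈1 : Y K.≈ 1#)
    where
    open SpecialValues P q q-reg 1-q^-reg using (total)
    private
      module F = Factors opsP q
      n = m ℕ.+ m
      two U V ωx ωy : Carrier
      two = 1# + 1#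
      U = 1# + H * H
      V = 1# + Y * Y
      ωx = (1# - H) * (1# - H)
      ωy = (1# - Y) * (1# - Y)
      e : ℕ → Carrier
      e = P.pow q

      X Y′ : Carrier → Carrier → ℕ → Carrier
      X h u = Cleared.cleared P (λ i → F.quad h u (F.zxn (e i))) (λ i → F.quad h u (F.zxd (e i))) n
      Y′ h u = Cleared.cleared P (λ i → F.quad h u (F.zyn (e i))) (λ i → F.quad h u (F.zyd (e i))) n
      gX gY : ℕ → Jet Carrier
      gX = jetsX q m 0<m q-reg 1-q^-reg q^n≈1 1-q^j-reg 1-q^2j-reg
      gY = jetsY q m 0<m q-reg 1-q^-reg q^n≈1 1-q^j-reg 1-q^2j-reg
      W : ℕ → Carrier
      W = weight q m 0<m q-reg 1-q^-reg q^n≈1 1-q^j-reg 1-q^2j-reg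
      gDX gDY : Jet Carrier
      gDX = J.prod n (λ i → DK.quadJet (F.zxd (e i)))
      gDY = J.prod n (λ i → DK.quadJet (F.zyd (e i)))

      ω≈0 : ∀ {H} → H K.≈ 1# → (1# - H) * (1# - H) K.≈ 0#
      ω≈0 p = K.trans (K.*-congʳ (K.x≈y⇒x-y≈0 (K.sym p))) (K.zeroˡ _)

    D₀ D₁ E₀ E₁ : Carrier
    D₀ = P.prod n (λ i → F.quad 1# two (F.zxd (e i)))
    D₁ = P.prod n (λ i → F.quad H U (F.zxd (e i)))
    E₀ = P.prod n (λ i → F.quad 1# two (F.zyd (e i)))
    E₁ = P.prod n (λ i → F.quad Y V (F.zyd (e i)))

    private
      exD : Expands H ωx n D₁ gDX
      exD = expands-prod H≈1 (ω≈0 H≈1) n (λ i → expands-quad q H (F.zxd (e i)))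
      exE : Expands Y ωy n E₁ gDY
      exE = expands-prod Y≈1 (ω≈0 Y≈1) n (λ i → expands-quad q Y (F.zyd (e i)))
      exX : ∀ k → k ℕ.≤ n → Expands H ωx n (X H U k) (gX k)
      exX k k≤n = expands-cleared H≈1 (ω≈0 H≈1) n k k≤n (λ i → expands-quad q H (F.zxn (e i))) (λ i → expands-quad q H (F.zxd (e i)))
      exY : ∀ k → k ℕ.≤ n → Expands Y ωy n (Y′ Y V k) (gY k)
      exY k k≤n = expands-cleared Y≈1 (ω≈0 Y≈1) n k k≤n (λ i → expands-quad q Y (F.zyn (e i))) (λ i → expands-quad q Y (F.zyd (e i)))

      D₀≡ : c₀ gDX ≡ D₀
      D₀≡ = c₀-prod n (λ i → DK.quadJet (F.zxd (e i)))
      E₀≡ : c₀ gDY ≡ E₀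
      E₀≡ = c₀-prod n (λ i → DK.quadJet (F.zyd (e i)))
      X₀≡ : ∀ k → c₀ (gX k) ≡ X 1# two k
      X₀≡ = c₀-cleared (λ i → DK.quadJet (F.zxn (e i))) (λ i → DK.quadJet (F.zxd (e i))) n
      Y₀≡ : ∀ k → c₀ (gY k) ≡ Y′ 1# two k
      Y₀≡ = c₀-cleared (λ i → DK.quadJet (F.zyn (e i))) (λ i → DK.quadJet (F.zyd (e i))) n

      -- The expansions are available only for k ≤ n. The value 0 beyond n never enters a sum.
      sX sY : ∀ k → Carrier
      sX k with k ℕ.≤? n
      ... | yes k≤n = slope exD (exX k k≤n)
      ... | no _    = 0#
      sY k with k ℕ.≤? n
      ... | yes k≤n = slope exE (exY k k≤n)
      ... | no _    = 0#

      sX-exact : ∀ k → k ℕ.≤ n → D₁ * X 1# two k P.≈ D₀ * X H U k + ωx * sX k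
      sX-exact k k≤n with k ℕ.≤? n
      ... | yes k≤n = P.trans (P.*-congˡ (P.reflexive (≡.sym (X₀≡ k)))) (P.trans (slope-exact exD (exX k k≤n)) (P.+-congʳ (P.*-congʳ (P.reflexive D₀≡))))
      ... | no  k≰n = ⊥-elim (k≰n k≤n)
      sY-exact : ∀ k → k ℕ.≤ n → E₁ * Y′ 1# two k P.≈ E₀ * Y′ Y V k + ωy * sY k
      sY-exact k k≤n with k ℕ.≤? n
      ... | yes k≤n = P.trans (P.*-congˡ (P.reflexive (≡.sym (Y₀≡ k)))) (P.trans (slope-exact exE (exY k k≤n)) (P.+-congʳ (P.*-congʳ (P.reflexive E₀≡))))
      ... | no  k≰n = ⊥-elim (k≰n k≤n)

      sX≈ : ∀ k → k ℕ.≤ n → sX k K.≈ c₂ gDX * c₀ (gX k) - c₀ gDX * c₂ (gX k)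
      sX≈ k k≤n with k ℕ.≤? n
      ... | yes k≤n = slope≈ exD (exX k k≤n)
      ... | no  k≰n = ⊥-elim (k≰n k≤n)
      sY≈ : ∀ k → k ℕ.≤ n → sY k K.≈ c₂ gDY * c₀ (gY k) - c₀ gDY * c₂ (gY k)
      sY≈ k k≤n with k ℕ.≤? n
      ... | yes k≤n = slope≈ exE (exY k k≤n)
      ... | no  k≰n = ⊥-elim (k≰n k≤n)

      split : ∀ h u h′ u′ → total h u h′ u′ n P.≈ P.sum (suc n) (λ k → W k * (X h′ u′ k * Y′ h u k))
      split h u h′ u′ = P.sum-cong (suc n) (λ k _ → P.trans (P.*-congˡ (P.trans
          (cleared-* (λ i → F.τn (e i) * F.quad h u (F.zyn (e i))) (λ i → F.τd (e i) * F.quad h u (F.zyd (e i))) (λ i → F.quad h′ u′ (F.zxn (e i))) (λ i → F.quad h′ u′ (F.zxd (e i))) n k)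
          (P.*-congʳ (cleared-* (λ i → F.τn (e i)) (λ i → F.τd (e i)) (λ i → F.quad h u (F.zyn (e i))) (λ i → F.quad h u (F.zyd (e i))) n k))))
          (P.*-solve 4 (λ w t y x → w P.∙ (t P.∙ y P.∙ x) P.≐ w P.∙ t P.∙ (x P.∙ y)) P.refl (F.w (e k)) _ (Y′ h u k) (X h′ u′ k)))
        where open ClearedProperties P

      linear : ∀ N a b f g → a * P.sum N f + b * P.sum N g P.≈ P.sum N (λ k → a * f k + b * g k)
      linear N a b f g = P.sym (P.trans (P.sum-+ N _ _) (P.+-cong (P.sum-*ˡ N a f) (P.sum-*ˡ N b g)))

    Ψ : Carrier
    Ψ = P.sum (suc n) (λ k → W k * (sX k * sY k))

    -- For each k this is (a + u)(b + v) + a b = a (b + v) + (a + u) b + u v, where u and v are the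
    -- increments of the factors in x and in y, multiples of `ωx` and `ωy`. The products D₀, D₁, E₀,
    -- E₁ compensate for the different common denominators at the nodes.
    interpolation : D₁ * E₁ * total 1# two 1# two n + D₀ * E₀ * total Y V H U n
      P.≈ D₀ * E₁ * total 1# two H U n + D₁ * E₀ * total Y V 1# two n + ωx * ωy * Ψ
    interpolation = P.trans (P.+-cong (P.*-congˡ (split 1# two 1# two)) (P.*-congˡ (split Y V H U))) (P.trans (linear (suc n) _ _ _ _)
      (P.trans (P.sum-cong (suc n) (λ k k≤n → pointwise k (ℕ.≤-pred k≤n)))
      (P.sym (P.trans (P.+-cong (P.trans (P.+-cong (P.*-congˡ (split 1# two H U)) (P.*-congˡ (split Y V 1# two))) (linear (suc n) _ _ _ _))
          (P.sym (P.sum-*ˡ (suc n) (ωx * ωy) _)))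
        (P.sym (P.sum-+ (suc n) _ _))))))
      where
        pointwise : ∀ k → k ℕ.≤ n → D₁ * E₁ * (W k * (X 1# two k * Y′ 1# two k)) + D₀ * E₀ * (W k * (X H U k * Y′ Y V k))
          P.≈ D₀ * E₁ * (W k * (X H U k * Y′ 1# two k)) + D₁ * E₀ * (W k * (X 1# two k * Y′ Y V k)) + ωx * ωy * (W k * (sX k * sY k))
        pointwise k k≤n = P.trans
          (solve 9 (λ D₁ E₁ w x y D₀ E₀ x′ y′ → D₁ ⊗ E₁ ⊗ (w ⊗ (x ⊗ y)) ⊕ D₀ ⊗ E₀ ⊗ (w ⊗ (x′ ⊗ y′)) ⊜ w ⊗ ((D₁ ⊗ x) ⊗ (E₁ ⊗ y) ⊕ (D₀ ⊗ x′) ⊗ (E₀ ⊗ y′))) P.refl D₁ E₁ w x y D₀ E₀ x′ y′)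
          (P.trans (P.*-congˡ (P.+-congʳ (P.*-cong eX eY)))
          (P.trans (solve 7 (λ w a b ωx ωy s t → w ⊗ ((a ⊕ ωx ⊗ s) ⊗ (b ⊕ ωy ⊗ t) ⊕ a ⊗ b) ⊜ w ⊗ (a ⊗ (b ⊕ ωy ⊗ t) ⊕ (a ⊕ ωx ⊗ s) ⊗ b ⊕ ωx ⊗ ωy ⊗ (s ⊗ t))) P.refl w (D₀ * x′) (E₀ * y′) ωx ωy (sX k) (sY k))
          (P.trans (P.*-congˡ (P.+-congʳ (P.+-cong (P.*-congˡ (P.sym eY)) (P.*-congʳ (P.sym eX)))))
          (solve 11 (λ w D₀ x′ E₁ y D₁ x E₀ y′ ω s → w ⊗ (D₀ ⊗ x′ ⊗ (E₁ ⊗ y) ⊕ D₁ ⊗ x ⊗ (E₀ ⊗ y′) ⊕ ω ⊗ s)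
             ⊜ D₀ ⊗ E₁ ⊗ (w ⊗ (x′ ⊗ y)) ⊕ D₁ ⊗ E₀ ⊗ (w ⊗ (x ⊗ y′)) ⊕ ω ⊗ (w ⊗ s)) P.refl w D₀ x′ E₁ y D₁ x E₀ y′ (ωx * ωy) (sX k * sY k)))))
          where
            w = W k
            x = X 1# two k
            y = Y′ 1# two k
            x′ = X H U k
            y′ = Y′ Y V k
            eX = sX-exact k k≤n
            eY = sY-exact k k≤n

    -- In K each slope is a combination of the coefficients c₀ and c₂ of its jet, with factors that
    -- do not depend on k. Multiplying out gives four sums, each an entry of the vanishing double
    -- jet.
    Ψ≈0 : Ψ K.≈ 0#
    Ψ≈0 = K.trans (K.sum-cong (suc n) (λ k k≤n → expand k (ℕ.≤-pred k≤n)))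
      (K.trans (K.sum-+ (suc n) _ _) (K.trans (K.+-cong
        (K.trans (K.sum-+ (suc n) _ _) (K.trans (K.+-cong (zero-sum (c₂ gDX * c₂ gDY) _ (sum₀₀ q m 0<m q-reg 1-q^-reg q^n≈1 1-q^j-reg 1-q^2j-reg)) (zero-sum (- (c₂ gDX * c₀ gDY)) _ (sum₀₂ q m 0<m q-reg 1-q^-reg q^n≈1 1-q^j-reg 1-q^2j-reg))) (K.+-identityˡ 0#)))
        (K.trans (K.sum-+ (suc n) _ _) (K.trans (K.+-cong (zero-sum (- (c₀ gDX * c₂ gDY)) _ (sum₂₀ q m 0<m q-reg 1-q^-reg q^n≈1 1-q^j-reg 1-q^2j-reg)) (zero-sum (c₀ gDX * c₀ gDY) _ (sum₂₂ q m 0<m q-reg 1-q^-reg q^n≈1 1-q^j-reg 1-q^2j-reg))) (K.+-identityˡ 0#))))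
      (K.+-identityˡ 0#)))
      where
        zero-sum : ∀ a f → K.sum (suc n) f K.≈ 0# → K.sum (suc n) (λ k → a * f k) K.≈ 0#
        zero-sum a f p = K.trans (K.sum-*ˡ (suc n) a f) (K.trans (K.*-congˡ p) (K.zeroʳ a))
        expand : ∀ k → k ℕ.≤ n → W k * (sX k * sY k) K.≈
            c₂ gDX * c₂ gDY * (W k * (c₀ (gX k) * c₀ (gY k))) + - (c₂ gDX * c₀ gDY) * (W k * (c₀ (gX k) * c₂ (gY k)))
          + (- (c₀ gDX * c₂ gDY) * (W k * (c₂ (gX k) * c₀ (gY k))) + c₀ gDX * c₀ gDY * (W k * (c₂ (gX k) * c₂ (gY k))))
        expand k k≤n = K.trans (K.*-congˡ (K.*-cong (sX≈ k k≤n) (sY≈ k k≤n)))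
          (K.solve 9 (λ w d₂ x₀ d₀ x₂ d₂′ y₀ d₀′ y₂ → w ⊗ ((d₂ ⊗ x₀ ⊖ d₀ ⊗ x₂) ⊗ (d₂′ ⊗ y₀ ⊖ d₀′ ⊗ y₂))
             K.⊜ d₂ ⊗ d₂′ ⊗ (w ⊗ (x₀ ⊗ y₀)) ⊕ ⊝ (d₂ ⊗ d₀′) ⊗ (w ⊗ (x₀ ⊗ y₂)) ⊕ (⊝ (d₀ ⊗ d₂′) ⊗ (w ⊗ (x₂ ⊗ y₀)) ⊕ d₀ ⊗ d₀′ ⊗ (w ⊗ (x₂ ⊗ y₂)))) K.refl
             (W k) (c₂ gDX) (c₀ (gX k)) (c₀ gDX) (c₂ (gX k)) (c₂ gDY) (c₀ (gY k)) (c₀ gDY) (c₂ (gY k)))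

-- The congruence modulo a fifth power, in an abstract ring.

-- Congruences modulo Φ (≈₁) and modulo Φ⁵ (≈₅), for n = 4l + 3 = 2m + 1.
module FifthPower (P : CommutativeRing 0ℓ 0ℓ) (_≈₁_ _≈₅_ : Coarser.Relation P) (isCommutativeRing₁ : Coarser.IsRing P _≈₁_)
  (isCommutativeRing₅ : Coarser.IsRing P _≈₅_) (coarsen₁ : Coarser.Coarsens P _≈₁_) (coarsen₅ : Coarser.Coarsens P _≈₅_) where
  open CommutativeRing P

  private
    K₅ : CommutativeRing 0ℓ 0ℓ
    K₅ = record { isCommutativeRing = isCommutativeRing₅ }
    module P = Ring P
    module K₁ = Ring (Coarsening.K P _≈₁_ isCommutativeRing₁ coarsen₁)
    module K₅ = Ring K₅
    module I = Interpolation P _≈₁_ isCommutativeRing₁ coarsen₁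
    ops = SummandIdentities.ringOps P
  open P using (solve; _⊜_; pow; prod; *-solve; _≐_; _∙_)

  half : ℕ → ℕ
  half l = suc (l ℕ.+ l)

  1-q^n : Carrier → ℕ → Carrier
  1-q^n q l = 1# - q * (pow q (half l) * pow q (half l))

  module _ (q : Carrier) (l : ℕ) (q-reg : P.Regular q) (1-q^-reg : P.Aperiodic q)
    (q^n≈1 : pow q (suc (half l ℕ.+ half l)) K₁.≈ 1#)
    (1-q^j-reg  : ∀ j → 0 ℕ.< j → j ℕ.≤ half l ℕ.+ half l → K₁.Regular (1# - pow q j))
    (1-q^2j-reg : ∀ j → 0 ℕ.< j → j ℕ.≤ half l ℕ.+ half l → K₁.Regular (1# - pow q (j ℕ.+ j)))
    (1-q^4j-reg : ∀ j → 0 ℕ.< j → j ℕ.≤ half l ℕ.+ half l → K₁.Regular (1# - pow q ((j ℕ.+ j) ℕ.+ (j ℕ.+ j))))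
    (reg-lift : ∀ {x} → K₁.Regular x → K₅.Regular x)
    (lift : ∀ {x} → x K₁.≈ 0# → 1-q^n q l * 1-q^n q l * (1-q^n q l * 1-q^n q l) * x K₅.≈ 0#)
    where
    open SpecialValues P q q-reg 1-q^-reg using (total; value-x; value-y)
    open Powers P q q-reg 1-q^-reg
    private
      module F = Factors ops q
      m N n : ℕ
      m = half l
      N = m ℕ.+ suc l
      n = m ℕ.+ m
      e : ℕ → Carrier
      e = pow q
      Y two H U V D : Carrier
      Y = q * (pow q m * pow q m)
      two = 1# + 1#
      H = q * F.sq (F.sq (e N))
      U = 1# + H * H
      V = 1# + Y * Y
      D = 1# - Y

      Y≈e : Y ≈e suc (m ℕ.+ m)
      Y≈e = q≈ ⊡ (e≈ m ⊡ e≈ m)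

      -- 4N + 1 = 3 (2m + 1), as m = 2l + 1 and N = 3l + 2.
      H≈Y³ : H ≈ Y * Y * Y
      H≈Y³ = P.trans (proof (q≈ ⊡ ((e≈ N ⊡ e≈ N) ⊡ (e≈ N ⊡ e≈ N)))) (P.trans (P.reflexive (≡.cong e (exponents l))) (P.sym (proof (Y≈e ⊡ Y≈e ⊡ Y≈e))))
        where
          exponents : ∀ l → let m = suc (l ℕ.+ l) ; N = m ℕ.+ suc l ; k = suc (m ℕ.+ m) in 1 ℕ.+ ((N ℕ.+ N) ℕ.+ (N ℕ.+ N)) ≡ k ℕ.+ k ℕ.+ k
          exponents = solve-∀

      Y≈1 : Y K₁.≈ 1#
      Y≈1 = K₁.trans (coarsen₁ (proof Y≈e)) q^n≈1
      H≈1 : H K₁.≈ 1#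
      H≈1 = K₁.trans (coarsen₁ H≈Y³) (K₁.trans (K₁.*-cong (K₁.*-cong Y≈1 Y≈1) Y≈1) (K₁.trans (K₁.*-congʳ (K₁.*-identityˡ _)) (K₁.*-identityˡ _)))

      N+l≡n : N ℕ.+ l ≡ n
      N+l≡n = ℕ.+-assoc m (suc l) l

      1-z² : ∀ z → F.quad 1# two z ≈ (1# - z) * (1# - z)
      1-z² = solve 1 (λ z → 𝟙 ⊗ (𝟙 ⊕ z ⊗ z) ⊖ z ⊗ (𝟙 ⊕ 𝟙) ⊜ (𝟙 ⊖ z) ⊗ (𝟙 ⊖ z)) P.refl

      zyd≈ : ∀ j → F.zyd (e j) ≈e 4 ℕ.+ ((j ℕ.+ j) ℕ.+ (j ℕ.+ j))
      zyd≈ j = (q≈ ⊡ q≈) ⊡ (q≈ ⊡ q≈) ⊡ ((e≈ j ⊡ e≈ j) ⊡ (e≈ j ⊡ e≈ j))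

      lower-reg₀ : ∀ j → P.Regular (F.quad 1# two (F.zyd (e j)))
      lower-reg₀ j = P.reg-cong (P.sym (1-z² _)) (P.reg-* r r)
        where r = 1-reg (s≤s z≤n) (zyd≈ j)

      lower-reg₁ : ∀ j → P.Regular (F.quad Y V (F.zyd (e j)))
      lower-reg₁ j = P.reg-cong (solve 2 (λ y z → (y ⊖ z) ⊗ (𝟙 ⊖ y ⊗ z) ⊜ y ⊗ (𝟙 ⊕ z ⊗ z) ⊖ z ⊗ (𝟙 ⊕ y ⊗ y)) P.refl Y (F.zyd (e j)))
        (P.reg-* (≢-reg odd≢even Y≈e (zyd≈ j)) (1-reg (s≤s z≤n) (Y≈e ⊡ zyd≈ j)))
        where
          odd≢even : ¬ suc (m ℕ.+ m) ≡ 4 ℕ.+ ((j ℕ.+ j) ℕ.+ (j ℕ.+ j))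
          odd≢even eq = ℕ.even≢odd (2 ℕ.+ (j ℕ.+ j)) m (≡.trans (double j) (≡.trans (≡.sym eq) (≡.cong (λ k → suc (m ℕ.+ k)) (≡.sym (ℕ.+-identityʳ m)))))
            where
              double : ∀ j → 2 ℕ.* (2 ℕ.+ (j ℕ.+ j)) ≡ 4 ℕ.+ ((j ℕ.+ j) ℕ.+ (j ℕ.+ j))
              double = solve-∀

      Τ D₀ D₁ E₀ E₁ L₀ L₁ O₀ O₁ : Carrier
      Τ  = prod n (λ i → F.τd (e i))
      D₀ = prod n (λ i → F.quad 1# two (F.zxd (e i)))
      D₁ = prod n (λ i → F.quad H U (F.zxd (e i)))
      E₀ = prod n (λ i → F.quad 1# two (F.zyd (e i)))
      E₁ = prod n (λ i → F.quad Y V (F.zyd (e i)))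
      L₀ = prod N (λ i → F.quad 1# two (F.zyd (e i)))
      L₁ = prod N (λ i → F.quad Y V (F.zyd (e i)))
      O₀ = prod N (λ i → F.quad 1# two (F.q2 * F.sq (F.sq (e i))))
      O₁ = prod N (λ i → F.quad Y V (F.q2 * F.sq (F.sq (e i))))

      full : ∀ h u h′ u′ → prod (N ℕ.+ l) (λ i → F.σd h u h′ u′ (e i)) ≈ Τ * prod n (λ i → F.quad h u (F.zyd (e i))) * prod n (λ i → F.quad h′ u′ (F.zxd (e i)))
      full h u h′ u′ = P.trans (P.reflexive (≡.cong (λ k → prod k (λ i → F.σd h u h′ u′ (e i))) N+l≡n))
        (P.trans (P.prod-* n (λ i → F.τd (e i) * F.quad h u (F.zyd (e i))) (λ i → F.quad h′ u′ (F.zxd (e i)))) (P.*-congʳ (P.prod-* n (λ i → F.τd (e i)) (λ i → F.quad h u (F.zyd (e i))))))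

      S₀₀ S₁₀ S₀₁ S₁₁ : Carrier
      S₀₀ = total 1# two 1# two n
      S₁₀ = total 1# two H U n
      S₀₁ = total Y V 1# two n
      S₁₁ = total Y V H U n

      value₁₀ : S₁₀ * L₀ ≈ Τ * E₀ * D₁ * (1# - H) * O₀
      value₁₀ = P.trans (P.*-congʳ (P.reflexive (≡.cong (total 1# two H U) (≡.sym N+l≡n)))) (P.trans (value-x 1# two N lower-reg₀ l) (P.*-congʳ (P.*-congʳ (full 1# two H U))))
      value₁₁ : S₁₁ * L₁ ≈ Τ * E₁ * D₁ * (1# - H) * O₁
      value₁₁ = P.trans (P.*-congʳ (P.reflexive (≡.cong (total Y V H U) (≡.sym N+l≡n)))) (P.trans (value-x Y V N lower-reg₁ l) (P.*-congʳ (P.*-congʳ (full Y V H U))))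
      value₀₁ : S₀₁ ≈ 0#
      value₀₁ = value-y l m

      ωx ωy Ψ : Carrier
      ωx = (1# - H) * (1# - H)
      ωy = D * D
      Ψ = I.Ψ q m (s≤s z≤n) q-reg 1-q^-reg q^n≈1 1-q^j-reg 1-q^2j-reg H Y H≈1 Y≈1

      interpolation : D₁ * E₁ * S₀₀ + D₀ * E₀ * S₁₁ ≈ D₀ * E₁ * S₁₀ + D₁ * E₀ * S₀₁ + ωx * ωy * Ψ
      interpolation = I.interpolation q m (s≤s z≤n) q-reg 1-q^-reg q^n≈1 1-q^j-reg 1-q^2j-reg H Y H≈1 Y≈1

      combined : D₁ * E₁ * (S₀₀ * (L₀ * L₁)) ≈ D₁ * E₁ * (Τ * E₀ * D₀ * (1# - H) * (O₀ * L₁ - O₁ * L₀)) + ωx * ωy * Ψ * (L₀ * L₁)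
      combined = begin
        a * (S₀₀ * (L₀ * L₁))
          ≈⟨ solve 6 (λ a s b s₁ L₀ L₁ → a ⊗ (s ⊗ (L₀ ⊗ L₁)) ⊜ (a ⊗ s ⊕ b ⊗ s₁) ⊗ (L₀ ⊗ L₁) ⊖ b ⊗ (s₁ ⊗ L₁) ⊗ L₀) P.refl a S₀₀ b S₁₁ L₀ L₁ ⟩
        (a * S₀₀ + b * S₁₁) * (L₀ * L₁) - b * (S₁₁ * L₁) * L₀
          ≈⟨ P.+-cong (P.*-congʳ (P.trans interpolation (P.+-congʳ (P.+-congˡ (P.trans (P.*-congˡ value₀₁) (P.zeroʳ _)))))) (P.-‿cong (P.*-congʳ (P.*-congˡ value₁₁))) ⟩
        (D₀ * E₁ * S₁₀ + 0# + ψ) * (L₀ * L₁) - b * (Τ * E₁ * D₁ * (1# - H) * O₁) * L₀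
          ≈⟨ solve 6 (λ c s ψ L₀ L₁ d → (c ⊗ s ⊕ Κ 0ℤ ⊕ ψ) ⊗ (L₀ ⊗ L₁) ⊖ d ⊜ c ⊗ (s ⊗ L₀) ⊗ L₁ ⊖ d ⊕ ψ ⊗ (L₀ ⊗ L₁)) P.refl (D₀ * E₁) S₁₀ ψ L₀ L₁ (b * (Τ * E₁ * D₁ * (1# - H) * O₁) * L₀) ⟩
        D₀ * E₁ * (S₁₀ * L₀) * L₁ - b * (Τ * E₁ * D₁ * (1# - H) * O₁) * L₀ + ψ * (L₀ * L₁)
          ≈⟨ P.+-congʳ (P.+-congʳ (P.*-congʳ (P.*-congˡ value₁₀))) ⟩
        D₀ * E₁ * (Τ * E₀ * D₁ * (1# - H) * O₀) * L₁ - b * (Τ * E₁ * D₁ * (1# - H) * O₁) * L₀ + ψ * (L₀ * L₁)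
          ≈⟨ P.+-congʳ (P.+-cong
               (*-solve 8 (λ D₀ E₁ Τ E₀ D₁ h O L → D₀ ∙ E₁ ∙ (Τ ∙ E₀ ∙ D₁ ∙ h ∙ O) ∙ L ≐ D₁ ∙ E₁ ∙ (Τ ∙ E₀ ∙ D₀ ∙ h) ∙ (O ∙ L)) P.refl D₀ E₁ Τ E₀ D₁ (1# - H) O₀ L₁)
               (P.-‿cong (*-solve 8 (λ D₀ E₁ Τ E₀ D₁ h O L → D₀ ∙ E₀ ∙ (Τ ∙ E₁ ∙ D₁ ∙ h ∙ O) ∙ L ≐ D₁ ∙ E₁ ∙ (Τ ∙ E₀ ∙ D₀ ∙ h) ∙ (O ∙ L)) P.refl D₀ E₁ Τ E₀ D₁ (1# - H) O₁ L₀))) ⟩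
        a * (Τ * E₀ * D₀ * (1# - H)) * (O₀ * L₁) - a * (Τ * E₀ * D₀ * (1# - H)) * (O₁ * L₀) + ψ * (L₀ * L₁)
          ≈⟨ solve 5 (λ a f x y r → a ⊗ f ⊗ x ⊖ a ⊗ f ⊗ y ⊕ r ⊜ a ⊗ (f ⊗ (x ⊖ y)) ⊕ r) P.refl a (Τ * E₀ * D₀ * (1# - H)) (O₀ * L₁) (O₁ * L₀) (ψ * (L₀ * L₁)) ⟩
        a * (Τ * E₀ * D₀ * (1# - H) * (O₀ * L₁ - O₁ * L₀)) + ψ * (L₀ * L₁) ∎
        where
          open import Relation.Binary.Reasoning.Setoid P.setoid
          a = D₁ * E₁
          b = D₀ * E₀
          ψ = ωx * ωy * Ψ

      1-reg₁ : ∀ {x i} → K₁.Regular (1# - pow q i) → x ≈e i → K₁.Regular (1# - x)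
      1-reg₁ r (power x≈) = K₁.reg-cong (K₁.+-congˡ (K₁.-‿cong (K₁.sym (coarsen₁ x≈)))) r

      quad-reg : ∀ {h} z → h K₁.≈ 1# → K₁.Regular (1# - z) → K₁.Regular (F.quad h (1# + h * h) z)
      quad-reg {h} z h≈1 r = K₁.reg-cong (K₁.sym (K₁.trans (K₁.+-cong (K₁.*-congʳ h≈1) (K₁.-‿cong (K₁.*-congˡ (K₁.+-congˡ (K₁.trans (K₁.*-cong h≈1 h≈1) (K₁.*-identityˡ 1#)))))) (coarsen₁ (1-z² z)))) (K₁.reg-* r r)

      zyd-reg : ∀ i → i ℕ.< n → K₁.Regular (1# - F.zyd (e i))
      zyd-reg i i<n = 1-reg₁ (1-q^4j-reg (suc i) (s≤s z≤n) i<n) (≡.subst (F.zyd (e i) ≈e_) (lem i) (zyd≈ i))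
        where
          lem : ∀ i → 4 ℕ.+ ((i ℕ.+ i) ℕ.+ (i ℕ.+ i)) ≡ (suc i ℕ.+ suc i) ℕ.+ (suc i ℕ.+ suc i)
          lem = solve-∀
      D₁-reg : K₁.Regular D₁
      D₁-reg = K₁.prod-reg n (λ i i<n → quad-reg (F.zxd (e i)) H≈1 (1-reg₁ (1-q^2j-reg (suc i) (s≤s z≤n) i<n)
        (≡.subst (F.zxd (e i) ≈e_) (≡.cong suc (≡.sym (ℕ.+-suc i i))) (q≈ ⊡ q≈ ⊡ (e≈ i ⊡ e≈ i)))))
      E₁-reg : K₁.Regular E₁
      E₁-reg = K₁.prod-reg n (λ i i<n → quad-reg (F.zyd (e i)) Y≈1 (zyd-reg i i<n))
      L₁-reg : K₁.Regular L₁
      L₁-reg = K₁.prod-reg N (λ i i<N → quad-reg (F.zyd (e i)) Y≈1 (zyd-reg i (ℕ.<-≤-trans i<N (ℕ.≤-trans (ℕ.m≤m+n N l) (ℕ.≤-reflexive N+l≡n)))))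

      -- 1 - H = (1 - Y)(1 + Y + Y²), so `ωx` and `ωy` contribute four factors 1 - Y; the fifth
      -- factor Φ is supplied by Ψ.
      D⁴·Ψ : ωx * ωy * Ψ * (L₀ * L₁) K₅.≈ 0#
      D⁴·Ψ = K₅.trans (coarsen₅ (P.trans (P.*-congʳ (P.*-congʳ (P.*-congʳ (P.*-cong 1-H 1-H))))
          (solve 5 (λ Y c Ψ L₀ L₁ → ((𝟙 ⊖ Y) ⊗ c) ⊗ ((𝟙 ⊖ Y) ⊗ c) ⊗ ((𝟙 ⊖ Y) ⊗ (𝟙 ⊖ Y)) ⊗ Ψ ⊗ (L₀ ⊗ L₁) ⊜ (𝟙 ⊖ Y) ⊗ (𝟙 ⊖ Y) ⊗ ((𝟙 ⊖ Y) ⊗ (𝟙 ⊖ Y)) ⊗ (Ψ ⊗ (c ⊗ c ⊗ (L₀ ⊗ L₁)))) P.refl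
             Y (1# + Y + Y * Y) Ψ L₀ L₁)))
        (lift (K₁.trans (K₁.*-congʳ (I.Ψ≈0 q m (s≤s z≤n) q-reg 1-q^-reg q^n≈1 1-q^j-reg 1-q^2j-reg H Y H≈1 Y≈1)) (K₁.zeroˡ _)))
        where
          1-H : 1# - H ≈ D * (1# + Y + Y * Y)
          1-H = P.trans (P.+-congˡ (P.-‿cong H≈Y³)) (solve 1 (λ y → 𝟙 ⊖ y ⊗ y ⊗ y ⊜ (𝟙 ⊖ y) ⊗ (𝟙 ⊕ y ⊕ y ⊗ y)) P.refl Y)

      reduced : S₀₀ * (L₀ * L₁) K₅.≈ Τ * E₀ * D₀ * (1# - H) * (O₀ * L₁ - O₁ * L₀)
      reduced = K₅.cancel (reg-lift (K₁.reg-* D₁-reg E₁-reg)) (K₅.trans (coarsen₅ combined) (K₅.trans (K₅.+-congˡ D⁴·Ψ) (K₅.+-identityʳ _)))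

      zo : ℕ → Carrier
      zo i = F.q2 * F.sq (F.sq (e i))
      f₀ f₁ : ℕ → Carrier
      f₀ i = F.quad 1# two (zo i)
      f₁ i = F.quad Y V (zo i)

      -- The product up to N without the index m. There `zo m` = Y², so the omitted factor is (1 -
      -- Y²)² in `O₀` and Y (1 - Y)(1 - Y³) in `O₁`, both divisible by (1 - Y)².
      rest : (ℕ → Carrier) → Carrier
      rest f = prod m f * prod l (λ i → f (m ℕ.+ suc i))

      pick : ∀ f → prod N f ≈ f m * rest f
      pick f = P.trans (P.prod-+ m (suc l) f) (P.trans (P.*-congˡ (P.trans (P.prod-front l (λ i → f (m ℕ.+ i))) (P.*-congʳ (P.reflexive (≡.cong f (ℕ.+-identityʳ m))))))
        (*-solve 3 (λ a b c → a ∙ (b ∙ c) ≐ b ∙ (a ∙ c)) P.refl (prod m f) (f m) (prod l (λ i → f (m ℕ.+ suc i)))))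

      zo-m : zo m ≈ Y * Y
      zo-m = *-solve 2 (λ q t → q ∙ q ∙ ((t ∙ t) ∙ (t ∙ t)) ≐ (q ∙ (t ∙ t)) ∙ (q ∙ (t ∙ t))) P.refl q (e m)

      quad-cong : ∀ h u {z z′} → z ≈ z′ → F.quad h u z ≈ F.quad h u z′
      quad-cong h u eq = P.+-cong (P.*-congˡ (P.+-congˡ (P.*-cong eq eq))) (P.-‿cong (P.*-congʳ eq))

      module DK = DoubleJets (Coarsening.K P _≈₁_ isCommutativeRing₁ coarsen₁)
      module J = Ring DK.J₁
      ωy≈0 : D * D K₁.≈ 0#
      ωy≈0 = K₁.trans (K₁.*-congʳ (K₁.x≈y⇒x-y≈0 (K₁.sym Y≈1))) (K₁.zeroˡ D)

      ex-rest : I.Expands Y ωy (m ℕ.+ l) (rest f₁) (J.prod m (λ i → DK.quadJet (zo i)) J.* J.prod l (λ i → DK.quadJet (zo (m ℕ.+ suc i))))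
      ex-rest = I.expands-* Y≈1 ωy≈0 (I.expands-prod Y≈1 ωy≈0 m (λ i → I.expands-quad q Y (zo i))) (I.expands-prod Y≈1 ωy≈0 l (λ i → I.expands-quad q Y (zo (m ℕ.+ suc i))))
      ex-L₁ : I.Expands Y ωy N L₁ (J.prod N (λ i → DK.quadJet (F.zyd (e i))))
      ex-L₁ = I.expands-prod Y≈1 ωy≈0 N (λ i → I.expands-quad q Y (F.zyd (e i)))

      Yᵏ : Carrier
      Yᵏ = pow Y (m ℕ.+ l)

      rest≈ : rest f₁ ≈ Yᵏ * rest f₀ + ωy * I.Expands.ψ ex-rest
      rest≈ = P.trans (I.Expands.exact ex-rest) (P.+-congʳ (P.*-congˡ (P.reflexive (≡.cong₂ _*_ (I.c₀-prod m (λ i → DK.quadJet (zo i))) (I.c₀-prod l (λ i → DK.quadJet (zo (m ℕ.+ suc i))))))))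
      L₁≈ : L₁ ≈ Y * Yᵏ * L₀ + ωy * I.Expands.ψ ex-L₁
      L₁≈ = P.trans (I.Expands.exact ex-L₁) (P.+-congʳ (P.*-cong (P.reflexive (≡.cong (pow Y) (ℕ.+-suc m l))) (P.reflexive (I.c₀-prod N (λ i → DK.quadJet (F.zyd (e i)))))))

      O₀≈ : O₀ ≈ (1# - Y * Y) * (1# - Y * Y) * rest f₀
      O₀≈ = P.trans (pick f₀) (P.*-congʳ (P.trans (quad-cong 1# two zo-m) (1-z² (Y * Y))))
      O₁≈ : O₁ ≈ Y * D * (1# - Y * Y * Y) * (Yᵏ * rest f₀ + ωy * I.Expands.ψ ex-rest)
      O₁≈ = P.trans (pick f₁) (P.*-cong (P.trans (quad-cong Y V zo-m)
        (solve 1 (λ y → y ⊗ (𝟙 ⊕ y ⊗ y ⊗ (y ⊗ y)) ⊖ y ⊗ y ⊗ (𝟙 ⊕ y ⊗ y) ⊜ y ⊗ (𝟙 ⊖ y) ⊗ (𝟙 ⊖ y ⊗ y ⊗ y)) P.refl Y)) rest≈)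

      D⁵≈0 : D * D * (D * D) * D K₅.≈ 0#
      D⁵≈0 = lift (K₁.x≈y⇒x-y≈0 (K₁.sym Y≈1))

      -- With 1 - H and the factors at index m, three factors 1 - Y are explicit, so the other
      -- products matter only modulo (1 - Y)². There L₁ and `rest f₁` are L₀ and `rest f₀` times
      -- powers of Y, one power more for L₁. The difference then collapses because (1 + Y)² - (1 + Y
      -- + Y²) = Y, and 1 ≡ Y (2 - Y) modulo (1 - Y)² brings in the factor 2 - q^n.
      closing : (1# - H) * (O₀ * L₁ - O₁ * L₀) * ((1# + Y) * (1# + Y)) K₅.≈ (1# - H) * (Y * Y * (two - Y)) * O₀ * L₁
      closing = K₅.trans (coarsen₅ (P.trans (P.*-congʳ (P.*-cong 1-H≈ (P.+-cong (P.*-cong O₀≈ L₁≈) (P.-‿cong (P.*-congʳ O₁≈))))) (P.trans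
          (solve 6 (λ Y p o L ψ ψ′ → let D = 𝟙 ⊖ Y ; c = 𝟙 ⊕ Y ⊕ Y ⊗ Y ; O = (𝟙 ⊖ Y ⊗ Y) ⊗ (𝟙 ⊖ Y ⊗ Y) ⊗ o ; L′ = Y ⊗ p ⊗ L ⊕ D ⊗ D ⊗ ψ′ ; s = (𝟙 ⊕ Y) ⊗ (𝟙 ⊕ Y) ; b = Y ⊗ Y ⊗ (𝟙 ⊕ 𝟙 ⊖ Y) in
              D ⊗ c ⊗ (O ⊗ L′ ⊖ Y ⊗ D ⊗ (𝟙 ⊖ Y ⊗ Y ⊗ Y) ⊗ (p ⊗ o ⊕ D ⊗ D ⊗ ψ) ⊗ L) ⊗ s
              ⊜ D ⊗ c ⊗ b ⊗ O ⊗ L′ ⊕ D ⊗ D ⊗ (D ⊗ D) ⊗ D ⊗ (c ⊗ s ⊗ (o ⊗ p ⊗ L ⊗ Y ⊗ Y ⊕ s ⊗ o ⊗ ψ′ ⊖ Y ⊗ c ⊗ ψ ⊗ L ⊖ b ⊗ o ⊗ ψ′))) P.refl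
             Y Yᵏ (rest f₀) L₀ (I.Expands.ψ ex-rest) (I.Expands.ψ ex-L₁))
          (P.+-congʳ (P.*-cong (P.*-cong (P.*-congʳ (P.sym 1-H≈)) (P.sym O₀≈)) (P.sym L₁≈))))))
        (K₅.trans (K₅.+-congˡ (K₅.trans (K₅.*-congʳ D⁵≈0) (K₅.zeroˡ _))) (K₅.+-identityʳ _))
        where
          1-H≈ : 1# - H ≈ D * (1# + Y + Y * Y)
          1-H≈ = P.trans (P.+-congˡ (P.-‿cong H≈Y³)) (solve 1 (λ y → 𝟙 ⊖ y ⊗ y ⊗ y ⊜ (𝟙 ⊖ y) ⊗ (𝟙 ⊕ y ⊕ y ⊗ y)) P.refl Y)

    supercongruence : S₀₀ * ((1# + Y) * (1# + Y) * L₀) K₅.≈ Τ * E₀ * D₀ * ((1# - H) * (Y * Y * (two - Y)) * O₀)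
    supercongruence = K₅.cancel (reg-lift L₁-reg) (begin
      L₁ * (S₀₀ * (s * L₀))
        ≈⟨ K₅.*-solve 4 (λ a b c d → a K₅.∙ (b K₅.∙ (c K₅.∙ d)) K₅.≐ b K₅.∙ (d K₅.∙ a) K₅.∙ c) K₅.refl L₁ S₀₀ s L₀ ⟩
      S₀₀ * (L₀ * L₁) * s
        ≈⟨ K₅.*-congʳ reduced ⟩
      Τ * E₀ * D₀ * (1# - H) * (O₀ * L₁ - O₁ * L₀) * s
        ≈⟨ K₅.*-solve 4 (λ a b c d → a K₅.∙ b K₅.∙ c K₅.∙ d K₅.≐ a K₅.∙ (b K₅.∙ c K₅.∙ d)) K₅.refl (Τ * E₀ * D₀) (1# - H) (O₀ * L₁ - O₁ * L₀) s ⟩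
      Τ * E₀ * D₀ * ((1# - H) * (O₀ * L₁ - O₁ * L₀) * s)
        ≈⟨ K₅.*-congˡ closing ⟩
      Τ * E₀ * D₀ * ((1# - H) * (Y * Y * (two - Y)) * O₀ * L₁)
        ≈⟨ K₅.*-solve 5 (λ f h b o l → f K₅.∙ (h K₅.∙ b K₅.∙ o K₅.∙ l) K₅.≐ l K₅.∙ (f K₅.∙ (h K₅.∙ b K₅.∙ o))) K₅.refl (Τ * E₀ * D₀) (1# - H) (Y * Y * (two - Y)) O₀ L₁ ⟩
      L₁ * (Τ * E₀ * D₀ * ((1# - H) * (Y * Y * (two - Y)) * O₀)) ∎)
      where
        open import Relation.Binary.Reasoning.Setoid K₅.setoid
        s = (1# + Y) * (1# + Y)

-- Unreduced fractions, and quotients by ideals.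

module FractionAlgebra (R : CommutativeRing 0ℓ 0ℓ) where
  open Ring R
  open import Relation.Binary.Reasoning.Setoid setoid

  extend-start : ∀ {a b D N} D′ → a * D ≈ N * b → a * (D * D′) ≈ (N * D′ + D * 0#) * b
  extend-start {a} {b} {D} {N} D′ eq = begin
    a * (D * D′)          ≈⟨ *-assoc a D D′ ⟨
    a * D * D′            ≈⟨ *-congʳ eq ⟩
    N * b * D′            ≈⟨ solve 4 (λ N b D D′ → N ⊗ b ⊗ D′ ⊜ (N ⊗ D′ ⊕ D ⊗ Κ 0ℤ) ⊗ b) refl N b D D′ ⟩
    (N * D′ + D * 0#) * b ∎

  extend-step : ∀ {a b c d D D′ N S M} → a * (D * D′) ≈ (N * D′ + D * S) * b → c * D′ ≈ M * d →
    (a * d + c * b) * (D * D′) ≈ (N * D′ + D * (S + M)) * (b * d)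
  extend-step {a} {b} {c} {d} {D} {D′} {N} {S} {M} eq eq′ = begin
    (a * d + c * b) * (D * D′)                    ≈⟨ solve 6 (λ a b c d D D′ → (a ⊗ d ⊕ c ⊗ b) ⊗ (D ⊗ D′) ⊜ a ⊗ (D ⊗ D′) ⊗ d ⊕ D ⊗ b ⊗ (c ⊗ D′)) refl a b c d D D′ ⟩
    a * (D * D′) * d + D * b * (c * D′)           ≈⟨ +-cong (*-congʳ eq) (*-congˡ eq′) ⟩
    (N * D′ + D * S) * b * d + D * b * (M * d)    ≈⟨ solve 7 (λ N D′ D S b d M → (N ⊗ D′ ⊕ D ⊗ S) ⊗ b ⊗ d ⊕ D ⊗ b ⊗ (M ⊗ d) ⊜ (N ⊗ D′ ⊕ D ⊗ (S ⊕ M)) ⊗ (b ⊗ d)) refl N D′ D S b d M ⟩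
    (N * D′ + D * (S + M)) * (b * d) ∎

  module _ (w num den : ℕ → Carrier) where
    shifted : ℕ → ℕ → Carrier
    shifted s k = sum (suc k) (λ j → w (s ℕ.+ j) * Cleared.cleared R (λ i → num (s ℕ.+ i)) (λ i → den (s ℕ.+ i)) k j)

    -- The product of the first s ratios is replaced by an equal quotient T/E. Its denominator E can
    -- be coprime to a modulus even when the product of the first s denominators is not.
    clear-term : ∀ {a b u E T} s k j → j ℕ.≤ k → u * a ≈ w (s ℕ.+ j) * prod (s ℕ.+ j) num → b ≈ prod (s ℕ.+ j) den → prod s num * E ≈ T * prod s den →
      a * (u * E * prod k (λ i → den (s ℕ.+ i))) ≈ T * (w (s ℕ.+ j) * Cleared.cleared R (λ i → num (s ℕ.+ i)) (λ i → den (s ℕ.+ i)) k j) * b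
    clear-term {a} {b} {u} {E} {T} s k j j≤k a≈ b≈ ET = begin
      a * (u * E * prod k d)
        ≈⟨ *-congˡ (*-congˡ (trans (reflexive (≡.cong (λ i → prod i d) (≡.sym (ℕ.m+[n∸m]≡n j≤k)))) (prod-+ j (k ℕ.∸ j) d))) ⟩
      a * (u * E * (prod j d * Q))
        ≈⟨ *-solve 5 (λ a u E p Q → a ∙ (u ∙ E ∙ (p ∙ Q)) ≐ u ∙ a ∙ E ∙ (p ∙ Q)) refl a u E (prod j d) Q ⟩
      u * a * E * (prod j d * Q)
        ≈⟨ *-congʳ (*-congʳ (trans a≈ (*-congˡ (prod-+ s j num)))) ⟩
      W * (prod s num * Nⱼ) * E * (prod j d * Q)
        ≈⟨ *-solve 6 (λ W A B E p Q → W ∙ (A ∙ B) ∙ E ∙ (p ∙ Q) ≐ W ∙ (B ∙ Q) ∙ p ∙ (A ∙ E)) refl W (prod s num) Nⱼ E (prod j d) Q ⟩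
      W * (Nⱼ * Q) * prod j d * (prod s num * E)
        ≈⟨ *-congˡ ET ⟩
      W * (Nⱼ * Q) * prod j d * (T * prod s den)
        ≈⟨ *-solve 5 (λ W N p T S → W ∙ N ∙ p ∙ (T ∙ S) ≐ T ∙ (W ∙ N) ∙ (S ∙ p)) refl W (Nⱼ * Q) (prod j d) T (prod s den) ⟩
      T * (W * (Nⱼ * Q)) * (prod s den * prod j d)
        ≈⟨ *-congˡ (trans b≈ (prod-+ s j den)) ⟨
      T * (W * (Nⱼ * Q)) * b ∎
      where
        d : ℕ → Carrier
        d i = den (s ℕ.+ i)
        W = w (s ℕ.+ j)
        Nⱼ = prod j (λ i → num (s ℕ.+ i))
        Q = prod (k ℕ.∸ j) (λ i → d (j ℕ.+ i))


  -- The trivial factors 0 and 1 in the first hypothesis have the shape that `extend-block` produces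
  -- when it starts from the empty sum.
  compare-sides : ∀ {a b c d u F S C} → a * (1# * (u * 1# * F)) ≈ (0# * (u * 1# * F) + 1# * (1# * S)) * b → u * c ≈ C →
    (a * d - c * b) * (u * F * d) ≈ (S * d - F * C) * (b * d)
  compare-sides {a} {b} {c} {d} {u} {F} {S} {C} eq eq′ = begin
    (a * d - c * b) * (u * F * d)
      ≈⟨ solve 6 (λ a b c d u F → (a ⊗ d ⊖ c ⊗ b) ⊗ (u ⊗ F ⊗ d) ⊜ a ⊗ (𝟙 ⊗ (u ⊗ 𝟙 ⊗ F)) ⊗ d ⊗ d ⊖ u ⊗ c ⊗ (b ⊗ F ⊗ d)) refl a b c d u F ⟩
    a * (1# * (u * 1# * F)) * d * d - u * c * (b * F * d)
      ≈⟨ +-cong (*-congʳ (*-congʳ eq)) (-‿cong (*-congʳ eq′)) ⟩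
    (0# * (u * 1# * F) + 1# * (1# * S)) * b * d * d - C * (b * F * d)
      ≈⟨ solve 6 (λ u F S b d C → (Κ 0ℤ ⊗ (u ⊗ 𝟙 ⊗ F) ⊕ 𝟙 ⊗ (𝟙 ⊗ S)) ⊗ b ⊗ d ⊗ d ⊖ C ⊗ (b ⊗ F ⊗ d) ⊜ (S ⊗ d ⊖ F ⊗ C) ⊗ (b ⊗ d)) refl u F S b d C ⟩
    (S * d - F * C) * (b * d) ∎

  subtract : ∀ {a b c d D N D′ N′} → a * D ≈ N * b → c * D′ ≈ N′ * d → (a * d - c * b) * (D * D′) ≈ (N * D′ - N′ * D) * (b * d)
  subtract {a} {b} {c} {d} {D} {N} {D′} {N′} eq eq′ = begin
    (a * d - c * b) * (D * D′)               ≈⟨ solve 6 (λ a b c d D D′ → (a ⊗ d ⊖ c ⊗ b) ⊗ (D ⊗ D′) ⊜ a ⊗ D ⊗ (d ⊗ D′) ⊖ c ⊗ D′ ⊗ (b ⊗ D)) refl a b c d D D′ ⟩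
    a * D * (d * D′) - c * D′ * (b * D)      ≈⟨ +-cong (*-congʳ eq) (-‿cong (*-congʳ eq′)) ⟩
    N * b * (d * D′) - N′ * d * (b * D)      ≈⟨ solve 6 (λ N b d D′ N′ D → N ⊗ b ⊗ (d ⊗ D′) ⊖ N′ ⊗ d ⊗ (b ⊗ D) ⊜ (N ⊗ D′ ⊖ N′ ⊗ D) ⊗ (b ⊗ d)) refl N b d D′ N′ D ⟩
    (N * D′ - N′ * D) * (b * d) ∎

  cross-* : ∀ {X E T Y X′ E′ T′ Y′} → X * E ≈ T * Y → X′ * E′ ≈ T′ * Y′ → X * X′ * (E * E′) ≈ T * T′ * (Y * Y′)
  cross-* {X} {E} {T} {Y} {X′} {E′} {T′} {Y′} eq eq′ = begin
    X * X′ * (E * E′)      ≈⟨ *-solve 4 (λ a b c d → a ∙ b ∙ (c ∙ d) ≐ a ∙ c ∙ (b ∙ d)) refl X X′ E E′ ⟩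
    X * E * (X′ * E′)      ≈⟨ *-cong eq eq′ ⟩
    T * Y * (T′ * Y′)      ≈⟨ *-solve 4 (λ a b c d → a ∙ c ∙ (b ∙ d) ≐ a ∙ b ∙ (c ∙ d)) refl T T′ Y Y′ ⟩
    T * T′ * (Y * Y′)      ∎

  clear-closed : ∀ {u Q Q′ B W p E T L G p² L²} → u * Q ≈ Q′ → p * E ≈ T * L → p² ≈ p * p → L² ≈ L * L →
    Q * B * W * p² * (u * (E * E) * G) ≈ Q′ * (B * W * (T * T)) * (G * L²)
  clear-closed {u} {Q} {Q′} {B} {W} {p} {E} {T} {L} {G} {p²} {L²} uQ pE p²≈ L²≈ = begin
    Q * B * W * p² * (u * (E * E) * G)            ≈⟨ *-congʳ (*-congˡ p²≈) ⟩
    Q * B * W * (p * p) * (u * (E * E) * G)       ≈⟨ *-solve 7 (λ Q B W p u E G → Q ∙ B ∙ W ∙ (p ∙ p) ∙ (u ∙ (E ∙ E) ∙ G) ≐ u ∙ Q ∙ (B ∙ W ∙ G) ∙ ((p ∙ E) ∙ (p ∙ E))) refl Q B W p u E G ⟩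
    u * Q * (B * W * G) * (p * E * (p * E))       ≈⟨ *-cong (*-congʳ uQ) (*-cong pE pE) ⟩
    Q′ * (B * W * G) * (T * L * (T * L))          ≈⟨ *-solve 6 (λ Q B W G T L → Q ∙ (B ∙ W ∙ G) ∙ (T ∙ L ∙ (T ∙ L)) ≐ Q ∙ (B ∙ W ∙ (T ∙ T)) ∙ (G ∙ (L ∙ L))) refl Q′ B W G T L ⟩
    Q′ * (B * W * (T * T)) * (G * (L * L))        ≈⟨ *-congˡ (*-congˡ L²≈) ⟨
    Q′ * (B * W * (T * T)) * (G * L²)             ∎

module FactorCongruence (R : CommutativeRing 0ℓ 0ℓ) (q : CommutativeRing.Carrier R) where
  open Ring R
  open Factors (SummandIdentities.ringOps R) q

  w-cong : ∀ {t t′} → t ≈ t′ → w t ≈ w t′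
  w-cong t≈ = +-congˡ (-‿cong (*-congˡ (*-cong (*-cong s s) s)))
    where s = *-cong t≈ t≈

  quad-cong : ∀ {h U z z′} → z ≈ z′ → quad h U z ≈ quad h U z′
  quad-cong z≈ = +-cong (*-congˡ (+-congˡ (*-cong z≈ z≈))) (-‿cong (*-congʳ z≈))

  σn-cong : ∀ {h U h′ U′ t t′} → t ≈ t′ → σn h U h′ U′ t ≈ σn h U h′ U′ t′
  σn-cong t≈ = *-cong (*-cong (*-congˡ (+-congˡ (-‿cong (*-congˡ s⁴)))) (quad-cong (*-congˡ s²))) (quad-cong (*-congˡ s⁴))
    where
      s² = *-cong t≈ t≈
      s⁴ = *-cong s² s²

  σd-cong : ∀ {h U h′ U′ t t′} → t ≈ t′ → σd h U h′ U′ t ≈ σd h U h′ U′ t′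
  σd-cong t≈ = *-cong (*-cong (+-congˡ (-‿cong (*-congˡ s⁴))) (quad-cong (*-congˡ s⁴))) (quad-cong (*-congˡ s²))
    where
      s² = *-cong t≈ t≈
      s⁴ = *-cong s² s²

record IsIdeal (R : CommutativeRing 0ℓ 0ℓ) (I : CommutativeRing.Carrier R → Set) : Set where
  open CommutativeRing R
  field
    I-cong : ∀ {x y} → x ≈ y → I x → I y
    I-0    : I 0#
    I-+    : ∀ {x y} → I x → I y → I (x + y)
    I-*    : ∀ a {x} → I x → I (a * x)

module IdealQuotient (R : CommutativeRing 0ℓ 0ℓ) (I : CommutativeRing.Carrier R → Set) (isIdeal : IsIdeal R I) where
  open Ring R
  open IsIdeal isIdeal

  infix 4 _≈ᵢ_
  record _≈ᵢ_ (x y : Carrier) : Set where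
    constructor ≈ᵢ-from
    field difference : I (x - y)
  open _≈ᵢ_ public

  coarsenᵢ : ∀ {x y} → x ≈ y → x ≈ᵢ y
  coarsenᵢ eq = ≈ᵢ-from (I-cong (sym (x≈y⇒x-y≈0 eq)) I-0)

  private
    -I : ∀ {x} → I x → I (- x)
    -I {x} i = I-cong (solve 1 (λ x → ⊝ 𝟙 ⊗ x ⊜ ⊝ x) refl x) (I-* (- 1#) i)
    symᵢ : ∀ {x y} → x ≈ᵢ y → y ≈ᵢ x
    symᵢ {x} {y} (≈ᵢ-from p) = ≈ᵢ-from (I-cong (solve 2 (λ x y → ⊝ (x ⊖ y) ⊜ y ⊖ x) refl x y) (-I p))
    transᵢ : ∀ {x y z} → x ≈ᵢ y → y ≈ᵢ z → x ≈ᵢ z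
    transᵢ {x} {y} {z} (≈ᵢ-from p) (≈ᵢ-from r) = ≈ᵢ-from (I-cong (solve 3 (λ x y z → x ⊖ y ⊕ (y ⊖ z) ⊜ x ⊖ z) refl x y z) (I-+ p r))
    +-congᵢ : ∀ {x y u v} → x ≈ᵢ y → u ≈ᵢ v → x + u ≈ᵢ y + v
    +-congᵢ {x} {y} {u} {v} (≈ᵢ-from p) (≈ᵢ-from r) = ≈ᵢ-from (I-cong (solve 4 (λ x y u v → x ⊖ y ⊕ (u ⊖ v) ⊜ x ⊕ u ⊖ (y ⊕ v)) refl x y u v) (I-+ p r))
    *-congᵢ : ∀ {x y u v} → x ≈ᵢ y → u ≈ᵢ v → x * u ≈ᵢ y * v
    *-congᵢ {x} {y} {u} {v} (≈ᵢ-from p) (≈ᵢ-from r) = ≈ᵢ-from (I-cong (solve 4 (λ x y u v → u ⊗ (x ⊖ y) ⊕ y ⊗ (u ⊖ v) ⊜ x ⊗ u ⊖ y ⊗ v) refl x y u v) (I-+ (I-* u p) (I-* y r)))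
    -‿congᵢ : ∀ {x y} → x ≈ᵢ y → - x ≈ᵢ - y
    -‿congᵢ {x} {y} (≈ᵢ-from p) = ≈ᵢ-from (I-cong (solve 2 (λ x y → ⊝ (x ⊖ y) ⊜ ⊝ x ⊖ ⊝ y) refl x y) (-I p))

  isCommutativeRingᵢ : IsCommutativeRing _≈ᵢ_ _+_ _*_ (-_) 0# 1#
  isCommutativeRingᵢ = record
    { isRing = record
      { +-isAbelianGroup = record
        { isGroup = record
          { isMonoid = record
            { isSemigroup = record
              { isMagma = record { isEquivalence = record { refl = coarsenᵢ refl ; sym = symᵢ ; trans = transᵢ } ; ∙-cong = +-congᵢ }
              ; assoc = λ x y z → coarsenᵢ (+-assoc x y z) }
            ; identity = (λ x → coarsenᵢ (+-identityˡ x)) , (λ x → coarsenᵢ (+-identityʳ x)) }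
          ; inverse = (λ x → coarsenᵢ (-‿inverseˡ x)) , (λ x → coarsenᵢ (-‿inverseʳ x))
          ; ⁻¹-cong = -‿congᵢ }
        ; comm = λ x y → coarsenᵢ (+-comm x y) }
      ; *-cong = *-congᵢ
      ; *-assoc = λ x y z → coarsenᵢ (*-assoc x y z)
      ; *-identity = (λ x → coarsenᵢ (*-identityˡ x)) , (λ x → coarsenᵢ (*-identityʳ x))
      ; distrib = (λ x y z → coarsenᵢ (distribˡ x y z)) , (λ x y z → coarsenᵢ (distribʳ x y z)) }
    ; *-comm = λ x y → coarsenᵢ (*-comm x y) }

  ≈ᵢ0⇒I : ∀ {x} → x ≈ᵢ 0# → I x
  ≈ᵢ0⇒I {x} (≈ᵢ-from p) = I-cong (solve 1 (λ x → x ⊖ Κ 0ℤ ⊜ x) refl x) p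

  I⇒≈ᵢ0 : ∀ {x} → I x → x ≈ᵢ 0#
  I⇒≈ᵢ0 {x} p = ≈ᵢ-from (I-cong (solve 1 (λ x → x ⊜ x ⊖ Κ 0ℤ) refl x) p)

-- Polynomials

infix 4 _≋_
-- A record, because `_≈ₚ_` unfolds to a family of coefficient equations from which the two
-- polynomials cannot be inferred.
record _≋_ (p r : Poly) : Set where
  constructor coefficients
  field at : p ≈ₚ r
open _≋_ public

coeff-+ : ∀ p r i → coeff (p +ₚ r) i ≡ coeff p i ℤ.+ coeff r i
coeff-+ []      r       i       = ≡.sym (ℤ.+-identityˡ _)
coeff-+ (a ∷ p) []      i       = ≡.sym (ℤ.+-identityʳ _)
coeff-+ (a ∷ p) (b ∷ r) zero    = ≡.refl
coeff-+ (a ∷ p) (b ∷ r) (suc i) = coeff-+ p r i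

coeff-scale : ∀ c p i → coeff (scaleₚ c p) i ≡ c ℤ.* coeff p i
coeff-scale c []      i       = ≡.sym (ℤ.*-zeroʳ c)
coeff-scale c (a ∷ p) zero    = ≡.refl
coeff-scale c (a ∷ p) (suc i) = coeff-scale c p i

private
  ≋-refl : ∀ {p} → p ≋ p
  ≋-refl = coefficients λ i → ≡.refl
  ≋-sym : ∀ {p r} → p ≋ r → r ≋ p
  ≋-sym eq = coefficients λ i → ≡.sym (at eq i)
  ≋-trans : ∀ {p r s} → p ≋ r → r ≋ s → p ≋ s
  ≋-trans eq eq′ = coefficients λ i → ≡.trans (at eq i) (at eq′ i)

  +ₚ-cong : ∀ {p p′ r r′} → p ≋ p′ → r ≋ r′ → p +ₚ r ≋ p′ +ₚ r′
  +ₚ-cong {p} {p′} {r} {r′} eq eq′ = coefficients λ i → ≡.trans (coeff-+ p r i) (≡.trans (≡.cong₂ ℤ._+_ (at eq i) (at eq′ i)) (≡.sym (coeff-+ p′ r′ i)))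
  +ₚ-comm : ∀ p r → p +ₚ r ≋ r +ₚ p
  +ₚ-comm p r = coefficients λ i → ≡.trans (coeff-+ p r i) (≡.trans (ℤ.+-comm (coeff p i) (coeff r i)) (≡.sym (coeff-+ r p i)))
  +ₚ-assoc : ∀ p r s → p +ₚ r +ₚ s ≋ p +ₚ (r +ₚ s)
  +ₚ-assoc p r s = coefficients λ i → ≡.trans (coeff-+ (p +ₚ r) s i) (≡.trans (≡.cong (λ z → z ℤ.+ coeff s i) (coeff-+ p r i))
    (≡.trans (ℤ.+-assoc (coeff p i) (coeff r i) (coeff s i)) (≡.sym (≡.trans (coeff-+ p (r +ₚ s) i) (≡.cong (λ z → coeff p i ℤ.+ z) (coeff-+ r s i))))))
  +ₚ-identityʳ : ∀ p → p +ₚ [] ≋ p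
  +ₚ-identityʳ []      = ≋-refl
  +ₚ-identityʳ (a ∷ p) = ≋-refl

  scale-cong : ∀ c {p r} → p ≋ r → scaleₚ c p ≋ scaleₚ c r
  scale-cong c {p} {r} eq = coefficients λ i → ≡.trans (coeff-scale c p i) (≡.trans (≡.cong (λ z → c ℤ.* z) (at eq i)) (≡.sym (coeff-scale c r i)))
  scale-+ : ∀ c p r → scaleₚ c (p +ₚ r) ≋ scaleₚ c p +ₚ scaleₚ c r
  scale-+ c p r = coefficients λ i → ≡.trans (coeff-scale c (p +ₚ r) i) (≡.trans (≡.cong (λ z → c ℤ.* z) (coeff-+ p r i))
    (≡.trans (ℤ.*-distribˡ-+ c (coeff p i) (coeff r i)) (≡.sym (≡.trans (coeff-+ (scaleₚ c p) (scaleₚ c r) i) (≡.cong₂ ℤ._+_ (coeff-scale c p i) (coeff-scale c r i))))))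
  scale-scale : ∀ c d p → scaleₚ c (scaleₚ d p) ≋ scaleₚ (c ℤ.* d) p
  scale-scale c d p = coefficients λ i → ≡.trans (coeff-scale c (scaleₚ d p) i) (≡.trans (≡.cong (λ z → c ℤ.* z) (coeff-scale d p i))
    (≡.trans (≡.sym (ℤ.*-assoc c d (coeff p i))) (≡.sym (coeff-scale (c ℤ.* d) p i))))
  scale-1 : ∀ p → scaleₚ 1ℤ p ≋ p
  scale-1 p = coefficients λ i → ≡.trans (coeff-scale 1ℤ p i) (ℤ.*-identityˡ _)
  scale-0 : ∀ p → scaleₚ 0ℤ p ≋ []
  scale-0 p = coefficients λ i → coeff-scale 0ℤ p i

  ∷-cong : ∀ {a b p r} → a ≡ b → p ≋ r → a ∷ p ≋ b ∷ r
  ∷-cong a≡b eq = coefficients λ { zero → a≡b ; (suc i) → at eq i }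
  0∷[] : 0ℤ ∷ [] ≋ []
  0∷[] = coefficients λ { zero → ≡.refl ; (suc i) → ≡.refl }
  0∷-+ : ∀ p r → 0ℤ ∷ (p +ₚ r) ≋ (0ℤ ∷ p) +ₚ (0ℤ ∷ r)
  0∷-+ p r = ∷-cong ≡.refl ≋-refl
  scale-0∷ : ∀ c p → scaleₚ c (0ℤ ∷ p) ≋ 0ℤ ∷ scaleₚ c p
  scale-0∷ c p = ∷-cong (ℤ.*-zeroʳ c) ≋-refl

  +ₚ-interchange : ∀ p r s t → p +ₚ r +ₚ (s +ₚ t) ≋ p +ₚ s +ₚ (r +ₚ t)
  +ₚ-interchange p r s t = ≋-trans (+ₚ-assoc p r (s +ₚ t)) (≋-trans (+ₚ-cong (≋-refl {p}) (≋-trans (≋-sym (+ₚ-assoc r s t)) (≋-trans (+ₚ-cong (+ₚ-comm r s) ≋-refl) (+ₚ-assoc s r t)))) (≋-sym (+ₚ-assoc p s (r +ₚ t))))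

  *ₚ-congˡ : ∀ p {r r′} → r ≋ r′ → p *ₚ r ≋ p *ₚ r′
  *ₚ-congˡ []      eq = ≋-refl
  *ₚ-congˡ (a ∷ p) eq = +ₚ-cong (scale-cong a eq) (∷-cong ≡.refl (*ₚ-congˡ p eq))

  *ₚ-zeroʳ : ∀ p → p *ₚ [] ≋ []
  *ₚ-zeroʳ []      = ≋-refl
  *ₚ-zeroʳ (a ∷ p) = ≋-trans (∷-cong ≡.refl (*ₚ-zeroʳ p)) 0∷[]

  *ₚ-∷ : ∀ p b r → p *ₚ (b ∷ r) ≋ scaleₚ b p +ₚ (0ℤ ∷ p *ₚ r)
  *ₚ-∷ []      b r = ≋-sym 0∷[]
  *ₚ-∷ (a ∷ p) b r = ∷-cong (≡.cong (λ z → z ℤ.+ 0ℤ) (ℤ.*-comm a b)) (≋-trans (+ₚ-cong (≋-refl {scaleₚ a r}) (*ₚ-∷ p b r))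
    (≋-trans (≋-sym (+ₚ-assoc (scaleₚ a r) (scaleₚ b p) _)) (≋-trans (+ₚ-cong (+ₚ-comm (scaleₚ a r) (scaleₚ b p)) ≋-refl) (+ₚ-assoc (scaleₚ b p) (scaleₚ a r) _))))

  *ₚ-comm : ∀ p r → p *ₚ r ≋ r *ₚ p
  *ₚ-comm []      r = ≋-sym (*ₚ-zeroʳ r)
  *ₚ-comm (a ∷ p) r = ≋-trans (+ₚ-cong ≋-refl (∷-cong ≡.refl (*ₚ-comm p r))) (≋-sym (*ₚ-∷ r a p))

  *ₚ-cong : ∀ {p p′ r r′} → p ≋ p′ → r ≋ r′ → p *ₚ r ≋ p′ *ₚ r′
  *ₚ-cong {p} {p′} {r} {r′} eq eq′ = ≋-trans (*ₚ-congˡ p eq′) (≋-trans (*ₚ-comm p r′) (≋-trans (*ₚ-congˡ r′ eq) (*ₚ-comm r′ p′)))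

  *ₚ-distribˡ : ∀ p r s → p *ₚ (r +ₚ s) ≋ p *ₚ r +ₚ p *ₚ s
  *ₚ-distribˡ []      r s = ≋-refl
  *ₚ-distribˡ (a ∷ p) r s = ≋-trans (+ₚ-cong (scale-+ a r s) (≋-trans (∷-cong ≡.refl (*ₚ-distribˡ p r s)) (0∷-+ (p *ₚ r) (p *ₚ s)))) (+ₚ-interchange (scaleₚ a r) (scaleₚ a s) (0ℤ ∷ p *ₚ r) (0ℤ ∷ p *ₚ s))

  *ₚ-distribʳ : ∀ s p r → (p +ₚ r) *ₚ s ≋ p *ₚ s +ₚ r *ₚ s
  *ₚ-distribʳ s p r = ≋-trans (*ₚ-comm (p +ₚ r) s) (≋-trans (*ₚ-distribˡ s p r) (+ₚ-cong (*ₚ-comm s p) (*ₚ-comm s r)))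

  scale-* : ∀ c p r → scaleₚ c p *ₚ r ≋ scaleₚ c (p *ₚ r)
  scale-* c []      r = ≋-refl
  scale-* c (a ∷ p) r = ≋-trans (+ₚ-cong (≋-sym (scale-scale c a r)) (≋-trans (∷-cong ≡.refl (scale-* c p r)) (≋-sym (scale-0∷ c _)))) (≋-sym (scale-+ c (scaleₚ a r) _))

0∷-* : ∀ p r → (0ℤ ∷ p) *ₚ r ≋ 0ℤ ∷ p *ₚ r
0∷-* p r = +ₚ-cong (scale-0 r) ≋-refl

private
  *ₚ-assoc : ∀ p r s → p *ₚ r *ₚ s ≋ p *ₚ (r *ₚ s)
  *ₚ-assoc []      r s = ≋-refl
  *ₚ-assoc (a ∷ p) r s = ≋-trans (*ₚ-distribʳ s (scaleₚ a r) (0ℤ ∷ p *ₚ r)) (+ₚ-cong (scale-* a r s) (≋-trans (0∷-* (p *ₚ r) s) (∷-cong ≡.refl (*ₚ-assoc p r s))))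

constₚ-* : ∀ c p → constₚ c *ₚ p ≋ scaleₚ c p
constₚ-* c p = ≋-trans (+ₚ-cong ≋-refl 0∷[]) (+ₚ-identityʳ _)

private
  *ₚ-identityˡ : ∀ p → oneₚ *ₚ p ≋ p
  *ₚ-identityˡ p = ≋-trans (constₚ-* 1ℤ p) (scale-1 p)

  -ₚ-inverseʳ : ∀ p → p +ₚ (-ₚ p) ≋ []
  -ₚ-inverseʳ p = coefficients λ i → ≡.trans (coeff-+ p (-ₚ p) i) (≡.trans (≡.cong (λ z → coeff p i ℤ.+ z) (≡.trans (coeff-scale (ℤ.- 1ℤ) p i) (ℤ.-1*i≡-i (coeff p i)))) (ℤ.+-inverseʳ (coeff p i)))

polyRing : CommutativeRing 0ℓ 0ℓ
polyRing = record
  { Carrier = Poly ; _≈_ = _≋_ ; _+_ = _+ₚ_ ; _*_ = _*ₚ_ ; -_ = -ₚ_ ; 0# = [] ; 1# = oneₚ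
  ; isCommutativeRing = record
    { isRing = record
      { +-isAbelianGroup = record
        { isGroup = record
          { isMonoid = record
            { isSemigroup = record
              { isMagma = record { isEquivalence = record { refl = ≋-refl ; sym = ≋-sym ; trans = ≋-trans } ; ∙-cong = +ₚ-cong }
              ; assoc = +ₚ-assoc }
            ; identity = (λ p → ≋-refl) , +ₚ-identityʳ }
          ; inverse = (λ p → ≋-trans (+ₚ-comm (-ₚ p) p) (-ₚ-inverseʳ p)) , -ₚ-inverseʳ
          ; ⁻¹-cong = scale-cong (ℤ.- 1ℤ) }
        ; comm = +ₚ-comm }
      ; *-cong = *ₚ-cong
      ; *-assoc = *ₚ-assoc
      ; *-identity = *ₚ-identityˡ , (λ p → ≋-trans (*ₚ-comm p oneₚ) (*ₚ-identityˡ p))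
      ; distrib = *ₚ-distribˡ , *ₚ-distribʳ }
    ; *-comm = *ₚ-comm } }

module ℤ[q] = Ring polyRing

-- Vanishing low coefficients of p are stripped off. Once the constant term a is nonzero, the
-- constant term of the product forces that of r to vanish, and r is shortened.
nonzero-regular : ∀ p i → ¬ coeff p i ≡ 0ℤ → ℤ[q].Regular p
nonzero-regular []      i       nz r eq = ⊥-elim (nz ≡.refl)
nonzero-regular (a ∷ p) i       nz r eq with a ℤ.≟ 0ℤ
nonzero-regular (a ∷ p) zero    nz r eq | yes a≡0 = ⊥-elim (nz a≡0)
nonzero-regular (a ∷ p) (suc i) nz r eq | yes ≡.refl = nonzero-regular p i nz r (coefficients λ j → ≡.trans (≡.sym (at (0∷-* p r) (suc j))) (at eq (suc j)))
nonzero-regular (a ∷ p) i nz r eq | no a≢0 = lowest r eq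
  where
    lowest : ∀ r → (a ∷ p) *ₚ r ≋ [] → r ≋ []
    lowest []      eq = ≋-refl
    lowest (b ∷ r) eq = ≋-trans (∷-cong b≡0 (lowest r shifted)) 0∷[]
      where
        b≡0 : b ≡ 0ℤ
        b≡0 with ℤ.i*j≡0⇒i≡0∨j≡0 a (≡.trans (≡.sym (ℤ.+-identityʳ (a ℤ.* b))) (at eq 0))
        ... | inj₁ a≡0 = ⊥-elim (a≢0 a≡0)
        ... | inj₂ b≡0 = b≡0
        shifted : (a ∷ p) *ₚ r ≋ []
        shifted = coefficients λ j → ≡.trans (≡.sym (at (≋-trans (*ₚ-congˡ (a ∷ p) (∷-cong b≡0 (≋-refl {r}))) (≋-trans (*ₚ-comm (a ∷ p) (0ℤ ∷ r)) (≋-trans (0∷-* r (a ∷ p)) (∷-cong ≡.refl (*ₚ-comm r (a ∷ p)))))) (suc j))) (at eq (suc j))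

𝕢 : Poly
𝕢 = qPow 1

qPow≋ : ∀ k → qPow k ≋ ℤ[q].pow 𝕢 k
qPow≋ zero    = ≋-refl
qPow≋ (suc k) = ≋-trans (∷-cong ≡.refl (≋-trans (qPow≋ k) (≋-sym (*ₚ-identityˡ _)))) (≋-sym (0∷-* oneₚ (ℤ[q].pow 𝕢 k)))

𝕢-regular : ℤ[q].Regular 𝕢
𝕢-regular = nonzero-regular 𝕢 1 λ ()

1-qPow-regular : ∀ i → 0 ℕ.< i → ℤ[q].Regular (oneₚ -ₚ qPow i)
1-qPow-regular (suc i) _ = nonzero-regular (oneₚ -ₚ qPow (suc i)) 0 λ ()

-- Degrees and division by monic polynomials

Deg≤ : Poly → ℕ → Set
Deg≤ p d = ∀ i → d ℕ.< i → coeff p i ≡ 0ℤ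

-- No trailing zero: the list ends with the leading coefficient, so that its length determines the
-- degree.
Normal : Poly → Set
Normal p = ∀ d → length p ≡ suc d → ¬ coeff p d ≡ 0ℤ

private
  coeff-length : ∀ p i → length p ℕ.≤ i → coeff p i ≡ 0ℤ
  coeff-length []      i       _         = ≡.refl
  coeff-length (a ∷ p) (suc i) (s≤s len) = coeff-length p i len

  coeff-snoc : ∀ p a → coeff (p ++ a ∷ []) (length p) ≡ a
  coeff-snoc []      a = ≡.refl
  coeff-snoc (b ∷ p) a = coeff-snoc p a

  length-snoc : ∀ (p : Poly) a → length (p ++ a ∷ []) ≡ suc (length p)
  length-snoc []      a = ≡.refl
  length-snoc (b ∷ p) a = ≡.cong suc (length-snoc p a)

  snoc-0 : ∀ p → p ++ 0ℤ ∷ [] ≋ p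
  snoc-0 []      = coefficients λ { zero → ≡.refl ; (suc i) → ≡.refl }
  snoc-0 (a ∷ p) = coefficients λ { zero → ≡.refl ; (suc i) → at (snoc-0 p) i }

  lead-snoc : ∀ p a → lead (p ++ a ∷ []) ≡ a
  lead-snoc p a with reverse (p ++ a ∷ []) | reverse-++ p (a ∷ [])
  ... | _ | ≡.refl = ≡.refl

  lead≡coeff : ∀ p d → length p ≡ suc d → lead p ≡ coeff p d
  lead≡coeff p d len with initLast p
  ... | xs ∷ʳ′ a rewrite ℕ.suc-injective (≡.trans (≡.sym len) (length-snoc xs a)) = ≡.trans (lead-snoc xs a) (≡.sym (coeff-snoc xs a))

  normalize-snoc-0 : ∀ p → normalize (p ++ 0ℤ ∷ []) ≡ normalize p
  normalize-snoc-0 p rewrite reverse-++ p (0ℤ ∷ []) = ≡.refl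

  normalize-snoc-≢ : ∀ p {a} → ¬ a ≡ 0ℤ → normalize (p ++ a ∷ []) ≡ p ++ a ∷ []
  normalize-snoc-≢ p {a} a≢0 rewrite reverse-++ p (a ∷ []) with a ℤ.≟ 0ℤ
  ... | yes a≡0 = ⊥-elim (a≢0 a≡0)
  ... | no _    = ≡.trans (unfold-reverse a (reverse p)) (≡.cong (_++ a ∷ []) (reverse-involutive p))

normalize-correct : ∀ p → normalize p ≋ p × Normal (normalize p)
normalize-correct p = go (length p) p ≡.refl
  where
    go : ∀ n p → length p ≡ n → normalize p ≋ p × Normal (normalize p)
    go n p len with initLast p
    go n .[] len | [] = ℤ[q].refl , λ d ()
    go zero .(xs ++ a ∷ []) len | xs ∷ʳ′ a with () ← ≡.trans (≡.sym (length-snoc xs a)) len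
    go (suc n) .(xs ++ a ∷ []) len | xs ∷ʳ′ a with a ℤ.≟ 0ℤ
    ... | yes ≡.refl = let (eq , nf) = go n xs (ℕ.suc-injective (≡.trans (≡.sym (length-snoc xs a)) len)) in
            ≡.subst (λ r → r ≋ xs ++ 0ℤ ∷ [] × Normal r) (≡.sym (normalize-snoc-0 xs)) (ℤ[q].trans eq (ℤ[q].sym (snoc-0 xs)) , nf)
    ... | no a≢0 = ≡.subst (λ r → r ≋ xs ++ a ∷ [] × Normal r) (≡.sym (normalize-snoc-≢ xs a≢0))
            (ℤ[q].refl , λ d len′ → λ eq → a≢0 (≡.trans (≡.sym (coeff-snoc xs a)) (≡.trans (≡.cong (coeff (xs ++ a ∷ [])) (ℕ.suc-injective (≡.trans (≡.sym (length-snoc xs a)) len′))) eq)))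

normalize≋ : ∀ p → normalize p ≋ p
normalize≋ p = proj₁ (normalize-correct p)

normal-length : ∀ p k → Normal p → (∀ i → k ℕ.≤ i → coeff p i ≡ 0ℤ) → length p ℕ.≤ k
normal-length p k nf zeros with length p
... | zero  = z≤n
... | suc d with k ℕ.≤? d
...   | yes k≤d = ⊥-elim (nf d ≡.refl (zeros d k≤d))
...   | no  k≰d = ℕ.≰⇒> k≰d

top-coeff : ∀ p r {a b} → Deg≤ p a → Deg≤ r b → coeff (p *ₚ r) (a ℕ.+ b) ≡ coeff p a ℤ.* coeff r b
top-coeff []      r {a} {b} _ _ = ≡.refl
top-coeff (x ∷ p) r {zero} {b} dp dr = ≡.trans (coeff-+ (scaleₚ x r) (0ℤ ∷ p *ₚ r) b) (≡.trans (≡.cong₂ ℤ._+_ (coeff-scale x r b) (at tail≋0 b)) (ℤ.+-identityʳ _))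
  where
    p≋0 : p ≋ []
    p≋0 = coefficients λ i → dp (suc i) (s≤s z≤n)
    tail≋0 : 0ℤ ∷ p *ₚ r ≋ []
    tail≋0 = coefficients λ { zero → ≡.refl ; (suc i) → at (ℤ[q].*-congʳ {r} {p} {[]} p≋0) i }
top-coeff (x ∷ p) r {suc a} {b} dp dr = ≡.trans (coeff-+ (scaleₚ x r) (0ℤ ∷ p *ₚ r) (suc a ℕ.+ b))
  (≡.trans (≡.cong₂ ℤ._+_ (≡.trans (coeff-scale x r (suc a ℕ.+ b)) (≡.trans (≡.cong (λ z → x ℤ.* z) (dr _ (s≤s (ℕ.m≤n+m b a)))) (ℤ.*-zeroʳ x))) (top-coeff p r (λ i a<i → dp (suc i) (s≤s a<i)) dr)) (ℤ.+-identityˡ _))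

deg-* : ∀ p r {a b} → Deg≤ p a → Deg≤ r b → Deg≤ (p *ₚ r) (a ℕ.+ b)
deg-* []      r _ _ i _ = ≡.refl
deg-* (x ∷ p) r {zero} {b} dp dr i b<i = ≡.trans (coeff-+ (scaleₚ x r) (0ℤ ∷ p *ₚ r) i)
  (≡.cong₂ ℤ._+_ (≡.trans (coeff-scale x r i) (≡.trans (≡.cong (λ z → x ℤ.* z) (dr i b<i)) (ℤ.*-zeroʳ x))) (at tail≋0 i))
  where
    p≋0 : p ≋ []
    p≋0 = coefficients λ i → dp (suc i) (s≤s z≤n)
    tail≋0 : 0ℤ ∷ p *ₚ r ≋ []
    tail≋0 = coefficients λ { zero → ≡.refl ; (suc i) → at (ℤ[q].*-congʳ {r} {p} {[]} p≋0) i }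
deg-* (x ∷ p) r {suc a} {b} dp dr (suc i) (s≤s a+b<i) = ≡.trans (coeff-+ (scaleₚ x r) (0ℤ ∷ p *ₚ r) (suc i))
  (≡.cong₂ ℤ._+_ (≡.trans (coeff-scale x r (suc i)) (≡.trans (≡.cong (λ z → x ℤ.* z) (dr (suc i) (ℕ.≤-trans (s≤s (ℕ.m≤n+m b a)) (ℕ.m≤n⇒m≤1+n a+b<i)))) (ℤ.*-zeroʳ x)))
    (deg-* p r (λ j a<j → dp (suc j) (s≤s a<j)) dr i a+b<i))

record Monic (p : Poly) : Set where
  constructor monic
  field
    degree  : ℕ
    bound   : Deg≤ p degree
    leading : coeff p degree ≡ 1ℤ

monic-cong : ∀ {p r} → p ≋ r → Monic p → Monic r
monic-cong eq (monic d b l) = monic d (λ i d<i → ≡.trans (≡.sym (at eq i)) (b i d<i)) (≡.trans (≡.sym (at eq d)) l)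

monic-* : ∀ {p r} → Monic p → Monic r → Monic (p *ₚ r)
monic-* {p} {r} (monic a ba la) (monic b bb lb) = monic (a ℕ.+ b) (deg-* p r ba bb) (≡.trans (top-coeff p r ba bb) (≡.cong₂ ℤ._*_ la lb))

private
  normal-deg : ∀ p {d} → length p ≡ suc d → Deg≤ p d
  normal-deg p len i d<i = coeff-length p i (ℕ.≤-trans (ℕ.≤-reflexive len) d<i)

  normalize-monic-length : ∀ {p} (mp : Monic p) → length (normalize p) ≡ suc (Monic.degree mp)
  normalize-monic-length {p} (monic d b l) = ℕ.≤-antisym
    (normal-length (normalize p) (suc d) (proj₂ (normalize-correct p)) (λ i d<i → ≡.trans (at (normalize≋ p) i) (b i d<i)))
    (ℕ.≰⇒> λ len≤d → 0≢1 (≡.trans (≡.sym (coeff-length (normalize p) d len≤d)) (≡.trans (at (normalize≋ p) d) l)))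
    where
      0≢1 : ¬ 0ℤ ≡ 1ℤ
      0≢1 ()

  coeff-qPow-* : ∀ s p i → coeff (qPow s *ₚ p) (s ℕ.+ i) ≡ coeff p i
  coeff-qPow-* zero    p i = at (ℤ[q].*-identityˡ p) i
  coeff-qPow-* (suc s) p i = ≡.trans (at (0∷-* (qPow s) p) (suc (s ℕ.+ i))) (coeff-qPow-* s p i)

  coeff-- : ∀ p r i → coeff (p -ₚ r) i ≡ coeff p i ℤ.- coeff r i
  coeff-- p r i = ≡.trans (coeff-+ p (-ₚ r) i) (≡.cong (λ z → coeff p i ℤ.+ z) (≡.trans (coeff-scale (ℤ.- 1ℤ) r i) (ℤ.-1*i≡-i (coeff r i))))

  -- As g is monic, subtracting `t *ₚ g` removes the leading coefficient, and normalisation makes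
  -- the list shorter. Hence the length of f is enough fuel for the division to finish.
  remainder-small : ∀ fuel f g e → length g ≡ suc e → coeff g e ≡ 1ℤ → length f ℕ.≤ fuel →
    ∀ i → e ℕ.≤ i → coeff (f -ₚ divMonicFuel fuel f g *ₚ g) i ≡ 0ℤ
  remainder-small zero [] g e lg cg _ i e≤i = ≡.refl
  remainder-small (suc fuel) f g e lg cg lf i e≤i with length f ℕ.<? length g
  ... | yes f<g = ≡.trans (at (ℤ[q].+-identityʳ f) i) (coeff-length f i (ℕ.≤-trans (ℕ.≤-pred (≡.subst (length f ℕ.<_) lg f<g)) e≤i))
  ... | no  f≮g = ≡.trans (at eq i) (remainder-small fuel f′ g e lg cg len′ i e≤i)
    where
      s = length f ℕ.∸ length g
      t = scaleₚ (lead f) (qPow s)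
      f′ = normalize (f -ₚ t *ₚ g)
      Q′ = divMonicFuel fuel f′ g
      open ℤ[q] using (solve; _⊜_)
      eq : f -ₚ (t +ₚ Q′) *ₚ g ≋ f′ -ₚ Q′ *ₚ g
      eq = ℤ[q].trans (solve 4 (λ f t Q g → f ⊖ (t ⊕ Q) ⊗ g ⊜ f ⊖ t ⊗ g ⊖ Q ⊗ g) ℤ[q].refl f t Q′ g) (ℤ[q].+-congʳ (ℤ[q].sym (normalize≋ (f -ₚ t *ₚ g))))
      g≤f : length g ℕ.≤ length f
      g≤f = ℕ.≮⇒≥ f≮g
      lenf : length f ≡ suc (s ℕ.+ e)
      lenf = ≡.trans (≡.sym (ℕ.m∸n+n≡m g≤f)) (≡.trans (≡.cong (s ℕ.+_) lg) (ℕ.+-suc s e))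
      top : ∀ j → s ℕ.+ e ℕ.≤ j → coeff (f -ₚ t *ₚ g) j ≡ 0ℤ
      top j s+e≤j = ≡.trans (coeff-- f (t *ₚ g) j) (≡.trans (≡.cong (λ z → coeff f j ℤ.- z) tg) (cancel-top (ℕ.m≤n⇒m<n∨m≡n e≤k)))
        where
          k = j ℕ.∸ s
          j≡ : s ℕ.+ k ≡ j
          j≡ = ℕ.m+[n∸m]≡n (ℕ.≤-trans (ℕ.m≤m+n s e) s+e≤j)
          e≤k : e ℕ.≤ k
          e≤k = ℕ.≤-trans (ℕ.≤-reflexive (≡.sym (ℕ.m+n∸m≡n s e))) (ℕ.∸-monoˡ-≤ s s+e≤j)
          tg : coeff (t *ₚ g) j ≡ lead f ℤ.* coeff g k
          tg = ≡.trans (at (ℤ[q].trans (ℤ[q].*-congʳ {g} (ℤ[q].sym (constₚ-* (lead f) (qPow s)))) (ℤ[q].trans (ℤ[q].*-assoc (constₚ (lead f)) (qPow s) g) (constₚ-* (lead f) (qPow s *ₚ g)))) j)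
            (≡.trans (coeff-scale (lead f) (qPow s *ₚ g) j) (≡.cong (λ z → lead f ℤ.* z) (≡.trans (≡.cong (coeff (qPow s *ₚ g)) (≡.sym j≡)) (coeff-qPow-* s g k))))
          cancel-top : e ℕ.< k ⊎ e ≡ k → coeff f j ℤ.- lead f ℤ.* coeff g k ≡ 0ℤ
          cancel-top (inj₁ e<k) = ≡.cong₂ (λ x y → x ℤ.- lead f ℤ.* y) (coeff-length f j (≡.subst (ℕ._≤ j) (≡.sym lenf) (≡.subst (s ℕ.+ e ℕ.<_) j≡ (ℕ.+-monoʳ-< s e<k))))
            (coeff-length g k (≡.subst (ℕ._≤ k) (≡.sym lg) e<k)) ⟨≡⟩ ≡.cong (λ z → 0ℤ ℤ.- z) (ℤ.*-zeroʳ (lead f))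
            where
              _⟨≡⟩_ : ∀ {x y z : ℤ} → x ≡ y → y ≡ z → x ≡ z
              _⟨≡⟩_ = ≡.trans
          cancel-top (inj₂ e≡k) = ≡.trans (≡.cong₂ (λ x y → x ℤ.- lead f ℤ.* y) (≡.trans (≡.cong (coeff f) (≡.trans (≡.sym j≡) (≡.cong (s ℕ.+_) (≡.sym e≡k)))) (≡.sym (lead≡coeff f (s ℕ.+ e) lenf)))
            (≡.trans (≡.cong (coeff g) (≡.sym e≡k)) cg)) (≡.trans (≡.cong (λ z → lead f ℤ.- z) (ℤ.*-identityʳ (lead f))) (ℤ.+-inverseʳ (lead f)))
      len′ : length f′ ℕ.≤ fuel
      len′ = ℕ.≤-trans (normal-length f′ (s ℕ.+ e) (proj₂ (normalize-correct (f -ₚ t *ₚ g))) (λ j le → ≡.trans (at (normalize≋ (f -ₚ t *ₚ g)) j) (top j le)))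
        (ℕ.≤-pred (≡.subst (ℕ._≤ suc fuel) lenf lf))

-- Otherwise the leading coefficient of A would reappear, g being monic, as a coefficient of the
-- product at a degree at least e.
small-multiple : ∀ A g {e} → Deg≤ g e → coeff g e ≡ 1ℤ → (∀ i → e ℕ.≤ i → coeff (A *ₚ g) i ≡ 0ℤ) → A ≋ []
small-multiple A g {e} dg cg small with normalize A | normalize-correct A
... | []    | A′≋A , _  = ℤ[q].sym A′≋A
... | A′@(x ∷ xs) | A′≋A , nf = ⊥-elim (nf d ≡.refl (≡.trans (≡.sym (≡.trans (top-coeff A′ g (normal-deg A′ ≡.refl) dg) (≡.trans (≡.cong (λ z → coeff A′ d ℤ.* z) cg) (ℤ.*-identityʳ _))))
    (≡.trans (at (ℤ[q].*-congʳ {g} A′≋A) (d ℕ.+ e)) (small (d ℕ.+ e) (ℕ.m≤n+m e d)))))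
  where d = length xs

-- If c F = Q₀ G and Q is the computed quotient, then (Q₀ - c Q) G is c times the remainder, hence
-- of degree below that of G, hence zero. For a monic divisor, divisibility over ℚ is thus
-- divisibility over ℤ.
divMonic-exact : ∀ F G → Monic G → DividesQ G F → F ≋ divMonic F G *ₚ G
divMonic-exact F G mG@(monic e dG lG) (c , c≢0 , Q₀ , eq₀) = ℤ[q].trans (ℤ[q].x-y≈0⇒x≈y R≋0) (ℤ[q].*-cong {y = divMonic F G} (ℤ[q].sym (normalize≋ Q)) (normalize≋ G))
  where
    F′ = normalize F
    G′ = normalize G
    Q  = divMonicFuel (length F) F′ G′
    lenG : length G′ ≡ suc e
    lenG = normalize-monic-length mG
    cG : coeff G′ e ≡ 1ℤ
    cG = ≡.trans (at (normalize≋ G) e) lG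
    dG′ : Deg≤ G′ e
    dG′ = normal-deg G′ lenG
    small : ∀ i → e ℕ.≤ i → coeff (F -ₚ Q *ₚ G′) i ≡ 0ℤ
    small i e≤i = ≡.trans (at (ℤ[q].+-congʳ (ℤ[q].sym (normalize≋ F))) i) (remainder-small (length F) F′ G′ e lenG cG
      (normal-length F′ (length F) (proj₂ (normalize-correct F)) (λ j le → ≡.trans (at (normalize≋ F) j) (coeff-length F j le))) i e≤i)
    open ℤ[q] using (solve; _⊜_)
    A = Q₀ -ₚ constₚ c *ₚ Q
    AG : A *ₚ G′ ≋ scaleₚ c (F -ₚ Q *ₚ G′)
    AG = ℤ[q].trans (solve 4 (λ Q₀ c Q G → (Q₀ ⊖ c ⊗ Q) ⊗ G ⊜ Q₀ ⊗ G ⊖ c ⊗ (Q ⊗ G)) ℤ[q].refl Q₀ (constₚ c) Q G′)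
      (ℤ[q].trans (ℤ[q].+-congʳ (ℤ[q].trans (ℤ[q].*-congˡ {Q₀} (normalize≋ G)) (ℤ[q].trans (ℤ[q].sym (coefficients eq₀)) (ℤ[q].sym (constₚ-* c F)))))
      (ℤ[q].trans (solve 3 (λ c F X → c ⊗ F ⊖ c ⊗ X ⊜ c ⊗ (F ⊖ X)) ℤ[q].refl (constₚ c) F (Q *ₚ G′)) (constₚ-* c (F -ₚ Q *ₚ G′))))
    A≋0 : A ≋ []
    A≋0 = small-multiple A G′ dG′ cG (λ i e≤i → ≡.trans (at AG i) (≡.trans (coeff-scale c (F -ₚ Q *ₚ G′) i) (≡.trans (≡.cong (λ z → c ℤ.* z) (small i e≤i)) (ℤ.*-zeroʳ c))))
    R≋0 : F -ₚ Q *ₚ G′ ≋ []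
    R≋0 = nonzero-regular (constₚ c) 0 c≢0 (F -ₚ Q *ₚ G′) (ℤ[q].trans (constₚ-* c _) (ℤ[q].trans (ℤ[q].sym AG) (ℤ[q].*-congʳ {G′} A≋0)))

quotient-monic : ∀ {F G} Q → Monic F → Monic G → F ≋ Q *ₚ G → Monic Q
quotient-monic {F} {G} Q (monic n bF lF) (monic e bG lG) F≋ with normalize Q | normalize-correct Q
... | []    | Q′≋Q , _  = ⊥-elim (0≢1 (≡.trans (≡.sym (at (ℤ[q].trans F≋ (ℤ[q].*-congʳ {G} (ℤ[q].sym Q′≋Q))) n)) lF))
  where
    0≢1 : ¬ 0ℤ ≡ 1ℤ
    0≢1 ()
... | Q′@(x ∷ xs) | Q′≋Q , nf = monic-cong Q′≋Q (monic d (normal-deg Q′ ≡.refl) (≡.trans (≡.sym top) (≡.trans (≡.sym (at F≋′ (d ℕ.+ e))) (≡.trans (≡.cong (coeff F) d+e≡n) lF))))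
  where
    d = length xs
    F≋′ : F ≋ Q′ *ₚ G
    F≋′ = ℤ[q].trans F≋ (ℤ[q].*-congʳ {G} (ℤ[q].sym Q′≋Q))
    top : coeff (Q′ *ₚ G) (d ℕ.+ e) ≡ coeff Q′ d
    top = ≡.trans (top-coeff Q′ G (normal-deg Q′ ≡.refl) bG) (≡.trans (≡.cong (λ z → coeff Q′ d ℤ.* z) lG) (ℤ.*-identityʳ _))
    d+e≡n : d ℕ.+ e ≡ n
    d+e≡n with ℕ.<-cmp (d ℕ.+ e) n
    ... | tri≈ _ eq _ = eq
    ... | tri< lt _ _ = ⊥-elim (1≢0 (≡.trans (≡.sym lF) (≡.trans (at F≋′ n) (deg-* Q′ G (normal-deg Q′ ≡.refl) bG n lt))))
      where
        1≢0 : ¬ 1ℤ ≡ 0ℤ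
        1≢0 ()
    ... | tri> _ _ gt = ⊥-elim (nf d ≡.refl (≡.trans (≡.sym top) (≡.trans (≡.sym (at F≋′ (d ℕ.+ e))) (bF (d ℕ.+ e) gt))))

-- Divisibility and coprimality over ℚ

private
  open module Z = ℤ[q] using (solve; _⊜_)

-- `DividesQ` and `CoprimeQ` with scalars written as constant polynomials and with `_≋_`, the form
-- in which the ring solver applies.
Divides Coprime : Poly → Poly → Set
Divides P N = Σ ℤ λ c → (¬ c ≡ 0ℤ) × (Σ Poly λ Q → constₚ c *ₚ N ≋ Q *ₚ P)
Coprime D P = Σ ℤ λ c → (¬ c ≡ 0ℤ) × (Σ Poly λ u → Σ Poly λ v → u *ₚ D +ₚ v *ₚ P ≋ constₚ c)

const-* : ∀ c d → constₚ (c ℤ.* d) ≋ constₚ c *ₚ constₚ d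
const-* c d = coefficients λ { zero → ≡.sym (ℤ.+-identityʳ _) ; (suc i) → ≡.refl }

nonzero-* : ∀ {c d} → ¬ c ≡ 0ℤ → ¬ d ≡ 0ℤ → ¬ c ℤ.* d ≡ 0ℤ
nonzero-* {c} {d} c≢0 d≢0 eq with ℤ.i*j≡0⇒i≡0∨j≡0 c eq
... | inj₁ c≡0 = c≢0 c≡0
... | inj₂ d≡0 = d≢0 d≡0

1≢0 : ¬ 1ℤ ≡ 0ℤ
1≢0 ()

divides-exact : ∀ {P N} Q → N ≋ Q *ₚ P → Divides P N
divides-exact {P} {N} Q eq = 1ℤ , 1≢0 , Q , Z.trans (Z.*-identityˡ N) eq

divides-cong : ∀ {P P′ N N′} → P ≋ P′ → N ≋ N′ → Divides P N → Divides P′ N′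
divides-cong eP eN (c , c≢0 , Q , eq) = c , c≢0 , Q , Z.trans (Z.*-congˡ {constₚ c} (Z.sym eN)) (Z.trans eq (Z.*-congˡ {Q} eP))

divides-0 : ∀ P → Divides P []
divides-0 P = divides-exact [] Z.refl

divides-+ : ∀ {P M N} → Divides P M → Divides P N → Divides P (M +ₚ N)
divides-+ {P} {M} {N} (c , c≢0 , Q , eq) (d , d≢0 , R , eq′) = c ℤ.* d , nonzero-* c≢0 d≢0 , constₚ d *ₚ Q +ₚ constₚ c *ₚ R ,
  Z.trans (Z.*-congʳ (const-* c d)) (Z.trans (solve 4 (λ c d M N → c ⊗ d ⊗ (M ⊕ N) ⊜ d ⊗ (c ⊗ M) ⊕ c ⊗ (d ⊗ N)) Z.refl (constₚ c) (constₚ d) M N)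
    (Z.trans (Z.+-cong (Z.*-congˡ {constₚ d} eq) (Z.*-congˡ {constₚ c} eq′)) (solve 5 (λ c d Q R P → d ⊗ (Q ⊗ P) ⊕ c ⊗ (R ⊗ P) ⊜ (d ⊗ Q ⊕ c ⊗ R) ⊗ P) Z.refl (constₚ c) (constₚ d) Q R P)))

divides-* : ∀ {P N} a → Divides P N → Divides P (a *ₚ N)
divides-* {P} {N} a (c , c≢0 , Q , eq) = c , c≢0 , a *ₚ Q , Z.trans (solve 3 (λ c a N → c ⊗ (a ⊗ N) ⊜ a ⊗ (c ⊗ N)) Z.refl (constₚ c) a N) (Z.trans (Z.*-congˡ {a} eq) (Z.sym (Z.*-assoc a Q P)))

divides-*-* : ∀ {P N P′ N′} → Divides P N → Divides P′ N′ → Divides (P *ₚ P′) (N *ₚ N′)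
divides-*-* {P} {N} {P′} {N′} (c , c≢0 , Q , eq) (d , d≢0 , R , eq′) = c ℤ.* d , nonzero-* c≢0 d≢0 , Q *ₚ R ,
  Z.trans (Z.*-congʳ (const-* c d)) (Z.trans (solve 4 (λ c d M N → c ⊗ d ⊗ (M ⊗ N) ⊜ c ⊗ M ⊗ (d ⊗ N)) Z.refl (constₚ c) (constₚ d) N N′)
    (Z.trans (Z.*-cong eq eq′) (solve 4 (λ Q P R P′ → Q ⊗ P ⊗ (R ⊗ P′) ⊜ Q ⊗ R ⊗ (P ⊗ P′)) Z.refl Q P R P′)))

-- From u A + v B = k one gets k N = u A N + v B N, and each term is a multiple of A B up to an
-- integer: the first because B divides N, the second because A does.
divides-coprime-* : ∀ {A B N} → Coprime A B → Divides A N → Divides B N → Divides (A *ₚ B) N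
divides-coprime-* {A} {B} {N} (k , k≢0 , u , v , eq) (c , c≢0 , Q , eqA) (d , d≢0 , R , eqB) =
  k ℤ.* (c ℤ.* d) , nonzero-* k≢0 (nonzero-* c≢0 d≢0) , constₚ c *ₚ u *ₚ R +ₚ constₚ d *ₚ v *ₚ Q ,
  Z.trans (Z.*-congʳ (Z.trans (const-* k (c ℤ.* d)) (Z.*-cong (Z.sym eq) (const-* c d))))
    (Z.trans (solve 7 (λ u A v B c d N → (u ⊗ A ⊕ v ⊗ B) ⊗ (c ⊗ d) ⊗ N ⊜ c ⊗ u ⊗ A ⊗ (d ⊗ N) ⊕ d ⊗ v ⊗ B ⊗ (c ⊗ N)) Z.refl u A v B (constₚ c) (constₚ d) N)
    (Z.trans (Z.+-cong (Z.*-congˡ {constₚ c *ₚ u *ₚ A} eqB) (Z.*-congˡ {constₚ d *ₚ v *ₚ B} eqA))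
    (solve 8 (λ u A v B c d R Q → c ⊗ u ⊗ A ⊗ (R ⊗ B) ⊕ d ⊗ v ⊗ B ⊗ (Q ⊗ A) ⊜ (c ⊗ u ⊗ R ⊕ d ⊗ v ⊗ Q) ⊗ (A ⊗ B)) Z.refl u A v B (constₚ c) (constₚ d) R Q)))

coprime-sym : ∀ {A B} → Coprime A B → Coprime B A
coprime-sym (c , c≢0 , u , v , eq) = c , c≢0 , v , u , Z.trans (Z.+-comm (v *ₚ _) (u *ₚ _)) eq

coprime-congˡ : ∀ {A A′ B} → A ≋ A′ → Coprime A B → Coprime A′ B
coprime-congˡ eA (c , c≢0 , u , v , eq) = c , c≢0 , u , v , Z.trans (Z.+-congʳ (Z.*-congˡ {u} (Z.sym eA))) eq

coprime-1 : ∀ B → Coprime oneₚ B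
coprime-1 B = 1ℤ , 1≢0 , oneₚ , [] , Z.trans (Z.+-identityʳ (oneₚ *ₚ oneₚ)) (Z.*-identityˡ oneₚ)

coprime-const : ∀ {c} B → ¬ c ≡ 0ℤ → Coprime (constₚ c) B
coprime-const {c} B c≢0 = c , c≢0 , oneₚ , [] , Z.trans (Z.+-identityʳ (oneₚ *ₚ constₚ c)) (Z.*-identityˡ (constₚ c))

coprime-*ˡ : ∀ {A A′ B} → Coprime A B → Coprime A′ B → Coprime (A *ₚ A′) B
coprime-*ˡ {A} {A′} {B} (c , c≢0 , u , v , eq) (d , d≢0 , u′ , v′ , eq′) = c ℤ.* d , nonzero-* c≢0 d≢0 ,
  u *ₚ u′ , u *ₚ A *ₚ v′ +ₚ v *ₚ (u′ *ₚ A′ +ₚ v′ *ₚ B) ,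
  Z.trans (solve 7 (λ u A v B u′ A′ v′ → u ⊗ u′ ⊗ (A ⊗ A′) ⊕ (u ⊗ A ⊗ v′ ⊕ v ⊗ (u′ ⊗ A′ ⊕ v′ ⊗ B)) ⊗ B ⊜ (u ⊗ A ⊕ v ⊗ B) ⊗ (u′ ⊗ A′ ⊕ v′ ⊗ B)) Z.refl u A v B u′ A′ v′)
    (Z.trans (Z.*-cong eq eq′) (Z.sym (const-* c d)))

coprime-factorˡ : ∀ {A X B} → Coprime (A *ₚ X) B → Coprime A B
coprime-factorˡ {A} {X} {B} (c , c≢0 , u , v , eq) = c , c≢0 , u *ₚ X , v , Z.trans (solve 5 (λ u X A v B → u ⊗ X ⊗ A ⊕ v ⊗ B ⊜ u ⊗ (A ⊗ X) ⊕ v ⊗ B) Z.refl u X A v B) eq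

coprime-+ˡ : ∀ {A B} X → Coprime A B → Coprime (A +ₚ X *ₚ B) B
coprime-+ˡ {A} {B} X (c , c≢0 , u , v , eq) = c , c≢0 , u , v -ₚ u *ₚ X , Z.trans (solve 5 (λ u A X B v → u ⊗ (A ⊕ X ⊗ B) ⊕ (v ⊖ u ⊗ X) ⊗ B ⊜ u ⊗ A ⊕ v ⊗ B) Z.refl u A X B v) eq

coprime-prodˡ : ∀ n {f B} → (∀ i → i ℕ.< n → Coprime (f i) B) → Coprime (Z.prod n f) B
coprime-prodˡ zero    {B = B} h = coprime-1 B
coprime-prodˡ (suc n) h = coprime-*ˡ (coprime-prodˡ n (λ i i<n → h i (ℕ.m<n⇒m<1+n i<n))) (h n (ℕ.n<1+n n))

coprime-^ʳ : ∀ {A B} k → Coprime A B → Coprime A (B ^ₚ k)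
coprime-^ʳ zero    c = coprime-sym (coprime-1 _)
coprime-^ʳ (suc k) c = coprime-sym (coprime-*ˡ (coprime-sym c) (coprime-sym (coprime-^ʳ k c)))

-- The binomials q^k - 1

qPow-1 : ℕ → Poly
qPow-1 k = qPow k -ₚ oneₚ

qPow-+ : ∀ a b → qPow (a ℕ.+ b) ≋ qPow a *ₚ qPow b
qPow-+ a b = Z.trans (qPow≋ (a ℕ.+ b)) (Z.trans (Z.pow-+ 𝕢 a b) (Z.*-cong (Z.sym (qPow≋ a)) (Z.sym (qPow≋ b))))

geometric : ℕ → ℕ → Poly
geometric k d = Z.sum k (λ i → qPow (i ℕ.* d))

qPow-1-multiple : ∀ k d → qPow-1 (k ℕ.* d) ≋ geometric k d *ₚ qPow-1 d
qPow-1-multiple zero    d = Z.-‿inverseʳ oneₚ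
qPow-1-multiple (suc k) d = Z.trans (Z.+-congʳ (qPow-+ d (k ℕ.* d))) (Z.trans
  (solve 2 (λ a b → a ⊗ b ⊖ 𝟙 ⊜ b ⊖ 𝟙 ⊕ b ⊗ (a ⊖ 𝟙)) Z.refl (qPow d) (qPow (k ℕ.* d)))
  (Z.trans (Z.+-congʳ (qPow-1-multiple k d)) (Z.sym (Z.distribʳ (qPow-1 d) (geometric k d) (qPow (k ℕ.* d))))))

const-suc : ∀ k → constₚ (+ suc k) ≋ constₚ (+ k) +ₚ oneₚ
const-suc k = coefficients λ { zero → ≡.cong +_ (ℕ.+-comm 1 k) ; (suc i) → ≡.refl }

geometric-mod : ∀ k d → Σ Poly λ W → geometric k d ≋ constₚ (+ k) +ₚ W *ₚ qPow-1 d
geometric-mod zero    d = [] , coefficients λ { zero → ≡.refl ; (suc i) → ≡.refl }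
geometric-mod (suc k) d = let (W , eq) = geometric-mod k d in W +ₚ geometric k d , Z.trans (Z.+-cong eq (Z.trans
    (solve 1 (λ a → a ⊜ 𝟙 ⊕ (a ⊖ 𝟙)) Z.refl (qPow (k ℕ.* d))) (Z.+-congˡ {oneₚ} (qPow-1-multiple k d))))
  (Z.trans (solve 4 (λ c W x g → c ⊕ W ⊗ x ⊕ (𝟙 ⊕ g ⊗ x) ⊜ c ⊕ 𝟙 ⊕ (W ⊕ g) ⊗ x) Z.refl (constₚ (+ k)) W (qPow-1 d) (geometric k d)) (Z.+-congʳ {(W +ₚ geometric k d) *ₚ qPow-1 d} (Z.sym (const-suc k))))

qPow-1-regular : ∀ i → 0 ℕ.< i → Z.Regular (qPow-1 i)
qPow-1-regular i 0<i = Z.reg-cong (solve 1 (λ a → ⊝ (𝟙 ⊖ a) ⊜ a ⊖ 𝟙) Z.refl (qPow i)) (Z.reg-neg {oneₚ -ₚ qPow i} (1-qPow-regular i 0<i))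

-- If g + y e = x j, then q^g - 1 = (q^{xj} - 1) - q^g (q^{ye} - 1), and both binomials are
-- multiples of q^j - 1 and q^e - 1. The other sign in Bézout's identity is symmetric.
qPow-1-gcd : ∀ j e → Σ Poly λ u → Σ Poly λ v → qPow-1 (gcd j e) ≋ u *ₚ qPow-1 j +ₚ v *ₚ qPow-1 e
qPow-1-gcd j e with Bézout.identity (gcd-GCD j e)
... | Bézout.+- x y eq = geometric x j , -ₚ (qPow g *ₚ geometric y e) , bezout
  where
    g = gcd j e
    bezout : qPow-1 g ≋ geometric x j *ₚ qPow-1 j +ₚ (-ₚ (qPow g *ₚ geometric y e)) *ₚ qPow-1 e
    bezout = Z.trans (solve 2 (λ a b → a ⊖ 𝟙 ⊜ a ⊗ b ⊖ 𝟙 ⊖ a ⊗ (b ⊖ 𝟙)) Z.refl (qPow g) (qPow (y ℕ.* e)))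
      (Z.trans (Z.+-cong (Z.trans (Z.+-congʳ (Z.trans (Z.sym (qPow-+ g (y ℕ.* e))) (Z.reflexive (≡.cong qPow eq)))) (qPow-1-multiple x j)) (Z.-‿cong (Z.*-congˡ {qPow g} (qPow-1-multiple y e))))
      (solve 4 (λ A a G E → A ⊖ a ⊗ (G ⊗ E) ⊜ A ⊕ (⊝ (a ⊗ G)) ⊗ E) Z.refl (geometric x j *ₚ qPow-1 j) (qPow g) (geometric y e) (qPow-1 e)))
... | Bézout.-+ x y eq = -ₚ (qPow g *ₚ geometric x j) , geometric y e , bezout
  where
    g = gcd j e
    bezout : qPow-1 g ≋ (-ₚ (qPow g *ₚ geometric x j)) *ₚ qPow-1 j +ₚ geometric y e *ₚ qPow-1 e
    bezout = Z.trans (solve 2 (λ a b → a ⊖ 𝟙 ⊜ ⊝ (a ⊗ (b ⊖ 𝟙)) ⊕ (a ⊗ b ⊖ 𝟙)) Z.refl (qPow g) (qPow (x ℕ.* j)))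
      (Z.trans (Z.+-cong (Z.-‿cong (Z.*-congˡ {qPow g} (qPow-1-multiple x j))) (Z.trans (Z.+-congʳ (Z.trans (Z.sym (qPow-+ g (x ℕ.* j))) (Z.reflexive (≡.cong qPow eq)))) (qPow-1-multiple y e)))
      (solve 4 (λ A a G E → ⊝ (a ⊗ (G ⊗ E)) ⊕ A ⊜ (⊝ (a ⊗ G)) ⊗ E ⊕ A) Z.refl (geometric y e *ₚ qPow-1 e) (qPow g) (geometric x j) (qPow-1 j)))

-- Cyclotomic polynomials

cyclotomicFactor : ℕ → ℕ → Poly
cyclotomicFactor n i = if does (suc i ∣? n) then Φ (suc i) else oneₚ

private
  length-cycList : ∀ m → length (cycList m) ≡ m
  length-cycList zero    = ≡.refl
  length-cycList (suc m) = ≡.trans (length-++ (cycList m)) (≡.trans (ℕ.+-comm _ 1) (≡.cong suc (length-cycList m)))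

  nth-snoc : ∀ (xs : List Poly) x → nth (xs ++ x ∷ []) (length xs) ≡ x
  nth-snoc []       x = ≡.refl
  nth-snoc (y ∷ xs) x = nth-snoc xs x

  Φ-suc : ∀ m → Φ (suc m) ≡ divMonic (qPow-1 (suc m)) (prodDivisors (suc m) (cycList m) 1)
  Φ-suc m = ≡.trans (≡.cong (nth (cycList (suc m))) (≡.sym (length-cycList m))) (nth-snoc (cycList m) _)

  prodDivisors-snoc : ∀ n xs x d → prodDivisors n (xs ++ x ∷ []) d ≋ prodDivisors n xs d *ₚ (if does (d ℕ.+ length xs ∣? n) then x else oneₚ)
  prodDivisors-snoc n [] x d rewrite ℕ.+-identityʳ d with does (d ∣? n)
  ... | true  = Z.*-comm x oneₚ
  ... | false = Z.sym (Z.*-identityˡ oneₚ)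
  prodDivisors-snoc n (y ∷ xs) x d rewrite ℕ.+-suc d (length xs) with does (d ∣? n)
  ... | true  = Z.trans (Z.*-congˡ {y} (prodDivisors-snoc n xs x (suc d))) (Z.sym (Z.*-assoc y _ _))
  ... | false = prodDivisors-snoc n xs x (suc d)

  prodDivisors-cycList : ∀ n m → prodDivisors n (cycList m) 1 ≋ Z.prod m (cyclotomicFactor n)
  prodDivisors-cycList n zero    = Z.refl
  prodDivisors-cycList n (suc m) = Z.trans (prodDivisors-snoc n (cycList m) _ 1)
    (Z.*-cong (prodDivisors-cycList n m) (Z.reflexive (≡.cong₂ (λ k x → if does (suc k ∣? n) then x else oneₚ) (length-cycList m) (≡.sym (Φ-suc m)))))

if-cases : ∀ {A : Set} (d : Dec A) {x y : Poly} → (A × (if does d then x else y) ≡ x) ⊎ (¬ A × (if does d then x else y) ≡ y)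
if-cases (yes a) = inj₁ (a , ≡.refl)
if-cases (no ¬a) = inj₂ (¬a , ≡.refl)

factor-cases : ∀ n i → (suc i ∣ n × cyclotomicFactor n i ≡ Φ (suc i)) ⊎ (¬ suc i ∣ n × cyclotomicFactor n i ≡ oneₚ)
factor-cases n i = if-cases (suc i ∣? n)

factor-divisor : ∀ n i → suc i ∣ n → cyclotomicFactor n i ≡ Φ (suc i)
factor-divisor n i d with factor-cases n i
... | inj₁ (_ , eq) = eq
... | inj₂ (¬d , _) = ⊥-elim (¬d d)

private
  -- Both properties are proved together: the division defining Φ n is exact because the Φ of the
  -- smaller divisors are monic and pairwise coprime, and coprimality in turn rests on the product
  -- formula for smaller indices.
  Claim : ℕ → Set
  Claim n = Monic (Φ n) × qPow-1 n ≋ Z.prod n (cyclotomicFactor n)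

  complement : ∀ {e} → Claim (suc e) → qPow-1 (suc e) ≋ Z.prod e (cyclotomicFactor (suc e)) *ₚ Φ (suc e)
  complement {e} (_ , eq) = Z.trans eq (Z.*-congˡ {Z.prod e (cyclotomicFactor (suc e))} (Z.reflexive (factor-divisor (suc e) e ∣-refl)))

  -- Put g = gcd(j, e′) and e′ = k g, where e′ = e + 1 does not divide j, so g < e′. The product
  -- formulas show that Φ of e′ divides (q^{e′} - 1)/(q^g - 1), which is congruent to k modulo q^g -
  -- 1; and q^g - 1 is a combination of q^j - 1 and q^{e′} - 1. This gives a combination equal to
  -- the nonzero constant k.
  coprime-claim : ∀ e → (∀ g → 0 ℕ.< g → g ℕ.≤ suc e → Claim g) → ∀ j → ¬ suc e ∣ j → Coprime (qPow-1 j) (Φ (suc e))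
  coprime-claim e claim j e∤j with gcd j (suc e) in eq-g | gcd[m,n]∣m j (suc e) | gcd[m,n]∣n j (suc e) | qPow-1-gcd j (suc e)
  ... | zero  | _ | g∣e | _ with () ← 0∣⇒≡0 g∣e
  ... | suc g | g∣j | divides k e≡kg | u , v , bezout = + k , k≢0 , (-ₚ W) *ₚ u , X -ₚ W *ₚ v *ₚ C , final
    where
      g<e : suc g ℕ.≤ e
      g<e with ℕ.m≤n⇒m<n∨m≡n (∣⇒≤ (divides k e≡kg))
      ... | inj₁ (s≤s lt) = lt
      ... | inj₂ eq = ⊥-elim (e∤j (≡.subst (_∣ j) eq g∣j))
      k≢0 : ¬ + k ≡ 0ℤ
      k≢0 eq = ℕ.1+n≢0 (≡.trans e≡kg (≡.cong (ℕ._* suc g) (ℤ.+-injective eq)))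
      C = Z.prod e (cyclotomicFactor (suc e))
      Φe = Φ (suc e)
      D = qPow-1 (suc g)
      W = proj₁ (geometric-mod k (suc g))
      W-eq = proj₂ (geometric-mod k (suc g))
      other : ℕ → Poly
      other i = if does (suc i ∣? suc g) then oneₚ else cyclotomicFactor (suc e) i
      split : ∀ i → cyclotomicFactor (suc e) i ≋ cyclotomicFactor (suc g) i *ₚ other i
      split i with if-cases (suc i ∣? suc g) {Φ (suc i)} {oneₚ} | if-cases (suc i ∣? suc g) {oneₚ} {cyclotomicFactor (suc e) i}
      ... | inj₁ (i∣g , eq) | inj₁ (_ , eq′) = Z.trans (Z.reflexive (factor-divisor (suc e) i (∣-trans i∣g (divides k e≡kg))))
              (Z.sym (Z.trans (Z.*-cong (Z.reflexive eq) (Z.reflexive eq′)) (Z.*-identityʳ _)))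
      ... | inj₂ (_ , eq)   | inj₂ (_ , eq′) = Z.sym (Z.trans (Z.*-cong (Z.reflexive eq) (Z.reflexive eq′)) (Z.*-identityˡ _))
      ... | inj₁ (i∣g , _)  | inj₂ (i∤g , _) = ⊥-elim (i∤g i∣g)
      ... | inj₂ (i∤g , _)  | inj₁ (i∣g , _) = ⊥-elim (i∤g i∣g)
      O = Z.prod (suc g) other
      Y = Z.prod (e ℕ.∸ suc g) (λ i → cyclotomicFactor (suc e) (suc g ℕ.+ i))
      X = O *ₚ Y
      C≋DX : C ≋ D *ₚ X
      C≋DX = Z.trans (Z.reflexive (≡.cong (λ n → Z.prod n (cyclotomicFactor (suc e))) (≡.sym (ℕ.m+[n∸m]≡n g<e))))
        (Z.trans (Z.prod-+ (suc g) (e ℕ.∸ suc g) (cyclotomicFactor (suc e)))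
        (Z.trans (Z.*-congʳ {Y} {Z.prod (suc g) (cyclotomicFactor (suc e))} {D *ₚ O} (Z.trans (Z.prod-cong (suc g) (λ i _ → split i)) (Z.trans (Z.prod-* (suc g) (cyclotomicFactor (suc g)) other) (Z.*-congʳ (Z.sym (proj₂ (claim (suc g) (s≤s z≤n) (ℕ.m≤n⇒m≤1+n g<e)))))))) (Z.*-assoc D O Y)))
      e-eq = complement (claim (suc e) (s≤s z≤n) ℕ.≤-refl)
      geometric≋ : geometric k (suc g) ≋ X *ₚ Φe
      geometric≋ = Z.cancel {a = D} {x = geometric k (suc g)} {y = X *ₚ Φe} (qPow-1-regular (suc g) (s≤s z≤n)) (Z.trans (Z.*-comm D (geometric k (suc g))) (Z.trans (Z.sym (qPow-1-multiple k (suc g)))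
        (Z.trans (Z.reflexive (≡.cong qPow-1 (≡.sym e≡kg))) (Z.trans e-eq (Z.trans (Z.*-congʳ {Φe} {C} {D *ₚ X} C≋DX) (Z.*-assoc D X Φe))))))
      final : (-ₚ W) *ₚ u *ₚ qPow-1 j +ₚ (X -ₚ W *ₚ v *ₚ C) *ₚ Φe ≋ constₚ (+ k)
      final = Z.trans (solve 7 (λ W u J X v C F → (⊝ W) ⊗ u ⊗ J ⊕ (X ⊖ W ⊗ v ⊗ C) ⊗ F ⊜ X ⊗ F ⊖ W ⊗ (u ⊗ J ⊕ v ⊗ (C ⊗ F))) Z.refl W u (qPow-1 j) X v C Φe)
        (Z.trans (Z.+-cong (Z.trans (Z.sym geometric≋) W-eq) (Z.-‿cong (Z.*-congˡ {W} (Z.trans (Z.+-congˡ {u *ₚ qPow-1 j} (Z.*-congˡ {v} (Z.sym e-eq))) (Z.sym bezout)))))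
        (solve 2 (λ c x → c ⊕ x ⊖ x ⊜ c) Z.refl (constₚ (+ k)) (W *ₚ D)))

  claims : ∀ n → (∀ m → 0 ℕ.< m → m ℕ.≤ n → Claim m)
  claims zero    m 0<m m≤0 = ⊥-elim (ℕ.n≮0 (ℕ.<-≤-trans 0<m m≤0))
  claims (suc n) m 0<m m≤n with ℕ.m≤n⇒m<n∨m≡n m≤n
  ... | inj₁ m<n = claims n m 0<m (ℕ.≤-pred m<n)
  ... | inj₂ ≡.refl = quotient-monic (Φ (suc n)) monic-F monic-G exact , Z.trans exact (Z.trans (Z.*-congˡ {Φ (suc n)} (prodDivisors-cycList (suc n) n))
      (Z.trans (Z.*-comm (Φ (suc n)) _) (Z.*-congˡ {Z.prod n (cyclotomicFactor (suc n))} (Z.reflexive (≡.sym (factor-divisor (suc n) n ∣-refl))))))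
    where
      F = qPow-1 (suc n)
      G = prodDivisors (suc n) (cycList n) 1
      claim : ∀ i → i ℕ.< n → Claim (suc i)
      claim i i<n = claims n (suc i) (s≤s z≤n) i<n
      coeff-qPow : ∀ k → coeff (qPow k) k ≡ 1ℤ
      coeff-qPow zero    = ≡.refl
      coeff-qPow (suc k) = coeff-qPow k
      deg-qPow : ∀ k → Deg≤ (qPow k) k
      deg-qPow zero    (suc i) _         = ≡.refl
      deg-qPow (suc k) (suc i) (s≤s k<i) = deg-qPow k i k<i
      monic-F : Monic F
      monic-F = monic (suc n) (λ i n<i → ≡.trans (coeff-+ (qPow (suc n)) (-ₚ oneₚ) i) (≡.cong₂ ℤ._+_ (deg-qPow (suc n) i n<i) (coeff-one i (ℕ.<-≤-trans (s≤s z≤n) n<i))))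
        (≡.trans (coeff-+ (qPow (suc n)) (-ₚ oneₚ) (suc n)) (≡.cong₂ ℤ._+_ (coeff-qPow (suc n)) (coeff-one (suc n) (s≤s z≤n))))
        where
          coeff-one : ∀ i → 0 ℕ.< i → coeff (-ₚ oneₚ) i ≡ 0ℤ
          coeff-one (suc i) _ = ≡.refl
      monic-factor : ∀ i → i ℕ.< n → Monic (cyclotomicFactor (suc n) i)
      monic-factor i i<n with factor-cases (suc n) i
      ... | inj₁ (_ , eq) = ≡.subst Monic (≡.sym eq) (proj₁ (claim i i<n))
      ... | inj₂ (_ , eq) = ≡.subst Monic (≡.sym eq) (monic 0 (λ { (suc i) _ → ≡.refl }) ≡.refl)
      monic-prod : ∀ k → k ℕ.≤ n → Monic (Z.prod k (cyclotomicFactor (suc n)))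
      monic-prod zero    _   = monic 0 (λ { (suc i) _ → ≡.refl }) ≡.refl
      monic-prod (suc k) k<n = monic-* (monic-prod k (ℕ.<⇒≤ k<n)) (monic-factor k k<n)
      monic-G : Monic G
      monic-G = monic-cong (Z.sym (prodDivisors-cycList (suc n) n)) (monic-prod n ℕ.≤-refl)
      coprime-factors : ∀ i k → i ℕ.< k → k ℕ.< n → Coprime (cyclotomicFactor (suc n) i) (cyclotomicFactor (suc n) k)
      coprime-factors i k i<k k<n with factor-cases (suc n) i | factor-cases (suc n) k
      ... | inj₂ (_ , eq) | _             = ≡.subst (λ x → Coprime x _) (≡.sym eq) (coprime-1 _)
      ... | inj₁ _        | inj₂ (_ , eq) = ≡.subst (Coprime _) (≡.sym eq) (coprime-sym (coprime-1 _))
      ... | inj₁ (_ , eq) | inj₁ (_ , eq′) = ≡.subst₂ Coprime (≡.sym eq) (≡.sym eq′) (coprime-factorˡ {X = Z.prod i (cyclotomicFactor (suc i))} (coprime-congˡ (Z.trans (complement (claim i (ℕ.<-trans i<k k<n))) (Z.*-comm _ (Φ (suc i))))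
          (coprime-claim k (λ g 0<g g≤k → claims n g 0<g (ℕ.≤-trans g≤k k<n)) (suc i) (λ k∣i → ℕ.<⇒≱ i<k (ℕ.≤-pred (∣⇒≤ k∣i))))))
      divides-factor : ∀ i → i ℕ.< n → Divides (cyclotomicFactor (suc n) i) F
      divides-factor i i<n with factor-cases (suc n) i
      ... | inj₂ (_ , eq) = ≡.subst (λ P → Divides P F) (≡.sym eq) (divides-exact F (Z.sym (Z.*-identityʳ F)))
      ... | inj₁ (divides x n≡ , eq) = ≡.subst (λ P → Divides P F) (≡.sym eq) (divides-exact (geometric x (suc i) *ₚ Z.prod i (cyclotomicFactor (suc i)))
          (Z.trans (Z.reflexive (≡.cong qPow-1 n≡)) (Z.trans (qPow-1-multiple x (suc i)) (Z.trans (Z.*-congˡ {geometric x (suc i)} (complement (claim i i<n))) (Z.sym (Z.*-assoc (geometric x (suc i)) _ (Φ (suc i))))))))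
      divides-prod : ∀ k → k ℕ.≤ n → Divides (Z.prod k (cyclotomicFactor (suc n))) F
      divides-prod zero    _   = divides-exact F (Z.sym (Z.*-identityʳ F))
      divides-prod (suc k) k<n = divides-coprime-* {N = F} (coprime-prodˡ k (λ i i<k → coprime-factors i k i<k k<n)) (divides-prod k (ℕ.<⇒≤ k<n)) (divides-factor k k<n)
      exact : F ≋ Φ (suc n) *ₚ G
      exact = let (c , c≢0 , Q , eq) = divides-cong {N = F} {F} (Z.sym (prodDivisors-cycList (suc n) n)) (Z.refl {F}) (divides-prod n ℕ.≤-refl) in
        Z.trans (divMonic-exact F G monic-G (c , c≢0 , Q , at (Z.trans (Z.sym (constₚ-* c F)) eq))) (Z.*-congʳ (Z.reflexive (≡.sym (Φ-suc n))))

cyclotomic-product : ∀ n → 0 ℕ.< n → qPow-1 n ≋ Z.prod n (cyclotomicFactor n)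
cyclotomic-product n 0<n = proj₂ (claims n n 0<n ℕ.≤-refl)

cyclotomic-divides : ∀ e → Σ Poly λ X → qPow-1 (suc e) ≋ X *ₚ Φ (suc e)
cyclotomic-divides e = Z.prod e (cyclotomicFactor (suc e)) , complement (claims (suc e) (suc e) (s≤s z≤n) ℕ.≤-refl)

cyclotomic-coprime : ∀ e j → ¬ suc e ∣ j → Coprime (qPow-1 j) (Φ (suc e))
cyclotomic-coprime e = coprime-claim e (claims (suc e))

-- Congruence modulo a polynomial and its powers.

divides-unscale : ∀ {P N d} → ¬ d ≡ 0ℤ → Divides P (constₚ d *ₚ N) → Divides P N
divides-unscale {P} {N} {d} d≢0 (c , c≢0 , Q , eq) = c ℤ.* d , nonzero-* c≢0 d≢0 , Q , Z.trans (Z.*-congʳ (const-* c d)) (Z.trans (Z.*-assoc (constₚ c) (constₚ d) N) eq)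

divides-trans : ∀ {P X N} → Divides (P *ₚ X) N → Divides P N
divides-trans {P} {X} (c , c≢0 , Q , eq) = c , c≢0 , Q *ₚ X , Z.trans eq (solve 3 (λ Q P X → Q ⊗ (P ⊗ X) ⊜ Q ⊗ X ⊗ P) Z.refl Q P X)

divides-isIdeal : ∀ P → IsIdeal polyRing (Divides P)
divides-isIdeal P = record
  { I-cong = λ {x} {y} → divides-cong {N = x} {y} (Z.refl {P})
  ; I-0    = divides-0 P
  ; I-+    = λ {x} {y} → divides-+ {M = x} {y}
  ; I-*    = λ a {x} → divides-* {N = x} a }

-- ℤ[q] with congruence modulo P over ℚ
module Modulo (P : Poly) where
  open IdealQuotient polyRing (Divides P) (divides-isIdeal P) public

  ring : CommutativeRing 0ℓ 0ℓ
  ring = record { isCommutativeRing = isCommutativeRingᵢ }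
  private module K = Ring ring

  coprime-regular : ∀ {x} → Coprime x P → K.Regular x
  coprime-regular {x} (c , c≢0 , u , v , eq) f xf≈0 = I⇒≈ᵢ0 (divides-unscale {N = f} c≢0 (divides-cong {N = u *ₚ (x *ₚ f) +ₚ v *ₚ f *ₚ P} Z.refl
      (Z.trans (solve 5 (λ u x f v P → u ⊗ (x ⊗ f) ⊕ v ⊗ f ⊗ P ⊜ (u ⊗ x ⊕ v ⊗ P) ⊗ f) Z.refl u x f v P) (Z.*-congʳ eq))
      (divides-+ (divides-* u (≈ᵢ0⇒I xf≈0)) (divides-exact (v *ₚ f) Z.refl))))

module Power (Φₙ : Poly) (Φ-reg : Z.Regular Φₙ) where
  private
    module M₁ = Modulo Φₙ
    module K₁ = Ring M₁.ring

  -- Induction on k. Regularity modulo Φₙ makes f a multiple of Φₙ over ℚ; after one Φₙ is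
  -- cancelled, the quotient satisfies the hypothesis for the next lower power.
  regular-^ : ∀ {x} → K₁.Regular x → ∀ k f → Divides (Φₙ ^ₚ k) (x *ₚ f) → Divides (Φₙ ^ₚ k) f
  regular-^ reg zero    f _ = divides-exact f (Z.sym (Z.*-identityʳ f))
  regular-^ {x} reg (suc k) f xf@(d , d≢0 , R , eq) = e ℤ.* c , nonzero-* e≢0 c≢0 , S , final
    where
      f∣ : Divides Φₙ f
      f∣ = M₁.≈ᵢ0⇒I (reg f (M₁.I⇒≈ᵢ0 (divides-trans {X = Φₙ ^ₚ k} {N = x *ₚ f} xf)))
      c = proj₁ f∣
      c≢0 = proj₁ (proj₂ f∣)
      Q = proj₁ (proj₂ (proj₂ f∣))
      f≋ : constₚ c *ₚ f ≋ Q *ₚ Φₙ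
      f≋ = proj₂ (proj₂ (proj₂ f∣))
      xQ : constₚ d *ₚ (x *ₚ Q) ≋ constₚ c *ₚ R *ₚ Φₙ ^ₚ k
      xQ = Z.cancel {a = Φₙ} {constₚ d *ₚ (x *ₚ Q)} {constₚ c *ₚ R *ₚ Φₙ ^ₚ k} Φ-reg (Z.trans
        (solve 4 (λ F d x Q → F ⊗ (d ⊗ (x ⊗ Q)) ⊜ d ⊗ (x ⊗ (Q ⊗ F))) Z.refl Φₙ (constₚ d) x Q)
        (Z.trans (Z.*-congˡ {constₚ d} (Z.*-congˡ {x} (Z.sym f≋)))
        (Z.trans (solve 4 (λ d x c f → d ⊗ (x ⊗ (c ⊗ f)) ⊜ c ⊗ (d ⊗ (x ⊗ f))) Z.refl (constₚ d) x (constₚ c) f)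
        (Z.trans (Z.*-congˡ {constₚ c} eq) (solve 4 (λ c R F p → c ⊗ (R ⊗ (F ⊗ p)) ⊜ F ⊗ (c ⊗ R ⊗ p)) Z.refl (constₚ c) R Φₙ (Φₙ ^ₚ k))))))
      Q∣ : Divides (Φₙ ^ₚ k) Q
      Q∣ = regular-^ {x} reg k Q (d , d≢0 , constₚ c *ₚ R , xQ)
      e = proj₁ Q∣
      e≢0 = proj₁ (proj₂ Q∣)
      S = proj₁ (proj₂ (proj₂ Q∣))
      final : constₚ (e ℤ.* c) *ₚ f ≋ S *ₚ (Φₙ *ₚ Φₙ ^ₚ k)
      final = Z.trans (Z.*-congʳ (const-* e c)) (Z.trans (Z.*-assoc (constₚ e) (constₚ c) f) (Z.trans (Z.*-congˡ {constₚ e} f≋)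
        (Z.trans (solve 3 (λ e Q F → e ⊗ (Q ⊗ F) ⊜ e ⊗ Q ⊗ F) Z.refl (constₚ e) Q Φₙ) (Z.trans (Z.*-congʳ {Φₙ} (proj₂ (proj₂ (proj₂ Q∣))))
        (solve 3 (λ S p F → S ⊗ p ⊗ F ⊜ S ⊗ (F ⊗ p)) Z.refl S (Φₙ ^ₚ k) Φₙ)))))

-- The parametric sums at the indeterminate q.

e′ : ℕ → Poly
e′ = Z.pow 𝕢

1-e≋ : ∀ j → oneₚ -ₚ e′ j ≋ -ₚ qPow-1 j
1-e≋ j = Z.trans (Z.+-congˡ {oneₚ} (Z.-‿cong (Z.sym (qPow≋ j)))) (solve 1 (λ a → 𝟙 ⊖ a ⊜ ⊝ (a ⊖ 𝟙)) Z.refl (qPow j))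

1-e-regular : ∀ i → 0 ℕ.< i → Z.Regular (oneₚ -ₚ e′ i)
1-e-regular i 0<i = Z.reg-cong (Z.sym (1-e≋ i)) (Z.reg-neg {qPow-1 i} (qPow-1-regular i 0<i))

two : Poly
two = oneₚ +ₚ oneₚ

module F = Factors (SummandIdentities.ringOps polyRing) 𝕢
open SpecialValues polyRing 𝕢 𝕢-regular 1-e-regular using (total) public

module OddCyclotomic (m : ℕ) (0<m : 0 ℕ.< m) where
  n : ℕ
  n = suc (m ℕ.+ m)
  module M₁ = Modulo (Φ n)
  module K₁ = Ring M₁.ring

  Φ-regular : Z.Regular (Φ n)
  Φ-regular = Z.reg-factor {Φ n} {proj₁ (cyclotomic-divides (m ℕ.+ m))} (Z.reg-cong (Z.trans (proj₂ (cyclotomic-divides (m ℕ.+ m))) (Z.*-comm (proj₁ (cyclotomic-divides (m ℕ.+ m))) (Φ n))) (qPow-1-regular n (s≤s z≤n)))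

  -- n j = m (2j) + j for n = 2m + 1.
  n∣2j⇒n∣j : ∀ j → n ∣ j ℕ.+ j → n ∣ j
  n∣2j⇒n∣j j n∣2j = ∣m+n∣m⇒∣n (≡.subst (n ∣_) (lem m j) (m∣m*n {n} j)) (∣n⇒∣m*n m n∣2j)
    where
      lem : ∀ m j → suc (m ℕ.+ m) ℕ.* j ≡ m ℕ.* (j ℕ.+ j) ℕ.+ j
      lem = solve-∀

  n∤small : ∀ j → 0 ℕ.< j → j ℕ.≤ m ℕ.+ m → ¬ n ∣ j
  n∤small (suc j) _ j≤2m n∣j = ℕ.<⇒≱ (s≤s j≤2m) (∣⇒≤ n∣j)

  coprime-1-e : ∀ {j} → ¬ n ∣ j → Coprime (oneₚ -ₚ e′ j) (Φ n)
  coprime-1-e {j} n∤j with cyclotomic-coprime (m ℕ.+ m) j n∤j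
  ... | c , c≢0 , u , v , eq = c , c≢0 , -ₚ u , v , Z.trans (Z.+-congʳ (Z.trans (Z.*-congˡ { -ₚ u} (1-e≋ j)) (solve 2 (λ u x → (⊝ u) ⊗ (⊝ x) ⊜ u ⊗ x) Z.refl u (qPow-1 j)))) eq

  Φ∣1-e : ∀ k → Divides (Φ n) (oneₚ -ₚ e′ (k ℕ.* n))
  Φ∣1-e k = divides-exact (-ₚ (geometric k n *ₚ X)) (Z.trans (1-e≋ (k ℕ.* n)) (Z.trans (Z.-‿cong (Z.trans (qPow-1-multiple k n) (Z.*-congˡ {geometric k n} X≋)))
    (solve 3 (λ g X F → ⊝ (g ⊗ (X ⊗ F)) ⊜ (⊝ (g ⊗ X)) ⊗ F) Z.refl (geometric k n) X (Φ n))))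
    where
      X = proj₁ (cyclotomic-divides (m ℕ.+ m))
      X≋ = proj₂ (cyclotomic-divides (m ℕ.+ m))

  e^kn≈1 : ∀ k → e′ (k ℕ.* n) K₁.≈ oneₚ
  e^kn≈1 k = K₁.sym (K₁.x-y≈0⇒x≈y (M₁.I⇒≈ᵢ0 (Φ∣1-e k)))

  q^n≈1 : e′ n K₁.≈ oneₚ
  q^n≈1 = ≡.subst (λ i → e′ i K₁.≈ oneₚ) (ℕ.+-identityʳ n) (e^kn≈1 1)

  reg₁ : ∀ j → 0 ℕ.< j → j ℕ.≤ m ℕ.+ m → K₁.Regular (oneₚ -ₚ e′ j)
  reg₁ j 0<j j≤2m = M₁.coprime-regular (coprime-1-e (n∤small j 0<j j≤2m))
  reg₂ : ∀ j → 0 ℕ.< j → j ℕ.≤ m ℕ.+ m → K₁.Regular (oneₚ -ₚ e′ (j ℕ.+ j))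
  reg₂ j 0<j j≤2m = M₁.coprime-regular (coprime-1-e (λ d → n∤small j 0<j j≤2m (n∣2j⇒n∣j j d)))
  reg₄ : ∀ j → 0 ℕ.< j → j ℕ.≤ m ℕ.+ m → K₁.Regular (oneₚ -ₚ e′ ((j ℕ.+ j) ℕ.+ (j ℕ.+ j)))
  reg₄ j 0<j j≤2m = M₁.coprime-regular (coprime-1-e (λ d → n∤small j 0<j j≤2m (n∣2j⇒n∣j j (n∣2j⇒n∣j (j ℕ.+ j) d))))

  private
    module C = Coarsening polyRing M₁._≈ᵢ_ M₁.isCommutativeRingᵢ M₁.coarsenᵢ

  -- The entry of order (0, 0) of the vanishing double jet. It holds for every odd n > 1, as it must
  -- for the later use: a divisor of a number congruent to 3 modulo 4 may be congruent to 1.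
  total≈0 : total oneₚ two oneₚ two (m ℕ.+ m) K₁.≈ []
  total≈0 = K₁.trans (K₁.sum-cong (suc (m ℕ.+ m)) (λ k _ → M₁.coarsenᵢ (split k)))
    (C.sum₀₀ 𝕢 m 0<m 𝕢-regular 1-e-regular q^n≈1 reg₁ reg₂)
    where
      open ClearedProperties polyRing
      module I = Interpolation polyRing M₁._≈ᵢ_ M₁.isCommutativeRingᵢ M₁.coarsenᵢ
      module DK = DoubleJets M₁.ring
      W = C.weight 𝕢 m 0<m 𝕢-regular 1-e-regular q^n≈1 reg₁ reg₂
      gX = C.jetsX 𝕢 m 0<m 𝕢-regular 1-e-regular q^n≈1 reg₁ reg₂
      gY = C.jetsY 𝕢 m 0<m 𝕢-regular 1-e-regular q^n≈1 reg₁ reg₂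
      X Y τ : ℕ → Poly
      X = Cleared.cleared polyRing (λ i → F.quad oneₚ two (F.zxn (e′ i))) (λ i → F.quad oneₚ two (F.zxd (e′ i))) (m ℕ.+ m)
      Y = Cleared.cleared polyRing (λ i → F.quad oneₚ two (F.zyn (e′ i))) (λ i → F.quad oneₚ two (F.zyd (e′ i))) (m ℕ.+ m)
      τ = Cleared.cleared polyRing (λ i → F.τn (e′ i)) (λ i → F.τd (e′ i)) (m ℕ.+ m)
      split : ∀ k → F.w (e′ k) *ₚ Cleared.cleared polyRing (λ i → F.σn oneₚ two oneₚ two (e′ i)) (λ i → F.σd oneₚ two oneₚ two (e′ i)) (m ℕ.+ m) k
        ≋ W k *ₚ (c₀ (gX k) *ₚ c₀ (gY k))
      split k = Z.trans (Z.*-congˡ {F.w (e′ k)} (Z.trans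
          (cleared-* (λ i → F.τn (e′ i) *ₚ F.quad oneₚ two (F.zyn (e′ i))) (λ i → F.τd (e′ i) *ₚ F.quad oneₚ two (F.zyd (e′ i))) (λ i → F.quad oneₚ two (F.zxn (e′ i))) (λ i → F.quad oneₚ two (F.zxd (e′ i))) (m ℕ.+ m) k)
          (Z.*-congʳ {X k} (cleared-* (λ i → F.τn (e′ i)) (λ i → F.τd (e′ i)) (λ i → F.quad oneₚ two (F.zyn (e′ i))) (λ i → F.quad oneₚ two (F.zyd (e′ i))) (m ℕ.+ m) k))))
        (Z.trans (Z.*-solve 4 (λ w t y x → w Z.∙ (t Z.∙ y Z.∙ x) Z.≐ (w Z.∙ t) Z.∙ (x Z.∙ y)) Z.refl (F.w (e′ k)) (τ k) (Y k) (X k))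
        (Z.*-congˡ {F.w (e′ k) *ₚ τ k} (Z.reflexive (≡.cong₂ _*ₚ_
          (≡.sym (I.c₀-cleared (λ i → DK.quadJet (F.zxn (e′ i))) (λ i → DK.quadJet (F.zxd (e′ i))) (m ℕ.+ m) k))
          (≡.sym (I.c₀-cleared (λ i → DK.quadJet (F.zyn (e′ i))) (λ i → DK.quadJet (F.zyd (e′ i))) (m ℕ.+ m) k))))))

private
  open Powers polyRing 𝕢 𝕢-regular 1-e-regular
  module FA = FractionAlgebra polyRing

open Frac

-- `sumFrac` multiplies all denominators without reducing, so its own denominator may be divisible
-- by the modulus. The sum is therefore described by an equal quotient N/D, whose denominator can be
-- kept coprime to the modulus.
sum-extend : ∀ f s {D N} → num (sumFrac s f) *ₚ D ≋ N *ₚ den (sumFrac s f) → ∀ r D′ (M : ℕ → Poly) →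
  (∀ i → i ℕ.< r → num (f (s ℕ.+ i)) *ₚ D′ ≋ M i *ₚ den (f (s ℕ.+ i))) →
  num (sumFrac (s ℕ.+ r) f) *ₚ (D *ₚ D′) ≋ (N *ₚ D′ +ₚ D *ₚ Z.sum r M) *ₚ den (sumFrac (s ℕ.+ r) f)
sum-extend f s {D} {N} eq zero D′ M h rewrite ℕ.+-identityʳ s = FA.extend-start {num (sumFrac s f)} {den (sumFrac s f)} {D} {N} D′ eq
sum-extend f s {D} {N} eq (suc r) D′ M h rewrite ℕ.+-suc s r =
  FA.extend-step {num (sumFrac (s ℕ.+ r) f)} {den (sumFrac (s ℕ.+ r) f)} {num (f (s ℕ.+ r))} {den (f (s ℕ.+ r))} {D} {D′} {N} {Z.sum r M} {M r}
    (sum-extend f s {D} {N} eq r D′ M (λ i i<r → h i (ℕ.m<n⇒m<1+n i<r))) (h r (ℕ.n<1+n r))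

sumFrac-den-regular : ∀ n f → (∀ k → Z.Regular (den (f k))) → Z.Regular (den (sumFrac n f))
sumFrac-den-regular zero    f h = Z.reg-1
sumFrac-den-regular (suc n) f h = Z.reg-* {den (sumFrac n f)} {den (f n)} (sumFrac-den-regular n f h) (h n)

-- The summands

prodRange≡prod : ∀ k f → prodRange k f ≡ Z.prod k f
prodRange≡prod zero    f = ≡.refl
prodRange≡prod (suc k) f = ≡.cong (_*ₚ f k) (prodRange≡prod k f)

1-qPow≋ : ∀ {x i} → x ≈e i → oneₚ -ₚ qPow i ≋ oneₚ -ₚ x
1-qPow≋ {x} {i} x≈ = Z.+-congˡ {oneₚ} (Z.-‿cong (Z.trans (qPow≋ i) (Z.sym (proof x≈))))

poch≋ : ∀ a b k → poch a b k ≋ Z.prod k (λ j → oneₚ -ₚ e′ (a ℕ.+ b ℕ.* j))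
poch≋ a b k = Z.trans (Z.reflexive (prodRange≡prod k (λ j → oneₚ -ₚ qPow (a ℕ.+ b ℕ.* j)))) (Z.prod-cong k (λ j _ → 1-qPow≋ (e≈ (a ℕ.+ b ℕ.* j))))

^-2 : ∀ p → p ^ₚ 2 ≋ p *ₚ p
^-2 p = Z.*-congˡ {p} (Z.*-identityʳ p)

^-3 : ∀ p → p ^ₚ 3 ≋ p *ₚ (p *ₚ p)
^-3 p = Z.*-congˡ {p} (^-2 p)

qint≋ : ∀ r → (oneₚ -ₚ 𝕢) *ₚ qint r ≋ oneₚ -ₚ e′ r
qint≋ zero    = Z.trans (Z.zeroʳ (oneₚ -ₚ 𝕢)) (Z.sym (Z.-‿inverseʳ oneₚ))
qint≋ (suc r) = Z.trans (Z.distribˡ (oneₚ -ₚ 𝕢) (qint r) (qPow r)) (Z.trans (Z.+-cong (qint≋ r) (Z.*-congˡ {oneₚ -ₚ 𝕢} (qPow≋ r)))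
  (solve 2 (λ q e → 𝟙 ⊖ e ⊕ (𝟙 ⊖ q) ⊗ e ⊜ 𝟙 ⊖ q ⊗ e) Z.refl 𝕢 (e′ r)))

σn₀ σd₀ w₀ : ℕ → Poly
σn₀ i = F.σn oneₚ two oneₚ two (e′ i)
σd₀ i = F.σd oneₚ two oneₚ two (e′ i)
w₀ i = F.w (e′ i)

quad≋ : ∀ z → F.quad oneₚ two z ≋ (oneₚ -ₚ z) *ₚ (oneₚ -ₚ z)
quad≋ = solve 1 (λ z → 𝟙 ⊗ (𝟙 ⊕ z ⊗ z) ⊖ z ⊗ (𝟙 ⊕ 𝟙) ⊜ (𝟙 ⊖ z) ⊗ (𝟙 ⊖ z)) Z.refl

reindex : ∀ {x i j} → i ≡ j → x ≈e i → x ≈e j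
reindex ≡.refl x≈ = x≈

poch-step : ∀ {x} a b k → x ≈e a ℕ.+ b ℕ.* k → poch a b (suc k) ≋ poch a b k *ₚ (oneₚ -ₚ x)
poch-step a b k x≈ = Z.*-congˡ {poch a b k} (1-qPow≋ x≈)

module _ (j : ℕ) where
  e²≈ : F.sq (e′ j) ≈e j ℕ.+ j
  e²≈ = e≈ j ⊡ e≈ j
  zyn≈ : F.zyn (e′ j) ≈e 1 ℕ.+ 2 ℕ.* j
  zyn≈ = reindex (lem j) (q≈ ⊡ e²≈)
    where lem : ∀ j → 1 ℕ.+ (j ℕ.+ j) ≡ 1 ℕ.+ 2 ℕ.* j
          lem = solve-∀
  zxn≈ : F.zxn (e′ j) ≈e 1 ℕ.+ 4 ℕ.* j
  zxn≈ = reindex (lem j) (q≈ ⊡ (e²≈ ⊡ e²≈))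
    where lem : ∀ j → 1 ℕ.+ (j ℕ.+ j ℕ.+ (j ℕ.+ j)) ≡ 1 ℕ.+ 4 ℕ.* j
          lem = solve-∀
  zon≈ : F.q2 *ₚ F.sq (F.sq (e′ j)) ≈e 2 ℕ.+ 4 ℕ.* j
  zon≈ = reindex (lem j) (q≈ ⊡ q≈ ⊡ (e²≈ ⊡ e²≈))
    where lem : ∀ j → 2 ℕ.+ (j ℕ.+ j ℕ.+ (j ℕ.+ j)) ≡ 2 ℕ.+ 4 ℕ.* j
          lem = solve-∀
  zyd≈ : F.zyd (e′ j) ≈e 4 ℕ.+ 4 ℕ.* j
  zyd≈ = reindex (lem j) (q≈ ⊡ q≈ ⊡ (q≈ ⊡ q≈) ⊡ (e²≈ ⊡ e²≈))
    where lem : ∀ j → 4 ℕ.+ (j ℕ.+ j ℕ.+ (j ℕ.+ j)) ≡ 4 ℕ.+ 4 ℕ.* j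
          lem = solve-∀
  zxd≈ : F.zxd (e′ j) ≈e 2 ℕ.+ 2 ℕ.* j
  zxd≈ = reindex (lem j) (q≈ ⊡ q≈ ⊡ e²≈)
    where lem : ∀ j → 2 ℕ.+ (j ℕ.+ j) ≡ 2 ℕ.+ 2 ℕ.* j
          lem = solve-∀
  w≈ : 𝕢 *ₚ (F.sq (e′ j) *ₚ F.sq (e′ j) *ₚ F.sq (e′ j)) ≈e 6 ℕ.* j ℕ.+ 1
  w≈ = reindex (lem j) (q≈ ⊡ (e²≈ ⊡ e²≈ ⊡ e²≈))
    where lem : ∀ j → 1 ℕ.+ (j ℕ.+ j ℕ.+ (j ℕ.+ j) ℕ.+ (j ℕ.+ j)) ≡ 6 ℕ.* j ℕ.+ 1
          lem = solve-∀

module SummandFrac where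
  num₀ den₀ : ℕ → Poly
  num₀ k = qint (6 ℕ.* k ℕ.+ 1) *ₚ poch 1 2 k ^ₚ 2 *ₚ poch 2 4 k *ₚ poch 1 4 k ^ₚ 2 *ₚ qPow (2 ℕ.* k)
  den₀ k = poch 2 2 k ^ₚ 2 *ₚ poch 4 4 k ^ₚ 3

  den≋ : ∀ k → den₀ k ≋ Z.prod k σd₀
  den≋ k = Z.trans (Z.*-cong (^-2 (poch 2 2 k)) (^-3 (poch 4 4 k))) (aux k)
    where
      aux : ∀ k → poch 2 2 k *ₚ poch 2 2 k *ₚ (poch 4 4 k *ₚ (poch 4 4 k *ₚ poch 4 4 k)) ≋ Z.prod k σd₀
      aux zero    = solve 0 (𝟙 ⊗ 𝟙 ⊗ (𝟙 ⊗ (𝟙 ⊗ 𝟙)) ⊜ 𝟙) Z.refl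
      aux (suc k) = Z.trans (Z.*-cong (Z.*-cong X Y) (Z.*-cong V (Z.*-cong V V)))
        (Z.trans (Z.*-solve 4 (λ a b c d → (a Z.∙ b) Z.∙ (a Z.∙ b) Z.∙ ((c Z.∙ d) Z.∙ ((c Z.∙ d) Z.∙ (c Z.∙ d))) Z.≐ (a Z.∙ a Z.∙ (c Z.∙ (c Z.∙ c))) Z.∙ (d Z.∙ (d Z.∙ d) Z.∙ (b Z.∙ b))) Z.refl (poch 2 2 k) b (poch 4 4 k) d)
        (Z.*-cong (aux k) (Z.*-cong (Z.*-congˡ {d} (Z.sym (quad≋ (F.zyd (e′ k))))) (Z.sym (quad≋ (F.zxd (e′ k)))))))
        where
          b = oneₚ -ₚ F.zxd (e′ k)
          d = oneₚ -ₚ F.zyd (e′ k)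
          X = poch-step 2 2 k (zxd≈ k)
          Y = X
          V = poch-step 4 4 k (zyd≈ k)

  num≋ : ∀ k → (oneₚ -ₚ 𝕢) *ₚ num₀ k ≋ w₀ k *ₚ Z.prod k σn₀
  num≋ k = Z.trans (Z.*-solve 6 (λ u Q a b c d → u Z.∙ (Q Z.∙ a Z.∙ b Z.∙ c Z.∙ d) Z.≐ (u Z.∙ Q) Z.∙ (a Z.∙ b Z.∙ c Z.∙ d)) Z.refl
      (oneₚ -ₚ 𝕢) (qint (6 ℕ.* k ℕ.+ 1)) (poch 1 2 k ^ₚ 2) (poch 2 4 k) (poch 1 4 k ^ₚ 2) (qPow (2 ℕ.* k)))
    (Z.*-cong (Z.trans (qint≋ (6 ℕ.* k ℕ.+ 1)) (Z.+-congˡ {oneₚ} (Z.-‿cong (Z.sym (proof (w≈ k))))))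
      (Z.trans (Z.*-congʳ {qPow (2 ℕ.* k)} (Z.*-cong (Z.*-congʳ {poch 2 4 k} (^-2 (poch 1 2 k))) (^-2 (poch 1 4 k)))) (aux k)))
    where
      aux : ∀ k → poch 1 2 k *ₚ poch 1 2 k *ₚ poch 2 4 k *ₚ (poch 1 4 k *ₚ poch 1 4 k) *ₚ qPow (2 ℕ.* k) ≋ Z.prod k σn₀
      aux zero    = solve 0 (𝟙 ⊗ 𝟙 ⊗ 𝟙 ⊗ (𝟙 ⊗ 𝟙) ⊗ 𝟙 ⊜ 𝟙) Z.refl
      aux (suc k) = Z.trans (Z.*-cong (Z.*-cong (Z.*-cong (Z.*-cong X X) Y) (Z.*-cong V V)) (Z.trans (Z.reflexive (≡.cong qPow (lem k))) (qPow-+ 2 (2 ℕ.* k))))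
        (Z.trans (Z.*-solve 8 (λ a b c d x y Q R → (a Z.∙ b) Z.∙ (a Z.∙ b) Z.∙ (c Z.∙ d) Z.∙ ((x Z.∙ y) Z.∙ (x Z.∙ y)) Z.∙ (Q Z.∙ R) Z.≐ (a Z.∙ a Z.∙ c Z.∙ (x Z.∙ x) Z.∙ R) Z.∙ (Q Z.∙ d Z.∙ (b Z.∙ b) Z.∙ (y Z.∙ y)))
            Z.refl (poch 1 2 k) b (poch 2 4 k) d (poch 1 4 k) y (qPow 2) (qPow (2 ℕ.* k)))
        (Z.*-cong (aux k) (Z.*-cong (Z.*-cong (Z.*-congʳ {d} (Z.trans (qPow≋ 2) (Z.*-congˡ {𝕢} (Z.*-identityʳ 𝕢)))) (Z.sym (quad≋ (F.zyn (e′ k))))) (Z.sym (quad≋ (F.zxn (e′ k)))))))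
        where
          lem : ∀ k → 2 ℕ.* suc k ≡ 2 ℕ.+ 2 ℕ.* k
          lem = solve-∀
          b = oneₚ -ₚ F.zyn (e′ k)
          d = oneₚ -ₚ F.q2 *ₚ F.sq (F.sq (e′ k))
          y = oneₚ -ₚ F.zxn (e′ k)
          X = poch-step 1 2 k (zyn≈ k)
          Y = poch-step 2 4 k (zon≈ k)
          V = poch-step 1 4 k (zxn≈ k)

  fraction : ℕ → Frac
  fraction k = num₀ k // den₀ k

  blockSum : ℕ → ℕ → Poly
  blockSum = FA.shifted w₀ σn₀ σd₀

  -- T/E is the product of all ratios before index s. Writing the block relative to it separates the
  -- pole-free prefactor from a sum that depends only on the ratios inside the block.
  extend-block : ∀ s k {D N E T} → num (sumFrac s fraction) *ₚ D ≋ N *ₚ den (sumFrac s fraction) → Z.prod s σn₀ *ₚ E ≋ T *ₚ Z.prod s σd₀ →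
    let D′ = (oneₚ -ₚ 𝕢) *ₚ E *ₚ Z.prod k (λ i → σd₀ (s ℕ.+ i)) in
    num (sumFrac (s ℕ.+ suc k) fraction) *ₚ (D *ₚ D′) ≋ (N *ₚ D′ +ₚ D *ₚ (T *ₚ blockSum s k)) *ₚ den (sumFrac (s ℕ.+ suc k) fraction)
  extend-block s k {D} {N} {E} {T} eq ET = Z.trans (sum-extend fraction s {D} {N} eq (suc k) D′ (λ j → T *ₚ g j)
      (λ j j≤k → FA.clear-term w₀ σn₀ σd₀ {num₀ (s ℕ.+ j)} {den₀ (s ℕ.+ j)} {oneₚ -ₚ 𝕢} {E} {T} s k j (ℕ.≤-pred j≤k) (num≋ (s ℕ.+ j)) (den≋ (s ℕ.+ j)) ET))
    (Z.*-congʳ {den (sumFrac (s ℕ.+ suc k) fraction)} (Z.+-congˡ {N *ₚ D′} (Z.*-congˡ {D} (Z.sum-*ˡ (suc k) T g))))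
    where
      D′ = (oneₚ -ₚ 𝕢) *ₚ E *ₚ Z.prod k (λ i → σd₀ (s ℕ.+ i))
      g : ℕ → Poly
      g j = w₀ (s ℕ.+ j) *ₚ Cleared.cleared polyRing (λ i → σn₀ (s ℕ.+ i)) (λ i → σd₀ (s ℕ.+ i)) k j

-- The data of a congruence in terms of `_≋_`. That the denominator D is nonzero is settled once, in
-- `congruent⇒≡`.
record Congruent (P : Poly) (x y : Frac) : Set where
  field
    D N      : Poly
    equation : (num x *ₚ den y -ₚ num y *ₚ den x) *ₚ D ≋ N *ₚ (den x *ₚ den y)
    vanishes : Divides P N
    coprime  : Coprime D P

coprime-^ˡ : ∀ {A B} k → Coprime A B → Coprime (A ^ₚ k) B
coprime-^ˡ k c = coprime-sym (coprime-^ʳ k (coprime-sym c))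

module CyclotomicUnits (m : ℕ) (0<m : 0 ℕ.< m) where
  open OddCyclotomic m 0<m public

  coprime-1-x : ∀ {x j} → x ≈e j → ¬ n ∣ j → Coprime (oneₚ -ₚ x) (Φ n)
  coprime-1-x x≈ n∤j = coprime-congˡ (Z.+-congˡ {oneₚ} (Z.-‿cong (Z.sym (proof x≈)))) (coprime-1-e n∤j)

  coprime-1-q : Coprime (oneₚ -ₚ 𝕢) (Φ n)
  coprime-1-q = coprime-1-x q≈ (n∤small 1 (s≤s z≤n) (ℕ.≤-trans 0<m (ℕ.m≤m+n m m)))

  n∤2j : ∀ {j} → ¬ n ∣ j → ¬ n ∣ j ℕ.+ j
  n∤2j {j} n∤j d = n∤j (n∣2j⇒n∣j j d)

  coprime-1-zyd : ∀ i → ¬ n ∣ suc i → Coprime (oneₚ -ₚ F.zyd (e′ i)) (Φ n)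
  coprime-1-zyd i n∤i = coprime-1-x (reindex (lem i) (zyd≈ i)) (n∤2j (n∤2j n∤i))
    where lem : ∀ i → 4 ℕ.+ 4 ℕ.* i ≡ (suc i ℕ.+ suc i) ℕ.+ (suc i ℕ.+ suc i)
          lem = solve-∀

  coprime-1-zxd : ∀ i → ¬ n ∣ suc i → Coprime (oneₚ -ₚ F.zxd (e′ i)) (Φ n)
  coprime-1-zxd i n∤i = coprime-1-x (reindex (lem i) (zxd≈ i)) (n∤2j n∤i)
    where lem : ∀ i → 2 ℕ.+ 2 ℕ.* i ≡ suc i ℕ.+ suc i
          lem = solve-∀

  coprime-σd : ∀ i → ¬ n ∣ suc i → Coprime (σd₀ i) (Φ n)
  coprime-σd i n∤i = coprime-*ˡ (coprime-*ˡ y (coprime-congˡ (Z.sym (quad≋ (F.zyd (e′ i)))) (coprime-*ˡ y y))) (coprime-congˡ (Z.sym (quad≋ (F.zxd (e′ i)))) (coprime-*ˡ x x))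
    where
      y = coprime-1-zyd i n∤i
      x = coprime-1-zxd i n∤i

  -- 1 + q^{kn} = 2 + (q^{kn} - 1) is congruent modulo Φ n to the constant 2, which is invertible
  -- over ℚ.
  coprime-1+q^kn : ∀ k → Coprime (oneₚ +ₚ qPow (k ℕ.* n)) (Φ n)
  coprime-1+q^kn k = coprime-congˡ eq (coprime-+ˡ (geometric k n *ₚ X) (coprime-const {+ 2} (Φ n) λ ()))
    where
      X = proj₁ (cyclotomic-divides (m ℕ.+ m))
      eq : two +ₚ geometric k n *ₚ X *ₚ Φ n ≋ oneₚ +ₚ qPow (k ℕ.* n)
      eq = Z.trans (Z.+-congˡ {two} (Z.trans (Z.*-assoc (geometric k n) X (Φ n)) (Z.trans (Z.*-congˡ {geometric k n} (Z.sym (proj₂ (cyclotomic-divides (m ℕ.+ m))))) (Z.sym (qPow-1-multiple k n)))))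
        (solve 1 (λ a → 𝟙 ⊕ 𝟙 ⊕ (a ⊖ 𝟙) ⊜ 𝟙 ⊕ a) Z.refl (qPow (k ℕ.* n)))

-- The closed form and the congruence modulo Φ_n⁵.

closedForm : ℕ → ℕ → Frac
closedForm n N = (qint (3 ℕ.* n) *ₚ qPow (2 ℕ.* n) *ₚ (constₚ (+ 2) -ₚ qPow n) *ₚ poch 2 4 N ^ₚ 2) // ((oneₚ +ₚ qPow n) ^ₚ 2 *ₚ poch 4 4 N ^ₚ 2)

prod-quad : ∀ a b {z : ℕ → Poly} → (∀ j → z j ≈e a ℕ.+ b ℕ.* j) → ∀ k → Z.prod k (λ j → F.quad oneₚ two (z j)) ≋ poch a b k ^ₚ 2
prod-quad a b {z} z≈ k = Z.trans (aux k) (Z.sym (^-2 (poch a b k)))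
  where
    aux : ∀ k → Z.prod k (λ j → F.quad oneₚ two (z j)) ≋ poch a b k *ₚ poch a b k
    aux zero    = Z.sym (Z.*-identityˡ oneₚ)
    aux (suc k) = Z.trans (Z.*-cong (aux k) (quad≋ (z k))) (Z.trans (Z.*-solve 2 (λ p x → p Z.∙ p Z.∙ (x Z.∙ x) Z.≐ (p Z.∙ x) Z.∙ (p Z.∙ x)) Z.refl (poch a b k) (oneₚ -ₚ z k))
      (Z.*-cong (Z.sym step) (Z.sym step)))
      where step = poch-step a b k (z≈ k)

module FifthPowerCongruence (l : ℕ) where
  private
    m N : ℕ
    m = suc (l ℕ.+ l)
    N = m ℕ.+ suc l
  open CyclotomicUnits m (s≤s z≤n)
  private
    module M₅ = Modulo (Φ n ^ₚ 5)
    module K₅ = Ring M₅.ring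
    open Power (Φ n) Φ-regular using (regular-^)
    Y H : Poly
    Y = 𝕢 *ₚ (e′ m *ₚ e′ m)
    H = 𝕢 *ₚ F.sq (F.sq (e′ N))

    Y≈ : Y ≈e n
    Y≈ = q≈ ⊡ (e≈ m ⊡ e≈ m)
    H≈ : H ≈e 3 ℕ.* n
    H≈ = reindex (lem l) (q≈ ⊡ (e²≈ N ⊡ e²≈ N))
      where lem : ∀ l → let m = suc (l ℕ.+ l) ; N = m ℕ.+ suc l in 1 ℕ.+ ((N ℕ.+ N) ℕ.+ (N ℕ.+ N)) ≡ 3 ℕ.* suc (m ℕ.+ m)
            lem = solve-∀
    Y²≈ : Y *ₚ Y ≈e 2 ℕ.* n
    Y²≈ = reindex (≡.cong (n ℕ.+_) (≡.sym (ℕ.+-identityʳ n))) (Y≈ ⊡ Y≈)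

    Φ∣1-Y : Divides (Φ n) (oneₚ -ₚ Y)
    Φ∣1-Y = divides-cong {N = oneₚ -ₚ e′ (1 ℕ.* n)} {oneₚ -ₚ Y} (Z.refl {Φ n})
      (Z.+-congˡ {oneₚ} (Z.-‿cong (Z.sym (proof (reindex (≡.sym (ℕ.+-identityʳ n)) Y≈))))) (Φ∣1-e 1)

    lift : ∀ {x} → x K₁.≈ [] → (oneₚ -ₚ Y) *ₚ (oneₚ -ₚ Y) *ₚ ((oneₚ -ₚ Y) *ₚ (oneₚ -ₚ Y)) *ₚ x K₅.≈ []
    lift {x} x≈0 = M₅.I⇒≈ᵢ0 (divides-cong {N = Y⁴x} {Y⁴x}
        (solve 1 (λ P → P ⊗ P ⊗ (P ⊗ P) ⊗ P ⊜ P ⊗ (P ⊗ (P ⊗ (P ⊗ (P ⊗ 𝟙))))) Z.refl (Φ n)) (Z.refl {Y⁴x})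
        (divides-*-* {N = (oneₚ -ₚ Y) *ₚ (oneₚ -ₚ Y) *ₚ ((oneₚ -ₚ Y) *ₚ (oneₚ -ₚ Y))} {Φ n} {x} (divides-*-* {N = (oneₚ -ₚ Y) *ₚ (oneₚ -ₚ Y)} {N′ = (oneₚ -ₚ Y) *ₚ (oneₚ -ₚ Y)} d² d²) (M₁.≈ᵢ0⇒I x≈0)))
      where
        Y⁴x = (oneₚ -ₚ Y) *ₚ (oneₚ -ₚ Y) *ₚ ((oneₚ -ₚ Y) *ₚ (oneₚ -ₚ Y)) *ₚ x
        d² = divides-*-* {N = oneₚ -ₚ Y} {N′ = oneₚ -ₚ Y} Φ∣1-Y Φ∣1-Y

    reg-lift : ∀ {x} → K₁.Regular x → K₅.Regular x
    reg-lift {x} reg f xf≈0 = M₅.I⇒≈ᵢ0 (regular-^ {x} reg 5 f (M₅.≈ᵢ0⇒I xf≈0))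

    module FP = FifthPower polyRing M₁._≈ᵢ_ M₅._≈ᵢ_ M₁.isCommutativeRingᵢ M₅.isCommutativeRingᵢ M₁.coarsenᵢ M₅.coarsenᵢ

    a b c d u full S C O₀ L₀ : Poly
    a = num (sumFrac n SummandFrac.fraction)
    b = den (sumFrac n SummandFrac.fraction)
    c = num (closedForm n N)
    d = den (closedForm n N)
    u = oneₚ -ₚ 𝕢
    full = Z.prod (m ℕ.+ m) σd₀
    S = total oneₚ two oneₚ two (m ℕ.+ m)
    O₀ = Z.prod N (λ i → F.quad oneₚ two (F.q2 *ₚ F.sq (F.sq (e′ i))))
    L₀ = Z.prod N (λ i → F.quad oneₚ two (F.zyd (e′ i)))
    C = (oneₚ -ₚ H) *ₚ (Y *ₚ Y *ₚ (two -ₚ Y)) *ₚ O₀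

    c≋ : u *ₚ c ≋ C
    c≋ = Z.trans (Z.*-solve 5 (λ u a b c d → u Z.∙ (a Z.∙ b Z.∙ c Z.∙ d) Z.≐ (u Z.∙ a) Z.∙ (b Z.∙ c) Z.∙ d) Z.refl u (qint (3 ℕ.* n)) (qPow (2 ℕ.* n)) (constₚ (+ 2) -ₚ qPow n) (poch 2 4 N ^ₚ 2))
      (Z.*-cong (Z.*-cong (Z.trans (qint≋ (3 ℕ.* n)) (Z.+-congˡ {oneₚ} (Z.-‿cong (Z.sym (proof H≈)))))
        (Z.*-cong (Z.trans (qPow≋ (2 ℕ.* n)) (Z.sym (proof Y²≈))) (Z.+-congˡ {two} (Z.-‿cong (Z.trans (qPow≋ n) (Z.sym (proof Y≈))))))) (Z.sym (prod-quad 2 4 zon≈ N)))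

    d≋ : d ≋ (oneₚ +ₚ Y) *ₚ (oneₚ +ₚ Y) *ₚ L₀
    d≋ = Z.*-cong (Z.trans (^-2 (oneₚ +ₚ qPow n)) (Z.*-cong 1+ 1+)) (Z.sym (prod-quad 4 4 zyd≈ N))
      where 1+ = Z.+-congˡ {oneₚ} (Z.trans (qPow≋ n) (Z.sym (proof Y≈)))

    full≋ : full ≋ Z.prod (m ℕ.+ m) (λ i → F.τd (e′ i)) *ₚ Z.prod (m ℕ.+ m) (λ i → F.quad oneₚ two (F.zyd (e′ i))) *ₚ Z.prod (m ℕ.+ m) (λ i → F.quad oneₚ two (F.zxd (e′ i)))
    full≋ = Z.trans (Z.prod-* (m ℕ.+ m) (λ i → F.τd (e′ i) *ₚ F.quad oneₚ two (F.zyd (e′ i))) (λ i → F.quad oneₚ two (F.zxd (e′ i))))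
      (Z.*-congʳ {Z.prod (m ℕ.+ m) (λ i → F.quad oneₚ two (F.zxd (e′ i)))} (Z.prod-* (m ℕ.+ m) (λ i → F.τd (e′ i)) (λ i → F.quad oneₚ two (F.zyd (e′ i)))))

    N≤2m : N ℕ.≤ m ℕ.+ m
    N≤2m = ℕ.+-monoʳ-≤ m (s≤s (ℕ.m≤m+n l l))

  congruent : Congruent (Φ n ^ₚ 5) (sumFrac n SummandFrac.fraction) (closedForm n N)
  congruent = record
    { D = u *ₚ full *ₚ d
    ; N = S *ₚ d -ₚ full *ₚ C
    ; equation = FA.compare-sides {a} {b} {c} {d} {u} {full} {S} {C} (SummandFrac.extend-block 0 (m ℕ.+ m) {oneₚ} {[]} {oneₚ} {oneₚ} Z.refl Z.refl) c≋
    ; vanishes = divides-cong {N = _} {S *ₚ d -ₚ full *ₚ C} (Z.refl {Φ n ^ₚ 5}) (Z.+-cong (Z.*-congˡ {S} (Z.sym d≋)) (Z.-‿cong (Z.*-congʳ {C} (Z.sym full≋))))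
        (M₅.difference (FP.supercongruence 𝕢 l 𝕢-regular 1-e-regular q^n≈1 reg₁ reg₂ reg₄ (λ {x} → reg-lift {x}) (λ {x} → lift {x})))
    ; coprime = coprime-^ʳ 5 (coprime-*ˡ (coprime-*ˡ coprime-1-q (coprime-prodˡ (m ℕ.+ m) (λ i i<2m → coprime-σd i (n∤small (suc i) (s≤s z≤n) i<2m))))
        (coprime-*ˡ (coprime-^ˡ 2 (≡.subst (λ i → Coprime (oneₚ +ₚ qPow i) (Φ n)) (ℕ.+-identityʳ n) (coprime-1+q^kn 1)))
          (coprime-^ˡ 2 (coprime-congˡ (Z.sym (poch≋ 4 4 N)) (coprime-prodˡ N (λ i i<N → coprime-congˡ (Z.+-congˡ {oneₚ} (Z.-‿cong (proof (zyd≈ i)))) (coprime-1-zyd i (n∤small (suc i) (s≤s z≤n) (ℕ.≤-trans i<N N≤2m))))))))) }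

-- Vanishing of both sides modulo Φ_e for an odd e > 1; in this part e is called n.

parity : ∀ m → (Σ ℕ λ s → m ≡ s ℕ.+ s) ⊎ (Σ ℕ λ s → m ≡ suc (s ℕ.+ s))
parity zero = inj₁ (0 , ≡.refl)
parity (suc m) with parity m
... | inj₁ (s , ≡.refl) = inj₂ (s , ≡.refl)
... | inj₂ (s , ≡.refl) = inj₁ (suc s , ≡.cong suc (≡.sym (ℕ.+-suc s s)))

module DivisorCongruence (m : ℕ) (0<m : 0 ℕ.< m) where
  open CyclotomicUnits m 0<m
  private
    X : Poly
    X = proj₁ (cyclotomic-divides (m ℕ.+ m))
    X≋ : qPow-1 n ≋ X *ₚ Φ n
    X≋ = proj₂ (cyclotomic-divides (m ℕ.+ m))

  -- The quotient x / y has no pole at the primitive n-th roots of unity.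
  record Integral (x y : Poly) : Set where
    field
      E U     : Poly
      coprime : Coprime E (Φ n)
      cross   : x *ₚ E ≋ U *ₚ y

  integral-* : ∀ {x y x′ y′} → Integral x y → Integral x′ y′ → Integral (x *ₚ x′) (y *ₚ y′)
  integral-* {x} {y} {x′} {y′} i j = record { E = I.E *ₚ J.E ; U = I.U *ₚ J.U ; coprime = coprime-*ˡ I.coprime J.coprime
    ; cross = FA.cross-* {x} {I.E} {I.U} {y} {x′} {J.E} {J.U} {y′} I.cross J.cross }
    where
      module I = Integral i
      module J = Integral j

  integral-cong : ∀ {x y x′ y′} → x ≋ x′ → y ≋ y′ → Integral x y → Integral x′ y′
  integral-cong ex ey i = record { E = I.E ; U = I.U ; coprime = I.coprime ; cross = Z.trans (Z.*-congʳ {I.E} (Z.sym ex)) (Z.trans I.cross (Z.*-congˡ {I.U} ey)) }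
    where module I = Integral i

  integral-scale : ∀ {x y} c → Integral x y → Integral (c *ₚ x) y
  integral-scale {x} {y} c i = record { E = I.E ; U = c *ₚ I.U ; coprime = I.coprime
    ; cross = Z.trans (Z.*-assoc c x I.E) (Z.trans (Z.*-congˡ {c} I.cross) (Z.sym (Z.*-assoc c I.U y))) }
    where module I = Integral i

  geometric-coprime : ∀ k → 0 ℕ.< k → Coprime (geometric k n) (Φ n)
  geometric-coprime k 0<k = let (W , eq) = geometric-mod k n in
    coprime-congˡ (Z.sym (Z.trans eq (Z.+-congˡ {constₚ (+ k)} (Z.trans (Z.*-congˡ {W} X≋) (Z.sym (Z.*-assoc W X (Φ n)))))))
      (coprime-+ˡ (W *ₚ X) (coprime-const (Φ n) (λ { ≡.refl → ℕ.n≮0 0<k })))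

  1-multiple : ∀ {x j} k → x ≈e j → j ≡ k ℕ.* n → oneₚ -ₚ x ≋ geometric k n *ₚ (oneₚ -ₚ e′ n)
  1-multiple k x≈ ≡.refl = Z.trans (Z.+-congˡ {oneₚ} (Z.-‿cong (proof x≈))) (Z.trans (1-e≋ (k ℕ.* n)) (Z.trans (Z.-‿cong (qPow-1-multiple k n))
    (Z.trans (Z.-‿distribʳ-* (geometric k n) (qPow-1 n)) (Z.*-congˡ {geometric k n} (Z.sym (1-e≋ n))))))

  prod-factor : ∀ k {f c x} j → j ℕ.< k → f j ≋ c *ₚ x → Σ Poly λ C → Z.prod k f ≋ C *ₚ x
  prod-factor (suc k) {f} {c} {x} j j≤k fj with ℕ.m≤n⇒m<n∨m≡n (ℕ.≤-pred j≤k)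
  ... | inj₂ ≡.refl = Z.prod k f *ₚ c , Z.trans (Z.*-congˡ {Z.prod k f} fj) (Z.sym (Z.*-assoc (Z.prod k f) c x))
  ... | inj₁ j<k = let (C , eq) = prod-factor k {f} {c} {x} j j<k fj in C *ₚ f k , Z.trans (Z.*-congʳ {f k} eq)
    (Z.*-solve 3 (λ C x y → C Z.∙ x Z.∙ y Z.≐ C Z.∙ y Z.∙ x) Z.refl C x (f k))

  -- Over a full period the one factor of the denominator which vanishes at the
  -- primitive n-th roots of unity is compensated by one of the numerator.
  period-integral : ∀ {f g : ℕ → Poly} {c k} j → j ℕ.< n → f j ≋ c *ₚ (oneₚ -ₚ e′ n) →
    (∀ i → i ℕ.< m ℕ.+ m → Coprime (g i) (Φ n)) → 0 ℕ.< k → g (m ℕ.+ m) ≋ geometric k n *ₚ (oneₚ -ₚ e′ n) →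
    Integral (Z.prod n f) (Z.prod n g)
  period-integral {f} {g} {c} {k} j j<n fj g-coprime 0<k g-last = record
    { E = G ; U = C ; coprime = coprime-*ˡ (coprime-prodˡ (m ℕ.+ m) g-coprime) (geometric-coprime k 0<k)
    ; cross = Z.trans (Z.*-congʳ {G} C≋) (Z.trans (Z.*-solve 4 (λ C x p d → (C Z.∙ x) Z.∙ (p Z.∙ d) Z.≐ C Z.∙ (p Z.∙ (d Z.∙ x))) Z.refl C (oneₚ -ₚ e′ n) (Z.prod (m ℕ.+ m) g) (geometric k n))
        (Z.*-congˡ {C} (Z.*-congˡ {Z.prod (m ℕ.+ m) g} (Z.sym g-last)))) }
    where
      G = Z.prod (m ℕ.+ m) g *ₚ geometric k n
      C = proj₁ (prod-factor n {f} {c} {oneₚ -ₚ e′ n} j j<n fj)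
      C≋ = proj₂ (prod-factor n {f} {c} {oneₚ -ₚ e′ n} j j<n fj)

  n∤shifted : ∀ b i → i ℕ.< m ℕ.+ m → ¬ n ∣ suc (b ℕ.* n ℕ.+ i)
  n∤shifted b i i<2m d = n∤small (suc i) (s≤s z≤n) i<2m (∣m+n∣m⇒∣n (≡.subst (n ∣_) (≡.sym (ℕ.+-suc (b ℕ.* n) i)) d) (divides b ≡.refl))

  1-zon 1-zyn 1-zxn 1-zyd 1-zxd : ℕ → Poly
  1-zon i = oneₚ -ₚ F.q2 *ₚ F.sq (F.sq (e′ i))
  1-zyn i = oneₚ -ₚ F.zyn (e′ i)
  1-zxn i = oneₚ -ₚ F.zxn (e′ i)
  1-zyd i = oneₚ -ₚ F.zyd (e′ i)
  1-zxd i = oneₚ -ₚ F.zxd (e′ i)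

  private
    m<n : m ℕ.< n
    m<n = s≤s (ℕ.m≤m+n m m)

    -- Within a period of n indices the exponent of the denominator factor, four times the next
    -- index, is divisible by n only at the last index 2m, where it is (4 + 4b) n.
    zyd-period : ∀ b {f c} j → j ℕ.< n → f j ≋ c *ₚ (oneₚ -ₚ e′ n) → Integral (Z.prod n f) (Z.prod n (λ i → 1-zyd (b ℕ.* n ℕ.+ i)))
    zyd-period b {f} {c} j j<n fj = period-integral {f} {λ i → 1-zyd (b ℕ.* n ℕ.+ i)} {c} {4 ℕ.+ 4 ℕ.* b} j j<n fj (λ i i<2m → coprime-1-zyd (b ℕ.* n ℕ.+ i) (n∤shifted b i i<2m)) (s≤s z≤n)
      (1-multiple (4 ℕ.+ 4 ℕ.* b) (zyd≈ (b ℕ.* n ℕ.+ (m ℕ.+ m))) (lem b m))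
      where lem : ∀ b m → 4 ℕ.+ 4 ℕ.* (b ℕ.* suc (m ℕ.+ m) ℕ.+ (m ℕ.+ m)) ≡ (4 ℕ.+ 4 ℕ.* b) ℕ.* suc (m ℕ.+ m)
            lem = solve-∀

    zxd-period : ∀ b {f c} j → j ℕ.< n → f j ≋ c *ₚ (oneₚ -ₚ e′ n) → Integral (Z.prod n f) (Z.prod n (λ i → 1-zxd (b ℕ.* n ℕ.+ i)))
    zxd-period b {f} {c} j j<n fj = period-integral {f} {λ i → 1-zxd (b ℕ.* n ℕ.+ i)} {c} {2 ℕ.+ 2 ℕ.* b} j j<n fj (λ i i<2m → coprime-1-zxd (b ℕ.* n ℕ.+ i) (n∤shifted b i i<2m)) (s≤s z≤n)
      (1-multiple (2 ℕ.+ 2 ℕ.* b) (zxd≈ (b ℕ.* n ℕ.+ (m ℕ.+ m))) (lem b m))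
      where lem : ∀ b m → 2 ℕ.+ 2 ℕ.* (b ℕ.* suc (m ℕ.+ m) ℕ.+ (m ℕ.+ m)) ≡ (2 ℕ.+ 2 ℕ.* b) ℕ.* suc (m ℕ.+ m)
            lem = solve-∀

    -- The compensating numerator factor sits at the middle index m, where the exponent 2 + 4m is
    -- 2n, up to a multiple of n from the preceding periods.
    zo-period : ∀ b → Integral (Z.prod n (λ i → 1-zon (b ℕ.* n ℕ.+ i))) (Z.prod n (λ i → 1-zyd (b ℕ.* n ℕ.+ i)))
    zo-period b = zyd-period b {λ i → 1-zon (b ℕ.* n ℕ.+ i)} {geometric (2 ℕ.+ 4 ℕ.* b) n} m m<n (1-multiple (2 ℕ.+ 4 ℕ.* b) (zon≈ (b ℕ.* n ℕ.+ m)) (lem b m))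
      where lem : ∀ b m → 2 ℕ.+ 4 ℕ.* (b ℕ.* suc (m ℕ.+ m) ℕ.+ m) ≡ (2 ℕ.+ 4 ℕ.* b) ℕ.* suc (m ℕ.+ m)
            lem = solve-∀

    zy-period : ∀ b → Integral (Z.prod n (λ i → 1-zyn (b ℕ.* n ℕ.+ i))) (Z.prod n (λ i → 1-zyd (b ℕ.* n ℕ.+ i)))
    zy-period b = zyd-period b {λ i → 1-zyn (b ℕ.* n ℕ.+ i)} {geometric (1 ℕ.+ 2 ℕ.* b) n} m m<n (1-multiple (1 ℕ.+ 2 ℕ.* b) (zyn≈ (b ℕ.* n ℕ.+ m)) (lem b m))
      where lem : ∀ b m → 1 ℕ.+ 2 ℕ.* (b ℕ.* suc (m ℕ.+ m) ℕ.+ m) ≡ (1 ℕ.+ 2 ℕ.* b) ℕ.* suc (m ℕ.+ m)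
            lem = solve-∀

    -- The index with n ∣ 1 + 4i depends on n modulo 4: for n = 4s + 1 it is i = s, with 1 + 4i = n,
    -- and for n = 4s + 3 it is i = 3s + 2, with 1 + 4i = 3n.
    zx-period : ∀ b → Integral (Z.prod n (λ i → 1-zxn (b ℕ.* n ℕ.+ i))) (Z.prod n (λ i → 1-zxd (b ℕ.* n ℕ.+ i)))
    zx-period b with parity m
    ... | inj₁ (s , m≡) = zxd-period b {λ i → 1-zxn (b ℕ.* n ℕ.+ i)} {geometric (1 ℕ.+ 4 ℕ.* b) n} s (ℕ.≤-<-trans (≡.subst (s ℕ.≤_) (≡.sym m≡) (ℕ.m≤m+n s s)) m<n)
        (1-multiple (1 ℕ.+ 4 ℕ.* b) (zxn≈ (b ℕ.* n ℕ.+ s)) (≡.trans (lem (b ℕ.* n) s) (≡.trans (≡.cong (λ m → 4 ℕ.* (b ℕ.* n) ℕ.+ suc (m ℕ.+ m)) (≡.sym m≡)) (lem′ b n))))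
      where lem : ∀ c s → 1 ℕ.+ 4 ℕ.* (c ℕ.+ s) ≡ 4 ℕ.* c ℕ.+ suc ((s ℕ.+ s) ℕ.+ (s ℕ.+ s))
            lem = solve-∀
            lem′ : ∀ b n → 4 ℕ.* (b ℕ.* n) ℕ.+ n ≡ (1 ℕ.+ 4 ℕ.* b) ℕ.* n
            lem′ = solve-∀
    ... | inj₂ (s , m≡) = zxd-period b {λ i → 1-zxn (b ℕ.* n ℕ.+ i)} {geometric (3 ℕ.+ 4 ℕ.* b) n} j j<n
        (1-multiple (3 ℕ.+ 4 ℕ.* b) (zxn≈ (b ℕ.* n ℕ.+ j)) (≡.trans (lem (b ℕ.* n) s) (≡.trans (≡.cong (λ m → 4 ℕ.* (b ℕ.* n) ℕ.+ 3 ℕ.* suc (m ℕ.+ m)) (≡.sym m≡)) (lem′ b n))))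
      where j = 2 ℕ.+ (s ℕ.+ s ℕ.+ s)
            lem : ∀ c s → 1 ℕ.+ 4 ℕ.* (c ℕ.+ (2 ℕ.+ (s ℕ.+ s ℕ.+ s))) ≡ 4 ℕ.* c ℕ.+ 3 ℕ.* suc (suc (s ℕ.+ s) ℕ.+ suc (s ℕ.+ s))
            lem = solve-∀
            lem′ : ∀ b n → 4 ℕ.* (b ℕ.* n) ℕ.+ 3 ℕ.* n ≡ (3 ℕ.+ 4 ℕ.* b) ℕ.* n
            lem′ = solve-∀
            lem″ : ∀ s → suc (2 ℕ.+ (s ℕ.+ s ℕ.+ s)) ℕ.+ s ≡ suc (suc (s ℕ.+ s) ℕ.+ suc (s ℕ.+ s))
            lem″ = solve-∀
            j<n : j ℕ.< n
            j<n = ≡.subst (λ m → suc j ℕ.≤ suc (m ℕ.+ m)) (≡.sym m≡) (≡.subst (suc j ℕ.≤_) (lem″ s) (ℕ.m≤m+n (suc j) s))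

    prod-square : ∀ k (z : ℕ → Poly) → Z.prod k (λ i → oneₚ -ₚ z i) *ₚ Z.prod k (λ i → oneₚ -ₚ z i) ≋ Z.prod k (λ i → F.quad oneₚ two (z i))
    prod-square k z = Z.trans (Z.sym (Z.prod-* k (λ i → oneₚ -ₚ z i) (λ i → oneₚ -ₚ z i))) (Z.prod-cong k (λ i _ → Z.sym (quad≋ (z i))))

  -- The multiplicities balance: `1-zon` and the square of `1-zyn` are set against the cube of
  -- `1-zyd`, and the square of `1-zxn` against the square of `1-zxd`.
  σ-period : ∀ b → Integral (Z.prod n (λ i → σn₀ (b ℕ.* n ℕ.+ i))) (Z.prod n (λ i → σd₀ (b ℕ.* n ℕ.+ i)))
  σ-period b = integral-cong
      (Z.trans (Z.*-cong (Z.*-cong (Z.sym (Z.prod-* n (λ _ → F.q2) (λ i → 1-zon (s i)))) (prod-square n (λ i → F.zyn (e′ (s i))))) (prod-square n (λ i → F.zxn (e′ (s i)))))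
        (merge (λ i → F.τn (e′ (s i))) (λ i → F.quad oneₚ two (F.zyn (e′ (s i)))) (λ i → F.quad oneₚ two (F.zxn (e′ (s i))))))
      (Z.trans (Z.*-cong (Z.*-congˡ {Z.prod n (λ i → 1-zyd (s i))} (prod-square n (λ i → F.zyd (e′ (s i))))) (prod-square n (λ i → F.zxd (e′ (s i)))))
        (merge (λ i → F.τd (e′ (s i))) (λ i → F.quad oneₚ two (F.zyd (e′ (s i)))) (λ i → F.quad oneₚ two (F.zxd (e′ (s i))))))
      (integral-* (integral-* (integral-scale (Z.prod n (λ _ → F.q2)) (zo-period b)) (integral-* (zy-period b) (zy-period b))) (integral-* (zx-period b) (zx-period b)))
    where
      s : ℕ → ℕ
      s i = b ℕ.* n ℕ.+ i
      merge : ∀ f g h → Z.prod n f *ₚ Z.prod n g *ₚ Z.prod n h ≋ Z.prod n (λ i → f i *ₚ g i *ₚ h i)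
      merge f g h = Z.sym (Z.trans (Z.prod-* n (λ i → f i *ₚ g i) h) (Z.*-congʳ {Z.prod n h} (Z.prod-* n f g)))

  integral-periods : ∀ {f g : ℕ → Poly} → (∀ b → Integral (Z.prod n (λ i → f (b ℕ.* n ℕ.+ i))) (Z.prod n (λ i → g (b ℕ.* n ℕ.+ i)))) →
    ∀ b → Integral (Z.prod (b ℕ.* n) f) (Z.prod (b ℕ.* n) g)
  integral-periods h zero = record { E = oneₚ ; U = oneₚ ; coprime = coprime-1 (Φ n) ; cross = Z.refl }
  integral-periods {f} {g} h (suc b) = ≡.subst (λ k → Integral (Z.prod k f) (Z.prod k g)) (ℕ.+-comm (b ℕ.* n) n)
    (integral-cong (Z.sym (Z.prod-+ (b ℕ.* n) n f)) (Z.sym (Z.prod-+ (b ℕ.* n) n g)) (integral-* (integral-periods {f} {g} h b) (h b)))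

  -- With N = t n + r, the t full periods have no pole, and the remaining r < n denominator factors
  -- stop before the end of a period, so they are coprime to Φ n.
  poch-integral : ∀ N → Integral (poch 2 4 N) (poch 4 4 N)
  poch-integral N = integral-cong (expand 2 zon≈) (expand 4 zyd≈)
      (integral-* (integral-periods {1-zon} {1-zyd} zo-period t) (record { E = Z.prod r (λ i → 1-zyd (t ℕ.* n ℕ.+ i)) ; U = Z.prod r (λ i → 1-zon (t ℕ.* n ℕ.+ i))
        ; coprime = coprime-prodˡ r (λ i i<r → coprime-1-zyd (t ℕ.* n ℕ.+ i) (n∤shifted t i (ℕ.<-≤-trans i<r (ℕ.≤-pred (m%n<n N n))))) ; cross = Z.refl }))
    where
      r = N % n
      t = N / n
      N≡ : t ℕ.* n ℕ.+ r ≡ N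
      N≡ = ≡.sym (≡.trans (m≡m%n+[m/n]*n N n) (ℕ.+-comm r (t ℕ.* n)))
      expand : ∀ a {z : ℕ → Poly} → (∀ j → z j ≈e a ℕ.+ 4 ℕ.* j) → Z.prod (t ℕ.* n) (λ i → oneₚ -ₚ z i) *ₚ Z.prod r (λ i → oneₚ -ₚ z (t ℕ.* n ℕ.+ i)) ≋ poch a 4 N
      expand a {z} z≈ = Z.trans (Z.sym (Z.prod-+ (t ℕ.* n) r (λ i → oneₚ -ₚ z i))) (Z.trans (Z.reflexive (≡.cong (λ k → Z.prod k (λ i → oneₚ -ₚ z i)) N≡))
        (Z.trans (Z.prod-cong N (λ j _ → Z.+-congˡ {oneₚ} (Z.-‿cong (proof (z≈ j))))) (Z.sym (poch≋ a 4 N))))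

  record Vanishing (x : Frac) : Set where
    field
      D N      : Poly
      equation : num x *ₚ D ≋ N *ₚ den x
      vanishes : Divides (Φ n) N
      coprime  : Coprime D (Φ n)

  private
    module FC = FactorCongruence M₁.ring 𝕢

    e-periodic : ∀ b j → e′ (b ℕ.* n ℕ.+ j) K₁.≈ e′ j
    e-periodic b j = K₁.trans (M₁.coarsenᵢ (Z.pow-+ 𝕢 (b ℕ.* n) j)) (K₁.trans (K₁.*-congʳ (e^kn≈1 b)) (K₁.*-identityˡ (e′ j)))

    blockSum≈0 : ∀ b → SummandFrac.blockSum (b ℕ.* n) (m ℕ.+ m) K₁.≈ []
    blockSum≈0 b = K₁.trans (K₁.sum-cong n (λ j j≤2m → K₁.*-cong (FC.w-cong {e′ (b ℕ.* n ℕ.+ j)} {e′ j} (e-periodic b j))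
        (ClearedProperties.cleared-cong M₁.ring (m ℕ.+ m) j (ℕ.≤-pred j≤2m) (λ i _ → FC.σn-cong {oneₚ} {two} {oneₚ} {two} {e′ (b ℕ.* n ℕ.+ i)} {e′ i} (e-periodic b i)) (λ i _ → FC.σd-cong {oneₚ} {two} {oneₚ} {two} {e′ (b ℕ.* n ℕ.+ i)} {e′ i} (e-periodic b i))))) total≈0

  sum-vanishing : ∀ b → Vanishing (sumFrac (b ℕ.* n) SummandFrac.fraction)
  sum-vanishing zero = record { D = oneₚ ; N = [] ; equation = Z.refl ; vanishes = divides-0 (Φ n) ; coprime = coprime-1 (Φ n) }
  sum-vanishing (suc b) = ≡.subst (λ k → Vanishing (sumFrac k SummandFrac.fraction)) (ℕ.+-comm (b ℕ.* n) n) (record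
    { equation = SummandFrac.extend-block (b ℕ.* n) (m ℕ.+ m) {V.D} {V.N} {I.E} {I.U} V.equation I.cross
    ; vanishes = divides-+ {M = V.N *ₚ D′} {V.D *ₚ (I.U *ₚ S)} (divides-cong {N = D′ *ₚ V.N} {V.N *ₚ D′} (Z.refl {Φ n}) (Z.*-comm D′ V.N) (divides-* {N = V.N} D′ V.vanishes))
        (divides-* {N = I.U *ₚ S} V.D (divides-* {N = S} I.U (M₁.≈ᵢ0⇒I (blockSum≈0 b))))
    ; coprime = coprime-*ˡ V.coprime (coprime-*ˡ (coprime-*ˡ coprime-1-q I.coprime) (coprime-prodˡ (m ℕ.+ m) (λ i i<2m → coprime-σd (b ℕ.* n ℕ.+ i) (n∤shifted b i i<2m)))) })
    where
      module V = Vanishing (sum-vanishing b)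
      module I = Integral (integral-periods {σn₀} {σd₀} σ-period b)
      D′ = (oneₚ -ₚ 𝕢) *ₚ I.E *ₚ Z.prod (m ℕ.+ m) (λ i → σd₀ (b ℕ.* n ℕ.+ i))
      S = SummandFrac.blockSum (b ℕ.* n) (m ℕ.+ m)

  -- The zero comes from the q-integer of 3 k n. `N` is arbitrary because the index (3n - 1)/4 of
  -- the theorem is not adapted to the period of a divisor.
  closedForm-vanishing : ∀ k N → Vanishing (closedForm (k ℕ.* n) N)
  closedForm-vanishing k N = record
    { equation = FA.clear-closed {oneₚ -ₚ 𝕢} {qint (3 ℕ.* M)} {oneₚ -ₚ e′ (3 ℕ.* M)} {qPow (2 ℕ.* M)} {constₚ (+ 2) -ₚ qPow M} {poch 2 4 N} {I.E} {I.U} {poch 4 4 N} {(oneₚ +ₚ qPow M) ^ₚ 2}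
        (qint≋ (3 ℕ.* M)) I.cross (^-2 (poch 2 4 N)) (^-2 (poch 4 4 N))
    ; vanishes = divides-cong {N = R *ₚ Q} {Q *ₚ R} (Z.refl {Φ n}) (Z.*-comm R Q) (divides-* {N = Q} R (≡.subst (λ j → Divides (Φ n) (oneₚ -ₚ e′ j)) (ℕ.*-assoc 3 k n) (Φ∣1-e (3 ℕ.* k))))
    ; coprime = coprime-*ˡ (coprime-*ˡ coprime-1-q (coprime-*ˡ I.coprime I.coprime)) (coprime-^ˡ 2 (coprime-1+q^kn k)) }
    where
      M = k ℕ.* n
      module I = Integral (poch-integral N)
      Q = oneₚ -ₚ e′ (3 ℕ.* M)
      R = qPow (2 ℕ.* M) *ₚ (constₚ (+ 2) -ₚ qPow M) *ₚ (I.U *ₚ I.U)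

  congruent : ∀ k N → Congruent (Φ n) (sumFrac (k ℕ.* n) SummandFrac.fraction) (closedForm (k ℕ.* n) N)
  congruent k N = record
    { D = V.D *ₚ W.D
    ; N = V.N *ₚ W.D -ₚ W.N *ₚ V.D
    ; equation = FA.subtract {num x} {den x} {num y} {den y} {V.D} {V.N} {W.D} {W.N} V.equation W.equation
    ; vanishes = divides-cong {N = W.D *ₚ V.N +ₚ (-ₚ V.D) *ₚ W.N} {V.N *ₚ W.D -ₚ W.N *ₚ V.D} (Z.refl {Φ n}) (solve 4 (λ a b c d → d ⊗ c ⊕ (⊝ a) ⊗ b ⊜ c ⊗ d ⊖ b ⊗ a) Z.refl V.D W.N V.N W.D)
        (divides-+ {M = W.D *ₚ V.N} {(-ₚ V.D) *ₚ W.N} (divides-* {N = V.N} W.D V.vanishes) (divides-* {N = W.N} (-ₚ V.D) W.vanishes))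
    ; coprime = coprime-*ˡ V.coprime W.coprime }
    where
      x = sumFrac (k ℕ.* n) SummandFrac.fraction
      y = closedForm (k ℕ.* n) N
      module V = Vanishing (sum-vanishing k)
      module W = Vanishing (closedForm-vanishing k N)

-- Assembling the congruences for all divisors of n.

coprime-congʳ : ∀ {A B B′} → B ≋ B′ → Coprime A B → Coprime A B′
coprime-congʳ eB c = coprime-sym (coprime-congˡ eB (coprime-sym c))

congruent-cong : ∀ {P P′ x y} → P ≋ P′ → Congruent P x y → Congruent P′ x y
congruent-cong {P} {P′} eP c = record
  { D = C.D ; N = C.N ; equation = C.equation ; vanishes = divides-cong {N = C.N} {C.N} eP (Z.refl {C.N}) C.vanishes ; coprime = coprime-congʳ eP C.coprime }
  where module C = Congruent c

congruent-1 : ∀ x y → Congruent oneₚ x y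
congruent-1 x y = record
  { D = den x *ₚ den y ; N = A ; equation = Z.refl ; vanishes = divides-exact A (Z.sym (Z.*-identityʳ A)) ; coprime = coprime-sym (coprime-1 _) }
  where A = num x *ₚ den y -ₚ num y *ₚ den x

-- The two congruences come with different denominators D and D′. The combination P′ D + P D′ is
-- congruent to P′ D modulo P and to P D′ modulo P′, hence coprime to both, and the same combination
-- of the numerators is divisible by both.
congruent-* : ∀ {P P′ x y} → Coprime P P′ → Congruent P x y → Congruent P′ x y → Congruent (P *ₚ P′) x y
congruent-* {P} {P′} {x} {y} PP′ c c′ = record
  { D = D ; N = N
  ; equation = Z.trans (solve 5 (λ A P P′ D D′ → A ⊗ (P′ ⊗ D ⊕ P ⊗ D′) ⊜ P′ ⊗ (A ⊗ D) ⊕ P ⊗ (A ⊗ D′)) Z.refl A P P′ C.D C′.D)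
      (Z.trans (Z.+-cong (Z.*-congˡ {P′} C.equation) (Z.*-congˡ {P} C′.equation))
      (solve 5 (λ B P P′ N N′ → P′ ⊗ (N ⊗ B) ⊕ P ⊗ (N′ ⊗ B) ⊜ (P′ ⊗ N ⊕ P ⊗ N′) ⊗ B) Z.refl (den x *ₚ den y) P P′ C.N C′.N))
  ; vanishes = divides-coprime-* {P} {P′} {N} PP′
      (divides-+ {M = P′ *ₚ C.N} {P *ₚ C′.N} (divides-* {N = C.N} P′ C.vanishes) (divides-exact C′.N (Z.*-comm P C′.N)))
      (divides-+ {M = P′ *ₚ C.N} {P *ₚ C′.N} (divides-exact C.N (Z.*-comm P′ C.N)) (divides-* {N = C′.N} P C′.vanishes))
  ; coprime = coprime-sym (coprime-*ˡ
      (coprime-sym (coprime-congˡ (Z.+-congˡ {P′ *ₚ C.D} (Z.*-comm C′.D P)) (coprime-+ˡ C′.D (coprime-*ˡ (coprime-sym PP′) C.coprime))))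
      (coprime-sym (coprime-congˡ (Z.trans (Z.+-comm (P *ₚ C′.D) (C.D *ₚ P′)) (Z.+-congʳ {P *ₚ C′.D} (Z.*-comm C.D P′))) (coprime-+ˡ C.D (coprime-*ˡ PP′ C′.coprime))))) }
  where
    module C = Congruent c
    module C′ = Congruent c′
    A D N : Poly
    A = num x *ₚ den y -ₚ num y *ₚ den x
    D = P′ *ₚ C.D +ₚ P *ₚ C′.D
    N = P′ *ₚ C.N +ₚ P *ₚ C′.N

congruent-prod : ∀ k {f : ℕ → Poly} {x y} → (∀ i j → i ℕ.< j → j ℕ.< k → Coprime (f i) (f j)) → (∀ i → i ℕ.< k → Congruent (f i) x y) → Congruent (Z.prod k f) x y
congruent-prod zero    {x = x} {y} _ _ = congruent-1 x y
congruent-prod (suc k) {f} h c = congruent-* (coprime-prodˡ k (λ i i<k → h i k i<k (ℕ.n<1+n k)))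
  (congruent-prod k {f} (λ i j i<j j<k → h i j i<j (ℕ.m<n⇒m<1+n j<k)) (λ i i<k → c i (ℕ.m<n⇒m<1+n i<k))) (c k (ℕ.n<1+n k))

zero? : ∀ p → (p ≋ []) ⊎ (¬ p ≋ [])
zero? []      = inj₁ Z.refl
zero? (a ∷ p) with a ℤ.≟ 0ℤ | zero? p
... | no a≢0  | _        = inj₂ (λ eq → a≢0 (at eq 0))
... | yes _   | inj₂ p≢0 = inj₂ (λ eq → p≢0 (coefficients λ i → at eq (suc i)))
... | yes a≡0 | inj₁ p≡0 = inj₁ (coefficients λ { zero → a≡0 ; (suc i) → at p≡0 i })

regular-nonzero : ∀ {p} → Z.Regular p → ¬ p ≋ []
regular-nonzero {p} reg eq = 1≢0 (at (reg oneₚ (Z.*-congʳ {oneₚ} {p} {[]} eq)) 0)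

congruent⇒≡ : ∀ {P x y} → Z.Regular (den x *ₚ den y) → Congruent P x y → x ≡ y [modₚ P ]
congruent⇒≡ {P} {x} {y} reg c with zero? (Congruent.D c)
... | inj₂ D≢0 = C.N , C.D , (λ eq → D≢0 (coefficients eq)) , toDivides C.vanishes , toCoprime C.coprime , at C.equation
  where
    module C = Congruent c
    toDivides : Divides P C.N → DividesQ P C.N
    toDivides (c , c≢0 , Q , eq) = c , c≢0 , Q , at (Z.trans (Z.sym (constₚ-* c C.N)) eq)
    toCoprime : Coprime C.D P → CoprimeQ C.D P
    toCoprime (c , c≢0 , u , v , eq) = c , c≢0 , u , v , at eq
-- If D = 0 then P is invertible over ℚ, and every congruence holds.
... | inj₁ D≡0 = A , B , (λ eq → regular-nonzero {B} reg (coefficients eq)) , P∣A , coprime , at (Z.refl {A *ₚ B})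
  where
    module C = Congruent c
    A B : Poly
    A = num x *ₚ den y -ₚ num y *ₚ den x
    B = den x *ₚ den y
    unit : Σ ℤ λ c → (¬ c ≡ 0ℤ) × (Σ Poly λ v → v *ₚ P ≋ constₚ c)
    unit = let (c , c≢0 , u , v , eq) = C.coprime in c , c≢0 , v , Z.trans (Z.sym (Z.trans (Z.+-congʳ {v *ₚ P} (Z.trans (Z.*-congˡ {u} D≡0) (Z.zeroʳ u))) (Z.+-identityˡ (v *ₚ P)))) eq
    P∣A : DividesQ P A
    P∣A = let (c , c≢0 , v , eq) = unit in c , c≢0 , A *ₚ v , at (Z.trans (Z.sym (constₚ-* c A)) (Z.trans (Z.*-congʳ {A} (Z.sym eq)) (solve 3 (λ v P A → v ⊗ P ⊗ A ⊜ A ⊗ v ⊗ P) Z.refl v P A)))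
    coprime : CoprimeQ B P
    coprime = let (c , c≢0 , v , eq) = unit in c , c≢0 , [] , v , at (Z.trans (Z.+-identityˡ (v *ₚ P)) eq)

coprime-Φ : ∀ i k → i ℕ.< k → Coprime (Φ (suc i)) (Φ (suc k))
coprime-Φ i k i<k = coprime-factorˡ {X = X} (coprime-congˡ (Z.trans (proj₂ (cyclotomic-divides i)) (Z.*-comm X (Φ (suc i))))
  (cyclotomic-coprime k (suc i) (λ k∣i → ℕ.<⇒≱ i<k (ℕ.≤-pred (∣⇒≤ k∣i)))))
  where X = proj₁ (cyclotomic-divides i)

coprime-factors : ∀ n i k → i ℕ.< k → Coprime (cyclotomicFactor n i) (cyclotomicFactor n k)
coprime-factors n i k i<k with factor-cases n i | factor-cases n k
... | inj₂ (_ , eq) | _              = ≡.subst (λ x → Coprime x _) (≡.sym eq) (coprime-1 _)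
... | inj₁ _        | inj₂ (_ , eq)  = ≡.subst (Coprime _) (≡.sym eq) (coprime-sym (coprime-1 _))
... | inj₁ (_ , eq) | inj₁ (_ , eq′) = ≡.subst₂ Coprime (≡.sym eq) (≡.sym eq′) (coprime-Φ i k i<k)

qint-factors : ∀ n → qint (suc n) ≋ Z.prod n (λ i → cyclotomicFactor (suc n) (suc i))
qint-factors n = Z.cancel {oneₚ -ₚ 𝕢} {qint (suc n)} {Q} (1-qPow-regular 1 (s≤s z≤n)) (Z.trans (qint≋ (suc n)) (Z.trans (1-e≋ (suc n))
  (Z.trans (Z.-‿cong (Z.trans (cyclotomic-product (suc n) (s≤s z≤n)) (Z.trans (Z.prod-front n (cyclotomicFactor (suc n))) (Z.*-congʳ {Q} Φ1))))
  (solve 2 (λ x Q → ⊝ ((x ⊖ 𝟙) ⊗ Q) ⊜ (𝟙 ⊖ x) ⊗ Q) Z.refl 𝕢 Q))))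
  where
    Q = Z.prod n (λ i → cyclotomicFactor (suc n) (suc i))
    Φ1 : cyclotomicFactor (suc n) 0 ≋ 𝕢 -ₚ oneₚ
    Φ1 = Z.trans (Z.reflexive (factor-divisor (suc n) 0 (divides (suc n) (≡.sym (ℕ.*-identityʳ (suc n))))))
      (Z.sym (Z.trans (cyclotomic-product 1 (s≤s z≤n)) (Z.trans (Z.*-identityˡ (cyclotomicFactor 1 0)) (Z.reflexive (factor-divisor 1 0 ∣-refl)))))

module Modulus (l : ℕ) where
  private
    m N n k : ℕ
    m = suc (l ℕ.+ l)
    N = m ℕ.+ suc l
    n = suc (m ℕ.+ m)
    -- This is n - 2: for i < k the indices i + 2 run through all e with 1 < e < n.
    k = (l ℕ.+ l) ℕ.+ m
    S C : Frac
    S = sumFrac n SummandFrac.fraction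
    C = closedForm n N

    factor : ∀ i → Congruent (cyclotomicFactor n (suc i)) S C
    factor i with factor-cases n (suc i)
    ... | inj₂ (_ , eq) = ≡.subst (λ P → Congruent P S C) (≡.sym eq) (congruent-1 S C)
    ... | inj₁ (divides t n≡ , eq) with parity (suc (suc i))
    -- An even divisor is excluded because n is odd.
    ...   | inj₁ (s , e≡) = ⊥-elim (ℕ.even≢odd (t ℕ.* s) m (≡.trans (lem t s) (≡.trans (≡.cong (t ℕ.*_) (≡.sym e≡)) (≡.trans (≡.sym n≡) (≡.cong (λ j → suc (m ℕ.+ j)) (≡.sym (ℕ.+-identityʳ m)))))))
      where lem : ∀ t s → 2 ℕ.* (t ℕ.* s) ≡ t ℕ.* (s ℕ.+ s)
            lem = solve-∀
    ...   | inj₂ (suc s , e≡) = ≡.subst₂ (λ P n → Congruent P (sumFrac n SummandFrac.fraction) (closedForm n N))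
      (≡.trans (≡.cong Φ (≡.sym e≡)) (≡.sym eq)) (≡.trans (≡.cong (t ℕ.*_) (≡.sym e≡)) (≡.sym n≡)) (DivisorCongruence.congruent (suc s) (s≤s z≤n) t N)

    Q : Poly
    Q = Z.prod k (λ i → cyclotomicFactor n (suc i))

    -- Q is [n] without its factor Φ n, and that factor is the fifth one of the power.
    modulus : Q *ₚ Φ n ^ₚ 5 ≋ qint n *ₚ Φ n ^ₚ 4
    modulus = Z.trans (Z.sym (Z.*-assoc Q (Φ n) (Φ n ^ₚ 4))) (Z.*-congʳ {Φ n ^ₚ 4} (Z.sym (Z.trans (qint-factors (suc k)) (Z.*-congˡ {Q} (Z.reflexive (factor-divisor n (suc k) ∣-refl))))))

    regular : Z.Regular (den S *ₚ den C)
    regular = Z.reg-* {den S} {den C} (sumFrac-den-regular n SummandFrac.fraction (λ k → Z.reg-* {poch 2 2 k ^ₚ 2} {poch 4 4 k ^ₚ 3} (^-regular 2 {poch 2 2 k} (poch-regular 1 2 k)) (^-regular 3 {poch 4 4 k} (poch-regular 3 4 k))))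
        (Z.reg-* {(oneₚ +ₚ qPow n) ^ₚ 2} {poch 4 4 N ^ₚ 2} (^-regular 2 {oneₚ +ₚ qPow n} (nonzero-regular (oneₚ +ₚ qPow n) 0 λ ())) (^-regular 2 {poch 4 4 N} (poch-regular 3 4 N)))
      where
        ^-regular : ∀ k {p} → Z.Regular p → Z.Regular (p ^ₚ k)
        ^-regular zero    reg = Z.reg-1
        ^-regular (suc k) {p} reg = Z.reg-* {p} {p ^ₚ k} reg (^-regular k {p} reg)
        poch-regular : ∀ a b k → Z.Regular (poch (suc a) b k)
        poch-regular a b zero    = Z.reg-1
        poch-regular a b (suc k) = Z.reg-* {poch (suc a) b k} {oneₚ -ₚ qPow (suc a ℕ.+ b ℕ.* k)} (poch-regular a b k) (1-qPow-regular (suc a ℕ.+ b ℕ.* k) (s≤s z≤n))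

  supercongruence : S ≡ C [modₚ qint n *ₚ Φ n ^ₚ 4 ]
  supercongruence = congruent⇒≡ {qint n *ₚ Φ n ^ₚ 4} {S} {C} regular (congruent-cong modulus (congruent-*
    (coprime-^ʳ 5 (coprime-prodˡ k (λ i i<k → ≡.subst (Coprime (cyclotomicFactor n (suc i))) (factor-divisor n (suc k) ∣-refl) (coprime-factors n (suc i) (suc k) (s≤s i<k)))))
    (congruent-prod k (λ i j i<j _ → coprime-factors n (suc i) (suc j) (s≤s i<j)) (λ i _ → factor i)) (FifthPowerCongruence.congruent l)))

open import Data.Nat using (ℕ; _+_; _*_; _∸_; _%_; _/_; _≤_)
open import Data.Integer using (+_)
open import Relation.Binary.PropositionalEquality using (_≡_)

theorem1p3 : (n : ℕ) → 1 ≤ n → n % 4 ≡ 3 →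
  sumFrac n (λ k →
      (qint (6 * k + 1) *ₚ poch 1 2 k ^ₚ 2 *ₚ poch 2 4 k *ₚ poch 1 4 k ^ₚ 2 *ₚ qPow (2 * k))
      // (poch 2 2 k ^ₚ 2 *ₚ poch 4 4 k ^ₚ 3))
  ≡ ((qint (3 * n) *ₚ qPow (2 * n) *ₚ (constₚ (+ 2) -ₚ qPow n) *ₚ poch 2 4 ((3 * n ∸ 1) / 4) ^ₚ 2)
      // ((oneₚ +ₚ qPow n) ^ₚ 2 *ₚ poch 4 4 ((3 * n ∸ 1) / 4) ^ₚ 2))
  [modₚ qint n *ₚ Φ n ^ₚ 4 ]
theorem1p3 n _ n≡3 = ≡.subst₂ (λ n N → sumFrac n SummandFrac.fraction ≡ closedForm n N [modₚ qint n *ₚ Φ n ^ₚ 4 ]) n≡ N≡ (Modulus.supercongruence l)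
  where
    l = n / 4
    n≡ : suc (suc (l ℕ.+ l) ℕ.+ suc (l ℕ.+ l)) ≡ n
    n≡ = ≡.trans (lem l) (≡.trans (≡.cong (ℕ._+ l ℕ.* 4) (≡.sym n≡3)) (≡.sym (m≡m%n+[m/n]*n n 4)))
      where lem : ∀ l → suc (suc (l ℕ.+ l) ℕ.+ suc (l ℕ.+ l)) ≡ 3 ℕ.+ l ℕ.* 4
            lem = solve-∀
    N≡ : suc (l ℕ.+ l) ℕ.+ suc l ≡ (3 ℕ.* n ℕ.∸ 1) / 4
    N≡ = ≡.sym (≡.trans (≡.cong (λ i → (i ℕ.∸ 1) / 4) (≡.trans (≡.cong (3 ℕ.*_) (≡.sym n≡)) (lem l))) (m*n/n≡m (suc (l ℕ.+ l) ℕ.+ suc l) 4))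
      where lem : ∀ l → 3 ℕ.* suc (suc (l ℕ.+ l) ℕ.+ suc (l ℕ.+ l)) ≡ suc ((suc (l ℕ.+ l) ℕ.+ suc l) ℕ.* 4)
            lem = solve-∀
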